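{- Let $t \ge 2$ be an integer, let $j$ be an integer with $2 \le j \le \binom{t+1}{2}$, and let $a = \frac{j+1}{2j-1}$. Then, as $n \to \infty$, $$(1-o(1))\,n^{(2+2a)/3} \le \mathrm{ex}\left(n, n^a, \{C_4, \theta_{3,t}\}\right) \le \left(\sqrt[3]{t-1} + o(1)\right) n^{(2+2a)/3}.$$
   Context: For positive integers $n, m$ and a family $\mathcal{F}$ of graphs, the bipartite Turán number $\mathrm{ex}(n,m,\mathcal{F})$ is the maximum number of edges in a bipartite graph with parts of sizes $m$ and $n$ that contains no graph of $\mathcal{F}$ as a subgraph. $C_4$ is the cycle of length $4$, and $\theta_{k,t}$ is the graph consisting of two vertices joined by $t$ internally vertex-disjoint paths, each of length $k$. -}

module Defs where

open import Data.Nat using (ℕ; zero; suc; _+_; _*_; _∸_; _^_; _≤_; _<_)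
open import Data.Bool using (Bool; true; false; if_then_else_)
open import Data.Fin using (Fin)
open import Data.List using (List; map; allFin)
open import Data.Nat.ListAction using (sum)
open import Data.Sum using (_⊎_; inj₁; inj₂)
open import Data.Product using (Σ; _×_; _,_)
open import Data.Empty using (⊥)
open import Data.Unit using (⊤)
open import Relation.Binary.PropositionalEquality using (_≡_)
open import Relation.Nullary using (¬_)
open import Function.Definitions using (Injective)

record Graph : Set₁ where
  field
    V   : Set
    Adj : V → V → Set
open Graph public

_⊆G_ : Graph → Graph → Set
H ⊆G G = Σ (V H → V G) λ f → Injective _≡_ _≡_ f × (∀ {x y} → Adj H x y → Adj G (f x) (f y))

data Family : Set₁ where
  []ᶠ  : Family
  _∷ᶠ_ : Graph → Family → Family

Free : Family → Graph → Set
Free []ᶠ G = ⊤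
Free (H ∷ᶠ F) G = ¬ (H ⊆G G) × Free F G

BipGraph : ℕ → ℕ → Set
BipGraph m n = Fin m → Fin n → Bool

toGraph : ∀ {m n} → BipGraph m n → Graph
toGraph {m} {n} E = record { V = Fin m ⊎ Fin n ; Adj = adj }
  where
  adj : Fin m ⊎ Fin n → Fin m ⊎ Fin n → Set
  adj (inj₁ a) (inj₂ b) = E a b ≡ true
  adj (inj₂ b) (inj₁ a) = E a b ≡ true
  adj _ _ = ⊥

edges : ∀ {m n} → BipGraph m n → ℕ
edges {m} {n} E = sum (map (λ a → sum (map (λ b → if E a b then 1 else 0) (allFin n))) (allFin m))

IsBipEx : ℕ → ℕ → Family → ℕ → Set
IsBipEx n m F k =
  (Σ (BipGraph m n) λ E → Free F (toGraph E) × edges E ≡ k)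
  × (∀ (E : BipGraph m n) → Free F (toGraph E) → edges E ≤ k)

C4adj : Fin 4 → Fin 4 → Set
C4adj Fin.zero (Fin.suc Fin.zero) = ⊤
C4adj (Fin.suc Fin.zero) Fin.zero = ⊤
C4adj (Fin.suc Fin.zero) (Fin.suc (Fin.suc Fin.zero)) = ⊤
C4adj (Fin.suc (Fin.suc Fin.zero)) (Fin.suc Fin.zero) = ⊤
C4adj (Fin.suc (Fin.suc Fin.zero)) (Fin.suc (Fin.suc (Fin.suc Fin.zero))) = ⊤
C4adj (Fin.suc (Fin.suc (Fin.suc Fin.zero))) (Fin.suc (Fin.suc Fin.zero)) = ⊤
C4adj (Fin.suc (Fin.suc (Fin.suc Fin.zero))) Fin.zero = ⊤
C4adj Fin.zero (Fin.suc (Fin.suc (Fin.suc Fin.zero))) = ⊤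
C4adj _ _ = ⊥

C4 : Graph
C4 = record { V = Fin 4 ; Adj = C4adj }

data ThetaV (t : ℕ) : Set where
  end₁ end₂ : ThetaV t
  mid₀ mid₁ : Fin t → ThetaV t

data ThetaAdj {t : ℕ} : ThetaV t → ThetaV t → Set where
  e₁  : ∀ i → ThetaAdj end₁ (mid₀ i)
  e₁' : ∀ i → ThetaAdj (mid₀ i) end₁
  e₂  : ∀ i → ThetaAdj (mid₀ i) (mid₁ i)
  e₂' : ∀ i → ThetaAdj (mid₁ i) (mid₀ i)
  e₃  : ∀ i → ThetaAdj (mid₁ i) end₂
  e₃' : ∀ i → ThetaAdj end₂ (mid₁ i)

θ3 : ℕ → Graph
θ3 t = record { V = ThetaV t ; Adj = ThetaAdj }

-- m = ⌊ n^((j+1)/(2j-1)) ⌋, i.e. m^(2j-1) ≤ n^(j+1) < (m+1)^(2j-1).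
IsFloorPow : ℕ → ℕ → ℕ → Set
IsFloorPow j n m = (m ^ (2 * j ∸ 1) ≤ n ^ (j + 1)) × (n ^ (j + 1) < suc m ^ (2 * j ∸ 1))

{-# OPTIONS --safe #-}

-- Lower bound. Over F_q the points (s, w) ∈ F_q × F_q^j and the lines (x, y) ∈ F_q^(j-1) × F_q^j are
-- incident when w = y + s (f(x), x); there are q^(j+1) points, q^(2j-1) lines and q^(2j) incidences,
-- and two points span at most one line. Here f is a sum of anisotropic forms of degrees 2, …, t on
-- disjoint blocks of variables, for which j - 1 ≤ 2 + … + t leaves room. A θ_{3,t} yields a line
-- meeting the graph of f in t + 1 points; the divided difference of order t annihilates the linear
-- part and all forms of degree < t, so the last block of the direction is a zero of the form of
-- degree t, hence vanishes, and one descends to t - 1 until the direction itself vanishes.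
--
-- The anisotropic form of degree d is the norm of F_(q^d). That field arises as the operators on
-- sequences of period q^d - 1 over F_q modulo the annihilator of one of them, chosen of minimal degree;
-- the minimum exists only up to double negation, harmless as the final inequality is decidable.
--
-- To reach every n one needs primes in ((1 - ε) Y, Y]. They come from Selberg's symmetry formula and
-- Erdős' argument, carried out over ℚ with a completely additive approximation L of the logarithm
-- satisfying 1/(n + 2) ≤ L(n + 1) - L(n) ≤ 1/n up to a prescribed bound.
--
-- Upper bound. Without C₄ and θ_{3,t} there are at most t - 1 paths of length 3 between two vertices
-- on different sides, so Σ (deg a - 1)(deg b - 1) ≤ (t - 1) m n over the edges ab; by AM-GM the left
-- side is at least (1 - o(1)) e³/(m n).

module Submission where

-- With `n = q^(2j-1)` lines and `m = q^(j+1)` points one has `m = n^a`, and the `q^(2j)` incidences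
-- are `n^((2+2a)/3)`. The constant 1 can be lost only in passing from `n` down to such a power, so
-- `q` must be asymptotic to the root of `n`; Bertrand's postulate would not do.
--
-- Erdős' argument is run as a bootstrap. Suppose that every window of logarithmic length `C`
-- carries a fixed positive amount of `Σ Λ(k)/k`. If a window `(x, Y]` of length `3C/4` were nearly
-- empty, Selberg's formula would give most windows `(x/k, Y/k]` almost twice their expected mass;
-- good `k` at distances of about `C` then chain to a long stretch of density 5/4, against Mertens'
-- estimate. The lengths shrink geometrically, hence reach any positive length, and proper prime
-- powers cannot supply the mass.
--
-- Real powers never occur: both sides of a bound are raised to the power `2j-1`, and a factor
-- `1 ± o(1)` becomes a strict comparison of integers built from `p` and `r`.

open import Data.Nat as ℕ using (ℕ; zero; suc; z≤n; s≤s)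
open import Data.Product using (_,_; _×_; ∃; proj₁; proj₂)
open import Data.Sum using (_⊎_; inj₁; inj₂)
open import Data.Empty using (⊥)
open import Relation.Nullary using (Dec; yes; no; ¬_; contradiction)
open import Data.List using ([]; _∷_)
open import Algebra.Bundles using (CommutativeRing)
open import Level using (0ℓ)
import Data.Nat.Properties as ℕ
import Relation.Binary.PropositionalEquality as ≡
import Data.Fin.Properties as Fin

-- Polynomial normal forms over a commutative ring.

module RingNormaliser {c ℓ} (R : CommutativeRing c ℓ) where

 open import Data.Bool using (Bool; true; false; _∧_; if_then_else_)
 open import Data.List using (List)
 open ≡ using (_≡_)
 import Data.List.Properties as List
 open CommutativeRing R hiding (zero)
 open import Algebra.Properties.Semiring.Mult semiring using (×-homo-+; ×1-homo-*) renaming (_×_ to _·_)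
 open import Algebra.Properties.Ring ring using (-‿+-comm; -‿distribˡ-*; -‿distribʳ-*; -0#≈0#)
 open import Algebra.Properties.AbelianGroup +-abelianGroup using (⁻¹-involutive)
 open import Algebra.Properties.CommutativeSemigroup +-commutativeSemigroup using (interchange)
   renaming (x∙yz≈y∙xz to +-swap)
 open import Algebra.Properties.CommutativeSemigroup *-commutativeSemigroup using (x∙yz≈y∙xz)
   renaming (interchange to *-interchange)
 open import Relation.Binary.Reasoning.Setoid setoid

 infixl 6 _:+_ _:-_
 infixl 7 _:*_
 infix 8 ⊝_

 -- `one` stands beside `nat 1` because `ι 1` unfolds to `1# + 0#`. In this way `ι (suc n)` is, by
 -- definition, the value of `one :+ x` with `x` standing for `ι n`.
 data Expr : Set where
   nat : ℕ → Expr
   one : Expr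
   var : ℕ → Expr
   _:+_ _:*_ : Expr → Expr → Expr
   ⊝_ : Expr → Expr

 _:-_ : Expr → Expr → Expr
 a :- b = a :+ ⊝ b

 x0 x1 x2 x3 x4 x5 x6 x7 x8 x9 x10 x11 x12 x13 x14 : Expr
 x0 = var 0
 x1 = var 1
 x2 = var 2
 x3 = var 3
 x4 = var 4
 x5 = var 5
 x6 = var 6
 x7 = var 7
 x8 = var 8
 x9 = var 9
 x10 = var 10
 x11 = var 11
 x12 = var 12
 x13 = var 13
 x14 = var 14

 Env : Set c
 Env = List Carrier

 atom : Env → ℕ → Carrier
 atom [] _ = 0#
 atom (x ∷ ρ) zero = x
 atom (x ∷ ρ) (suc i) = atom ρ i

 ι : ℕ → Carrier
 ι n = n · 1#

 ⟦_⟧ : Expr → Env → Carrier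
 ⟦ nat n ⟧ ρ = ι n
 ⟦ one ⟧ ρ = 1#
 ⟦ var i ⟧ ρ = atom ρ i
 ⟦ a :+ b ⟧ ρ = ⟦ a ⟧ ρ + ⟦ b ⟧ ρ
 ⟦ a :* b ⟧ ρ = ⟦ a ⟧ ρ * ⟦ b ⟧ ρ
 ⟦ ⊝ a ⟧ ρ = - ⟦ a ⟧ ρ

 -- A coefficient is a formal difference of naturals, so that integers need no canonical form; a
 -- monomial is a sorted list of variable indices with repetition.
 Coeff Mono Term Poly : Set
 Coeff = ℕ × ℕ
 Mono = List ℕ
 Term = Coeff × Mono
 Poly = List Term

 evalC : Coeff → Carrier
 evalC (p , n) = ι p - ι n

 evalM : Env → Mono → Carrier
 evalM ρ [] = 1#
 evalM ρ (i ∷ m) = atom ρ i * evalM ρ m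

 evalT : Env → Term → Carrier
 evalT ρ (k , m) = evalC k * evalM ρ m

 evalP : Env → Poly → Carrier
 evalP ρ [] = 0#
 evalP ρ (t ∷ p) = evalT ρ t + evalP ρ p

 addC mulC : Coeff → Coeff → Coeff
 addC (p , n) (p′ , n′) = p ℕ.+ p′ , n ℕ.+ n′
 mulC (p , n) (p′ , n′) = p ℕ.* p′ ℕ.+ n ℕ.* n′ , p ℕ.* n′ ℕ.+ n ℕ.* p′

 insertM : ℕ → Mono → Mono
 insertM i [] = i ∷ []
 insertM i (j ∷ m) = if i ℕ.≤ᵇ j then i ∷ j ∷ m else j ∷ insertM i m

 mulM : Mono → Mono → Mono
 mulM [] m′ = m′
 mulM (i ∷ m) m′ = insertM i (mulM m m′)

 _<ᵐ_ : Mono → Mono → Bool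
 [] <ᵐ [] = false
 [] <ᵐ (_ ∷ _) = true
 (_ ∷ _) <ᵐ [] = false
 (i ∷ m) <ᵐ (j ∷ m′) = if i ℕ.≡ᵇ j then m <ᵐ m′ else (i ℕ.<ᵇ j)

 insertT : Term → Poly → Poly
 insertT t [] = t ∷ []
 insertT (k , m) ((k′ , m′) ∷ p) with List.≡-dec ℕ._≟_ m m′
 ... | yes _ = (addC k k′ , m) ∷ p
 ... | no _ = if m <ᵐ m′ then (k , m) ∷ (k′ , m′) ∷ p else (k′ , m′) ∷ insertT (k , m) p

 addP : Poly → Poly → Poly
 addP [] q = q
 addP (t ∷ p) q = insertT t (addP p q)

 scaleP : Term → Poly → Poly
 scaleP t [] = []
 scaleP (k , m) ((k′ , m′) ∷ p) = insertT (mulC k k′ , mulM m m′) (scaleP (k , m) p)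

 mulP : Poly → Poly → Poly
 mulP [] q = []
 mulP (t ∷ p) q = addP (scaleP t q) (mulP p q)

 negP : Poly → Poly
 negP [] = []
 negP (((p , n) , m) ∷ q) = ((n , p) , m) ∷ negP q

 normalise : Expr → Poly
 normalise (nat n) = ((n , 0) , []) ∷ []
 normalise one = ((1 , 0) , []) ∷ []
 normalise (var i) = ((1 , 0) , i ∷ []) ∷ []
 normalise (a :+ b) = addP (normalise a) (normalise b)
 normalise (a :* b) = mulP (normalise a) (normalise b)
 normalise (⊝ a) = negP (normalise a)

 addC-sound : ∀ k k′ → evalC (addC k k′) ≈ evalC k + evalC k′
 addC-sound (p , n) (p′ , n′) = begin
   ι (p ℕ.+ p′) - ι (n ℕ.+ n′) ≈⟨ +-cong (×-homo-+ 1# p p′) (-‿cong (×-homo-+ 1# n n′)) ⟩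
   (ι p + ι p′) - (ι n + ι n′) ≈⟨ lemma (ι p) (ι p′) (ι n) (ι n′) ⟩
   (ι p - ι n) + (ι p′ - ι n′) ∎
   where
   lemma : ∀ a b x y → (a + b) - (x + y) ≈ (a - x) + (b - y)
   lemma a b x y = trans (+-congˡ (sym (-‿+-comm x y))) (interchange a b (- x) (- y))

 mulC-sound : ∀ k k′ → evalC (mulC k k′) ≈ evalC k * evalC k′
 mulC-sound (p , n) (p′ , n′) = begin
   ι (p ℕ.* p′ ℕ.+ n ℕ.* n′) - ι (p ℕ.* n′ ℕ.+ n ℕ.* p′)
     ≈⟨ +-cong (split p p′ n n′) (-‿cong (split p n′ n p′)) ⟩
   (ι p * ι p′ + ι n * ι n′) - (ι p * ι n′ + ι n * ι p′) ≈⟨ lemma (ι p) (ι n) (ι p′) (ι n′) ⟩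
   (ι p - ι n) * (ι p′ - ι n′) ∎
   where
   split : ∀ a b x y → ι (a ℕ.* b ℕ.+ x ℕ.* y) ≈ ι a * ι b + ι x * ι y
   split a b x y = trans (×-homo-+ 1# (a ℕ.* b) (x ℕ.* y)) (+-cong (×1-homo-* a b) (×1-homo-* x y))
   lemma : ∀ a b x y → (a * x + b * y) - (a * y + b * x) ≈ (a - b) * (x - y)
   lemma a b x y = begin
     (a * x + b * y) - (a * y + b * x) ≈⟨ lemma₁ (a * x) (b * y) (a * y) (b * x) ⟩
     (a * x + - (a * y)) + (- (b * x) + b * y)
       ≈⟨ +-cong (+-congˡ (-‿distribʳ-* a y)) (+-cong (-‿distribˡ-* b x)
            (trans (sym (⁻¹-involutive (b * y)))
              (trans (-‿cong (-‿distribˡ-* b y)) (-‿distribʳ-* (- b) y)))) ⟩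
     (a * x + a * - y) + (- b * x + - b * - y) ≈⟨ +-cong (sym (distribˡ a x (- y))) (sym (distribˡ (- b) x (- y))) ⟩
     a * (x - y) + - b * (x - y) ≈⟨ sym (distribʳ (x - y) a (- b)) ⟩
     (a - b) * (x - y) ∎
     where
     lemma₁ : ∀ p q r s → (p + q) - (r + s) ≈ (p - r) + (- s + q)
     lemma₁ p q r s = trans (+-congˡ (sym (-‿+-comm r s)))
       (trans (interchange p q (- r) (- s)) (+-congˡ (+-comm q (- s))))

 swap* : ∀ a b x → a * (b * x) ≈ b * (a * x)
 swap* = x∙yz≈y∙xz

 insertM-sound : ∀ ρ i m → evalM ρ (insertM i m) ≈ atom ρ i * evalM ρ m
 insertM-sound ρ i [] = refl
 insertM-sound ρ i (j ∷ m) with i ℕ.≤ᵇ j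
 ... | true = refl
 ... | false = trans (*-congˡ (insertM-sound ρ i m)) (swap* (atom ρ j) (atom ρ i) (evalM ρ m))

 mulM-sound : ∀ ρ m m′ → evalM ρ (mulM m m′) ≈ evalM ρ m * evalM ρ m′
 mulM-sound ρ [] m′ = sym (*-identityˡ _)
 mulM-sound ρ (i ∷ m) m′ = trans (insertM-sound ρ i (mulM m m′))
   (trans (*-congˡ (mulM-sound ρ m m′)) (sym (*-assoc _ _ _)))

 insertT-sound : ∀ ρ t p → evalP ρ (insertT t p) ≈ evalT ρ t + evalP ρ p
 insertT-sound ρ t [] = refl
 insertT-sound ρ (k , m) ((k′ , m′) ∷ p) with List.≡-dec ℕ._≟_ m m′
 ... | yes ≡.refl = begin
   evalC (addC k k′) * evalM ρ m + evalP ρ p ≈⟨ +-congʳ (*-congʳ (addC-sound k k′)) ⟩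
   (evalC k + evalC k′) * evalM ρ m + evalP ρ p ≈⟨ +-congʳ (distribʳ _ _ _) ⟩
   (evalC k * evalM ρ m + evalC k′ * evalM ρ m) + evalP ρ p ≈⟨ +-assoc _ _ _ ⟩
   evalC k * evalM ρ m + (evalC k′ * evalM ρ m + evalP ρ p) ∎
 ... | no _ with m <ᵐ m′
 ... | true = refl
 ... | false = begin
   evalT ρ (k′ , m′) + evalP ρ (insertT (k , m) p) ≈⟨ +-congˡ (insertT-sound ρ (k , m) p) ⟩
   evalT ρ (k′ , m′) + (evalT ρ (k , m) + evalP ρ p) ≈⟨ +-swap _ _ _ ⟩
   evalT ρ (k , m) + (evalT ρ (k′ , m′) + evalP ρ p) ∎

 addP-sound : ∀ ρ p q → evalP ρ (addP p q) ≈ evalP ρ p + evalP ρ q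
 addP-sound ρ [] q = sym (+-identityˡ _)
 addP-sound ρ (t ∷ p) q = trans (insertT-sound ρ t (addP p q))
   (trans (+-congˡ (addP-sound ρ p q)) (sym (+-assoc _ _ _)))

 scaleP-sound : ∀ ρ t p → evalP ρ (scaleP t p) ≈ evalT ρ t * evalP ρ p
 scaleP-sound ρ t [] = sym (zeroʳ _)
 scaleP-sound ρ (k , m) ((k′ , m′) ∷ p) = begin
   evalP ρ (insertT (mulC k k′ , mulM m m′) (scaleP (k , m) p))
     ≈⟨ insertT-sound ρ (mulC k k′ , mulM m m′) (scaleP (k , m) p) ⟩
   evalC (mulC k k′) * evalM ρ (mulM m m′) + evalP ρ (scaleP (k , m) p)
     ≈⟨ +-cong (*-cong (mulC-sound k k′) (mulM-sound ρ m m′)) (scaleP-sound ρ (k , m) p) ⟩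
   (evalC k * evalC k′) * (evalM ρ m * evalM ρ m′) + evalT ρ (k , m) * evalP ρ p
     ≈⟨ lemma _ _ _ _ _ ⟩
   evalT ρ (k , m) * (evalT ρ (k′ , m′) + evalP ρ p) ∎
   where
   lemma : ∀ a b x y p → (a * b) * (x * y) + (a * x) * p ≈ (a * x) * (b * y + p)
   lemma a b x y p = trans (+-congʳ (*-interchange a b x y)) (sym (distribˡ _ _ _))

 mulP-sound : ∀ ρ p q → evalP ρ (mulP p q) ≈ evalP ρ p * evalP ρ q
 mulP-sound ρ [] q = sym (zeroˡ _)
 mulP-sound ρ (t ∷ p) q = begin
   evalP ρ (addP (scaleP t q) (mulP p q)) ≈⟨ addP-sound ρ (scaleP t q) (mulP p q) ⟩
   evalP ρ (scaleP t q) + evalP ρ (mulP p q) ≈⟨ +-cong (scaleP-sound ρ t q) (mulP-sound ρ p q) ⟩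
   evalT ρ t * evalP ρ q + evalP ρ p * evalP ρ q ≈⟨ sym (distribʳ _ _ _) ⟩
   (evalT ρ t + evalP ρ p) * evalP ρ q ∎

 negP-sound : ∀ ρ p → evalP ρ (negP p) ≈ - evalP ρ p
 negP-sound ρ [] = sym -0#≈0#
 negP-sound ρ (((p , n) , m) ∷ q) = begin
   (ι n - ι p) * evalM ρ m + evalP ρ (negP q) ≈⟨ +-cong (*-congʳ flip) (negP-sound ρ q) ⟩
   - (ι p - ι n) * evalM ρ m + - evalP ρ q ≈⟨ +-congʳ (sym (-‿distribˡ-* _ _)) ⟩
   - ((ι p - ι n) * evalM ρ m) + - evalP ρ q ≈⟨ -‿+-comm _ _ ⟩
   - ((ι p - ι n) * evalM ρ m + evalP ρ q) ∎
   where
   flip : ι n - ι p ≈ - (ι p - ι n)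
   flip = trans (+-comm _ _) (trans (+-congˡ (sym (⁻¹-involutive _))) (-‿+-comm _ _))

 normalise-sound : ∀ ρ e → evalP ρ (normalise e) ≈ ⟦ e ⟧ ρ
 normalise-sound ρ (nat n) = trans (+-identityʳ _) (trans (*-identityʳ _)
   (trans (+-congˡ -0#≈0#) (+-identityʳ _)))
 normalise-sound ρ one = trans (+-identityʳ _) (trans (*-identityʳ _)
   (trans (+-cong (+-identityʳ _) -0#≈0#) (+-identityʳ _)))
 normalise-sound ρ (var i) = trans (+-identityʳ _)
   (trans (*-cong (trans (+-cong (+-identityʳ _) -0#≈0#) (+-identityʳ _)) (*-identityʳ _)) (*-identityˡ _))
 normalise-sound ρ (a :+ b) = trans (addP-sound ρ (normalise a) (normalise b))
   (+-cong (normalise-sound ρ a) (normalise-sound ρ b))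
 normalise-sound ρ (a :* b) = trans (mulP-sound ρ (normalise a) (normalise b))
   (*-cong (normalise-sound ρ a) (normalise-sound ρ b))
 normalise-sound ρ (⊝ a) = trans (negP-sound ρ (normalise a)) (-‿cong (normalise-sound ρ a))

 -- Terms whose coefficient cancels stay in the list, so a vanishing polynomial is recognised by its
 -- coefficients and not by emptiness.
 isZero : Poly → Bool
 isZero [] = true
 isZero (((p , n) , _) ∷ q) = (p ℕ.≡ᵇ n) ∧ isZero q

 evalC-zero : ∀ p n → (p ℕ.≡ᵇ n) ≡ true → evalC (p , n) ≈ 0#
 evalC-zero p n eq = trans (+-congˡ (-‿cong (reflexive (≡.cong ι (≡.sym (ℕ.≡ᵇ⇒≡ p n (≡.subst T′ (≡.sym eq) _))))))) (-‿inverseʳ _)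
   where
   open import Data.Bool using () renaming (T to T′)

 isZero-sound : ∀ ρ p → isZero p ≡ true → evalP ρ p ≈ 0#
 isZero-sound ρ [] _ = refl
 isZero-sound ρ (((p , n) , m) ∷ q) eq with p ℕ.≡ᵇ n in pn
 ... | true = trans (+-cong (trans (*-congʳ (evalC-zero p n pn)) (zeroˡ _)) (isZero-sound ρ q eq)) (+-identityʳ _)

 -- The test is made on the formal difference: only integer coefficients are compared, so equality
 -- in the ring itself may be undecidable.
 ring-eq : ∀ ρ a b → isZero (normalise (a :- b)) ≡ true → ⟦ a ⟧ ρ ≈ ⟦ b ⟧ ρ
 ring-eq ρ a b eq = begin
   ⟦ a ⟧ ρ ≈⟨ +-identityʳ _ ⟨
   ⟦ a ⟧ ρ + 0# ≈⟨ +-congˡ (-‿inverseˡ _) ⟨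
   ⟦ a ⟧ ρ + (- ⟦ b ⟧ ρ + ⟦ b ⟧ ρ) ≈⟨ +-assoc _ _ _ ⟨
   (⟦ a ⟧ ρ - ⟦ b ⟧ ρ) + ⟦ b ⟧ ρ
     ≈⟨ +-congʳ (trans (sym (normalise-sound ρ (a :- b))) (isZero-sound ρ (normalise (a :- b)) eq)) ⟩
   0# + ⟦ b ⟧ ρ ≈⟨ +-identityˡ _ ⟩
   ⟦ b ⟧ ρ ∎

-- Ordered arithmetic of the rationals and certificates for inequalities.

module RationalArithmetic where

 open import Data.Bool using (Bool; true; false; _∧_; T)
 open import Data.List using (List; map)
 open import Algebra.Structures using (IsCommutativeRing)
 open import Data.Rational public using (ℚ; _≤_; _<_)
 import Data.Rational as Q
 import Data.Rational.Properties as QP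
 open import Data.Rational.Properties public
   using (≤-refl; ≤-trans; ≤-reflexive; <⇒≤; ≰⇒>; _≤?_; ≤-total)
 open import Relation.Binary.PropositionalEquality

 infixl 6 _+_ _-_
 infixl 7 _*_
 infix 8 -_

 -- The operations are opaque because Agda would otherwise try to evaluate sums and products
 -- instead of unifying them.
 opaque
   0ℚ 1ℚ : ℚ
   0ℚ = Q.0ℚ
   1ℚ = Q.1ℚ

   _+_ _*_ : ℚ → ℚ → ℚ
   _+_ = Q._+_
   _*_ = Q._*_

   -_ : ℚ → ℚ
   -_ = Q.-_

   isCommutativeRing : IsCommutativeRing _≡_ _+_ _*_ -_ 0ℚ 1ℚ
   isCommutativeRing = CommutativeRing.isCommutativeRing QP.+-*-commutativeRing

   +-mono-≤ : ∀ {p q r s} → p ≤ q → r ≤ s → p + r ≤ q + s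
   +-mono-≤ = QP.+-mono-≤

   0≤* : ∀ {p q} → 0ℚ ≤ p → 0ℚ ≤ q → 0ℚ ≤ p * q
   0≤* {p} {q} hp hq = ≤-trans (≤-reflexive (sym (QP.*-zeroʳ p)))
     (QP.*-monoˡ-≤-nonNeg p {{Q.nonNegative hp}} hq)

   0<1 : 0ℚ < 1ℚ
   0<1 = QP.positive⁻¹ Q.1ℚ

   ≤-cancel-* : ∀ r {p q} → 0ℚ < r → r * p ≤ r * q → p ≤ q
   ≤-cancel-* r r>0 = QP.*-cancelˡ-≤-pos r {{Q.positive r>0}}

   inverse : ∀ r → 0ℚ < r → ℚ
   inverse r r>0 = (Q.1/ r) {{QP.pos⇒nonZero r {{Q.positive r>0}}}}

   *-inverse : ∀ r r>0 → r * inverse r r>0 ≡ 1ℚ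
   *-inverse r r>0 = QP.*-inverseʳ r {{QP.pos⇒nonZero r {{Q.positive r>0}}}}

 _-_ : ℚ → ℚ → ℚ
 p - q = p + - q

 commutativeRing : CommutativeRing _ _
 commutativeRing = record { isCommutativeRing = isCommutativeRing }

 module ℚₚ where
   open CommutativeRing commutativeRing public
     using (+-identityˡ; +-identityʳ; *-identityˡ; *-identityʳ; zeroˡ; zeroʳ; distribˡ; distribʳ;
            +-comm; *-comm; +-assoc; *-assoc; -‿inverseʳ; +-monoid; semiring)
   open QP public using (<-≤-trans; ≤-<-trans; <-irrefl; ≤-antisym)

 open RingNormaliser commutativeRing public

 <⇒≱ : ∀ {p q} → p < q → q ≤ p → ⊥
 <⇒≱ p<q q≤p = ℚₚ.<-irrefl refl (ℚₚ.<-≤-trans p<q q≤p)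

 infixl 6 _⊞_
 infixl 7 _⊛_ _⊠_

 -- Evaluation is not injective; wrapped in a record, `e` can be read off from the type when
 -- certificates are combined.
 record Pos (ρ : Env) (e : Expr) : Set where
   constructor pos
   field nonneg : 0ℚ ≤ ⟦ e ⟧ ρ
 open Pos public

 0≤+ : ∀ {p q} → 0ℚ ≤ p → 0ℚ ≤ q → 0ℚ ≤ p + q
 0≤+ hp hq = ≤-trans (≤-reflexive (sym (ℚₚ.+-identityˡ 0ℚ))) (+-mono-≤ hp hq)

 0≤1 : 0ℚ ≤ 1ℚ
 0≤1 = <⇒≤ 0<1

 0≤ι : ∀ n → 0ℚ ≤ ι n
 0≤ι zero = ≤-refl
 0≤ι (suc n) = 0≤+ 0≤1 (0≤ι n)

 ∅ : ∀ {ρ} → Pos ρ (nat 0)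
 ∅ = pos ≤-refl

 ≤⇒0≤- : ∀ {p q} → p ≤ q → 0ℚ ≤ q - p
 ≤⇒0≤- {p} {q} h = ≤-trans (≤-reflexive (sym (ℚₚ.-‿inverseʳ p))) (+-mono-≤ h (≤-refl { - p}))

 le : ∀ {ρ} l r → ⟦ l ⟧ ρ ≤ ⟦ r ⟧ ρ → Pos ρ (r :- l)
 le l r h = pos (≤⇒0≤- h)

 nn : ∀ {ρ} e → 0ℚ ≤ ⟦ e ⟧ ρ → Pos ρ (e :- nat 0)
 nn = le (nat 0)

 _⊞_ : ∀ {ρ a b} → Pos ρ a → Pos ρ b → Pos ρ (a :+ b)
 pos p ⊞ pos q = pos (0≤+ p q)

 _⊛_ : ∀ {ρ a b} → Pos ρ a → Pos ρ b → Pos ρ (a :* b)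
 pos p ⊛ pos q = pos (0≤* p q)

 _⊠_ : ∀ {ρ b} n → Pos ρ b → Pos ρ (nat n :* b)
 n ⊠ pos q = pos (0≤* (0≤ι n) q)

 -- Nothing is known about the signs of the variables, so every nonconstant monomial must cancel;
 -- only the constant may be positive.
 isNonneg : Poly → Bool
 isNonneg [] = true
 isNonneg (((p , n) , []) ∷ q) = (n ℕ.≤ᵇ p) ∧ isNonneg q
 isNonneg (((p , n) , _ ∷ _) ∷ q) = (p ℕ.≡ᵇ n) ∧ isNonneg q

 ι-mono : ∀ {m n} → m ℕ.≤ n → ι m ≤ ι n
 ι-mono {n = n} ℕ.z≤n = 0≤ι n
 ι-mono (ℕ.s≤s h) = +-mono-≤ (≤-refl {1ℚ}) (ι-mono h)

 isNonneg-sound : ∀ ρ p → isNonneg p ≡ true → 0ℚ ≤ evalP ρ p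
 isNonneg-sound ρ [] _ = ≤-refl
 isNonneg-sound ρ (((p , n) , []) ∷ q) eq with n ℕ.≤ᵇ p in np
 ... | true = 0≤+ (0≤* (≤⇒0≤- (ι-mono (ℕ.≤ᵇ⇒≤ n p (subst T (sym np) _)))) 0≤1) (isNonneg-sound ρ q eq)
 isNonneg-sound ρ (((p , n) , i ∷ m) ∷ q) eq with p ℕ.≡ᵇ n in pn
 ... | true = 0≤+ (≤-reflexive (sym (trans (cong (_* evalM ρ (i ∷ m)) (evalC-zero p n pn)) (ℚₚ.zeroˡ (evalM ρ (i ∷ m))))))
   (isNonneg-sound ρ q eq)

 0<1+ι : ∀ n → 0ℚ < ι (suc n)
 0<1+ι n = ℚₚ.<-≤-trans 0<1 (≤-trans (≤-reflexive (sym (ℚₚ.+-identityʳ 1ℚ))) (+-mono-≤ (≤-refl {1ℚ}) (0≤ι n)))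

 0≤-cancel : ∀ g x → 0ℚ ≤ ι (suc g) * x → 0ℚ ≤ x
 0≤-cancel g x h = ≤-cancel-* (ι (suc g)) (0<1+ι g) (≤-trans (≤-reflexive (ℚₚ.zeroʳ (ι (suc g)))) h)

 0≤-⇒≤ : ∀ {p q} → 0ℚ ≤ q - p → p ≤ q
 0≤-⇒≤ {p} {q} h = ≤-trans (≤-reflexive (sym (ℚₚ.+-identityˡ p)))
   (≤-trans (+-mono-≤ h (≤-refl {p})) (≤-reflexive (ring-eq (p ∷ q ∷ []) (var 1 :- var 0 :+ var 0) (var 1) refl)))

 -- A linear-arithmetic certificate: suc g times the goal is the certified nonnegative
 -- expression e plus a nonnegative constant.
 lin : ∀ ρ g l r {e} → Pos ρ e → isNonneg (normalise (nat (suc g) :* (r :- l) :- e)) ≡ true → ⟦ l ⟧ ρ ≤ ⟦ r ⟧ ρ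
 lin ρ g l r {e} (pos h) ok = 0≤-⇒≤ (0≤-cancel g _ (≤-trans (0≤+ h (isNonneg-sound ρ (normalise goal) ok))
   (≤-reflexive (trans (cong (⟦ e ⟧ ρ +_) (normalise-sound ρ goal))
     (ring-eq (⟦ e ⟧ ρ ∷ ι (suc g) * (⟦ r ⟧ ρ - ⟦ l ⟧ ρ) ∷ []) (var 0 :+ (var 1 :- var 0)) (var 1) refl)))))
   where
   goal : Expr
   goal = nat (suc g) :* (r :- l) :- e

 -- The certificate combines the hypotheses into a nonnegative expression that reduces formally to a
 -- constant at most -1.
 lin-⊥ : ∀ ρ {e} → Pos ρ e → isNonneg (normalise (⊝ nat 1 :- e)) ≡ true → ⊥
 lin-⊥ ρ {e} (pos h) ok = <⇒≱ (0<1+ι 0) (0≤-⇒≤ {ι 1} {0ℚ} (≤-trans (0≤+ h (isNonneg-sound ρ (normalise goal) ok))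
   (≤-reflexive (trans (cong (⟦ e ⟧ ρ +_) (normalise-sound ρ goal))
     (ring-eq (⟦ e ⟧ ρ ∷ []) (var 0 :+ (⊝ nat 1 :- var 0)) (nat 0 :- nat 1) refl)))))
   where
   goal : Expr
   goal = ⊝ nat 1 :- e

 ι-+ : ∀ m n → ι (m ℕ.+ n) ≡ ι m + ι n
 ι-+ m n = ×-homo-+ 1ℚ m n
   where open import Algebra.Properties.Monoid.Mult ℚₚ.+-monoid using (×-homo-+)

 ι-* : ∀ m n → ι (m ℕ.* n) ≡ ι m * ι n
 ι-* m n = ×1-homo-* m n
   where
   open import Algebra.Properties.Semiring.Mult ℚₚ.semiring using (×1-homo-*)

 ι-cancel-≤ : ∀ {m n} → ι m ≤ ι n → m ℕ.≤ n
 ι-cancel-≤ {m} {n} h with m ℕ.≤? n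
 ... | yes p = p
 ... | no ¬p = contradiction (≤-trans (ι-mono (ℕ.≰⇒> ¬p)) h) (λ q → lin-⊥ (ι n ∷ []) (le (one :+ var 0) (var 0) q) refl)

 -- The value 0 at 0 makes `rec-*` unconditional and lets isolated vertices count as nothing in
 -- `0≤-weight`.
 rec : ℕ → ℚ
 rec zero = 0ℚ
 rec (suc n) = inverse (ι (suc n)) (0<1+ι n)

 ι*rec : ∀ n → ι (suc n) * rec (suc n) ≡ 1ℚ
 ι*rec n = *-inverse (ι (suc n)) (0<1+ι n)

 0≤rec : ∀ n → 0ℚ ≤ rec n
 0≤rec zero = ≤-refl
 0≤rec (suc n) = 0≤-cancel n (rec (suc n)) (≤-trans 0≤1 (≤-reflexive (sym (ι*rec n))))

 ≤-cancel : ∀ n {x y} → ι (suc n) * x ≤ ι (suc n) * y → x ≤ y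
 ≤-cancel n {x} {y} h = 0≤-⇒≤ (0≤-cancel n (y - x) (≤-trans (≤⇒0≤- h)
   (≤-reflexive (ring-eq (ι (suc n) ∷ x ∷ y ∷ []) (var 0 :* var 2 :- var 0 :* var 1) (var 0 :* (var 2 :- var 1)) refl))))

 -- The value at `⊝` is a dummy, excluded by `positive?` from every expression that is cast.
 -- Subtraction takes place in ℚ only, inside the certificates.
 ⟦_⟧ᴺ : Expr → List ℕ → ℕ
 ⟦ nat n ⟧ᴺ ρ = n
 ⟦ one ⟧ᴺ ρ = 1
 ⟦ var i ⟧ᴺ ρ = atomᴺ ρ i
   where
   atomᴺ : List ℕ → ℕ → ℕ
   atomᴺ [] _ = 0
   atomᴺ (x ∷ ρ) zero = x
   atomᴺ (x ∷ ρ) (suc i) = atomᴺ ρ i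
 ⟦ a :+ b ⟧ᴺ ρ = ⟦ a ⟧ᴺ ρ ℕ.+ ⟦ b ⟧ᴺ ρ
 ⟦ a :* b ⟧ᴺ ρ = ⟦ a ⟧ᴺ ρ ℕ.* ⟦ b ⟧ᴺ ρ
 ⟦ ⊝ a ⟧ᴺ ρ = 0

 positive? : Expr → Bool
 positive? (nat _) = true
 positive? one = true
 positive? (var _) = true
 positive? (a :+ b) = positive? a ∧ positive? b
 positive? (a :* b) = positive? a ∧ positive? b
 positive? (⊝ _) = false

 cast : ∀ ρ e → T (positive? e) → ι (⟦ e ⟧ᴺ ρ) ≡ ⟦ e ⟧ (map ι ρ)
 cast ρ (nat n) _ = refl
 cast ρ one _ = ℚₚ.+-identityʳ 1ℚ
 cast [] (var i) _ = refl
 cast (x ∷ ρ) (var zero) _ = refl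
 cast (x ∷ ρ) (var (suc i)) _ = cast ρ (var i) _
 cast ρ (a :+ b) ok with positive? a in pa
 ... | true = trans (ι-+ (⟦ a ⟧ᴺ ρ) (⟦ b ⟧ᴺ ρ)) (cong₂ _+_ (cast ρ a (subst T (sym pa) _)) (cast ρ b ok))
 cast ρ (a :* b) ok with positive? a in pa
 ... | true = trans (ι-* (⟦ a ⟧ᴺ ρ) (⟦ b ⟧ᴺ ρ)) (cong₂ _*_ (cast ρ a (subst T (sym pa) _)) (cast ρ b ok))

 record Posᴺ (ρ : List ℕ) (e : Expr) : Set where
   constructor posᴺ
   field pos′ : Pos (map ι ρ) e

 leᴺ : ∀ {ρ} l r {ok : T (positive? l)} {ok′ : T (positive? r)} → ⟦ l ⟧ᴺ ρ ℕ.≤ ⟦ r ⟧ᴺ ρ → Posᴺ ρ (r :- l)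
 leᴺ {ρ} l r {ok} {ok′} h = posᴺ (le l r (subst₂ _≤_ (cast ρ l ok) (cast ρ r ok′) (ι-mono h)))

 nnᴺ : ∀ {ρ} e {ok : T (positive? e)} → 0 ℕ.≤ ⟦ e ⟧ᴺ ρ → Posᴺ ρ (e :- nat 0)
 nnᴺ e {ok} = leᴺ (nat 0) e {_} {ok}

 _⊞ᴺ_ : ∀ {ρ a b} → Posᴺ ρ a → Posᴺ ρ b → Posᴺ ρ (a :+ b)
 posᴺ p ⊞ᴺ posᴺ q = posᴺ (p ⊞ q)

 _⊛ᴺ_ : ∀ {ρ a b} → Posᴺ ρ a → Posᴺ ρ b → Posᴺ ρ (a :* b)
 posᴺ p ⊛ᴺ posᴺ q = posᴺ (p ⊛ q)

 _⊠ᴺ_ : ∀ {ρ b} n → Posᴺ ρ b → Posᴺ ρ (nat n :* b)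
 n ⊠ᴺ posᴺ q = posᴺ (n ⊠ q)

 infixl 6 _⊞ᴺ_
 infixl 7 _⊛ᴺ_ _⊠ᴺ_

 ∅ᴺ : ∀ {ρ} → Posᴺ ρ (nat 0)
 ∅ᴺ = posᴺ ∅

 linᴺ : ∀ ρ g l r {ok : T (positive? l)} {ok′ : T (positive? r)} {e} → Posᴺ ρ e →
   isNonneg (normalise (nat (suc g) :* (r :- l) :- e)) ≡ true → ⟦ l ⟧ᴺ ρ ℕ.≤ ⟦ r ⟧ᴺ ρ
 linᴺ ρ g l r {ok} {ok′} (posᴺ h) p =
   ι-cancel-≤ (subst₂ _≤_ (sym (cast ρ l ok)) (sym (cast ρ r ok′)) (lin (map ι ρ) g l r h p))

 lin-⊥ᴺ : ∀ ρ {e} → Posᴺ ρ e → isNonneg (normalise (⊝ nat 1 :- e)) ≡ true → ⊥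
 lin-⊥ᴺ ρ (posᴺ h) p = lin-⊥ (map ι ρ) h p

 ring-eqᴺ : ∀ ρ l r {ok : T (positive? l)} {ok′ : T (positive? r)} →
   isZero (normalise (l :- r)) ≡ true → ⟦ l ⟧ᴺ ρ ≡ ⟦ r ⟧ᴺ ρ
 ring-eqᴺ ρ l r {ok} {ok′} p = ℕ.≤-antisym
   (ι-cancel-≤ (≤-reflexive eq)) (ι-cancel-≤ (≤-reflexive (sym eq)))
   where
   eq : ι (⟦ l ⟧ᴺ ρ) ≡ ι (⟦ r ⟧ᴺ ρ)
   eq = trans (cast ρ l ok) (trans (ring-eq (map ι ρ) l r p) (sym (cast ρ r ok′)))

 open import Data.Nat.Properties public using () renaming (≤-reflexive to ≤-reflexiveᴺ)

-- Finite sums over divisors and multiples.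

module DivisorSums where

 open import Data.Nat.DivMod using (_/_; m≡m%n+[m/n]*n; m%n<n; _%_; m/n/o≡m/[n*o])
 open import Data.Nat.Divisibility using (_∣_; _∣?_; divides; ∣⇒≤; *-cancelˡ-∣; *-monoʳ-∣; ∣n⇒∣m*n)
 open import Data.Nat.Coprimality using (Coprime; coprime-divisor)
 open import Data.Nat.Primality using (Prime; prime⇒irreducible; prime⇒nonZero)
 open import Relation.Binary.PropositionalEquality
 open RationalArithmetic

 open ≡-Reasoning

 ∑ : ℕ → (ℕ → ℚ) → ℚ
 ∑ zero f = 0ℚ
 ∑ (suc n) f = ∑ n f + f (suc n)

 ⟨_⟩ : ∀ {a} {P : Set a} → Dec P → ℚ
 ⟨ yes _ ⟩ = 1ℚ
 ⟨ no _ ⟩ = 0ℚ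

 ⟨⟩-yes : ∀ {a} {P : Set a} (d : Dec P) → P → ⟨ d ⟩ ≡ 1ℚ
 ⟨⟩-yes (yes _) _ = refl
 ⟨⟩-yes (no ¬p) p = contradiction p ¬p

 ⟨⟩-no : ∀ {a} {P : Set a} (d : Dec P) → ¬ P → ⟨ d ⟩ ≡ 0ℚ
 ⟨⟩-no (yes p) ¬p = contradiction p ¬p
 ⟨⟩-no (no _) _ = refl

 ⟨⟩-cong : ∀ {a b} {P : Set a} {Q : Set b} (d : Dec P) (e : Dec Q) → (P → Q) → (Q → P) → ⟨ d ⟩ ≡ ⟨ e ⟩
 ⟨⟩-cong (yes p) e to from = sym (⟨⟩-yes e (to p))
 ⟨⟩-cong (no ¬p) e to from = sym (⟨⟩-no e (λ q → ¬p (from q)))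

 0≤⟨⟩ : ∀ {a} {P : Set a} (d : Dec P) → 0ℚ ≤ ⟨ d ⟩
 0≤⟨⟩ (yes _) = 0≤1
 0≤⟨⟩ (no _) = ≤-refl

 ∑-cong : ∀ n {f g : ℕ → ℚ} → (∀ i → 1 ℕ.≤ i → i ℕ.≤ n → f i ≡ g i) → ∑ n f ≡ ∑ n g
 ∑-cong zero h = refl
 ∑-cong (suc n) h = cong₂ _+_ (∑-cong n (λ i p q → h i p (ℕ.m≤n⇒m≤1+n q))) (h (suc n) (s≤s z≤n) ℕ.≤-refl)

 ∑-mono : ∀ n {f g : ℕ → ℚ} → (∀ i → 1 ℕ.≤ i → i ℕ.≤ n → f i ≤ g i) → ∑ n f ≤ ∑ n g
 ∑-mono zero h = ≤-refl
 ∑-mono (suc n) h = +-mono-≤ (∑-mono n (λ i p q → h i p (ℕ.m≤n⇒m≤1+n q))) (h (suc n) (s≤s z≤n) ℕ.≤-refl)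

 ∑-+ : ∀ n (f g : ℕ → ℚ) → ∑ n (λ i → f i + g i) ≡ ∑ n f + ∑ n g
 ∑-+ zero f g = sym (ℚₚ.+-identityˡ 0ℚ)
 ∑-+ (suc n) f g = trans (cong (_+ (f (suc n) + g (suc n))) (∑-+ n f g))
   (ring-eq ((∑ n f) ∷ (∑ n g) ∷ (f (suc n)) ∷ (g (suc n)) ∷ []) (x0 :+ x1 :+ (x2 :+ x3)) (x0 :+ x2 :+ (x1 :+ x3)) refl)

 ∑-* : ∀ n c (f : ℕ → ℚ) → ∑ n (λ i → c * f i) ≡ c * ∑ n f
 ∑-* zero c f = sym (ℚₚ.zeroʳ c)
 ∑-* (suc n) c f = trans (cong (_+ c * f (suc n)) (∑-* n c f)) (sym (ℚₚ.distribˡ c (∑ n f) (f (suc n))))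

 ∑-0 : ∀ n → ∑ n (λ _ → 0ℚ) ≡ 0ℚ
 ∑-0 zero = refl
 ∑-0 (suc n) = trans (cong (_+ 0ℚ) (∑-0 n)) (ℚₚ.+-identityˡ 0ℚ)

 ∑-const : ∀ n c → ∑ n (λ _ → c) ≡ ι n * c
 ∑-const zero c = sym (ℚₚ.zeroˡ c)
 ∑-const (suc n) c = trans (cong (_+ c) (∑-const n c)) (ring-eq ((ι n) ∷ c ∷ []) (x0 :* x1 :+ x1) ((one :+ x0) :* x1) refl)

 ∑-swap : ∀ n m (f : ℕ → ℕ → ℚ) → ∑ n (λ i → ∑ m (f i)) ≡ ∑ m (λ j → ∑ n (λ i → f i j))
 ∑-swap zero m f = sym (∑-0 m)
 ∑-swap (suc n) m f = trans (cong (_+ ∑ m (f (suc n))) (∑-swap n m f)) (sym (∑-+ m (λ j → ∑ n (λ i → f i j)) (f (suc n))))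

 ∑-extend : ∀ {n N} (f : ℕ → ℚ) → n ℕ.≤ N → (∀ i → n ℕ.< i → i ℕ.≤ N → f i ≡ 0ℚ) → ∑ N f ≡ ∑ n f
 ∑-extend {n} {zero} f z≤n h = refl
 ∑-extend {n} {suc N} f n≤N h with ℕ.m≤n⇒m<n∨m≡n n≤N
 ... | inj₂ refl = refl
 ... | inj₁ (s≤s n≤N′) = trans (cong₂ _+_ (∑-extend f n≤N′ (λ i p q → h i p (ℕ.m≤n⇒m≤1+n q))) (h (suc N) (s≤s n≤N′) ℕ.≤-refl))
   (ℚₚ.+-identityʳ _)

 ∑-grow : ∀ {n N} (f : ℕ → ℚ) → n ℕ.≤ N → (∀ i → n ℕ.< i → i ℕ.≤ N → 0ℚ ≤ f i) → ∑ n f ≤ ∑ N f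
 ∑-grow {n} {zero} f z≤n h = ≤-refl
 ∑-grow {n} {suc N} f n≤N h with ℕ.m≤n⇒m<n∨m≡n n≤N
 ... | inj₂ refl = ≤-refl
 ... | inj₁ (s≤s n≤N′) = lin ((∑ n f) ∷ (∑ N f) ∷ (f (suc N)) ∷ []) 0 x0 (x1 :+ x2) (le x0 x1 (∑-grow f n≤N′ (λ i p q → h i p (ℕ.m≤n⇒m≤1+n q))) ⊞
     le (nat 0) x2 (h (suc N) (s≤s n≤N′) ℕ.≤-refl)) refl

 0≤∑ : ∀ n {f : ℕ → ℚ} → (∀ i → 1 ℕ.≤ i → i ℕ.≤ n → 0ℚ ≤ f i) → 0ℚ ≤ ∑ n f
 0≤∑ n h = ≤-trans (≤-reflexive (sym (∑-0 n))) (∑-mono n h)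

 ∑-point : ∀ n (f : ℕ → ℚ) → 1 ℕ.≤ n → ∑ n (λ k → ⟨ k ℕ.≟ 1 ⟩ * f k) ≡ f 1
 ∑-point n f n≥1 = trans (∑-extend {1} {n} (λ k → ⟨ k ℕ.≟ 1 ⟩ * f k) n≥1
   (λ i p q → trans (cong (_* f i) (⟨⟩-no (i ℕ.≟ 1) (ℕ.>⇒≢ p))) (ℚₚ.zeroˡ (f i))))
   (trans (ℚₚ.+-identityˡ (1ℚ * f 1)) (ℚₚ.*-identityˡ (f 1)))

 infixl 7 _div_

 -- Total division, with n div 0 = 0.
 _div_ : ℕ → ℕ → ℕ
 n div zero = 0
 n div suc k = n / suc k

 div-≤ : ∀ N n → n ℕ.* (N div n) ℕ.≤ N
 div-≤ N zero = z≤n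
 div-≤ N n@(suc _) = ℕ.≤-trans (ℕ.m≤n+m _ (N % n)) (ℕ.≤-reflexive (trans (cong (N % n ℕ.+_) (ℕ.*-comm n (N / n))) (sym (m≡m%n+[m/n]*n N n))))

 div-< : ∀ N {n} → 1 ℕ.≤ n → N ℕ.< n ℕ.* suc (N div n)
 div-< N n@{suc _} _ = ℕ.≤-trans (ℕ.≤-reflexive (cong suc (m≡m%n+[m/n]*n N n)))
   (ℕ.≤-trans (ℕ.+-monoˡ-≤ ((N / n) ℕ.* n) (m%n<n N n)) (ℕ.≤-reflexive (ℕ.*-comm (suc (N / n)) n)))

 ≤-div : ∀ {N n q} → 1 ℕ.≤ n → n ℕ.* q ℕ.≤ N → q ℕ.≤ N div n
 ≤-div {N} {n} {q} p h = ℕ.s≤s⁻¹ (ℕ.*-cancelˡ-< n q (suc (N div n)) (ℕ.≤-<-trans h (div-< N p)))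

 div-unique : ∀ {N n q} → 1 ℕ.≤ n → n ℕ.* q ℕ.≤ N → N ℕ.< n ℕ.* suc q → N div n ≡ q
 div-unique {N} {n} {q} p h k = ℕ.≤-antisym
   (ℕ.s≤s⁻¹ (ℕ.*-cancelˡ-< n (N div n) (suc q) (ℕ.≤-<-trans (div-≤ N n) k))) (≤-div p h)

 div-mono : ∀ {M N} n → M ℕ.≤ N → M div n ℕ.≤ N div n
 div-mono zero h = z≤n
 div-mono {M} {N} n@(suc _) h = ≤-div {N} {n} (s≤s z≤n) (ℕ.≤-trans (div-≤ M n) h)

 div≤ : ∀ N n → N div n ℕ.≤ N
 div≤ N zero = z≤n
 div≤ N n@(suc k) = ℕ.≤-trans (ℕ.m≤m+n _ (k ℕ.* (N div n))) (div-≤ N n)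

 div-div : ∀ N m n → (N div m) div n ≡ N div (m ℕ.* n)
 div-div N zero zero = refl
 div-div N zero (suc n) = refl
 div-div N (suc m) zero = cong (N div_) (sym (ℕ.*-zeroʳ m))
 div-div N (suc m) (suc n) = m/n/o≡m/[n*o] N (suc m) (suc n)

 m*n-div : ∀ {n} q → 1 ℕ.≤ n → (n ℕ.* q) div n ≡ q
 m*n-div {n} q p = div-unique p ℕ.≤-refl (ℕ.≤-trans (ℕ.+-monoˡ-≤ (n ℕ.* q) p) (ℕ.≤-reflexive (sym (ℕ.*-suc n q))))

 ∑-multiples : ∀ {n} N (g : ℕ → ℚ) → 1 ℕ.≤ n → ∑ N (λ k → ⟨ n ∣? k ⟩ * g k) ≡ ∑ (N div n) (λ m → g (n ℕ.* m))
 ∑-multiples {suc n} zero g p = refl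
 ∑-multiples {n} (suc N) g p with n ∣? suc N
 ... | yes (divides zero ())
 ... | yes (divides (suc q) eq) = begin
   ∑ N (λ k → ⟨ n ∣? k ⟩ * g k) + 1ℚ * g (suc N) ≡⟨ cong₂ _+_ (∑-multiples N g p) (ℚₚ.*-identityˡ (g (suc N))) ⟩
   ∑ (N div n) (λ m → g (n ℕ.* m)) + g (suc N) ≡⟨ cong₂ (λ a b → ∑ a (λ m → g (n ℕ.* m)) + g b) N-div eq′ ⟩
   ∑ (suc q) (λ m → g (n ℕ.* m)) ≡⟨ cong (λ a → ∑ a (λ m → g (n ℕ.* m))) 1+N-div ⟨
   ∑ (suc N div n) (λ m → g (n ℕ.* m)) ∎
   where
   eq′ : suc N ≡ n ℕ.* suc q
   eq′ = trans eq (ℕ.*-comm (suc q) n)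
   1+N-div : suc N div n ≡ suc q
   1+N-div = trans (cong (_div n) eq′) (m*n-div (suc q) p)
   N-div : N div n ≡ q
   N-div = div-unique p (linᴺ (N ∷ n ∷ q ∷ []) 0 (x1 :* x2) x0 (leᴺ (x1 :+ x1 :* x2) (nat 1 :+ x0) (≤-reflexiveᴺ (sym eq′′)) ⊞ᴺ leᴺ (nat 1) x1 p) refl) (ℕ.≤-reflexive eq′)
     where
     eq′′ : suc N ≡ n ℕ.+ n ℕ.* q
     eq′′ = trans eq′ (ℕ.*-suc n q)
 ... | no ¬d = begin
   ∑ N (λ k → ⟨ n ∣? k ⟩ * g k) + 0ℚ * g (suc N) ≡⟨ cong₂ _+_ (∑-multiples N g p) (ℚₚ.zeroˡ (g (suc N))) ⟩
   ∑ (N div n) (λ m → g (n ℕ.* m)) + 0ℚ ≡⟨ ℚₚ.+-identityʳ _ ⟩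
   ∑ (N div n) (λ m → g (n ℕ.* m)) ≡⟨ cong (λ a → ∑ a (λ m → g (n ℕ.* m))) same ⟨
   ∑ (suc N div n) (λ m → g (n ℕ.* m)) ∎
   where
   same : suc N div n ≡ N div n
   same = div-unique p (ℕ.m≤n⇒m≤1+n (div-≤ N n))
     (ℕ.≤∧≢⇒< (div-< N p) (λ eq → ¬d (divides (suc (N div n)) (trans eq (ℕ.*-comm n _)))))

 ∑-indicator : ∀ {n} N (f : ℕ → ℚ) → 1 ℕ.≤ n → ∑ (N div n) f ≡ ∑ N (λ m → ⟨ n ℕ.* m ℕ.≤? N ⟩ * f m)
 ∑-indicator {n} N f p = trans
   (∑-cong (N div n) (λ i _ q → sym (trans (cong (_* f i) (⟨⟩-yes (n ℕ.* i ℕ.≤? N) (ℕ.≤-trans (ℕ.*-monoʳ-≤ n q) (div-≤ N n)))) (ℚₚ.*-identityˡ (f i)))))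
   (sym (∑-extend (λ m → ⟨ n ℕ.* m ℕ.≤? N ⟩ * f m) (div≤ N n)
     (λ i q _ → trans (cong (_* f i) (⟨⟩-no (n ℕ.* i ℕ.≤? N) (λ h → ℕ.<⇒≱ q (≤-div p h)))) (ℚₚ.zeroˡ (f i)))))

 -- Both sides run over the pairs with `n * m ≤ N`, a condition that `∑-indicator` makes symmetric.
 ∑-div-swap : ∀ N (f : ℕ → ℕ → ℚ) → ∑ N (λ n → ∑ (N div n) (f n)) ≡ ∑ N (λ m → ∑ (N div m) (λ n → f n m))
 ∑-div-swap N f = begin
   ∑ N (λ n → ∑ (N div n) (f n)) ≡⟨ ∑-cong N (λ n p _ → ∑-indicator N (f n) p) ⟩
   ∑ N (λ n → ∑ N (λ m → ⟨ n ℕ.* m ℕ.≤? N ⟩ * f n m)) ≡⟨ ∑-swap N N _ ⟩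
   ∑ N (λ m → ∑ N (λ n → ⟨ n ℕ.* m ℕ.≤? N ⟩ * f n m))
     ≡⟨ ∑-cong N (λ m _ _ → ∑-cong N (λ n _ _ → cong (λ a → ⟨ a ℕ.≤? N ⟩ * f n m) (ℕ.*-comm n m))) ⟩
   ∑ N (λ m → ∑ N (λ n → ⟨ m ℕ.* n ℕ.≤? N ⟩ * f n m)) ≡⟨ ∑-cong N (λ m p _ → sym (∑-indicator N (λ n → f n m) p)) ⟩
   ∑ N (λ m → ∑ (N div m) (λ n → f n m)) ∎

 divisorSum : (ℕ → ℚ) → ℕ → ℚ
 divisorSum g k = ∑ k (λ d → ⟨ d ∣? k ⟩ * g d)

 divisorSum-cong : ∀ {f g} k → (∀ d → 1 ℕ.≤ d → d ∣ k → f d ≡ g d) → divisorSum f k ≡ divisorSum g k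
 divisorSum-cong {f} {g} k h = ∑-cong k pointwise
   where
   pointwise : ∀ d → 1 ℕ.≤ d → d ℕ.≤ k → ⟨ d ∣? k ⟩ * f d ≡ ⟨ d ∣? k ⟩ * g d
   pointwise d p _ with d ∣? k
   ... | yes d∣k = cong (1ℚ *_) (h d p d∣k)
   ... | no _ = trans (ℚₚ.zeroˡ (f d)) (sym (ℚₚ.zeroˡ (g d)))

 divisorSum-+ : ∀ f g k → divisorSum (λ d → f d + g d) k ≡ divisorSum f k + divisorSum g k
 divisorSum-+ f g k = trans (∑-cong k (λ d _ _ → ℚₚ.distribˡ ⟨ d ∣? k ⟩ (f d) (g d))) (∑-+ k _ _)

 divisorSum-* : ∀ c f k → divisorSum (λ d → c * f d) k ≡ c * divisorSum f k
 divisorSum-* c f k = trans (∑-cong k (λ d _ _ → (ring-eq ((⟨ d ∣? k ⟩) ∷ c ∷ (f d) ∷ []) (x0 :* (x1 :* x2)) (x1 :* (x0 :* x2)) refl))) (∑-* k c _)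

 divisorSum-≤ : ∀ g {k N} → 1 ℕ.≤ k → k ℕ.≤ N → ∑ N (λ d → ⟨ d ∣? k ⟩ * g d) ≡ divisorSum g k
 divisorSum-≤ g {k@(suc _)} {N} _ k≤N = ∑-extend (λ d → ⟨ d ∣? k ⟩ * g d) k≤N
   (λ d k<d _ → trans (cong (_* g d) (⟨⟩-no (d ∣? k) (λ d∣k → ℕ.<⇒≱ k<d (∣⇒≤ d∣k)))) (ℚₚ.zeroˡ (g d)))

 -- The pairs are regrouped by their product `k`; this turns sums over quotients into sums of
 -- Dirichlet convolutions.
 ∑-divisors : ∀ N (h : ℕ → ℕ → ℚ) →
   ∑ N (λ n → ∑ (N div n) (λ m → h n (n ℕ.* m))) ≡ ∑ N (λ k → divisorSum (λ n → h n k) k)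
 ∑-divisors N h = begin
   ∑ N (λ n → ∑ (N div n) (λ m → h n (n ℕ.* m))) ≡⟨ ∑-cong N (λ n p _ → sym (∑-multiples N (h n) p)) ⟩
   ∑ N (λ n → ∑ N (λ k → ⟨ n ∣? k ⟩ * h n k)) ≡⟨ ∑-swap N N _ ⟩
   ∑ N (λ k → ∑ N (λ n → ⟨ n ∣? k ⟩ * h n k)) ≡⟨ ∑-cong N (λ k p q → divisorSum-≤ (λ n → h n k) p q) ⟩
   ∑ N (λ k → divisorSum (λ n → h n k) k) ∎

 _prime-to_ : ℕ → (ℕ → ℚ) → ℕ → ℚ
 (p prime-to g) d with p ∣? d
 ... | yes _ = 0ℚ
 ... | no _ = g d

 multiple-of : ℕ → (ℕ → ℚ) → ℕ → ℚ
 multiple-of p g d with p ∣? d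
 ... | yes _ = g d
 ... | no _ = 0ℚ

 prime-to+multiple : ∀ p g d → (p prime-to g) d + multiple-of p g d ≡ g d
 prime-to+multiple p g d with p ∣? d
 ... | yes _ = ℚₚ.+-identityˡ (g d)
 ... | no _ = ℚₚ.+-identityʳ (g d)

 prime∤⇒coprime : ∀ {p d} → Prime p → ¬ p ∣ d → Coprime d p
 prime∤⇒coprime pr p∤d (i∣d , i∣p) with prime⇒irreducible pr i∣p
 ... | inj₁ i≡1 = i≡1
 ... | inj₂ refl = contradiction i∣d p∤d

 prime≥1 : ∀ {p} → Prime p → 1 ℕ.≤ p
 prime≥1 {p} pr = ℕ.>-nonZero⁻¹ p {{prime⇒nonZero pr}}

 -- A divisor of `p * m` is either prime to `p`, and then divides `m`, or it is `p * e` with `e`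
 -- dividing `m`. As `p` may divide `m` again, this one recursion drives the identities proved by
 -- `prime-induction`.
 divisorSum-prime : ∀ {p} m g → Prime p → 1 ℕ.≤ m →
   divisorSum g (p ℕ.* m) ≡ divisorSum (p prime-to g) m + divisorSum (λ e → g (p ℕ.* e)) m
 divisorSum-prime {p} m g pr m≥1 = begin
   divisorSum g (p ℕ.* m) ≡⟨ divisorSum-cong (p ℕ.* m) (λ d _ _ → sym (prime-to+multiple p g d)) ⟩
   divisorSum (λ d → (p prime-to g) d + multiple-of p g d) (p ℕ.* m) ≡⟨ divisorSum-+ (p prime-to g) (multiple-of p g) (p ℕ.* m) ⟩
   divisorSum (p prime-to g) (p ℕ.* m) + divisorSum (multiple-of p g) (p ℕ.* m) ≡⟨ cong₂ _+_ first second ⟩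
   divisorSum (p prime-to g) m + divisorSum (λ e → g (p ℕ.* e)) m ∎
   where
   instance
     _ : ℕ.NonZero p
     _ = prime⇒nonZero pr
   same : ∀ d → ⟨ d ∣? p ℕ.* m ⟩ * (p prime-to g) d ≡ ⟨ d ∣? m ⟩ * (p prime-to g) d
   same d with p ∣? d
   ... | yes _ = trans (ℚₚ.zeroʳ ⟨ d ∣? p ℕ.* m ⟩) (sym (ℚₚ.zeroʳ ⟨ d ∣? m ⟩))
   ... | no p∤d = cong (_* g d) (⟨⟩-cong (d ∣? p ℕ.* m) (d ∣? m) (coprime-divisor (prime∤⇒coprime pr p∤d)) (∣n⇒∣m*n p))
   first : divisorSum (p prime-to g) (p ℕ.* m) ≡ divisorSum (p prime-to g) m
   first = trans (∑-cong (p ℕ.* m) (λ d _ _ → same d))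
     (divisorSum-≤ (p prime-to g) m≥1 (ℕ.m≤n*m m p))
   shuffle : ∀ d → ⟨ d ∣? p ℕ.* m ⟩ * multiple-of p g d ≡ ⟨ p ∣? d ⟩ * (⟨ d ∣? p ℕ.* m ⟩ * g d)
   shuffle d with p ∣? d
   ... | yes _ = sym (ℚₚ.*-identityˡ (⟨ d ∣? p ℕ.* m ⟩ * g d))
   ... | no _ = trans (ℚₚ.zeroʳ ⟨ d ∣? p ℕ.* m ⟩) (sym (ℚₚ.zeroˡ (⟨ d ∣? p ℕ.* m ⟩ * g d)))
   second : divisorSum (multiple-of p g) (p ℕ.* m) ≡ divisorSum (λ e → g (p ℕ.* e)) m
   second = begin
     divisorSum (multiple-of p g) (p ℕ.* m) ≡⟨ ∑-cong (p ℕ.* m) (λ d _ _ → shuffle d) ⟩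
     ∑ (p ℕ.* m) (λ d → ⟨ p ∣? d ⟩ * (⟨ d ∣? p ℕ.* m ⟩ * g d)) ≡⟨ ∑-multiples (p ℕ.* m) _ (prime≥1 pr) ⟩
     ∑ ((p ℕ.* m) div p) (λ e → ⟨ p ℕ.* e ∣? p ℕ.* m ⟩ * g (p ℕ.* e)) ≡⟨ cong (λ n → ∑ n (λ e → ⟨ p ℕ.* e ∣? p ℕ.* m ⟩ * g (p ℕ.* e))) (m*n-div m (prime≥1 pr)) ⟩
     ∑ m (λ e → ⟨ p ℕ.* e ∣? p ℕ.* m ⟩ * g (p ℕ.* e))
       ≡⟨ ∑-cong m (λ e _ _ → cong (_* g (p ℕ.* e)) (⟨⟩-cong (p ℕ.* e ∣? p ℕ.* m) (e ∣? m) (*-cancelˡ-∣ p) (*-monoʳ-∣ p))) ⟩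
     divisorSum (λ e → g (p ℕ.* e)) m ∎

-- The functions of Möbius and von Mangoldt.

module MoebiusMangoldt where

 open import Data.List using (List; _++_)
 open import Data.List.Membership.Propositional using (_∈_)
 open import Data.List.Relation.Binary.Permutation.Propositional using (_↭_; ↭-sym)
 import Data.List.Relation.Binary.Permutation.Propositional as ↭
 open import Data.List.Relation.Binary.Permutation.Propositional.Properties using (∈-resp-↭)
 open import Data.List.Relation.Unary.All as All using (All; []; _∷_)
 import Data.List.Relation.Unary.All.Properties as All
 open import Data.List.Relation.Unary.Any using (here; there)
 open import Data.List.Membership.DecPropositional ℕ._≟_ using (_∈?_)
 open import Data.Nat.ListAction using (product)
 open import Data.Nat.ListAction.Properties using (product-++; ∈⇒∣product)
 open import Data.Nat.Divisibility using (_∣_; _∣?_; divides; ∣-trans; m∣m*n; ∣-refl)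
 open import Data.Nat.Induction using (<-rec)
 open import Data.Nat.Primality using (Prime; prime⇒nonTrivial; ¬prime[1]; productOfPrimes≥1)
 open import Data.Nat.Primality.Factorisation
 open import Data.Product using (∃₂)
 open import Relation.Binary.PropositionalEquality
 open RationalArithmetic
 open DivisorSums

 open ≡-Reasoning
 open PrimeFactorisation using (isFactorisation; factorsPrime)

 primeFactors : ℕ → List ℕ
 primeFactors zero = []
 primeFactors n@(suc _) = factors (factorise n)

 product-primeFactors : ∀ {n} → 1 ℕ.≤ n → n ≡ product (primeFactors n)
 product-primeFactors {n@(suc _)} _ = isFactorisation (factorise n)

 primeFactors-prime : ∀ n → All Prime (primeFactors n)
 primeFactors-prime zero = []
 primeFactors-prime n@(suc _) = factorsPrime (factorise n)

 primeFactors-unique : ∀ {n} l → 1 ℕ.≤ n → n ≡ product l → All Prime l → primeFactors n ↭ l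
 primeFactors-unique {n@(suc _)} l _ eq ps =
   factorisationUnique (factorise n) (record { factors = l ; isFactorisation = eq ; factorsPrime = ps })

 primeFactors-* : ∀ {a b} → 1 ℕ.≤ a → 1 ℕ.≤ b → primeFactors (a ℕ.* b) ↭ primeFactors a ++ primeFactors b
 primeFactors-* {a} {b} a≥1 b≥1 = primeFactors-unique _ (ℕ.*-mono-≤ a≥1 b≥1)
   (trans (cong₂ ℕ._*_ (product-primeFactors a≥1) (product-primeFactors b≥1)) (sym (product-++ (primeFactors a) (primeFactors b))))
   (All.++⁺ (primeFactors-prime a) (primeFactors-prime b))

 primeFactors-∷ : ∀ {p m} → Prime p → 1 ℕ.≤ m → primeFactors (p ℕ.* m) ↭ p ∷ primeFactors m
 primeFactors-∷ {p} {m} pr m≥1 = primeFactors-unique _ (ℕ.*-mono-≤ (prime≥1 pr) m≥1)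
   (cong (p ℕ.*_) (product-primeFactors m≥1)) (pr ∷ primeFactors-prime m)

 ∈-primeFactors : ∀ {p m} → Prime p → 1 ℕ.≤ m → p ∣ m → p ∈ primeFactors m
 ∈-primeFactors {p} {m} pr m≥1 p∣m =
   factorisationHasAllPrimeFactors pr (subst (p ∣_) (product-primeFactors m≥1) p∣m) (primeFactors-prime m)

 ∈-primeFactors⁻ : ∀ {p m} → 1 ℕ.≤ m → p ∈ primeFactors m → p ∣ m
 ∈-primeFactors⁻ {p} m≥1 p∈ = subst (p ∣_) (sym (product-primeFactors m≥1)) (∈⇒∣product p∈)

 -- Primes are peeled off one at a time, so prime powers get no separate treatment.
 prime-induction : ∀ {a} (P : ℕ → Set a) → P 1 → (∀ {p m} → Prime p → 1 ℕ.≤ m → P m → P (p ℕ.* m)) → ∀ {n} → 1 ℕ.≤ n → P n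
 prime-induction P base step {n} n≥1 = subst P (sym (product-primeFactors n≥1)) (go (primeFactors n) (primeFactors-prime n))
   where
   go : ∀ l → All Prime l → P (product l)
   go [] [] = base
   go (p ∷ l) (pr ∷ ps) = step pr (productOfPrimes≥1 ps) (go l ps)

 -- The Möbius function of the product of a list of primes. Factorisations are unique only up to
 -- order, hence the invariance `möbius-↭`.
 möbius : List ℕ → ℚ
 möbius [] = 1ℚ
 möbius (p ∷ l) with p ∈? l
 ... | yes _ = 0ℚ
 ... | no _ = - möbius l

 möbius-∈ : ∀ {p l} → p ∈ l → möbius (p ∷ l) ≡ 0ℚ
 möbius-∈ {p} {l} p∈l with p ∈? l
 ... | yes _ = refl
 ... | no p∉l = contradiction p∈l p∉l

 möbius-∉ : ∀ {p l} → ¬ p ∈ l → möbius (p ∷ l) ≡ - möbius l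
 möbius-∉ {p} {l} p∉l with p ∈? l
 ... | yes p∈l = contradiction p∈l p∉l
 ... | no _ = refl

 -0≡0 : - 0ℚ ≡ 0ℚ
 -0≡0 = ring-eq ([]) (⊝ nat 0) (nat 0) refl

 möbius-swap : ∀ p q l → möbius (p ∷ q ∷ l) ≡ möbius (q ∷ p ∷ l)
 möbius-swap p q l = go (p ℕ.≟ q) (p ∈? l) (q ∈? l)
   where
   go : Dec (p ≡ q) → Dec (p ∈ l) → Dec (q ∈ l) → möbius (p ∷ q ∷ l) ≡ möbius (q ∷ p ∷ l)
   go (yes refl) _ _ = refl
   go (no p≢q) (yes p∈l) (yes q∈l) = trans (möbius-∈ {l = q ∷ l} (there p∈l)) (sym (möbius-∈ {l = p ∷ l} (there q∈l)))
   go (no p≢q) (yes p∈l) (no q∉l) = trans (möbius-∈ {l = q ∷ l} (there p∈l))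
     (sym (trans (möbius-∉ {l = p ∷ l} λ { (here q≡p) → p≢q (sym q≡p) ; (there q∈l) → q∉l q∈l })
       (trans (cong -_ (möbius-∈ p∈l)) -0≡0)))
   go (no p≢q) (no p∉l) (yes q∈l) = trans (möbius-∉ {l = q ∷ l} λ { (here p≡q) → p≢q p≡q ; (there p∈l) → p∉l p∈l })
     (trans (trans (cong -_ (möbius-∈ q∈l)) -0≡0) (sym (möbius-∈ {l = p ∷ l} (there q∈l))))
   go (no p≢q) (no p∉l) (no q∉l) = trans (möbius-∉ {l = q ∷ l} λ { (here p≡q) → p≢q p≡q ; (there p∈l) → p∉l p∈l })
     (trans (cong -_ (trans (möbius-∉ q∉l) (sym (möbius-∉ p∉l))))
       (sym (möbius-∉ {l = p ∷ l} λ { (here q≡p) → p≢q (sym q≡p) ; (there q∈l) → q∉l q∈l })))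

 möbius-∷ : ∀ p {l l′} → l ↭ l′ → möbius l ≡ möbius l′ → möbius (p ∷ l) ≡ möbius (p ∷ l′)
 möbius-∷ p {l} {l′} r eq with p ∈? l
 ... | yes p∈l = sym (möbius-∈ (∈-resp-↭ r p∈l))
 ... | no p∉l = trans (cong -_ eq) (sym (möbius-∉ (λ p∈l′ → p∉l (∈-resp-↭ (↭-sym r) p∈l′))))

 möbius-↭ : ∀ {l l′} → l ↭ l′ → möbius l ≡ möbius l′
 möbius-↭ ↭.refl = refl
 möbius-↭ (↭.prep p r) = möbius-∷ p r (möbius-↭ r)
 möbius-↭ (↭.swap {xs} {ys} p q r) = trans (möbius-swap p q xs) (möbius-∷ q (↭.prep p r) (möbius-∷ p r (möbius-↭ r)))
 möbius-↭ (↭.trans r s) = trans (möbius-↭ r) (möbius-↭ s)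

 μ : ℕ → ℚ
 μ n = möbius (primeFactors n)

 μ-1 : μ 1 ≡ 1ℚ
 μ-1 = möbius-↭ (primeFactors-unique [] ℕ.≤-refl refl [])

 μ-prime : ∀ {p m} → Prime p → 1 ℕ.≤ m → μ (p ℕ.* m) ≡ - (p prime-to μ) m
 μ-prime {p} {m} pr m≥1 with p ∣? m
 ... | yes p∣m = trans (möbius-↭ (primeFactors-∷ pr m≥1)) (trans (möbius-∈ (∈-primeFactors pr m≥1 p∣m)) (sym -0≡0))
 ... | no p∤m = trans (möbius-↭ (primeFactors-∷ pr m≥1)) (möbius-∉ (λ p∈ → p∤m (∈-primeFactors⁻ m≥1 p∈)))

 möbius-bound : ∀ l → - 1ℚ ≤ möbius l × möbius l ≤ 1ℚ
 möbius-bound [] = (lin ([]) 0 (⊝ one) one (∅) refl) , ≤-refl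
 möbius-bound (p ∷ l) with p ∈? l | möbius-bound l
 ... | yes _ | _ = (lin ([]) 0 (⊝ one) (nat 0) (∅) refl) , (lin ([]) 0 (nat 0) one (∅) refl)
 ... | no _ | (h , k) = (lin ((möbius l) ∷ []) 0 (⊝ one) (⊝ x0) (le x0 one k) refl) , (lin ((möbius l) ∷ []) 0 (⊝ x0) one (le (⊝ one) x0 h) refl)

 divisorSum-1 : ∀ g → divisorSum g 1 ≡ g 1
 divisorSum-1 g = trans (ℚₚ.+-identityˡ (⟨ 1 ∣? 1 ⟩ * g 1)) (trans (cong (_* g 1) (⟨⟩-yes (1 ∣? 1) ∣-refl)) (ℚₚ.*-identityˡ (g 1)))

 prime*≢1 : ∀ {p} m → Prime p → ¬ p ℕ.* m ≡ 1
 prime*≢1 {p} m pr eq = ¬prime[1] (subst Prime (ℕ.m*n≡1⇒m≡1 p m eq) pr)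

 -- At `p * m` the two sums of `divisorSum-prime` are opposite to each other by `μ-prime`.
 divisorSum-μ : ∀ {n} → 1 ℕ.≤ n → divisorSum μ n ≡ ⟨ n ℕ.≟ 1 ⟩
 divisorSum-μ = prime-induction (λ n → divisorSum μ n ≡ ⟨ n ℕ.≟ 1 ⟩) (trans (divisorSum-1 μ) μ-1) step
   where
   step : ∀ {p m} → Prime p → 1 ℕ.≤ m → divisorSum μ m ≡ ⟨ m ℕ.≟ 1 ⟩ → divisorSum μ (p ℕ.* m) ≡ ⟨ p ℕ.* m ℕ.≟ 1 ⟩
   step {p} {m} pr m≥1 _ = begin
     divisorSum μ (p ℕ.* m) ≡⟨ divisorSum-prime m μ pr m≥1 ⟩
     divisorSum (p prime-to μ) m + divisorSum (λ e → μ (p ℕ.* e)) m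
       ≡⟨ cong (divisorSum (p prime-to μ) m +_) (trans
            (divisorSum-cong m (λ e e≥1 _ → trans (μ-prime pr e≥1) (ring-eq (((p prime-to μ) e) ∷ []) (⊝ x0) (⊝ nat 1 :* x0) refl)))
            (divisorSum-* (- ι 1) (p prime-to μ) m)) ⟩
     divisorSum (p prime-to μ) m + - ι 1 * divisorSum (p prime-to μ) m
       ≡⟨ ring-eq ((divisorSum (p prime-to μ) m) ∷ []) (x0 :+ ⊝ nat 1 :* x0) (nat 0) refl ⟩
     0ℚ ≡⟨ ⟨⟩-no (p ℕ.* m ℕ.≟ 1) (prime*≢1 m pr) ⟨
     ⟨ p ℕ.* m ℕ.≟ 1 ⟩ ∎

 prime-to-∣ : ∀ {p d} g → p ∣ d → (p prime-to g) d ≡ 0ℚ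
 prime-to-∣ {p} {d} g h with p ∣? d
 ... | yes _ = refl
 ... | no ¬h = contradiction h ¬h

 prime-to-∤ : ∀ {p d} g → ¬ p ∣ d → (p prime-to g) d ≡ g d
 prime-to-∤ {p} {d} g ¬h with p ∣? d
 ... | yes h = contradiction h ¬h
 ... | no _ = refl

 -- Σ μ(e) over the divisors e of m prime to p: this is 1 if m is a power of p and 0 otherwise.
 coprimeSum : ℕ → ℕ → ℚ
 coprimeSum p m = divisorSum (p prime-to μ) m

 -- The additional divisors `p * e` are not prime to `p` and contribute nothing.
 coprimeSum-step : ∀ {p m} → Prime p → 1 ℕ.≤ m → coprimeSum p (p ℕ.* m) ≡ coprimeSum p m
 coprimeSum-step {p} {m} pr m≥1 = begin
   coprimeSum p (p ℕ.* m) ≡⟨ divisorSum-prime m (p prime-to μ) pr m≥1 ⟩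
   divisorSum (p prime-to (p prime-to μ)) m + divisorSum (λ e → (p prime-to μ) (p ℕ.* e)) m
     ≡⟨ cong₂ _+_ (divisorSum-cong m (λ d _ _ → idem d)) (trans
          (divisorSum-cong m (λ e _ _ → trans (prime-to-∣ {p} {p ℕ.* e} μ (m∣m*n e)) (sym (ℚₚ.zeroˡ 1ℚ)))) (trans (divisorSum-* 0ℚ (λ _ → 1ℚ) m) (ℚₚ.zeroˡ _))) ⟩
   coprimeSum p m + 0ℚ ≡⟨ ℚₚ.+-identityʳ _ ⟩
   coprimeSum p m ∎
   where
   idem : ∀ d → (p prime-to (p prime-to μ)) d ≡ (p prime-to μ) d
   idem d with p ∣? d in eq
   ... | yes _ = refl
   ... | no p∤d = prime-to-∤ μ p∤d

 coprimeSum-∤ : ∀ {p m} → 1 ℕ.≤ m → ¬ p ∣ m → coprimeSum p m ≡ ⟨ m ℕ.≟ 1 ⟩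
 coprimeSum-∤ {p} {m} m≥1 p∤m = trans
   (divisorSum-cong m (λ d _ d∣m → prime-to-∤ μ (λ p∣d → p∤m (∣-trans p∣d d∣m)))) (divisorSum-μ m≥1)

 coprimeSum-power : ∀ {p} → Prime p → ∀ m → 1 ℕ.≤ m →
   coprimeSum p m ≡ 0ℚ ⊎ (coprimeSum p m ≡ 1ℚ × ∃ λ k → m ≡ p ℕ.^ k)
 coprimeSum-power {p} pr = <-rec _ go
   where
   go : ∀ m → (∀ {m′} → m′ ℕ.< m → 1 ℕ.≤ m′ → coprimeSum p m′ ≡ 0ℚ ⊎ (coprimeSum p m′ ≡ 1ℚ × ∃ λ k → m′ ≡ p ℕ.^ k)) →
     1 ℕ.≤ m → coprimeSum p m ≡ 0ℚ ⊎ (coprimeSum p m ≡ 1ℚ × ∃ λ k → m ≡ p ℕ.^ k)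
   go m rec m≥1 with p ∣? m
   ... | no p∤m with m ℕ.≟ 1
   ...   | yes refl = inj₂ (trans (coprimeSum-∤ m≥1 p∤m) (⟨⟩-yes (1 ℕ.≟ 1) refl) , 0 , refl)
   ...   | no m≢1 = inj₁ (trans (coprimeSum-∤ m≥1 p∤m) (⟨⟩-no (m ℕ.≟ 1) m≢1))
   go m rec m≥1 | yes (divides zero refl) = contradiction m≥1 (λ ())
   go m rec m≥1 | yes (divides q@(suc q′) eq) with rec q<m (s≤s z≤n)
     where
     q<m : q ℕ.< m
     q<m = subst (q ℕ.<_) (sym eq) (ℕ.m<m*n q p (ℕ.nonTrivial⇒n>1 p {{prime⇒nonTrivial pr}}))
   ... | inj₁ h = inj₁ (trans (cong (coprimeSum p) (trans eq (ℕ.*-comm q p))) (trans (coprimeSum-step pr (s≤s z≤n)) h))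
   ... | inj₂ (h , k , eq′) = inj₂ (trans (cong (coprimeSum p) (trans eq (ℕ.*-comm q p))) (trans (coprimeSum-step pr (s≤s z≤n)) h) ,
     suc k , trans eq (trans (ℕ.*-comm q p) (cong (p ℕ.*_) eq′)))

 -- The identities around the von Mangoldt function are formal consequences of complete additivity.
 -- This is what allows a rational approximation in the place of the logarithm.
 module Mangoldt (L : ℕ → ℚ) (L-* : ∀ {a b} → 1 ℕ.≤ a → 1 ℕ.≤ b → L (a ℕ.* b) ≡ L a + L b) where

   L-1 : L 1 ≡ 0ℚ
   L-1 = begin
     L 1 ≡⟨ ring-eq ((L 1) ∷ []) x0 (x0 :+ x0 :- x0) refl ⟩
     L 1 + L 1 - L 1 ≡⟨ cong (_- L 1) (sym (L-* ℕ.≤-refl ℕ.≤-refl)) ⟩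
     L 1 - L 1 ≡⟨ ℚₚ.-‿inverseʳ (L 1) ⟩
     0ℚ ∎

   Λ : ℕ → ℚ
   Λ n = - divisorSum (λ d → μ d * L d) n

   Λ-1 : Λ 1 ≡ 0ℚ
   Λ-1 = trans (cong -_ (trans (divisorSum-1 (λ d → μ d * L d)) (trans (cong (μ 1 *_) L-1) (ℚₚ.zeroʳ (μ 1))))) -0≡0

   -- When `e` is paired with `p * e`, the terms `μ(e) L(e)` cancel and additivity leaves
   -- `- L(p) μ(e)` for `e` prime to `p`.
   Λ-prime : ∀ {p m} → Prime p → 1 ℕ.≤ m → Λ (p ℕ.* m) ≡ L p * coprimeSum p m
   Λ-prime {p} {m} pr m≥1 = begin
     - divisorSum g (p ℕ.* m) ≡⟨ cong -_ (divisorSum-prime m g pr m≥1) ⟩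
     - (divisorSum (p prime-to g) m + divisorSum (λ e → g (p ℕ.* e)) m) ≡⟨ cong -_ (divisorSum-+ (p prime-to g) (λ e → g (p ℕ.* e)) m) ⟨
     - divisorSum (λ e → (p prime-to g) e + g (p ℕ.* e)) m ≡⟨ cong -_ (divisorSum-cong m (λ e e≥1 _ → pointwise e e≥1)) ⟩
     - divisorSum (λ e → - L p * (p prime-to μ) e) m ≡⟨ cong -_ (divisorSum-* (- L p) (p prime-to μ) m) ⟩
     - (- L p * coprimeSum p m) ≡⟨ ring-eq ((L p) ∷ (coprimeSum p m) ∷ []) (⊝ (⊝ x0 :* x1)) (x0 :* x1) refl ⟩
     L p * coprimeSum p m ∎
     where
     g : ℕ → ℚ
     g d = μ d * L d
     prime-to-g : ∀ e → (p prime-to g) e ≡ (p prime-to μ) e * L e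
     prime-to-g e with p ∣? e
     ... | yes _ = sym (ℚₚ.zeroˡ (L e))
     ... | no _ = refl
     pointwise : ∀ e → 1 ℕ.≤ e → (p prime-to g) e + g (p ℕ.* e) ≡ - L p * (p prime-to μ) e
     pointwise e e≥1 = trans (cong₂ _+_ (prime-to-g e) (cong₂ _*_ (μ-prime pr e≥1) (L-* (prime≥1 pr) e≥1)))
       (ring-eq (((p prime-to μ) e) ∷ (L e) ∷ (L p) ∷ []) (x0 :* x1 :+ ⊝ x0 :* (x2 :+ x1)) (⊝ x2 :* x0) refl)

   Λ-cases : ∀ {n} → 1 ℕ.≤ n → Λ n ≡ 0ℚ ⊎ (∃₂ λ p k → Prime p × n ≡ p ℕ.^ suc k × Λ n ≡ L p)
   Λ-cases = prime-induction Cases (inj₁ Λ-1) step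
     where
     Cases : ℕ → Set
     Cases n = Λ n ≡ 0ℚ ⊎ (∃₂ λ p k → Prime p × n ≡ p ℕ.^ suc k × Λ n ≡ L p)
     step : ∀ {p m} → Prime p → 1 ℕ.≤ m → Cases m → Cases (p ℕ.* m)
     step {p} {m} pr m≥1 _ with coprimeSum-power pr m m≥1
     ... | inj₁ h = inj₁ (trans (Λ-prime pr m≥1) (trans (cong (L p *_) h) (ℚₚ.zeroʳ (L p))))
     ... | inj₂ (h , k , eq) = inj₂ (p , k , pr , cong (p ℕ.*_) eq , trans (Λ-prime pr m≥1) (trans (cong (L p *_) h) (ℚₚ.*-identityʳ (L p))))

   -- In passing from `m` to `p * m` the paired terms reproduce `Λ e`, and `L p` is added exactly
   -- once, at `e = 1`.
   divisorSum-Λ : ∀ {n} → 1 ℕ.≤ n → divisorSum Λ n ≡ L n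
   divisorSum-Λ = prime-induction (λ n → divisorSum Λ n ≡ L n) (trans (divisorSum-1 Λ) (trans Λ-1 (sym L-1))) step
     where
     step : ∀ {p m} → Prime p → 1 ℕ.≤ m → divisorSum Λ m ≡ L m → divisorSum Λ (p ℕ.* m) ≡ L (p ℕ.* m)
     step {p} {m} pr m≥1 IH = begin
       divisorSum Λ (p ℕ.* m) ≡⟨ divisorSum-prime m Λ pr m≥1 ⟩
       divisorSum (p prime-to Λ) m + divisorSum (λ e → Λ (p ℕ.* e)) m ≡⟨ divisorSum-+ (p prime-to Λ) (λ e → Λ (p ℕ.* e)) m ⟨
       divisorSum (λ e → (p prime-to Λ) e + Λ (p ℕ.* e)) m ≡⟨ divisorSum-cong m (λ e e≥1 _ → pointwise e e≥1) ⟩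
       divisorSum (λ e → Λ e + L p * ⟨ e ℕ.≟ 1 ⟩) m ≡⟨ divisorSum-+ Λ (λ e → L p * ⟨ e ℕ.≟ 1 ⟩) m ⟩
       divisorSum Λ m + divisorSum (λ e → L p * ⟨ e ℕ.≟ 1 ⟩) m ≡⟨ cong₂ _+_ IH (trans (divisorSum-* (L p) (λ e → ⟨ e ℕ.≟ 1 ⟩) m) (cong (L p *_) unit)) ⟩
       L m + L p * 1ℚ ≡⟨ ring-eq ((L m) ∷ (L p) ∷ []) (x0 :+ x1 :* one) (x1 :+ x0) refl ⟩
       L p + L m ≡⟨ L-* (prime≥1 pr) m≥1 ⟨
       L (p ℕ.* m) ∎
       where
       unit : divisorSum (λ e → ⟨ e ℕ.≟ 1 ⟩) m ≡ 1ℚ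
       unit = trans (∑-cong m (λ e _ _ → ℚₚ.*-comm ⟨ e ∣? m ⟩ ⟨ e ℕ.≟ 1 ⟩))
         (trans (∑-point m (λ e → ⟨ e ∣? m ⟩) m≥1) (⟨⟩-yes (1 ∣? m) (divides m (sym (ℕ.*-identityʳ m)))))
       pointwise : ∀ e → 1 ℕ.≤ e → (p prime-to Λ) e + Λ (p ℕ.* e) ≡ Λ e + L p * ⟨ e ℕ.≟ 1 ⟩
       pointwise e e≥1 with p ∣? e
       ... | no p∤e = cong (Λ e +_) (trans (Λ-prime pr e≥1) (cong (L p *_) (coprimeSum-∤ e≥1 p∤e)))
       ... | yes (divides zero refl) = contradiction e≥1 (λ ())
       ... | yes (divides q@(suc _) refl) = begin
         0ℚ + Λ (p ℕ.* (q ℕ.* p)) ≡⟨ cong (0ℚ +_) (trans (Λ-prime pr e≥1) (cong (L p *_)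
           (trans (cong (coprimeSum p) (ℕ.*-comm q p)) (coprimeSum-step pr (s≤s z≤n))))) ⟩
         0ℚ + L p * coprimeSum p q ≡⟨ cong (0ℚ +_) (Λ-prime pr (s≤s z≤n)) ⟨
         0ℚ + Λ (p ℕ.* q) ≡⟨ ring-eq ((Λ (p ℕ.* q)) ∷ (L p) ∷ []) (nat 0 :+ x0) (x0 :+ x1 :* nat 0) refl ⟩
         Λ (p ℕ.* q) + L p * 0ℚ ≡⟨ cong₂ (λ a b → Λ a + L p * b) (ℕ.*-comm p q)
           (sym (⟨⟩-no (q ℕ.* p ℕ.≟ 1) (λ eq → prime*≢1 q pr (trans (ℕ.*-comm p q) eq)))) ⟩
         Λ (q ℕ.* p) + L p * ⟨ q ℕ.* p ℕ.≟ 1 ⟩ ∎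

   -- Selberg's weight in convolution with 1: the part `c μ` isolates `k = 1` and the part `- μ L`
   -- yields `Λ`.
   divisorSum-μ-log : ∀ c {k} → 1 ℕ.≤ k → divisorSum (λ n → μ n * (c - L n)) k ≡ ⟨ k ℕ.≟ 1 ⟩ * c + Λ k
   divisorSum-μ-log c {k} k≥1 = begin
     divisorSum (λ n → μ n * (c - L n)) k
       ≡⟨ divisorSum-cong k (λ n _ _ → (ring-eq ((μ n) ∷ c ∷ (L n) ∷ []) (x0 :* (x1 :- x2)) (x1 :* x0 :+ ⊝ nat 1 :* (x0 :* x2)) refl)) ⟩
     divisorSum (λ n → c * μ n + - ι 1 * (μ n * L n)) k ≡⟨ divisorSum-+ (λ n → c * μ n) (λ n → - ι 1 * (μ n * L n)) k ⟩
     divisorSum (λ n → c * μ n) k + divisorSum (λ n → - ι 1 * (μ n * L n)) k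
       ≡⟨ cong₂ _+_ (trans (divisorSum-* c μ k) (cong (c *_) (divisorSum-μ k≥1))) (divisorSum-* (- ι 1) (λ n → μ n * L n) k) ⟩
     c * ⟨ k ℕ.≟ 1 ⟩ + - ι 1 * divisorSum (λ n → μ n * L n) k
       ≡⟨ ring-eq (c ∷ (⟨ k ℕ.≟ 1 ⟩) ∷ (divisorSum (λ n → μ n * L n) k) ∷ []) (x0 :* x1 :+ ⊝ nat 1 :* x2) (x1 :* x0 :- x2) refl ⟩
     ⟨ k ℕ.≟ 1 ⟩ * c + Λ k ∎

-- A completely additive rational approximation of the logarithm.

module IntegerLogarithm where

 open import Data.List using (List; length)
 open import Data.List.Relation.Binary.Permutation.Propositional using (_↭_)
 import Data.List.Relation.Binary.Permutation.Propositional as ↭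
 open import Data.List.Relation.Unary.All as All using (All; []; _∷_)
 open import Data.Nat.ListAction using (product; sum)
 open import Data.Nat.ListAction.Properties using (sum-↭; sum-++)
 import Data.List.Relation.Binary.Permutation.Propositional.Properties as ↭
 open import Data.List using (map)
 import Data.List.Properties as List
 open import Data.Nat.Primality using (Prime; productOfPrimes≥1; prime⇒nonTrivial)
 open import Relation.Binary.PropositionalEquality
 open RationalArithmetic
 open DivisorSums
 open MoebiusMangoldt

 -- The increments of the true logarithm lie strictly between `1/(n+1)` and `1/n`. The weaker lower
 -- bound `1/(n+2)` and the finite range `n < X` leave room for rational values.
 record Logarithm (X : ℕ) : Set where
   field
     L : ℕ → ℚ
     L-* : ∀ {a b} → 1 ℕ.≤ a → 1 ℕ.≤ b → L (a ℕ.* b) ≡ L a + L b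
     ΔL≤ : ∀ {n} → 1 ℕ.≤ n → n ℕ.< X → L (suc n) - L n ≤ rec n
     ΔL≥ : ∀ {n} → 1 ℕ.≤ n → n ℕ.< X → rec (2 ℕ.+ n) ≤ L (suc n) - L n

 lastTrue : ∀ {P : ℕ → Set} → (∀ n → Dec (P n)) → P 0 → ∀ N → ¬ P N → ∃ λ n → P n × ¬ P (suc n)
 lastTrue P? p0 zero ¬pN = contradiction p0 ¬pN
 lastTrue P? p0 (suc N) ¬pN with P? N
 ... | yes pN = N , pN , ¬pN
 ... | no ¬pN′ = lastTrue P? p0 N ¬pN′

 -- `(1 + 1/K)^r ≥ 1 + r/K`, with denominators cleared.
 bernoulli₁ : ∀ K r → K ℕ.^ r ℕ.* (K ℕ.+ r) ℕ.≤ suc K ℕ.^ r ℕ.* K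
 bernoulli₁ K zero = linᴺ (K ∷ []) 0 (nat 1 :* (x0 :+ nat 0)) (nat 1 :* x0) (∅ᴺ) refl
 bernoulli₁ K (suc r) = ℕ.≤-trans
   (linᴺ ((K ℕ.^ r) ∷ r ∷ K ∷ []) 0 (x2 :* x0 :* (x2 :+ (nat 1 :+ x1))) ((nat 1 :+ x2) :* (x0 :* (x2 :+ x1))) (nnᴺ (x0 :* x1) z≤n) refl)
   (ℕ.≤-trans (ℕ.*-monoʳ-≤ (suc K) (bernoulli₁ K r))
     (ℕ.≤-reflexive (sym (ℕ.*-assoc (suc K) (suc K ℕ.^ r) K))))

 -- `(1 - 1/(K+1))^r ≥ 1 - r/(K+1)`, with denominators cleared.
 bernoulli₂ : ∀ K r → suc K ℕ.^ r ℕ.* suc K ℕ.≤ K ℕ.^ r ℕ.* suc K ℕ.+ r ℕ.* suc K ℕ.^ r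
 bernoulli₂ K zero = linᴺ (K ∷ []) 0 (nat 1 :* (nat 1 :+ x0)) (nat 1 :* (nat 1 :+ x0) :+ nat 0 :* nat 1) (∅ᴺ) refl
 bernoulli₂ K (suc r) = linᴺ ((suc K ℕ.^ r) ∷ K ∷ (K ℕ.^ r) ∷ r ∷ []) 0 ((nat 1 :+ x1) :* x0 :* (nat 1 :+ x1)) (x1 :* x2 :* (nat 1 :+ x1) :+ (nat 1 :+ x3) :* ((nat 1 :+ x1) :* x0)) ((leᴺ (x0 :* (nat 1 :+ x1)) (x2 :* (nat 1 :+ x1) :+ x3 :* x0) (bernoulli₂ K r)) ⊛ᴺ (nnᴺ x1 (z≤n {K})) ⊞ᴺ (nnᴺ x3 (z≤n {r})) ⊛ᴺ (nnᴺ x0 (z≤n {suc K ℕ.^ r}))) refl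

 length≤product : ∀ {l} → All Prime l → length l ℕ.≤ product l
 length≤product [] = z≤n
 length≤product {p ∷ l} (pr ∷ ps) = linᴺ ((length l) ∷ (product l) ∷ p ∷ []) 0 (nat 1 :+ x0) (x2 :* x1) (leᴺ x0 x1 (length≤product ps) ⊞ᴺ leᴺ (nat 1) x1 (productOfPrimes≥1 ps) ⊞ᴺ leᴺ (nat 2) x2 (ℕ.nonTrivial⇒n>1 p {{prime⇒nonTrivial pr}}) ⊞ᴺ (leᴺ (nat 2) x2 (ℕ.nonTrivial⇒n>1 p {{prime⇒nonTrivial pr}})) ⊛ᴺ (leᴺ (nat 1) x1 (productOfPrimes≥1 ps))) refl

 module _ (X : ℕ) where

   private
     -- Logarithms to base `1 + 1/K` are rounded down at every prime, so `N n` falls short by at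
     -- most `Ω n ≤ X`. The terms `X²` absorb this error multiplied by `n`; the term `2X³` makes one
     -- increment of `N` at least `2X²`, which pays for `n + 2` instead of `n + 1` in `ΔL≥`.
     K : ℕ
     K = suc (X ℕ.* X ℕ.+ 2 ℕ.* (X ℕ.* X ℕ.* X))

     K′ : ℕ
     K′ = K ℕ.+ X ℕ.* X

     Fits : ℕ → ℕ → Set
     Fits p l = suc K ℕ.^ l ℕ.≤ p ℕ.* K ℕ.^ l

     1≤^ : ∀ r → 1 ℕ.≤ K ℕ.^ r
     1≤^ r = ℕ.m^n>0 K r

     ¬fits : ∀ p → ¬ Fits p (p ℕ.* K)
     ¬fits p h = too-large (ℕ.*-cancelˡ-≤ (K ℕ.^ (p ℕ.* K)) {{ℕ.>-nonZero (1≤^ (p ℕ.* K))}}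
       (ℕ.≤-trans (bernoulli₁ K (p ℕ.* K)) (ℕ.≤-trans (ℕ.*-monoˡ-≤ K h) (ℕ.≤-reflexive
         (ring-eqᴺ (p ∷ (K ℕ.^ (p ℕ.* K)) ∷ K ∷ []) (x0 :* x1 :* x2) (x1 :* (x0 :* x2)) refl)))))
       where
       too-large : ¬ K ℕ.+ p ℕ.* K ℕ.≤ p ℕ.* K
       too-large q = lin-⊥ᴺ (K ∷ p ∷ []) (leᴺ (x0 :+ x1 :* x0) (x1 :* x0) q ⊞ᴺ leᴺ (nat 1) x0 (s≤s z≤n)) refl

     -- The integer part of the logarithm of p to base 1 + 1/K.
     weights : ∀ p → 1 ℕ.≤ p → ∃ λ l → Fits p l × ¬ Fits p (suc l)
     weights p p≥1 = lastTrue (λ l → suc K ℕ.^ l ℕ.≤? p ℕ.* K ℕ.^ l) (ℕ.≤-trans p≥1 (ℕ.≤-reflexive (sym (ℕ.*-identityʳ p)))) (p ℕ.* K) (¬fits p)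

     weight : ℕ → ℕ
     weight zero = 0
     weight p@(suc _) = proj₁ (weights p (s≤s z≤n))

     total : List ℕ → ℕ
     total l = sum (map weight l)

     weight-lower : ∀ {p} → Prime p → suc K ℕ.^ weight p ℕ.≤ p ℕ.* K ℕ.^ weight p
     weight-lower {zero} pr = contradiction (prime≥1 pr) (λ ())
     weight-lower {p@(suc _)} pr = proj₁ (proj₂ (weights p (s≤s z≤n)))

     weight-upper : ∀ {p} → Prime p → p ℕ.* K ℕ.^ suc (weight p) ℕ.≤ suc K ℕ.^ suc (weight p)
     weight-upper {zero} pr = z≤n
     weight-upper {p@(suc _)} pr = ℕ.<⇒≤ (ℕ.≰⇒> (proj₂ (proj₂ (weights p (s≤s z≤n)))))

     total-lower : ∀ {l} → All Prime l → suc K ℕ.^ total l ℕ.≤ product l ℕ.* K ℕ.^ total l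
     total-lower [] = s≤s z≤n
     total-lower {p ∷ l} (pr ∷ ps) = begin
       suc K ℕ.^ (weight p ℕ.+ total l) ≡⟨ ℕ.^-distribˡ-+-* (suc K) (weight p) (total l) ⟩
       suc K ℕ.^ weight p ℕ.* suc K ℕ.^ total l ≤⟨ ℕ.*-mono-≤ (weight-lower pr) (total-lower ps) ⟩
       (p ℕ.* K ℕ.^ weight p) ℕ.* (product l ℕ.* K ℕ.^ total l) ≡⟨ ℕ.[m*n]*[o*p]≡[m*o]*[n*p] p _ (product l) _ ⟩
       (p ℕ.* product l) ℕ.* (K ℕ.^ weight p ℕ.* K ℕ.^ total l) ≡⟨ cong (p ℕ.* product l ℕ.*_) (ℕ.^-distribˡ-+-* K (weight p) (total l)) ⟨
       (p ℕ.* product l) ℕ.* K ℕ.^ (weight p ℕ.+ total l) ∎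
       where open ℕ.≤-Reasoning

     total-upper : ∀ {l} → All Prime l → product l ℕ.* K ℕ.^ (total l ℕ.+ length l) ℕ.≤ suc K ℕ.^ (total l ℕ.+ length l)
     total-upper [] = s≤s z≤n
     total-upper {p ∷ l} (pr ∷ ps) = begin
       (p ℕ.* product l) ℕ.* K ℕ.^ (weight p ℕ.+ total l ℕ.+ suc (length l))
         ≡⟨ cong (λ e → (p ℕ.* product l) ℕ.* K ℕ.^ e) e≡ ⟩
       (p ℕ.* product l) ℕ.* K ℕ.^ (suc (weight p) ℕ.+ (total l ℕ.+ length l))
         ≡⟨ cong (p ℕ.* product l ℕ.*_) (ℕ.^-distribˡ-+-* K (suc (weight p)) (total l ℕ.+ length l)) ⟩
       (p ℕ.* product l) ℕ.* (K ℕ.^ suc (weight p) ℕ.* K ℕ.^ (total l ℕ.+ length l)) ≡⟨ ℕ.[m*n]*[o*p]≡[m*o]*[n*p] p (product l) _ _ ⟩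
       (p ℕ.* K ℕ.^ suc (weight p)) ℕ.* (product l ℕ.* K ℕ.^ (total l ℕ.+ length l)) ≤⟨ ℕ.*-mono-≤ (weight-upper pr) (total-upper ps) ⟩
       suc K ℕ.^ suc (weight p) ℕ.* suc K ℕ.^ (total l ℕ.+ length l) ≡⟨ ℕ.^-distribˡ-+-* (suc K) (suc (weight p)) (total l ℕ.+ length l) ⟨
       suc K ℕ.^ (suc (weight p) ℕ.+ (total l ℕ.+ length l)) ≡⟨ cong (suc K ℕ.^_) e≡ ⟨
       suc K ℕ.^ (weight p ℕ.+ total l ℕ.+ suc (length l)) ∎
       where
       open ℕ.≤-Reasoning
       e≡ : weight p ℕ.+ total l ℕ.+ suc (length l) ≡ suc (weight p) ℕ.+ (total l ℕ.+ length l)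
       e≡ = ring-eqᴺ ((weight p) ∷ (total l) ∷ (length l) ∷ []) (x0 :+ x1 :+ (nat 1 :+ x2)) (nat 1 :+ x0 :+ (x1 :+ x2)) refl

     N : ℕ → ℕ
     N n = total (primeFactors n)

     Ω : ℕ → ℕ
     Ω n = length (primeFactors n)

     N-* : ∀ {a b} → 1 ℕ.≤ a → 1 ℕ.≤ b → N (a ℕ.* b) ≡ N a ℕ.+ N b
     N-* {a} {b} p q = trans (sum-↭ (↭.map⁺ weight (primeFactors-* p q)))
       (trans (cong sum (List.map-++ weight (primeFactors a) (primeFactors b))) (sum-++ (map weight (primeFactors a)) (map weight (primeFactors b))))

     Ω≤ : ∀ {n} → 1 ℕ.≤ n → Ω n ℕ.≤ n
     Ω≤ {n} p = ℕ.≤-trans (length≤product (primeFactors-prime n)) (ℕ.≤-reflexive (sym (product-primeFactors p)))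

     N-lower : ∀ {n} → 1 ℕ.≤ n → suc K ℕ.^ N n ℕ.≤ n ℕ.* K ℕ.^ N n
     N-lower {n} p = ℕ.≤-trans (total-lower (primeFactors-prime n)) (ℕ.≤-reflexive (cong (ℕ._* K ℕ.^ N n) (sym (product-primeFactors p))))

     N-upper : ∀ {n} → 1 ℕ.≤ n → n ℕ.* K ℕ.^ (N n ℕ.+ Ω n) ℕ.≤ suc K ℕ.^ (N n ℕ.+ Ω n)
     N-upper {n} p = ℕ.≤-trans (ℕ.≤-reflexive (cong (ℕ._* K ℕ.^ (N n ℕ.+ Ω n)) (product-primeFactors p))) (total-upper (primeFactors-prime n))

     -- To base `1 + 1/K`, `a` is above the logarithm of `n` and `c` below that of `n + 1`. Thus
     -- `(1 + 1/K)^(c-a) ≤ 1 + 1/n`, and `bernoulli₁` gives `c - a ≤ K/n`.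
     upper-step : ∀ {n a c} → 1 ℕ.≤ n → n ℕ.* K ℕ.^ a ℕ.≤ suc K ℕ.^ a → suc K ℕ.^ c ℕ.≤ suc n ℕ.* K ℕ.^ c →
       n ℕ.* c ℕ.≤ n ℕ.* a ℕ.+ K
     upper-step {n} {a} {c} n≥1 h k with ℕ.≤-total c a
     ... | inj₁ c≤a = ℕ.≤-trans (ℕ.*-monoʳ-≤ n c≤a) (ℕ.m≤m+n (n ℕ.* a) K)
     ... | inj₂ a≤c with ℕ.m≤n⇒∃[o]m+o≡n a≤c
     ... | r , refl = linᴺ (n ∷ K ∷ r ∷ a ∷ []) 0 (x0 :* (x3 :+ x2)) (x0 :* x3 :+ x1) (leᴺ (x0 :* (x1 :+ x2)) ((nat 1 :+ x0) :* x1) final) refl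
       where
       bound : K ℕ.^ a ℕ.* (n ℕ.* suc K ℕ.^ r) ℕ.≤ K ℕ.^ a ℕ.* (suc n ℕ.* K ℕ.^ r)
       bound = ℕ.≤-trans (linᴺ (n ∷ (K ℕ.^ a) ∷ (suc K ℕ.^ a) ∷ (suc K ℕ.^ r) ∷ []) 0 (x1 :* (x0 :* x3)) (x2 :* x3) ((leᴺ (x0 :* x1) x2 h) ⊛ᴺ (nnᴺ x3 z≤n)) refl)
         (ℕ.≤-trans (ℕ.≤-reflexive (sym (ℕ.^-distribˡ-+-* (suc K) a r))) (ℕ.≤-trans k
           (ℕ.≤-reflexive (trans (cong (suc n ℕ.*_) (ℕ.^-distribˡ-+-* K a r)) (ring-eqᴺ (n ∷ (K ℕ.^ a) ∷ (K ℕ.^ r) ∷ []) ((nat 1 :+ x0) :* (x1 :* x2)) (x1 :* ((nat 1 :+ x0) :* x2)) refl)))))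
       bound′ : n ℕ.* suc K ℕ.^ r ℕ.≤ suc n ℕ.* K ℕ.^ r
       bound′ = ℕ.*-cancelˡ-≤ (K ℕ.^ a) {{ℕ.>-nonZero (1≤^ a)}} bound
       final : n ℕ.* (K ℕ.+ r) ℕ.≤ suc n ℕ.* K
       final = ℕ.*-cancelˡ-≤ (K ℕ.^ r) {{ℕ.>-nonZero (1≤^ r)}} (linᴺ (n ∷ (suc K ℕ.^ r) ∷ (K ℕ.^ r) ∷ K ∷ r ∷ []) 0 (x2 :* (x0 :* (x3 :+ x4))) (x2 :* ((nat 1 :+ x0) :* x3)) ((leᴺ (x0 :* x1) ((nat 1 :+ x0) :* x2) bound′) ⊛ᴺ (nnᴺ x3 (z≤n {K})) ⊞ᴺ (leᴺ (x2 :* (x3 :+ x4)) (x1 :* x3) (bernoulli₁ K r)) ⊛ᴺ (nnᴺ x0 (z≤n {n}))) refl)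

     -- Dually `(1 + 1/K)^(c-a) ≥ 1 + 1/n`, and `bernoulli₂` gives `c - a ≥ (K+1)/(n+1)`.
     lower-step : ∀ {n a c} → suc K ℕ.^ a ℕ.≤ n ℕ.* K ℕ.^ a → suc n ℕ.* K ℕ.^ c ℕ.≤ suc K ℕ.^ c →
       suc n ℕ.* a ℕ.+ K ℕ.≤ suc n ℕ.* c
     lower-step {n} {a} {c} h k with ℕ.≤-total a c
     ... | inj₂ c≤a with ℕ.m≤n⇒∃[o]m+o≡n c≤a
     ... | s , refl = contradiction (ℕ.*-cancelˡ-≤ (K ℕ.^ c) {{ℕ.>-nonZero (1≤^ c)}} bound) absurd
       where
       bound : K ℕ.^ c ℕ.* (suc n ℕ.* suc K ℕ.^ s) ℕ.≤ K ℕ.^ c ℕ.* (n ℕ.* K ℕ.^ s)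
       bound = ℕ.≤-trans (linᴺ (n ∷ (K ℕ.^ c) ∷ (suc K ℕ.^ c) ∷ (suc K ℕ.^ s) ∷ []) 0 (x1 :* ((nat 1 :+ x0) :* x3)) (x2 :* x3) ((leᴺ ((nat 1 :+ x0) :* x1) x2 k) ⊛ᴺ (nnᴺ x3 z≤n)) refl)
         (ℕ.≤-trans (ℕ.≤-reflexive (sym (ℕ.^-distribˡ-+-* (suc K) c s))) (ℕ.≤-trans h
           (ℕ.≤-reflexive (trans (cong (n ℕ.*_) (ℕ.^-distribˡ-+-* K c s)) (ring-eqᴺ (n ∷ (K ℕ.^ c) ∷ (K ℕ.^ s) ∷ []) (x0 :* (x1 :* x2)) (x1 :* (x0 :* x2)) refl)))))
       absurd : ¬ suc n ℕ.* suc K ℕ.^ s ℕ.≤ n ℕ.* K ℕ.^ s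
       absurd q = lin-⊥ᴺ (n ∷ (suc K ℕ.^ s) ∷ (K ℕ.^ s) ∷ []) (leᴺ ((nat 1 :+ x0) :* x1) (x0 :* x2) q ⊞ᴺ leᴺ x2 x1 (ℕ.^-monoˡ-≤ s (ℕ.n≤1+n K)) ⊞ᴺ leᴺ (nat 1) x2 (1≤^ s) ⊞ᴺ (leᴺ x2 x1 (ℕ.^-monoˡ-≤ s (ℕ.n≤1+n K))) ⊛ᴺ (nnᴺ x0 (z≤n {n}))) refl
     lower-step {n} {a} {c} h k | inj₁ a≤c with ℕ.m≤n⇒∃[o]m+o≡n a≤c
     ... | r , refl = linᴺ (K ∷ n ∷ r ∷ a ∷ []) 0 ((nat 1 :+ x1) :* x3 :+ x0) ((nat 1 :+ x1) :* (x3 :+ x2)) (leᴺ (nat 1 :+ x0) ((nat 1 :+ x1) :* x2) final) refl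
       where
       bound : K ℕ.^ a ℕ.* (suc n ℕ.* K ℕ.^ r) ℕ.≤ K ℕ.^ a ℕ.* (n ℕ.* suc K ℕ.^ r)
       bound = ℕ.≤-trans (ℕ.≤-reflexive (trans (ring-eqᴺ ((K ℕ.^ a) ∷ n ∷ (K ℕ.^ r) ∷ []) (x0 :* ((nat 1 :+ x1) :* x2)) ((nat 1 :+ x1) :* (x0 :* x2)) refl) (cong (suc n ℕ.*_) (sym (ℕ.^-distribˡ-+-* K a r)))))
         (ℕ.≤-trans k (ℕ.≤-trans (ℕ.≤-reflexive (ℕ.^-distribˡ-+-* (suc K) a r))
           (linᴺ ((suc K ℕ.^ a) ∷ n ∷ (K ℕ.^ a) ∷ (suc K ℕ.^ r) ∷ []) 0 (x0 :* x3) (x2 :* (x1 :* x3)) ((leᴺ x0 (x1 :* x2) h) ⊛ᴺ (nnᴺ x3 z≤n)) refl)))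
       bound′ : suc n ℕ.* K ℕ.^ r ℕ.≤ n ℕ.* suc K ℕ.^ r
       bound′ = ℕ.*-cancelˡ-≤ (K ℕ.^ a) {{ℕ.>-nonZero (1≤^ a)}} bound
       final : suc K ℕ.≤ suc n ℕ.* r
       final = ℕ.*-cancelˡ-≤ (suc K ℕ.^ r) {{ℕ.>-nonZero (ℕ.m^n>0 (suc K) r)}} (linᴺ (n ∷ (K ℕ.^ r) ∷ (suc K ℕ.^ r) ∷ K ∷ r ∷ []) 0 (x2 :* (nat 1 :+ x3)) (x2 :* ((nat 1 :+ x0) :* x4)) ((leᴺ ((nat 1 :+ x0) :* x1) (x0 :* x2) bound′) ⊛ᴺ (nnᴺ (nat 1 :+ x3) (z≤n {suc K})) ⊞ᴺ (leᴺ (x2 :* (nat 1 :+ x3)) (x1 :* (nat 1 :+ x3) :+ x4 :* x2) (bernoulli₂ K r)) ⊛ᴺ (nnᴺ (nat 1 :+ x0) (z≤n {suc n}))) refl)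

     k′ : ℚ
     k′ = rec K′

     K′k′ : ι K′ * k′ ≡ 1ℚ
     K′k′ = ι*rec (ℕ.pred K′)

     scaled-≤ : ∀ n D → ι (suc n) * D ≤ ι K′ → k′ * D ≤ rec (suc n)
     scaled-≤ n D h = lin ((ι n) ∷ D ∷ (ι K′) ∷ k′ ∷ (rec (suc n)) ∷ []) 0 (x3 :* x1) x4 (le (one :* (x3 :* x1)) ((one :+ x0) :* x4 :* (x3 :* x1)) (≤-reflexive (sym e₁))
         ⊞ le (x2 :* x3 :* x4) (one :* x4) (≤-reflexive e₂) ⊞
         (le ((one :+ x0) :* x1) x2 h) ⊛ (nn (x3 :* x4) (0≤* (0≤rec K′) (0≤rec (suc n))))) refl
       where
       e₁ : (ι (suc n) * rec (suc n)) * (k′ * D) ≡ 1ℚ * (k′ * D)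
       e₁ = cong (_* (k′ * D)) (ι*rec n)
       e₂ : (ι K′ * k′) * rec (suc n) ≡ 1ℚ * rec (suc n)
       e₂ = cong (_* rec (suc n)) K′k′

     scaled-≥ : ∀ n D → ι K′ ≤ ι (suc n) * D → rec (suc n) ≤ k′ * D
     scaled-≥ n D h = lin ((ι K′) ∷ (ι n) ∷ D ∷ k′ ∷ (rec (suc n)) ∷ []) 0 x4 (x3 :* x2) (le ((one :+ x1) :* x4 :* (x3 :* x2)) (one :* (x3 :* x2)) (≤-reflexive e₁) ⊞
         le (one :* x4) (x0 :* x3 :* x4) (≤-reflexive (sym e₂)) ⊞
         (le x0 ((one :+ x1) :* x2) h) ⊛ (nn (x3 :* x4) (0≤* (0≤rec K′) (0≤rec (suc n))))) refl
       where
       e₁ : (ι (suc n) * rec (suc n)) * (k′ * D) ≡ 1ℚ * (k′ * D)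
       e₁ = cong (_* (k′ * D)) (ι*rec n)
       e₂ : (ι K′ * k′) * rec (suc n) ≡ 1ℚ * rec (suc n)
       e₂ = cong (_* rec (suc n)) K′k′

     ιK : ι K ≡ 1ℚ + (ι X * ι X + ι 2 * (ι X * ι X * ι X))
     ιK = cast (X ∷ []) (one :+ (var 0 :* var 0 :+ nat 2 :* (var 0 :* var 0 :* var 0))) _

     ιK′ : ι K′ ≡ 1ℚ + (ι X * ι X + ι 2 * (ι X * ι X * ι X)) + ι X * ι X
     ιK′ = trans (ι-+ K (X ℕ.* X)) (cong₂ _+_ ιK (ι-* X X))

     upper : ∀ {n} → 1 ℕ.≤ n → n ℕ.< X → k′ * ι (N (suc n)) - k′ * ι (N n) ≤ rec n
     upper {n@(suc n′)} n≥1 n<X = ≤-trans (lin (k′ ∷ (ι (N (suc n))) ∷ (ι (N n)) ∷ []) 0 (x0 :* x1 :- x0 :* x2) (x0 :* (x1 :- x2)) (∅) refl) (scaled-≤ n′ (ι (N (suc n)) - ι (N n)) bound)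
       where
       h : n ℕ.* N (suc n) ℕ.≤ n ℕ.* (N n ℕ.+ Ω n) ℕ.+ K
       h = upper-step {n} {N n ℕ.+ Ω n} {N (suc n)} n≥1 (N-upper n≥1) (N-lower {suc n} (s≤s z≤n))
       hℚ : ι n * ι (N (suc n)) ≤ ι n * (ι (N n) + ι (Ω n)) + ι K
       hℚ = subst₂ _≤_ (ι-* n (N (suc n))) (trans (ι-+ (n ℕ.* (N n ℕ.+ Ω n)) K) (cong (_+ ι K) (trans (ι-* n (N n ℕ.+ Ω n)) (cong (ι n *_) (ι-+ (N n) (Ω n)))))) (ι-mono h)
       Ω≤X : ι (Ω n) ≤ ι X
       Ω≤X = ι-mono (ℕ.≤-trans (Ω≤ n≥1) (ℕ.<⇒≤ n<X))
       bound : ι n * (ι (N (suc n)) - ι (N n)) ≤ ι K′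
       bound = lin ((ι n) ∷ (ι (N (suc n))) ∷ (ι (N n)) ∷ (ι (Ω n)) ∷ (ι K) ∷ (ι X) ∷ (ι K′) ∷ []) 0 (x0 :* (x1 :- x2)) x6 (le (x0 :* x1) (x0 :* (x2 :+ x3) :+ x4) hℚ ⊞
           le x4 (one :+ (x5 :* x5 :+ nat 2 :* (x5 :* x5 :* x5))) (≤-reflexive ιK) ⊞
           le (one :+ (x5 :* x5 :+ nat 2 :* (x5 :* x5 :* x5)) :+ x5 :* x5) x6 (≤-reflexive (sym ιK′)) ⊞
           (le x3 x5 Ω≤X) ⊛ (nn x0 (0≤ι n)) ⊞
           (le x0 x5 (ι-mono (ℕ.<⇒≤ n<X))) ⊛ (nn x5 (0≤ι X))) refl

     lower : ∀ {n} → 1 ℕ.≤ n → n ℕ.< X → rec (2 ℕ.+ n) ≤ k′ * ι (N (suc n)) - k′ * ι (N n)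
     lower {n} n≥1 n<X = ≤-trans (scaled-≥ (suc n) D bound) (lin (k′ ∷ (ι (N (suc n))) ∷ (ι (N n)) ∷ []) 0 (x0 :* (x1 :- x2)) (x0 :* x1 :- x0 :* x2) (∅) refl)
       where
       D : ℚ
       D = ι (N (suc n)) - ι (N n)
       m c a : ℚ
       m = ι (suc n)
       c = ι (N (suc n))
       a = ι (N n)
       h : suc n ℕ.* N n ℕ.+ K ℕ.≤ suc n ℕ.* (N (suc n) ℕ.+ Ω (suc n))
       h = lower-step {n} {N n} {N (suc n) ℕ.+ Ω (suc n)} (N-lower n≥1) (N-upper {suc n} (s≤s z≤n))
       hℚ : m * a + ι K ≤ m * (c + ι (Ω (suc n)))
       hℚ = subst₂ _≤_ (trans (ι-+ (suc n ℕ.* N n) K) (cong (_+ ι K) (ι-* (suc n) (N n))))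
         (trans (ι-* (suc n) (N (suc n) ℕ.+ Ω (suc n))) (cong (m *_) (ι-+ (N (suc n)) (Ω (suc n))))) (ι-mono h)
       m≤X : m ≤ ι X
       m≤X = ι-mono n<X
       Ω≤X : ι (Ω (suc n)) ≤ ι X
       Ω≤X = ι-mono (ℕ.≤-trans (Ω≤ {suc n} (s≤s z≤n)) n<X)
       E : 1ℚ + ι 2 * (ι X * ι X * ι X) ≤ m * (c - a)
       E = lin (m ∷ a ∷ (ι K) ∷ c ∷ (ι (Ω (suc n))) ∷ (ι X) ∷ []) 0 (one :+ nat 2 :* (x5 :* x5 :* x5)) (x0 :* (x3 :- x1)) (le (x0 :* x1 :+ x2) (x0 :* (x3 :+ x4)) hℚ
           ⊞ le (one :+ (x5 :* x5 :+ nat 2 :* (x5 :* x5 :* x5))) x2 (≤-reflexive (sym ιK)) ⊞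
           (le x4 x5 Ω≤X) ⊛ (nn x0 (0≤ι (suc n))) ⊞
           (le x0 x5 m≤X) ⊛ (nn x5 (0≤ι X))) refl
       bound : ι K′ ≤ (1ℚ + m) * (c - a)
       bound = ≤-cancel n (lin ((ι X) ∷ m ∷ c ∷ a ∷ (ι K′) ∷ []) 0 (x1 :* x4) (x1 :* ((one :+ x1) :* (x2 :- x3))) (le (one :+ nat 2 :* (x0 :* x0 :* x0)) (x1 :* (x2 :- x3)) E
           ⊞
           le (x1 :* x4) (x1 :* (one :+ (x0 :* x0 :+ nat 2 :* (x0 :* x0 :* x0)) :+ x0 :* x0)) (≤-reflexive (cong (m *_) ιK′))
           ⊞ (le (one :+ nat 2 :* (x0 :* x0 :* x0)) (x1 :* (x2 :- x3)) E) ⊛ (nn x1 (0≤ι (suc n))) ⊞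
           2 ⊠ ((nn (x0 :* x0) (0≤* (0≤ι X) (0≤ι X))) ⊛ (le x1 x0 m≤X))) refl)

   logarithm : Logarithm X
   logarithm = record
     { L = λ n → k′ * ι (N n)
     ; L-* = λ {a} {b} p q → trans (cong (λ n → k′ * ι n) (N-* p q)) (trans (cong (k′ *_) (ι-+ (N a) (N b))) (ℚₚ.distribˡ k′ (ι (N a)) (ι (N b))))
     ; ΔL≤ = upper
     ; ΔL≥ = lower
     }

-- Estimates of Chebyshev and Mertens, and moments of the logarithm.

module MertensEstimates where

 open import Data.Nat.Induction using (<-rec)
 open import Relation.Binary.PropositionalEquality
 open RationalArithmetic
 open DivisorSums
 open MoebiusMangoldt
 open IntegerLogarithm

 ι*rec′ : ∀ {n} → 1 ℕ.≤ n → ι n * rec n ≡ 1ℚ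
 ι*rec′ {suc n} _ = ι*rec n

 1≤ι : ∀ {n} → 1 ℕ.≤ n → 1ℚ ≤ ι n
 1≤ι n≥1 = ≤-trans (≤-reflexive (sym (ℚₚ.+-identityʳ 1ℚ))) (ι-mono n≥1)

 rec-anti : ∀ {m n} → 1 ℕ.≤ m → m ℕ.≤ n → rec n ≤ rec m
 rec-anti {m} {n} m≥1 m≤n = lin ((ι m) ∷ (ι n) ∷ (rec m) ∷ (rec n) ∷ []) 0 x3 x2 (le (one :* x3) (x0 :* x2 :* x3) (≤-reflexive (sym e₁)) ⊞
     le (x1 :* x3 :* x2) (one :* x2) (≤-reflexive e₂) ⊞
     (le x0 x1 (ι-mono m≤n)) ⊛ (nn (x2 :* x3) (0≤* (0≤rec m) (0≤rec n)))) refl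
   where
   e₁ : (ι m * rec m) * rec n ≡ 1ℚ * rec n
   e₁ = cong (_* rec n) (ι*rec′ m≥1)
   e₂ : (ι n * rec n) * rec m ≡ 1ℚ * rec m
   e₂ = cong (_* rec m) (ι*rec′ (ℕ.≤-trans m≥1 m≤n))

 rec-1 : rec 1 ≡ 1ℚ
 rec-1 = trans (ring-eq ((rec 1) ∷ []) x0 (nat 1 :* x0) refl) (ι*rec 0)

 rec≤1 : ∀ {n} → 1 ℕ.≤ n → rec n ≤ 1ℚ
 rec≤1 n≥1 = ≤-trans (rec-anti ℕ.≤-refl n≥1) (≤-reflexive rec-1)

 rec-diff : ∀ {n} → 1 ℕ.≤ n → rec n - rec (suc n) ≡ rec n * rec (suc n)
 rec-diff {n} n≥1 = begin
   rec n - rec (suc n) ≡⟨ ring-eq ((rec n) ∷ (rec (suc n)) ∷ []) (x0 :- x1) (one :* x0 :- one :* x1) refl ⟩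
   1ℚ * rec n - 1ℚ * rec (suc n) ≡⟨ cong₂ (λ a b → a * rec n - b * rec (suc n)) (sym (ι*rec n)) (sym (ι*rec′ n≥1)) ⟩
   (ι (suc n) * rec (suc n)) * rec n - (ι n * rec n) * rec (suc n)
     ≡⟨ ring-eq ((ι n) ∷ (rec (suc n)) ∷ (rec n) ∷ []) ((one :+ x0) :* x1 :* x2 :- x0 :* x2 :* x1) (x2 :* x1) refl ⟩
   rec n * rec (suc n) ∎
   where open ≡-Reasoning

 rec-double : ∀ {n} → 1 ℕ.≤ n → rec n ≤ ι 2 * rec (suc n)
 rec-double {n} n≥1 = lin ((rec n) ∷ (rec (suc n)) ∷ []) 0 x0 (nat 2 :* x1) (le (x0 :- x1) (x0 :* x1) (≤-reflexive (rec-diff n≥1)) ⊞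
     (le x0 one (rec≤1 n≥1)) ⊛ (nn x1 (0≤rec (suc n)))) refl

 rec-* : ∀ m n → rec (m ℕ.* n) ≡ rec m * rec n
 rec-* zero n = sym (ℚₚ.zeroˡ (rec n))
 rec-* (suc m) zero = trans (cong rec (ℕ.*-zeroʳ m)) (sym (ℚₚ.zeroʳ (rec (suc m))))
 rec-* (suc m) (suc n) = begin
   rec k ≡⟨ ring-eq ((rec k) ∷ []) x0 (x0 :* (one :* one)) refl ⟩
   rec k * (1ℚ * 1ℚ) ≡⟨ cong₂ (λ a b → rec k * (a * b)) (sym (ι*rec m)) (sym (ι*rec n)) ⟩
   rec k * ((a * rec (suc m)) * (b * rec (suc n)))
     ≡⟨ ring-eq ((rec k) ∷ a ∷ (rec (suc m)) ∷ b ∷ (rec (suc n)) ∷ []) (x0 :* (x1 :* x2 :* (x3 :* x4))) (x1 :* x3 :* x0 :* (x2 :* x4)) refl ⟩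
   ((a * b) * rec k) * (rec (suc m) * rec (suc n)) ≡⟨ cong (λ c → (c * rec k) * (rec (suc m) * rec (suc n))) (sym (ι-* (suc m) (suc n))) ⟩
   (ι k * rec k) * (rec (suc m) * rec (suc n)) ≡⟨ cong (_* (rec (suc m) * rec (suc n))) (ι*rec′ {k} (s≤s z≤n)) ⟩
   1ℚ * (rec (suc m) * rec (suc n)) ≡⟨ ℚₚ.*-identityˡ _ ⟩
   rec (suc m) * rec (suc n) ∎
   where
   open ≡-Reasoning
   k : ℕ
   k = suc m ℕ.* suc n
   a b : ℚ
   a = ι (suc m)
   b = ι (suc n)

 range-induction : ∀ {X} (P : ℕ → Set) {a} → P a → (∀ {n} → a ℕ.≤ n → n ℕ.< X → P n → P (suc n)) → ∀ {b} → a ℕ.≤ b → b ℕ.≤ X → P b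
 range-induction P {a} base step {b} a≤b b≤X with ℕ.m≤n⇒m<n∨m≡n a≤b
 ... | inj₂ refl = base
 range-induction P {a} base step {suc b} a≤b b≤X | inj₁ (s≤s a≤b′) =
   step a≤b′ b≤X (range-induction P base step a≤b′ (ℕ.<⇒≤ b≤X))

 ∑-window : ∀ {a b} (f g : ℕ → ℚ) → a ℕ.≤ b → (∀ i → 1 ℕ.≤ i → i ℕ.≤ a → 0ℚ ≤ g i) → (∀ i → a ℕ.< i → i ℕ.≤ b → f i ≤ g i) →
   ∑ b f - ∑ a f ≤ ∑ b g
 ∑-window {a} {b} f g a≤b h k with ℕ.m≤n⇒m<n∨m≡n a≤b
 ... | inj₂ refl = lin ((∑ a g) ∷ (∑ a f) ∷ []) 0 (x1 :- x1) x0 (nn x0 (0≤∑ a h)) refl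
 ∑-window {a} {suc b} f g a≤b h k | inj₁ (s≤s a≤b′) = lin ((∑ b f) ∷ (∑ a f) ∷ (∑ b g) ∷ (f (suc b)) ∷ (g (suc b)) ∷ []) 0 (x0 :+ x3 :- x1) (x2 :+ x4) (le (x0 :- x1) x2 (∑-window f g a≤b′ h (λ i p q → k i p (ℕ.m≤n⇒m≤1+n q)))
     ⊞ le x3 x4 (k (suc b) (s≤s a≤b′) ℕ.≤-refl)) refl

 0≤*-mono : ∀ {a b c} → 0ℚ ≤ a → b ≤ c → a * b ≤ a * c
 0≤*-mono {a} {b} {c} h k = lin (a ∷ b ∷ c ∷ []) 0 (x0 :* x1) (x0 :* x2) ((nn x0 h) ⊛ (le x1 x2 k)) refl

 ι-div-≤ : ∀ N d → ι (N div d) ≤ ι N * rec d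
 ι-div-≤ N zero = ≤-reflexive (sym (ℚₚ.zeroʳ (ι N)))
 ι-div-≤ N d@(suc d′) = lin ((ι d) ∷ (ι (N div d)) ∷ (ι N) ∷ (rec d) ∷ []) 0 x1 (x2 :* x3) (le (one :* x1) (x0 :* x3 :* x1) (≤-reflexive (sym (cong (_* ι (N div d)) (ι*rec d′))))
     ⊞
     (le (x0 :* x1) x2 (subst (_≤ ι N) (ι-* d (N div d)) (ι-mono (div-≤ N d)))) ⊛ (nn x3 (0≤rec d))) refl

 ι-div-> : ∀ N {d} → 1 ℕ.≤ d → ι N * rec d ≤ ι (N div d) + 1ℚ
 ι-div-> N {d} d≥1 = lin ((ι N) ∷ (ι d) ∷ (ι (N div d)) ∷ (rec d) ∷ []) 0 (x0 :* x3) (x2 :+ one) (le (x1 :* x3 :* (one :+ x2)) (one :* (one :+ x2)) (≤-reflexive (cong (_* (1ℚ + ι (N div d))) (ι*rec′ d≥1)))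
     ⊞ (le x0 (x1 :* (one :+ x2)) bound) ⊛ (nn x3 (0≤rec d))) refl
   where
   bound : ι N ≤ ι d * (1ℚ + ι (N div d))
   bound = subst (ι N ≤_) (ι-* d (suc (N div d))) (ι-mono (ℕ.<⇒≤ (div-< N d≥1)))

 div≡0 : ∀ {N d} → 1 ℕ.≤ d → N ℕ.< d → N div d ≡ 0
 div≡0 {N} {d} d≥1 N<d = div-unique d≥1 (subst (ℕ._≤ N) (sym (ℕ.*-zeroʳ d)) z≤n) (subst (N ℕ.<_) (sym (ℕ.*-identityʳ d)) N<d)

 H : ℕ → ℚ
 H n = ∑ n rec

 module Estimates {X : ℕ} (log : Logarithm X) where
   open Logarithm log public
   open Mangoldt L L-* public

   0≤ΔL : ∀ {n} → 1 ℕ.≤ n → n ℕ.< X → L n ≤ L (suc n)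
   0≤ΔL {n} p q = lin ((rec (2 ℕ.+ n)) ∷ (L (suc n)) ∷ (L n) ∷ []) 0 x2 x1 (le x0 (x1 :- x2) (ΔL≥ p q) ⊞
       le (nat 0) x0 (0≤rec (2 ℕ.+ n))) refl

   L-mono : ∀ {a b} → 1 ℕ.≤ a → a ℕ.≤ b → b ℕ.≤ X → L a ≤ L b
   L-mono {a} a≥1 = range-induction (λ b → L a ≤ L b) ≤-refl (λ p q h → ≤-trans h (0≤ΔL (ℕ.≤-trans a≥1 p) q))

   0≤L : ∀ {n} → 1 ℕ.≤ n → n ℕ.≤ X → 0ℚ ≤ L n
   0≤L p q = subst (_≤ L _) L-1 (L-mono ℕ.≤-refl p q)

   L-growth : ∀ {a b} → 1 ℕ.≤ a → a ℕ.≤ b → b ℕ.≤ X → L b ≤ L a + (ι b - ι a) * rec a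
   L-growth {a} a≥1 = range-induction (λ b → L b ≤ L a + (ι b - ι a) * rec a) (lin ((L a) ∷ (ι a) ∷ (rec a) ∷ []) 0 x0 (x0 :+ (x1 :- x1) :* x2) (∅) refl) step
     where
     step : ∀ {n} → a ℕ.≤ n → n ℕ.< X → L n ≤ L a + (ι n - ι a) * rec a → L (suc n) ≤ L a + (ι (suc n) - ι a) * rec a
     step {n} p q h = lin ((L n) ∷ (L a) ∷ (ι n) ∷ (ι a) ∷ (rec a) ∷ (L (suc n)) ∷ (rec n) ∷ []) 0 x5 (x1 :+ (one :+ x2 :- x3) :* x4) (le x0 (x1 :+ (x2 :- x3) :* x4) h ⊞
         le (x5 :- x0) x6 (ΔL≤ (ℕ.≤-trans a≥1 p) q) ⊞ le x6 x4 (rec-anti a≥1 p)) refl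

   L≤ : ∀ {n} → 1 ℕ.≤ n → n ℕ.≤ X → L n ≤ ι n - 1ℚ
   L≤ {n} p q = lin ((L n) ∷ (L 1) ∷ (ι n) ∷ (rec 1) ∷ []) 0 x0 (x2 :- one) (le x0 (x1 :+ (x2 :- nat 1) :* x3) (L-growth ℕ.≤-refl p q) ⊞
       le x1 (nat 0) (≤-reflexive L-1) ⊞
       le ((x2 :- nat 1) :* x3) ((x2 :- nat 1) :* one) (≤-reflexive (cong ((ι n - ι 1) *_) rec-1))) refl

   0≤Λ : ∀ {n} → 1 ℕ.≤ n → n ℕ.≤ X → 0ℚ ≤ Λ n
   0≤Λ {n} p q with Λ-cases p
   ... | inj₁ eq = ≤-reflexive (sym eq)
   ... | inj₂ (r , k , pr , eq , eq′) = ≤-trans (0≤L (prime≥1 pr) (ℕ.≤-trans r≤n q)) (≤-reflexive (sym eq′))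
     where
     r≤n : r ℕ.≤ n
     r≤n = ℕ.≤-trans (ℕ.m≤m*n r (r ℕ.^ k) {{ℕ.>-nonZero (ℕ.m^n>0 r {{ℕ.>-nonZero (prime≥1 pr)}} k)}}) (ℕ.≤-reflexive (sym eq))

   -- `Mert` and `ψ` are the sums of Mertens and Chebyshev and `T n` stands for `log n!`. `U n` is
   -- the sum of `L n - L k` over `k ≤ n`, so its bounds are a weak form of Stirling's formula.
   Mert ψ T U : ℕ → ℚ
   Mert n = ∑ n (λ k → Λ k * rec k)
   ψ n = ∑ n Λ
   T n = ∑ n L
   U n = ι n * L n - T n

   -- Legendre's formula for the factorial, a consequence of `divisorSum-Λ`.
   T-Λ : ∀ N → T N ≡ ∑ N (λ d → Λ d * ι (N div d))
   T-Λ N = begin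
     T N ≡⟨ ∑-cong N (λ k p _ → sym (divisorSum-Λ p)) ⟩
     ∑ N (λ k → divisorSum (λ n → Λ n) k) ≡⟨ ∑-divisors N (λ n _ → Λ n) ⟨
     ∑ N (λ n → ∑ (N div n) (λ _ → Λ n)) ≡⟨ ∑-cong N (λ n _ _ → trans (∑-const (N div n) (Λ n)) (ℚₚ.*-comm (ι (N div n)) (Λ n))) ⟩
     ∑ N (λ d → Λ d * ι (N div d)) ∎
     where open ≡-Reasoning

   U-step : ∀ {n} → 1 ℕ.≤ n → n ℕ.< X → U n ≤ U (suc n) × U (suc n) ≤ U n + 1ℚ
   U-step {n} p q = (lin ((ι n) ∷ (L n) ∷ (L (suc n)) ∷ (T n) ∷ []) 0 (x0 :* x1 :- x3) ((one :+ x0) :* x2 :- (x3 :+ x2)) ((nn x0 (0≤ι n)) ⊛ (le x1 x2 (0≤ΔL p q))) refl) ,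
     (lin ((ι n) ∷ (L (suc n)) ∷ (L n) ∷ (rec n) ∷ (T n) ∷ []) 0 ((one :+ x0) :* x1 :- (x4 :+ x1)) (x0 :* x2 :- x4 :+ one) (le (x0 :* x3) one (≤-reflexive (ι*rec′ p))
         ⊞ (nn x0 (0≤ι n)) ⊛ (le (x1 :- x2) x3 (ΔL≤ p q))) refl)

   U-bounds : ∀ {n} → 1 ℕ.≤ n → n ℕ.≤ X → 0ℚ ≤ U n × U n ≤ ι n
   U-bounds = range-induction (λ n → 0ℚ ≤ U n × U n ≤ ι n)
     ((lin ((L 1) ∷ []) 0 (nat 0) (nat 1 :* x0 :- (nat 0 :+ x0)) (∅) refl) , (lin ((L 1) ∷ []) 0 (nat 1 :* x0 :- (nat 0 :+ x0)) (nat 1) (∅) refl))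
     (λ {n} p q (h , k) → ≤-trans h (proj₁ (U-step p q)) , (lin ((U (suc n)) ∷ (U n) ∷ (ι n) ∷ []) 0 x0 (one :+ x2) (le x0 (x1 :+ one) (proj₂ (U-step p q)) ⊞ le x1 x2 k) refl))

   0≤Λrec : ∀ {n} → 1 ℕ.≤ n → n ℕ.≤ X → 0ℚ ≤ Λ n * rec n
   0≤Λrec {n} p q = 0≤* (0≤Λ p q) (0≤rec n)

   Mert-mono : ∀ {a b} → a ℕ.≤ b → b ℕ.≤ X → Mert a ≤ Mert b
   Mert-mono a≤b b≤X = ∑-grow _ a≤b (λ i p q → 0≤Λrec (ℕ.≤-trans (s≤s z≤n) p) (ℕ.≤-trans q b≤X))

   0≤ψ : ∀ {n} → n ℕ.≤ X → 0ℚ ≤ ψ n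
   0≤ψ {n} n≤X = 0≤∑ n (λ i p q → 0≤Λ p (ℕ.≤-trans q n≤X))

   -- In `T-Λ` the quotient `⌊N/d⌋` is replaced by `N/d`, while `U-bounds` keeps `T N` above
   -- `N L(N) - N`.
   Mert-lower : ∀ {N} → 1 ℕ.≤ N → N ℕ.≤ X → L N - 1ℚ ≤ Mert N
   Mert-lower {N@(suc N′)} N≥1 N≤X = ≤-cancel N′ (lin ((T N) ∷ (ι N) ∷ (Mert N) ∷ (L N) ∷ []) 0 (x1 :* (x3 :- one)) (x1 :* x2) (le x0 (x1 :* x2) TM ⊞
       le (x1 :* x3 :- x0) x1 (proj₂ (U-bounds N≥1 N≤X))) refl)
     where
     TM : T N ≤ ι N * Mert N
     TM = ≤-trans (≤-reflexive (T-Λ N)) (≤-trans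
       (∑-mono N {g = λ d → ι N * (Λ d * rec d)} (λ d p q → ≤-trans (0≤*-mono (0≤Λ p (ℕ.≤-trans q N≤X)) (ι-div-≤ N d))
         (≤-reflexive (ring-eq ((Λ d) ∷ (ι N) ∷ (rec d) ∷ []) (x0 :* (x1 :* x2)) (x1 :* (x0 :* x2)) refl))))
       (≤-reflexive (∑-* N (ι N) (λ d → Λ d * rec d))))

   -- Chebyshev's device: `⌊N/d⌋ - 2⌊⌊N/2⌋/d⌋` is never negative, and it is at least 1 for
   -- `⌊N/2⌋ < d ≤ N`.
   T-halving : ∀ {N} → N ℕ.≤ X → ψ N - ψ (N div 2) ≤ T N - ι 2 * T (N div 2)
   T-halving {N} N≤X = ≤-trans (∑-window Λ g (div≤ N 2) small large) (≤-reflexive eq)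
     where
     y : ℕ
     y = N div 2
     g : ℕ → ℚ
     g d = Λ d * (ι (N div d) - ι 2 * ι (y div d))
     twice : ∀ d → 1 ℕ.≤ d → ι 2 * ι (y div d) ≤ ι (N div d)
     twice d p = subst (_≤ ι (N div d)) (ι-* 2 (y div d)) (ι-mono (≤-div p (ℕ.≤-trans
       (ℕ.≤-reflexive (ring-eqᴺ (d ∷ (y div d) ∷ []) (x0 :* (nat 2 :* x1)) (nat 2 :* (x0 :* x1)) refl)) (ℕ.≤-trans (ℕ.*-monoʳ-≤ 2 (div-≤ y d)) (div-≤ N 2)))))
     small : ∀ d → 1 ℕ.≤ d → d ℕ.≤ y → 0ℚ ≤ g d
     small d p q = 0≤* (0≤Λ p (ℕ.≤-trans q (ℕ.≤-trans (div≤ N 2) N≤X))) (≤⇒0≤- (twice d p))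
     large : ∀ d → y ℕ.< d → d ℕ.≤ N → Λ d ≤ g d
     large d y<d d≤N = lin ((Λ d) ∷ (ι (N div d)) ∷ (ι (y div d)) ∷ []) 0 x0 (x0 :* (x1 :- nat 2 :* x2)) (2 ⊠ (le (x0 :* x2) (x0 :* nat 0) (≤-reflexive (cong (λ k → Λ d * ι k) (div≡0 d≥1 y<d))))
         ⊞
         (nn x0 (0≤Λ d≥1 (ℕ.≤-trans d≤N N≤X))) ⊛ (le one x1 (1≤ι (≤-div {N} {d} {1} d≥1 (subst (ℕ._≤ N) (sym (ℕ.*-identityʳ d)) d≤N))))) refl
       where
       d≥1 : 1 ℕ.≤ d
       d≥1 = ℕ.≤-trans (s≤s z≤n) y<d
     ext : ∑ N (λ d → Λ d * ι (y div d)) ≡ T y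
     ext = trans (∑-extend (λ d → Λ d * ι (y div d)) (div≤ N 2) (λ d p q → trans (cong (λ k → Λ d * ι k) (div≡0 (ℕ.≤-trans (s≤s z≤n) p) p)) (ℚₚ.zeroʳ (Λ d))))
       (sym (T-Λ y))
     eq : ∑ N g ≡ T N - ι 2 * T y
     eq = begin
       ∑ N g ≡⟨ ∑-cong N (λ d _ _ → (ring-eq ((Λ d) ∷ (ι (N div d)) ∷ (ι (y div d)) ∷ []) (x0 :* (x1 :- nat 2 :* x2)) (x0 :* x1 :+ ⊝ nat 2 :* (x0 :* x2)) refl)) ⟩
       ∑ N (λ d → Λ d * ι (N div d) + - ι 2 * (Λ d * ι (y div d))) ≡⟨ ∑-+ N (λ d → Λ d * ι (N div d)) (λ d → - ι 2 * (Λ d * ι (y div d))) ⟩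
       ∑ N (λ d → Λ d * ι (N div d)) + ∑ N (λ d → - ι 2 * (Λ d * ι (y div d)))
         ≡⟨ cong₂ _+_ (sym (T-Λ N)) (trans (∑-* N (- ι 2) (λ d → Λ d * ι (y div d))) (cong (- ι 2 *_) ext)) ⟩
       T N + - ι 2 * T y ≡⟨ ring-eq ((T N) ∷ (T y) ∷ []) (x0 :+ ⊝ nat 2 :* x1) (x0 :- nat 2 :* x1) refl ⟩
       T N - ι 2 * T y ∎
       where open ≡-Reasoning

   L-halving : ∀ {N} → 2 ℕ.≤ N → N ℕ.≤ X → L N ≤ L (N div 2) + ι 2
   L-halving {N} N≥2 N≤X with ℕ.m≤n⇒m<n∨m≡n (div-≤ N 2)
   ... | inj₂ eq = lin ((L N) ∷ (L 2) ∷ (L (N div 2)) ∷ []) 0 x0 (x2 :+ nat 2) (le x0 (x1 :+ x2) (≤-reflexive (trans (cong L (sym eq)) (L-* (s≤s z≤n) y≥1)))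
       ⊞ le x1 (nat 2 :- one) L2) refl
     where
     y≥1 : 1 ℕ.≤ N div 2
     y≥1 = ≤-div {N} {2} {1} (s≤s z≤n) N≥2
     L2 : L 2 ≤ ι 2 - 1ℚ
     L2 = L≤ (s≤s z≤n) (ℕ.≤-trans N≥2 N≤X)
   ... | inj₁ 2y<N = lin ((L (suc (2 ℕ.* y))) ∷ (L (2 ℕ.* y)) ∷ (rec (2 ℕ.* y)) ∷ (L N) ∷ (L 2) ∷ (L y) ∷ []) 0 x3 (x5 :+ nat 2) (le (x0 :- x1) x2 (ΔL≤ (ℕ.*-mono-≤ {1} {2} (s≤s z≤n) y≥1) (ℕ.≤-trans 2y<N N≤X))
       ⊞ le x2 one (rec≤1 (ℕ.*-mono-≤ {1} {2} (s≤s z≤n) y≥1)) ⊞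
       le x3 x0 (≤-reflexive (cong L (ℕ.≤-antisym (ℕ.s≤s⁻¹ (ℕ.≤-trans (div-< N (s≤s z≤n)) (ℕ.≤-reflexive (trans (ℕ.*-suc 2 y) refl)))) 2y<N)))
       ⊞ le x1 (x4 :+ x5) (≤-reflexive (L-* (s≤s z≤n) y≥1)) ⊞
       le x4 (nat 2 :- one) (L≤ (s≤s z≤n) (ℕ.≤-trans N≥2 N≤X))) refl
     where
     y : ℕ
     y = N div 2
     y≥1 : 1 ℕ.≤ y
     y≥1 = ≤-div {N} {2} {1} (s≤s z≤n) N≥2

   -- By `U-bounds` the right side of `T-halving` is of linear size, and repeated halving sums a
   -- geometric series. The constant 8 leaves room for odd `N`.
   ψ≤ : ∀ N → N ℕ.≤ X → ψ N ≤ ι 8 * ι N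
   ψ≤ = <-rec _ go
     where
     go : ∀ N → (∀ {M} → M ℕ.< N → M ℕ.≤ X → ψ M ≤ ι 8 * ι M) → N ℕ.≤ X → ψ N ≤ ι 8 * ι N
     go 0 rec _ = lin ([]) 0 (nat 0) (nat 8 :* nat 0) (∅) refl
     go 1 rec _ = lin ((Λ 1) ∷ []) 0 (nat 0 :+ x0) (nat 8 :* nat 1) (le x0 (nat 0) (≤-reflexive Λ-1)) refl
     go N@(suc (suc _)) rec N≤X = lin ((ψ N) ∷ (ψ y) ∷ (T N) ∷ (T y) ∷ (ι y) ∷ (ι N) ∷ (L N) ∷ (L y) ∷ []) 0 x0 (nat 8 :* x5) (le (x0 :- x1) (x2 :- nat 2 :* x3) (T-halving N≤X) ⊞
         le x1 (nat 8 :* x4) (rec y<N (ℕ.≤-trans (div≤ N 2) N≤X)) ⊞ 8 ⊠ (le (nat 2 :* x4) x5 y₂) ⊞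
         2 ⊠ (le x5 (nat 2 :* x4 :+ one) y₃) ⊞ 2 ⊠ (le x7 (x4 :- one) (L≤ y≥1 y≤X)) ⊞
         le (nat 0) x7 (0≤L y≥1 y≤X) ⊞ le (nat 0) (x5 :* x6 :- x2) (proj₁ (U-bounds (s≤s z≤n) N≤X)) ⊞
         2 ⊠ (le (x4 :* x7 :- x3) x4 (proj₂ (U-bounds y≥1 y≤X))) ⊞
         (nn x5 (0≤ι N)) ⊛ (le x6 (x7 :+ nat 2) (L-halving (s≤s (s≤s z≤n)) N≤X)) ⊞
         (nn x7 (0≤L y≥1 y≤X)) ⊛ (le x5 (nat 2 :* x4 :+ one) y₃)) refl
       where
       y : ℕ
       y = N div 2
       y≤X : y ℕ.≤ X
       y≤X = ℕ.≤-trans (div≤ N 2) N≤X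
       y≥1 : 1 ℕ.≤ y
       y≥1 = ≤-div {N} {2} {1} (s≤s z≤n) (s≤s (s≤s z≤n))
       y₂ : ι 2 * ι y ≤ ι N
       y₂ = subst (_≤ ι N) (ι-* 2 y) (ι-mono (div-≤ N 2))
       y<N : y ℕ.< N
       y<N = linᴺ (y ∷ N ∷ []) 0 (nat 1 :+ x0) x1 (leᴺ (nat 2 :* x0) x1 (div-≤ N 2) ⊞ᴺ leᴺ (nat 1) x0 y≥1) refl
       y₃ : ι N ≤ ι 2 * ι y + 1ℚ
       y₃ = lin ((ι N) ∷ (ι y) ∷ []) 0 x0 (nat 2 :* x1 :+ one) (le (one :+ x0) (nat 2 :* (one :+ x1)) (subst (1ℚ + ι N ≤_) (ι-* 2 (suc y)) (ι-mono (div-< N {2} (s≤s z≤n))))) refl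

   -- Replacing `⌊N/d⌋` by `N/d - 1` in `T-Λ` costs one `ψ N`, which after division by `N` is the
   -- constant 8.
   Mert-upper : ∀ {N} → 1 ℕ.≤ N → N ℕ.≤ X → Mert N ≤ L N + ι 8
   Mert-upper {N@(suc N′)} N≥1 N≤X = ≤-cancel N′ (lin ((ι N) ∷ (Mert N) ∷ (ψ N) ∷ (T N) ∷ (L N) ∷ []) 0 (x0 :* x1) (x0 :* (x4 :+ nat 8)) (le (x0 :* x1 :+ ⊝ nat 1 :* x2) x3 MT ⊞
       le (nat 0) (x0 :* x4 :- x3) (proj₁ (U-bounds N≥1 N≤X)) ⊞ le x2 (nat 8 :* x0) (ψ≤ N N≤X)) refl)
     where
     MT : ι N * Mert N + - ι 1 * ψ N ≤ T N
     MT = ≤-trans (≤-reflexive (trans (cong₂ _+_ (sym (∑-* N (ι N) (λ d → Λ d * rec d))) (sym (∑-* N (- ι 1) Λ))) (sym (∑-+ N (λ d → ι N * (Λ d * rec d)) (λ d → - ι 1 * Λ d)))))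
       (≤-trans (∑-mono N (λ d p q → (lin ((Λ d) ∷ (ι N) ∷ (rec d) ∷ (ι (N div d)) ∷ []) 0 (x1 :* (x0 :* x2) :+ ⊝ nat 1 :* x0) (x0 :* x3) ((nn x0 (0≤Λ p (ℕ.≤-trans q N≤X))) ⊛ (le (x1 :* x2) (x3 :+ one) (ι-div-> N p))) refl))) (≤-reflexive (sym (T-Λ N))))

   H-L : ∀ {a b} → 1 ℕ.≤ a → a ℕ.≤ b → b ℕ.≤ X → H b - H a ≤ L b - L a + rec a × L b - L a ≤ H b - H a + rec a
   H-L {a} {b} a≥1 a≤b b≤X = strong (range-induction P base step a≤b b≤X)
     where
     P : ℕ → Set
     -- `1/(n+1)` differs from the bounds for the increment of `L` by `1/(n+1) - 1/(n+2)` and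
     -- `1/n - 1/(n+1)`. The invariants carry the telescoped remainders.
     P b = H b - H a ≤ L b - L a + rec (suc a) - rec (suc b) × L b - L a ≤ H b - H a + rec a - rec b
     base : P a
     base = (lin ((L a) ∷ (rec (suc a)) ∷ (H a) ∷ []) 0 (x2 :- x2) (x0 :- x0 :+ x1 :- x1) (∅) refl) , (lin ((H a) ∷ (rec a) ∷ (L a) ∷ []) 0 (x2 :- x2) (x0 :- x0 :+ x1 :- x1) (∅) refl)
     step : ∀ {n} → a ℕ.≤ n → n ℕ.< X → P n → P (suc n)
     step {n} p q (h , k) =
       (lin ((H n) ∷ (H a) ∷ (L n) ∷ (L a) ∷ (rec (suc a)) ∷ (rec (suc n)) ∷ (rec (suc (suc n))) ∷
           (L (suc n)) ∷ []) 0 (x0 :+ x5 :- x1) (x7 :- x3 :+ x4 :- x6) (le (x0 :- x1) (x2 :- x3 :+ x4 :- x5) h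
           ⊞ le x6 (x7 :- x2) (ΔL≥ (ℕ.≤-trans a≥1 p) q)) refl) ,
       (lin ((L n) ∷ (L a) ∷ (H n) ∷ (H a) ∷ (rec a) ∷ (rec n) ∷ (L (suc n)) ∷ (rec (suc n)) ∷ []) 0 (x6 :- x1) (x2 :+ x7 :- x3 :+ x4 :- x7) (le (x0 :- x1) (x2 :- x3 :+ x4 :- x5) k ⊞
           le (x6 :- x0) x5 (ΔL≤ (ℕ.≤-trans a≥1 p) q)) refl)
     strong : P b → H b - H a ≤ L b - L a + rec a × L b - L a ≤ H b - H a + rec a
     strong (h , k) = (lin ((H b) ∷ (H a) ∷ (L b) ∷ (L a) ∷ (rec (suc a)) ∷ (rec (suc b)) ∷ (rec a) ∷ []) 0 (x0 :- x1) (x2 :- x3 :+ x6) (le (x0 :- x1) (x2 :- x3 :+ x4 :- x5) h ⊞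
         le (nat 0) x5 (0≤rec (suc b)) ⊞ le x4 x6 (rec-anti a≥1 (ℕ.n≤1+n a))) refl) ,
       (lin ((L b) ∷ (L a) ∷ (H b) ∷ (H a) ∷ (rec a) ∷ (rec b) ∷ []) 0 (x0 :- x1) (x2 :- x3 :+ x4) (le (x0 :- x1) (x2 :- x3 :+ x4 :- x5) k ⊞
           le (nat 0) x5 (0≤rec b)) refl)

   Q : ℕ → ℚ
   Q n = ∑ n (λ N → L N * rec N)

   -- One increment of `L²` is `δ (2 L(n+1) - δ)`; its distance from `2 L(n+1)/(n+1)` is at most a
   -- multiple of `1/n - 1/(n+1)`, so the errors telescope to `rec a`. `c` bounds the logarithms
   -- that multiply them.
   Q-L² : ∀ {a b c} → 1 ℕ.≤ a → a ℕ.≤ b → b ℕ.≤ X → L b ≤ c →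
     ι 2 * (Q b - Q a) ≤ L b * L b - L a * L a + (ι 2 * c + ι 2) * rec a ×
     L b * L b - L a * L a ≤ ι 2 * (Q b - Q a) + (ι 2 * c + ι 2) * rec a
   Q-L² {a} {b} {c} a≥1 a≤b b≤X Lb≤c = strong (range-induction P base step a≤b ℕ.≤-refl)
     where
     err : ℕ → ℚ
     err n = (ι 2 * c + ι 2) * (rec a - rec n)
     P : ℕ → Set
     P n = ι 2 * (Q n - Q a) ≤ L n * L n - L a * L a + err n × L n * L n - L a * L a ≤ ι 2 * (Q n - Q a) + err n
     base : P a
     base = (lin ((L a) ∷ c ∷ (rec a) ∷ (Q a) ∷ []) 0 (nat 2 :* (x3 :- x3)) (x0 :* x0 :- x0 :* x0 :+ (nat 2 :* x1 :+ nat 2) :* (x2 :- x2)) (∅) refl) ,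
       (lin ((Q a) ∷ c ∷ (rec a) ∷ (L a) ∷ []) 0 (x3 :* x3 :- x3 :* x3) (nat 2 :* (x0 :- x0) :+ (nat 2 :* x1 :+ nat 2) :* (x2 :- x2)) (∅) refl)
     step : ∀ {n} → a ℕ.≤ n → n ℕ.< b → P n → P (suc n)
     step {n} p q (h , k) =
       (lin ((Q n) ∷ (Q a) ∷ (L n) ∷ (L a) ∷ c ∷ (rec a) ∷ r ∷ s ∷ δ ∷ (L (suc n)) ∷ []) 0 (nat 2 :* (x0 :+ x9 :* x7 :- x1)) (x9 :* x9 :- x3 :* x3 :+ (nat 2 :* x4 :+ nat 2) :* (x5 :- x7)) (le (nat 2 :* (x0 :- x1)) (x2 :* x2 :- x3 :* x3 :+ (nat 2 :* x4 :+ nat 2) :* (x5 :- x6)) h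
           ⊞ le (x8 :* x8) (nat 2 :* (x6 :- x7)) δ² ⊞
           le (x2 :* x2) ((x9 :- x8) :* (x9 :- x8)) (≤-reflexive Ln²) ⊞
           2 ⊠ ((le (x7 :- x8) (x6 :- x7) δ≥) ⊛ (nn x9 0≤L′)) ⊞
           2 ⊠ ((le x9 x4 Lc) ⊛ (nn (x6 :- x7) r-s≥0))) refl) ,
       (lin ((L n) ∷ (L a) ∷ (Q n) ∷ (Q a) ∷ c ∷ (rec a) ∷ r ∷ δ ∷ (L (suc n)) ∷ s ∷ []) 0 (x8 :* x8 :- x1 :* x1) (nat 2 :* (x2 :+ x8 :* x9 :- x3) :+ (nat 2 :* x4 :+ nat 2) :* (x5 :- x9)) (le (x0 :* x0 :- x1 :* x1) (nat 2 :* (x2 :- x3) :+ (nat 2 :* x4 :+ nat 2) :* (x5 :- x6)) k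
           ⊞ le (nat 0) (x7 :* x7) (0≤* 0≤δ 0≤δ) ⊞ 2 ⊠ (nn (x6 :- x9) r-s≥0) ⊞
           le ((x8 :- x7) :* (x8 :- x7)) (x0 :* x0) (≤-reflexive (sym Ln²)) ⊞
           2 ⊠ ((le x7 x6 δ≤) ⊛ (nn x8 0≤L′)) ⊞
           2 ⊠ ((le x8 x4 Lc) ⊛ (nn (x6 :- x9) r-s≥0))) refl)
       where
       n≥1 : 1 ℕ.≤ n
       n≥1 = ℕ.≤-trans a≥1 p
       n<X : n ℕ.< X
       n<X = ℕ.≤-trans q b≤X
       δ r s : ℚ
       δ = L (suc n) - L n
       r = rec n
       s = rec (suc n)
       Ln² : L n * L n ≡ (L (suc n) - δ) * (L (suc n) - δ)
       Ln² = ring-eq ((L n) ∷ (L (suc n)) ∷ []) (x0 :* x0) ((x1 :- (x1 :- x0)) :* (x1 :- (x1 :- x0))) refl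
       δ≤ : δ ≤ r
       δ≤ = ΔL≤ n≥1 n<X
       0≤δ : 0ℚ ≤ δ
       0≤δ = ≤⇒0≤- (0≤ΔL n≥1 n<X)
       r-s≥0 : 0ℚ ≤ r - s
       r-s≥0 = ≤⇒0≤- (rec-anti n≥1 (ℕ.n≤1+n n))
       δ≥ : s - δ ≤ r - s
       δ≥ = lin ((rec (suc (suc n))) ∷ δ ∷ s ∷ r ∷ []) 0 (x2 :- x1) (x3 :- x2) (le x0 x1 (ΔL≥ n≥1 n<X) ⊞
           le (x2 :- x0) (x2 :* x0) (≤-reflexive (rec-diff {suc n} (s≤s z≤n))) ⊞
           le (x3 :* x2) (x3 :- x2) (≤-reflexive (sym (rec-diff n≥1))) ⊞
           (nn x2 (0≤rec (suc n))) ⊛ (le x0 x3 (≤-trans (rec-anti {suc n} (s≤s z≤n) (ℕ.n≤1+n (suc n))) (rec-anti n≥1 (ℕ.n≤1+n n))))) refl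
       δ² : δ * δ ≤ ι 2 * (r - s)
       δ² = lin (δ ∷ r ∷ s ∷ []) 0 (x0 :* x0) (nat 2 :* (x1 :- x2)) (2 ⊠ (le (x1 :* x2) (x1 :- x2) (≤-reflexive (sym (rec-diff n≥1))))
           ⊞ (le x0 x1 δ≤) ⊛ (nn x0 0≤δ) ⊞ (le x0 x1 δ≤) ⊛ (nn x1 (0≤rec n)) ⊞
           (nn x1 (0≤rec n)) ⊛ (le x1 (nat 2 :* x2) (rec-double n≥1))) refl
       0≤L′ : 0ℚ ≤ L (suc n)
       0≤L′ = 0≤L {suc n} (s≤s z≤n) n<X
       Lc : L (suc n) ≤ c
       Lc = ≤-trans (L-mono (s≤s z≤n) q b≤X) Lb≤c
     strong : P b → _
     strong (h , k) =
       (lin ((Q b) ∷ (Q a) ∷ (L b) ∷ (L a) ∷ c ∷ (rec a) ∷ (rec b) ∷ []) 0 (nat 2 :* (x0 :- x1)) (x2 :* x2 :- x3 :* x3 :+ (nat 2 :* x4 :+ nat 2) :* x5) (le (nat 2 :* (x0 :- x1)) (x2 :* x2 :- x3 :* x3 :+ (nat 2 :* x4 :+ nat 2) :* (x5 :- x6)) h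
           ⊞ 2 ⊠ (nn x6 (0≤rec b)) ⊞
           2 ⊠ ((nn x6 (0≤rec b)) ⊛ (nn x4 c≥0))) refl) ,
       (lin ((L b) ∷ (L a) ∷ (Q b) ∷ (Q a) ∷ c ∷ (rec a) ∷ (rec b) ∷ []) 0 (x0 :* x0 :- x1 :* x1) (nat 2 :* (x2 :- x3) :+ (nat 2 :* x4 :+ nat 2) :* x5) (le (x0 :* x0 :- x1 :* x1) (nat 2 :* (x2 :- x3) :+ (nat 2 :* x4 :+ nat 2) :* (x5 :- x6)) k
           ⊞ 2 ⊠ (nn x6 (0≤rec b)) ⊞
           2 ⊠ ((nn x6 (0≤rec b)) ⊛ (nn x4 c≥0))) refl)
       where
       c≥0 : 0ℚ ≤ c
       c≥0 = ≤-trans (0≤L (ℕ.≤-trans a≥1 a≤b) b≤X) Lb≤c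

   U₂ : ℕ → ℚ
   U₂ n = ∑ n (λ k → (L n - L k) * (L n - L k))

   U-sum : ∀ n → ∑ n (λ k → L n - L k) ≡ U n
   U-sum n = begin
     ∑ n (λ k → L n - L k) ≡⟨ ∑-cong n (λ k _ _ → (ring-eq ((L n) ∷ (L k) ∷ []) (x0 :- x1) (x0 :+ ⊝ nat 1 :* x1) refl)) ⟩
     ∑ n (λ k → L n + - ι 1 * L k) ≡⟨ ∑-+ n (λ _ → L n) (λ k → - ι 1 * L k) ⟩
     ∑ n (λ _ → L n) + ∑ n (λ k → - ι 1 * L k) ≡⟨ cong₂ _+_ (∑-const n (L n)) (∑-* n (- ι 1) L) ⟩
     ι n * L n + - ι 1 * T n ≡⟨ ring-eq ((ι n) ∷ (L n) ∷ (T n) ∷ []) (x0 :* x1 :+ ⊝ nat 1 :* x2) (x0 :* x1 :- x2) refl ⟩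
     U n ∎
     where open ≡-Reasoning

   -- From `n` to `n + 1` all differences grow by the same `δ ≤ 1/n`, so the sum of squares grows by
   -- `2 δ U(n) + n δ²`, at most 3.
   U₂≤ : ∀ {n} → 1 ℕ.≤ n → n ℕ.≤ X → U₂ n ≤ ι 3 * ι n
   U₂≤ = range-induction (λ n → U₂ n ≤ ι 3 * ι n) (lin ((L 1) ∷ []) 0 (nat 0 :+ (x0 :- x0) :* (x0 :- x0)) (nat 3 :* nat 1) (∅) refl) step
     where
     step : ∀ {n} → 1 ℕ.≤ n → n ℕ.< X → U₂ n ≤ ι 3 * ι n → U₂ (suc n) ≤ ι 3 * ι (suc n)
     step {n} p q h = lin ((U₂ (suc n)) ∷ (U₂ n) ∷ δ ∷ (U n) ∷ (ι n) ∷ (rec n) ∷ []) 0 x0 (nat 3 :* (one :+ x4)) (le x0 (x1 :+ nat 2 :* x2 :* x3 :+ x4 :* (x2 :* x2)) (≤-reflexive expand)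
         ⊞ le x1 (nat 3 :* x4) h ⊞ 3 ⊠ (le (x4 :* x5) one (≤-reflexive (ι*rec′ p))) ⊞
         2 ⊠ ((nn x2 (≤⇒0≤- (0≤ΔL p q))) ⊛ (le x3 x4 (proj₂ (U-bounds p (ℕ.<⇒≤ q))))) ⊞
         3 ⊠ ((le x2 x5 (ΔL≤ p q)) ⊛ (nn x4 (0≤ι n))) ⊞
         (nn (x4 :* x2) (0≤* (0≤ι n) (≤⇒0≤- (0≤ΔL p q)))) ⊛ (le x2 one δ≤1)) refl
       where
       δ : ℚ
       δ = L (suc n) - L n
       δ≤1 : δ ≤ 1ℚ
       δ≤1 = ≤-trans (ΔL≤ p q) (rec≤1 p)
       u : ℕ → ℚ
       u k = L n - L k
       expand : U₂ (suc n) ≡ U₂ n + ι 2 * δ * U n + ι n * (δ * δ)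
       expand = begin
         ∑ n (λ k → (L (suc n) - L k) * (L (suc n) - L k)) + (L (suc n) - L (suc n)) * (L (suc n) - L (suc n))
           ≡⟨ cong₂ _+_ (∑-cong n (λ k _ _ → (ring-eq ((L (suc n)) ∷ (L k) ∷ (L n) ∷ []) ((x0 :- x1) :* (x0 :- x1)) ((x2 :- x1) :* (x2 :- x1) :+ (nat 2 :* (x0 :- x2) :* (x2 :- x1) :+ (x0 :- x2) :* (x0 :- x2))) refl)))
              (ring-eq ((L (suc n)) ∷ []) ((x0 :- x0) :* (x0 :- x0)) (nat 0) refl) ⟩
         ∑ n (λ k → u k * u k + (ι 2 * δ * u k + δ * δ)) + 0ℚ
           ≡⟨ cong (_+ 0ℚ) (trans (∑-+ n (λ k → u k * u k) (λ k → ι 2 * δ * u k + δ * δ)) (cong (U₂ n +_)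
                (trans (∑-+ n (λ k → ι 2 * δ * u k) (λ _ → δ * δ)) (cong₂ _+_ (trans (∑-* n (ι 2 * δ) u) (cong (ι 2 * δ *_) (U-sum n))) (∑-const n (δ * δ)))))) ⟩
         U₂ n + (ι 2 * δ * U n + ι n * (δ * δ)) + 0ℚ ≡⟨ ring-eq ((U₂ n) ∷ δ ∷ (U n) ∷ (ι n) ∷ []) (x0 :+ (nat 2 :* x1 :* x2 :+ x3 :* (x1 :* x1)) :+ nat 0) (x0 :+ nat 2 :* x1 :* x2 :+ x3 :* (x1 :* x1)) refl ⟩
         U₂ n + ι 2 * δ * U n + ι n * (δ * δ) ∎
         where open ≡-Reasoning

   -- Rounding the quotient loses less than one increment of `L`. The comparison uses
   -- `n (⌊z/n⌋ + 1)`, which may exceed `z` but not `2 z`.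
   L-div : ∀ {z n} → 1 ℕ.≤ n → n ℕ.≤ z → 2 ℕ.* z ℕ.≤ X → L n + L (z div n) ≤ L z × L z ≤ L n + L (z div n) + rec (z div n)
   L-div {z} {n} n≥1 n≤z 2z≤X =
     subst (_≤ L z) (L-* n≥1 a≥1) (L-mono (ℕ.*-mono-≤ n≥1 a≥1) (div-≤ z n) z≤X) ,
     (lin ((L z) ∷ (L (n ℕ.* suc (z div n))) ∷ (L n) ∷ (L (suc (z div n))) ∷ (L (z div n)) ∷
         (rec (z div n)) ∷ []) 0 x0 (x2 :+ x4 :+ x5) (le x0 x1 (L-mono (ℕ.≤-trans n≥1 n≤z) (ℕ.<⇒≤ (div-< z n≥1)) big) ⊞
         le x1 (x2 :+ x3) (≤-reflexive (L-* n≥1 (s≤s z≤n))) ⊞ le (x3 :- x4) x5 (ΔL≤ a≥1 a<X)) refl)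
     where
     z≤X : z ℕ.≤ X
     z≤X = ℕ.≤-trans (ℕ.m≤m+n z _) 2z≤X
     a≥1 : 1 ℕ.≤ z div n
     a≥1 = ≤-div {z} {n} {1} n≥1 (subst (ℕ._≤ z) (sym (ℕ.*-identityʳ n)) n≤z)
     big : n ℕ.* suc (z div n) ℕ.≤ X
     big = ℕ.≤-trans (ℕ.≤-reflexive (ℕ.*-suc n (z div n))) (linᴺ (n ∷ z ∷ (z div n) ∷ X ∷ []) 0 (x0 :+ x0 :* x2) x3 (leᴺ x0 x1 n≤z ⊞ᴺ leᴺ (x0 :* x2) x1 (div-≤ z n) ⊞ᴺ leᴺ (nat 2 :* x1) x3 2z≤X) refl)
     a<X : z div n ℕ.< X
     a<X = linᴺ (n ∷ z ∷ (z div n) ∷ X ∷ []) 0 (nat 1 :+ x2) x3 (leᴺ x0 x1 n≤z ⊞ᴺ leᴺ (nat 1) x0 n≥1 ⊞ᴺ leᴺ x2 x1 (div≤ z n) ⊞ᴺ leᴺ (nat 2 :* x1) x3 2z≤X) refl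

-- Selberg's symmetry formula for windows.

module SelbergWindows where

 open import Relation.Binary.PropositionalEquality
 open RationalArithmetic
 open DivisorSums
 open MoebiusMangoldt
 open IntegerLogarithm
 open MertensEstimates

 ∑-abs : ∀ n {f g : ℕ → ℚ} → (∀ i → 1 ℕ.≤ i → i ℕ.≤ n → - g i ≤ f i × f i ≤ g i) → - ∑ n g ≤ ∑ n f × ∑ n f ≤ ∑ n g
 ∑-abs n {f} {g} h = ≤-trans (≤-reflexive (trans (ring-eq ((∑ n g) ∷ []) (⊝ x0) (⊝ nat 1 :* x0) refl) (sym (∑-* n (- ι 1) g))))
     (∑-mono n (λ i p q → ≤-trans (lin ((g i) ∷ []) 0 (⊝ nat 1 :* x0) (⊝ x0) (∅) refl) (proj₁ (h i p q)))) ,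
   ∑-mono n (λ i p q → proj₂ (h i p q))

 -- `R (12 + C)` comes from `S-bound`; the rest covers the constants in the bounds for `Mert Y`,
 -- `lrec` and `ψrec`, rounded up to serve both directions.
 selbergError : ℕ → ℚ
 selbergError R = ι R * (ι 40 + ι 14 * ι R + ι 2 * (ι R * ι R))

 -- The formula is `L Y (Mert Y - Mert x) + W = 2 ℓ L Y +
 -- O(1)`. Its error depends only on the bound `R` for `Y/x` and so becomes negligible against `L
 -- Y`.
 module SelbergFormula {X : ℕ} (log : Logarithm X) {x Y R : ℕ} (x≥1 : 1 ℕ.≤ x) (x≤Y : x ℕ.≤ Y) (Y≤Rx : Y ℕ.≤ R ℕ.* x) (2Y≤X : 2 ℕ.* Y ℕ.≤ X) where
   open Estimates log

   private
     Y≥1 : 1 ℕ.≤ Y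
     Y≥1 = ℕ.≤-trans x≥1 x≤Y
     Y≤X : Y ℕ.≤ X
     Y≤X = ℕ.≤-trans (ℕ.m≤m+n Y _) 2Y≤X
     x≤X : x ℕ.≤ X
     x≤X = ℕ.≤-trans x≤Y Y≤X
     -- `κ` is dictated by `Φ n`. Up to rounding and the factor `1/n`, the difference of `Q` there
     -- is `ℓ u(n) - ℓ²/2`, while `- ℓ H(Y/n)` is `- ℓ (u(n) + g)`, with `g` in the role of Euler's
     -- constant. What is left to cancel is `ℓ²/2 + ℓ g`.
     ρ ℓ g κ : ℚ
     ρ = ι R
     ℓ = L Y - L x
     g = H Y - L Y
     κ = rec 2 * (ℓ * ℓ) + ℓ * g

     κ₂ : ι 2 * κ ≡ ℓ * ℓ + ι 2 * (ℓ * g)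
     κ₂ = trans (ring-eq ((rec 2) ∷ ℓ ∷ g ∷ []) (nat 2 :* (x0 :* (x1 :* x1) :+ x1 :* x2)) (nat 2 :* x0 :* (x1 :* x1) :+ nat 2 :* (x1 :* x2)) refl)
       (trans (cong (λ a → a * (ℓ * ℓ) + ι 2 * (ℓ * g)) (ι*rec 1)) (ring-eq (ℓ ∷ g ∷ []) (one :* (x0 :* x0) :+ nat 2 :* (x0 :* x1)) (x0 :* x0 :+ nat 2 :* (x0 :* x1)) refl))

     0≤ρ : 0ℚ ≤ ρ
     0≤ρ = 0≤ι R
     0≤ℓ : 0ℚ ≤ ℓ
     0≤ℓ = ≤⇒0≤- (L-mono x≥1 x≤Y Y≤X)
     Y≤ρx : ι Y ≤ ρ * ι x
     Y≤ρx = subst (ι Y ≤_) (ι-* R x) (ι-mono Y≤Rx)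
     ℓ≤ρ : ℓ ≤ ρ
     ℓ≤ρ = lin ((L Y) ∷ (L x) ∷ (ι Y) ∷ (ι x) ∷ (rec x) ∷ ρ ∷ []) 0 (x0 :- x1) x5 (le x0 (x1 :+ (x2 :- x3) :* x4) (L-growth x≥1 x≤Y Y≤X) ⊞
         le (x5 :* (x3 :* x4)) (x5 :* one) (≤-reflexive (cong (ρ *_) (ι*rec′ x≥1))) ⊞
         le one (x3 :* x4) (≤-reflexive (sym (ι*rec′ x≥1))) ⊞
         (le x2 (x5 :* x3) Y≤ρx) ⊛ (nn x4 (0≤rec x))) refl
     H1 : H 1 ≡ 1ℚ
     H1 = trans (ℚₚ.+-identityˡ (rec 1)) rec-1
     0≤g : 0ℚ ≤ g
     0≤g = lin ((L Y) ∷ (L 1) ∷ (H Y) ∷ (H 1) ∷ (rec 1) ∷ []) 0 (nat 0) (x2 :- x0) (le (x0 :- x1) (x2 :- x3 :+ x4) (proj₂ (H-L ℕ.≤-refl Y≥1 Y≤X)) ⊞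
         le x1 (nat 0) (≤-reflexive L-1) ⊞ le one x3 (≤-reflexive (sym H1)) ⊞
         le x4 one (≤-reflexive rec-1)) refl
     g≤2 : g ≤ ι 2
     g≤2 = lin ((H Y) ∷ (H 1) ∷ (L Y) ∷ (L 1) ∷ (rec 1) ∷ []) 0 (x0 :- x2) (nat 2) (le (x0 :- x1) (x2 :- x3 :+ x4) (proj₁ (H-L ℕ.≤-refl Y≥1 Y≤X)) ⊞
         le (nat 0) x3 (≤-reflexive (sym L-1)) ⊞ le x1 one (≤-reflexive H1) ⊞
         le x4 one (≤-reflexive rec-1)) refl
     0≤κ : 0ℚ ≤ κ
     0≤κ = lin (κ ∷ ℓ ∷ g ∷ []) 1 (nat 0) x0 (le (x1 :* x1 :+ nat 2 :* (x1 :* x2)) (nat 2 :* x0) (≤-reflexive (sym κ₂)) ⊞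
         (nn x1 0≤ℓ) ⊛ (nn x1 0≤ℓ) ⊞
         2 ⊠ ((nn x1 0≤ℓ) ⊛ (nn x2 0≤g))) refl
     κ≤ : ι 2 * κ ≤ ρ * ρ + ι 4 * ρ
     κ≤ = lin (κ ∷ ℓ ∷ g ∷ ρ ∷ []) 0 (nat 2 :* x0) (x3 :* x3 :+ nat 4 :* x3) (le (nat 2 :* x0) (x1 :* x1 :+ nat 2 :* (x1 :* x2)) (≤-reflexive κ₂)
         ⊞ 4 ⊠ (le x1 x3 ℓ≤ρ) ⊞ 2 ⊠ ((nn x1 0≤ℓ) ⊛ (le x2 (nat 2) g≤2)) ⊞
         (nn x1 0≤ℓ) ⊛ (le x1 x3 ℓ≤ρ) ⊞ (le x1 x3 ℓ≤ρ) ⊛ (nn x3 0≤ρ)) refl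

     -- The mass of `(x/k, Y/k]` over `k`, minus its expected value, plus a constant that makes the
     -- sums `Φ n` over multiples of `n` small. The sum `S` of `μ(n) u(n) Φ(n)` is evaluated twice:
     -- regrouped by divisors it contains the symmetry formula, and through `Φ` it is bounded.
     F : ℕ → ℚ
     F k = rec k * (Mert (Y div k) - Mert (x div k)) + (- ℓ * rec k + κ * rec Y)

     u Φ : ℕ → ℚ
     u n = L Y - L n
     Φ n = ∑ (Y div n) (λ m → F (n ℕ.* m))

     C : ℚ
     C = ι 2 + ι 9 * ρ + ι 2 * (ρ * ρ)

     -- `divisorSum-Λ` under the completely multiplicative weight `1/k`.
     mert-convolution : ∀ B → ∑ B (λ m → rec m * Mert (B div m)) ≡ Q B
     mert-convolution B = begin
       ∑ B (λ m → rec m * Mert (B div m)) ≡⟨ ∑-cong B (λ m _ _ → sym (∑-* (B div m) (rec m) (λ l → Λ l * rec l))) ⟩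
       ∑ B (λ m → ∑ (B div m) (λ l → rec m * (Λ l * rec l))) ≡⟨ ∑-div-swap B (λ m l → rec m * (Λ l * rec l)) ⟩
       ∑ B (λ l → ∑ (B div l) (λ m → rec m * (Λ l * rec l)))
         ≡⟨ ∑-cong B (λ l _ _ → ∑-cong (B div l) (λ m _ _ → trans (ring-eq ((rec m) ∷ (Λ l) ∷ (rec l) ∷ []) (x0 :* (x1 :* x2)) (x2 :* x0 :* x1) refl) (cong (_* Λ l) (sym (rec-* l m))))) ⟩
       ∑ B (λ l → ∑ (B div l) (λ m → rec (l ℕ.* m) * Λ l)) ≡⟨ ∑-divisors B (λ l k → rec k * Λ l) ⟩
       ∑ B (λ k → divisorSum (λ l → rec k * Λ l) k)
         ≡⟨ ∑-cong B (λ k p _ → trans (divisorSum-* (rec k) Λ k) (trans (cong (rec k *_) (divisorSum-Λ p)) (ℚₚ.*-comm (rec k) (L k)))) ⟩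
       Q B ∎
       where open ≡-Reasoning

     mert-convolution′ : ∀ {A B} → A ℕ.≤ B → ∑ B (λ m → rec m * Mert (A div m)) ≡ Q A
     mert-convolution′ {A} {B} A≤B = trans
       (∑-extend (λ m → rec m * Mert (A div m)) A≤B (λ m p _ → trans (cong (λ k → rec m * Mert k) (div≡0 (ℕ.≤-trans (s≤s z≤n) p) p)) (ℚₚ.zeroʳ (rec m))))
       (mert-convolution A)

     Φ-formula : ∀ n → Φ n ≡ rec n * (Q (Y div n) - Q (x div n)) + (- ℓ * rec n * H (Y div n) + ι (Y div n) * (κ * rec Y))
     Φ-formula n = begin
       ∑ b (λ m → F (n ℕ.* m)) ≡⟨ ∑-cong b (λ m _ _ → pointwise m) ⟩
       ∑ b (λ m → rec n * (rec m * Mert (b div m)) + (- rec n * (rec m * Mert (a div m)) + (- ℓ * rec n * rec m + κ * rec Y)))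
         ≡⟨ trans (∑-+ b _ _) (cong (∑ b (λ m → rec n * (rec m * Mert (b div m))) +_) (trans (∑-+ b _ _) (cong (∑ b (λ m → - rec n * (rec m * Mert (a div m))) +_) (∑-+ b _ _)))) ⟩
       ∑ b (λ m → rec n * (rec m * Mert (b div m))) + (∑ b (λ m → - rec n * (rec m * Mert (a div m))) + (∑ b (λ m → - ℓ * rec n * rec m) + ∑ b (λ _ → κ * rec Y)))
         ≡⟨ cong₂ _+_ (trans (∑-* b (rec n) _) (cong (rec n *_) (mert-convolution b)))
              (cong₂ _+_ (trans (∑-* b (- rec n) _) (cong (- rec n *_) (mert-convolution′ (div-mono n x≤Y))))
                (cong₂ _+_ (∑-* b (- ℓ * rec n) rec) (∑-const b (κ * rec Y)))) ⟩
       rec n * Q b + (- rec n * Q a + (- ℓ * rec n * H b + ι b * (κ * rec Y)))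
         ≡⟨ ring-eq ((rec n) ∷ (Q b) ∷ (Q a) ∷ ℓ ∷ (H b) ∷ (ι b) ∷ κ ∷ (rec Y) ∷ []) (x0 :* x1 :+ (⊝ x0 :* x2 :+ (⊝ x3 :* x0 :* x4 :+ x5 :* (x6 :* x7)))) (x0 :* (x1 :- x2) :+ (⊝ x3 :* x0 :* x4 :+ x5 :* (x6 :* x7))) refl ⟩
       rec n * (Q b - Q a) + (- ℓ * rec n * H b + ι b * (κ * rec Y)) ∎
       where
       open ≡-Reasoning
       a b : ℕ
       a = x div n
       b = Y div n
       pointwise : ∀ m → F (n ℕ.* m) ≡ rec n * (rec m * Mert (b div m)) + (- rec n * (rec m * Mert (a div m)) + (- ℓ * rec n * rec m + κ * rec Y))
       pointwise m = trans (cong₂ _+_ (cong₂ _*_ (rec-* n m) (cong₂ (λ k l → Mert k - Mert l) (sym (div-div Y n m)) (sym (div-div x n m)))) (cong (λ z → - ℓ * z + κ * rec Y) (rec-* n m)))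
         (ring-eq ((rec n) ∷ (rec m) ∷ (Mert (b div m)) ∷ (Mert (a div m)) ∷ ℓ ∷ κ ∷ (rec Y) ∷ []) (x0 :* x1 :* (x2 :- x3) :+ (⊝ x4 :* (x0 :* x1) :+ x5 :* x6)) (x0 :* (x1 :* x2) :+ (⊝ x0 :* (x1 :* x3) :+ (⊝ x4 :* x0 :* x1 :+ x5 :* x6))) refl)

     0≤u : ∀ {n} → 1 ℕ.≤ n → n ℕ.≤ Y → 0ℚ ≤ u n
     0≤u p q = ≤⇒0≤- (L-mono p q Y≤X)

     L-divY : ∀ {z n} → 1 ℕ.≤ n → n ℕ.≤ z → z ℕ.≤ Y → L n + L (z div n) ≤ L z × L z ≤ L n + L (z div n) + rec (z div n)
     L-divY n≥1 n≤z z≤Y = L-div n≥1 n≤z (ℕ.≤-trans (ℕ.*-monoʳ-≤ 2 z≤Y) 2Y≤X)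

     scale : ∀ {n} E → 1 ℕ.≤ n → ι x * E ≤ ι n * (ι 4 * u n + C) → ι x * (rec n * E) ≤ ι 4 * u n + C
     scale {n} E n≥1 h = lin ((ι x) ∷ E ∷ (ι n) ∷ (u n) ∷ C ∷ (rec n) ∷ []) 0 (x0 :* (x5 :* x1)) (nat 4 :* x3 :+ x4) (le (x2 :* x5 :* (nat 4 :* x3 :+ x4)) (one :* (nat 4 :* x3 :+ x4)) (≤-reflexive (cong (_* (ι 4 * u n + C)) (ι*rec′ n≥1)))
         ⊞ (le (x0 :* x1) (x2 :* (nat 4 :* x3 :+ x4)) h) ⊛ (nn x5 (0≤rec n))) refl

     -- The reciprocals of the rounded quotients are of size `n/x`, and they multiply logarithms of
     -- size at most `u n`; hence a bound linear in `u n`.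
     Φ-bound : ∀ n → 1 ℕ.≤ n → n ℕ.≤ Y → - (ι 4 * u n + C) ≤ ι x * Φ n × ι x * Φ n ≤ ι 4 * u n + C
     Φ-bound n n≥1 n≤Y = (lin ((ι x) ∷ (rec n) ∷ E ∷ (u n) ∷ C ∷ (Φ n) ∷ []) 0 (⊝ (nat 4 :* x3 :+ x4)) (x0 :* x5) (le (x0 :* (x1 :* ⊝ x2)) (nat 4 :* x3 :+ x4) (scale (- E) n≥1 lo)
         ⊞ le (x0 :* (x1 :* x2)) (x0 :* x5) (≤-reflexive (sym Φ≡))) refl) ,
       (lin ((ι x) ∷ (rec n) ∷ E ∷ (u n) ∷ C ∷ (Φ n) ∷ []) 0 (x0 :* x5) (nat 4 :* x3 :+ x4) (le (x0 :* (x1 :* x2)) (nat 4 :* x3 :+ x4) (scale E n≥1 hi) ⊞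
           le (x0 :* x5) (x0 :* (x1 :* x2)) (≤-reflexive Φ≡)) refl)
       where
       a b : ℕ
       a = x div n
       b = Y div n
       w E : ℚ
       w = ι n * ι b * rec Y
       E = Q b - Q a - ℓ * H b + κ * w
       b≥1 : 1 ℕ.≤ b
       b≥1 = ≤-div {Y} {n} {1} n≥1 (subst (ℕ._≤ Y) (sym (ℕ.*-identityʳ n)) n≤Y)
       b≤X : b ℕ.≤ X
       b≤X = ℕ.≤-trans (div≤ Y n) Y≤X
       Φ≡ : ι x * Φ n ≡ ι x * (rec n * E)
       Φ≡ = cong (ι x *_) (trans (Φ-formula n) (trans
         (ring-eq ((rec n) ∷ (Q b) ∷ (Q a) ∷ ℓ ∷ (H b) ∷ (ι b) ∷ κ ∷ (rec Y) ∷ []) (x0 :* (x1 :- x2) :+ (⊝ x3 :* x0 :* x4 :+ x5 :* (x6 :* x7))) (x0 :* (x1 :- x2) :+ (⊝ x3 :* x0 :* x4 :+ one :* (x5 :* (x6 :* x7)))) refl)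
         (trans (cong (λ z → rec n * (Q b - Q a) + (- ℓ * rec n * H b + z * (ι b * (κ * rec Y)))) (sym (ι*rec′ n≥1)))
           (ring-eq ((rec n) ∷ (Q b) ∷ (Q a) ∷ ℓ ∷ (H b) ∷ (ι n) ∷ (ι b) ∷ κ ∷ (rec Y) ∷ []) (x0 :* (x1 :- x2) :+ (⊝ x3 :* x0 :* x4 :+ x5 :* x0 :* (x6 :* (x7 :* x8)))) (x0 :* (x1 :- x2 :- x3 :* x4 :+ x7 :* (x5 :* x6 :* x8))) refl))))
       nb≤Y : ι n * ι b ≤ ι Y
       nb≤Y = subst (_≤ ι Y) (ι-* n b) (ι-mono (div-≤ Y n))
       0≤w : 0ℚ ≤ w
       0≤w = 0≤* (0≤* (0≤ι n) (0≤ι b)) (0≤rec Y)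
       w≤1 : w ≤ 1ℚ
       w≤1 = lin ((ι n) ∷ (ι b) ∷ (ι Y) ∷ (rec Y) ∷ []) 0 (x0 :* x1 :* x3) one (le (x2 :* x3) one (≤-reflexive (ι*rec′ Y≥1)) ⊞
           (le (x0 :* x1) x2 nb≤Y) ⊛ (nn x3 (0≤rec Y))) refl
       0≤un : 0ℚ ≤ u n
       0≤un = 0≤u n≥1 n≤Y

       bounds : ι x * E ≤ ι n * (ι 4 * u n + C) × ι x * (- E) ≤ ι n * (ι 4 * u n + C)
       bounds with n ℕ.≤? x
       -- Both quotients are positive. `α`, `β`, `τ` and `θ` are the rounding errors in `L (x/n)`,
       -- `L (Y/n)`, `H (Y/n)` and `n ⌊Y/n⌋ / Y`; the main terms cancel by the choice of `κ`.
       ... | yes n≤x = near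
         where
         a≥1 : 1 ℕ.≤ a
         a≥1 = ≤-div {x} {n} {1} n≥1 (subst (ℕ._≤ x) (sym (ℕ.*-identityʳ n)) n≤x)
         a≤b : a ℕ.≤ b
         a≤b = div-mono n x≤Y
         ra la lb un q h α β τ θ : ℚ
         ra = rec a
         la = L a
         lb = L b
         un = u n
         q = Q b - Q a
         h = H b
         α = L x - L n - la
         β = un - lb
         τ = h - lb - g
         θ = 1ℚ - w
         0≤ra : 0ℚ ≤ ra
         0≤ra = 0≤rec a
         rb≤ra : rec b ≤ ra
         rb≤ra = rec-anti a≥1 a≤b
         0≤α : 0ℚ ≤ α
         0≤α = lin ((L n) ∷ (L a) ∷ (L x) ∷ []) 0 (nat 0) (x2 :- x0 :- x1) (le (x0 :+ x1) x2 (proj₁ (L-divY n≥1 n≤x x≤Y))) refl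
         α≤ : α ≤ ra
         α≤ = lin ((L x) ∷ (L n) ∷ (L a) ∷ (rec a) ∷ []) 0 (x0 :- x1 :- x2) x3 (le x0 (x1 :+ x2 :+ x3) (proj₂ (L-divY n≥1 n≤x x≤Y))) refl
         0≤β : 0ℚ ≤ β
         0≤β = lin ((L n) ∷ (L b) ∷ (L Y) ∷ []) 0 (nat 0) (x2 :- x0 :- x1) (le (x0 :+ x1) x2 (proj₁ (L-divY n≥1 n≤Y ℕ.≤-refl))) refl
         β≤ : β ≤ ra
         β≤ = lin ((L Y) ∷ (L n) ∷ (L b) ∷ (rec b) ∷ ra ∷ []) 0 (x0 :- x1 :- x2) x4 (le x0 (x1 :+ x2 :+ x3) (proj₂ (L-divY n≥1 n≤Y ℕ.≤-refl)) ⊞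
             le x3 x4 rb≤ra) refl
         la≡ : la ≡ un - ℓ - α
         la≡ = ring-eq ((L a) ∷ (L Y) ∷ (L n) ∷ (L x) ∷ []) x0 (x1 :- x2 :- (x1 :- x3) :- (x3 :- x2 :- x0)) refl
         lb≡ : lb ≡ un - β
         lb≡ = ring-eq (lb ∷ un ∷ []) x0 (x1 :- (x1 :- x0)) refl
         h≡ : h ≡ lb + g + τ
         h≡ = ring-eq (h ∷ lb ∷ g ∷ []) x0 (x1 :+ x2 :+ (x0 :- x1 :- x2)) refl
         τ≤ : τ ≤ ra
         τ≤ = lin ((L Y) ∷ (L b) ∷ (H Y) ∷ (H b) ∷ (rec b) ∷ ra ∷ []) 0 (x3 :- x1 :- (x2 :- x0)) x5 (le (x0 :- x1) (x2 :- x3 :+ x4) (proj₂ (H-L b≥1 (div≤ Y n) Y≤X))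
             ⊞ le x4 x5 rb≤ra) refl
         -ra≤τ : - ra ≤ τ
         -ra≤τ = lin ((H Y) ∷ (H b) ∷ (L Y) ∷ (L b) ∷ (rec b) ∷ ra ∷ []) 0 (⊝ x5) (x1 :- x3 :- (x0 :- x2)) (le (x0 :- x1) (x2 :- x3 :+ x4) (proj₁ (H-L b≥1 (div≤ Y n) Y≤X))
             ⊞ le x4 x5 rb≤ra) refl
         0≤θ : 0ℚ ≤ θ
         0≤θ = lin (w ∷ []) 0 (nat 0) (one :- x0) (le x0 one w≤1) refl
         xθ≤n : ι x * θ ≤ ι n
         xθ≤n = lin ((ι Y) ∷ (ι n) ∷ (ι b) ∷ (ι x) ∷ (rec Y) ∷ []) 0 (x3 :* (one :- x1 :* x2 :* x4)) x1 (le (x3 :* one) (x3 :* (x0 :* x4)) (≤-reflexive (sym (cong (ι x *_) (ι*rec′ Y≥1))))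
             ⊞ le (x1 :* (x0 :* x4)) (x1 :* one) (≤-reflexive (cong (ι n *_) (ι*rec′ Y≥1))) ⊞
             (le x0 (x1 :* (one :+ x2)) (subst (ι Y ≤_) (ι-* n (suc b)) (ι-mono (ℕ.<⇒≤ (div-< Y n≥1))))) ⊛ (nn (x3 :* x4) (0≤* (0≤ι x) (0≤rec Y)))
             ⊞ (le x3 x0 (ι-mono x≤Y)) ⊛ (nn (x1 :* x4) (0≤* (0≤ι n) (0≤rec Y)))) refl
         xra≤2n : ι x * ra ≤ ι 2 * ι n
         xra≤2n = lin ((ι x) ∷ (ι n) ∷ (ι a) ∷ (rec a) ∷ []) 0 (x0 :* x3) (nat 2 :* x1) (le (x1 :* (x2 :* x3)) (x1 :* one) (≤-reflexive (cong (ι n *_) (ι*rec′ a≥1)))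
             ⊞
             (le x0 (x1 :* (one :+ x2)) (subst (ι x ≤_) (ι-* n (suc a)) (ι-mono (ℕ.<⇒≤ (div-< x n≥1))))) ⊛ (nn x3 (0≤rec a))
             ⊞ (le x3 one (rec≤1 a≥1)) ⊛ (nn x1 (0≤ι n))) refl
         lb≤un : lb ≤ un
         lb≤un = lin (un ∷ lb ∷ []) 0 x1 x0 (nn (x0 :- x1) 0≤β) refl
         0≤la : 0ℚ ≤ la
         0≤la = 0≤L a≥1 (ℕ.≤-trans (div≤ x n) x≤X)
         0≤lb : 0ℚ ≤ lb
         0≤lb = 0≤L b≥1 b≤X
         la≤un : la ≤ un
         la≤un = ≤-trans (L-mono a≥1 a≤b b≤X) lb≤un
         -- 2E, with the logarithms of ⌊x/n⌋ and ⌊Y/n⌋ eliminated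
         expand : ι 2 * E ≡ (ι 2 * q - (lb * lb - la * la)) + ((α - β) * (lb + la) + ℓ * (β - α) - ι 2 * (ℓ * τ) - ι 2 * κ * θ)
         expand = begin
           ι 2 * (q - ℓ * h + κ * w) ≡⟨ ring-eq (q ∷ ℓ ∷ h ∷ κ ∷ w ∷ []) (nat 2 :* (x0 :- x1 :* x2 :+ x3 :* x4)) (nat 2 :* x0 :- nat 2 :* (x1 :* x2) :+ nat 2 :* x3 :- nat 2 :* x3 :* (one :- x4)) refl ⟩
           ι 2 * q - ι 2 * (ℓ * h) + ι 2 * κ - ι 2 * κ * θ ≡⟨ cong₂ (λ s t → ι 2 * q - ι 2 * (ℓ * s) + t - ι 2 * κ * θ) h≡ κ₂ ⟩
           ι 2 * q - ι 2 * (ℓ * (lb + g + τ)) + (ℓ * ℓ + ι 2 * (ℓ * g)) - ι 2 * κ * θ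
             ≡⟨ cong (λ s → ι 2 * q - ι 2 * (ℓ * (s + g + τ)) + (ℓ * ℓ + ι 2 * (ℓ * g)) - ι 2 * κ * θ) lb≡ ⟩
           ι 2 * q - ι 2 * (ℓ * (un - β + g + τ)) + (ℓ * ℓ + ι 2 * (ℓ * g)) - ι 2 * κ * θ
             ≡⟨ ring-eq (q ∷ ℓ ∷ un ∷ β ∷ g ∷ τ ∷ κ ∷ θ ∷ α ∷ []) (nat 2 :* x0 :- nat 2 :* (x1 :* (x2 :- x3 :+ x4 :+ x5)) :+ (x1 :* x1 :+ nat 2 :* (x1 :* x4)) :- nat 2 :* x6 :* x7) (nat 2 :* x0 :- ((x2 :- x3) :* (x2 :- x3) :- (x2 :- x1 :- x8) :* (x2 :- x1 :- x8)) :+ ((x8 :- x3) :* (x2 :- x3 :+ (x2 :- x1 :- x8)) :+ x1 :* (x3 :- x8) :- nat 2 :* (x1 :* x5) :- nat 2 :* x6 :* x7)) refl ⟩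
           (ι 2 * q - ((un - β) * (un - β) - (un - ℓ - α) * (un - ℓ - α))) + ((α - β) * (un - β + (un - ℓ - α)) + ℓ * (β - α) - ι 2 * (ℓ * τ) - ι 2 * κ * θ)
             ≡⟨ cong₂ (λ s t → (ι 2 * q - (s * s - t * t)) + ((α - β) * (s + t) + ℓ * (β - α) - ι 2 * (ℓ * τ) - ι 2 * κ * θ)) (sym lb≡) (sym la≡) ⟩
           (ι 2 * q - (lb * lb - la * la)) + ((α - β) * (lb + la) + ℓ * (β - α) - ι 2 * (ℓ * τ) - ι 2 * κ * θ) ∎
           where open ≡-Reasoning
         q≤ : ι 2 * q - (lb * lb - la * la) ≤ (ι 2 * un + ι 2) * ra
         q≤ = lin ((Q b) ∷ (Q a) ∷ lb ∷ la ∷ un ∷ ra ∷ []) 0 (nat 2 :* (x0 :- x1) :- (x2 :* x2 :- x3 :* x3)) ((nat 2 :* x4 :+ nat 2) :* x5) (le (nat 2 :* (x0 :- x1)) (x2 :* x2 :- x3 :* x3 :+ (nat 2 :* x4 :+ nat 2) :* x5) (proj₁ (Q-L² {c = un} a≥1 a≤b b≤X lb≤un))) refl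
         ≤q : - ((ι 2 * un + ι 2) * ra) ≤ ι 2 * q - (lb * lb - la * la)
         ≤q = lin (lb ∷ la ∷ (Q b) ∷ (Q a) ∷ un ∷ ra ∷ []) 0 (⊝ ((nat 2 :* x4 :+ nat 2) :* x5)) (nat 2 :* (x2 :- x3) :- (x0 :* x0 :- x1 :* x1)) (le (x0 :* x0 :- x1 :* x1) (nat 2 :* (x2 :- x3) :+ (nat 2 :* x4 :+ nat 2) :* x5) (proj₂ (Q-L² {c = un} a≥1 a≤b b≤X lb≤un))) refl
         e₁ : (α - β) * (lb + la) ≤ ra * (ι 2 * un)
         e₁ = lin (α ∷ ra ∷ β ∷ la ∷ lb ∷ un ∷ []) 0 ((x0 :- x2) :* (x4 :+ x3)) (x1 :* (nat 2 :* x5)) ((le x0 x1 α≤) ⊛ (nn x3 0≤la) ⊞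
             (le x0 x1 α≤) ⊛ (nn x4 0≤lb) ⊞ (nn x2 0≤β) ⊛ (nn x3 0≤la) ⊞
             (nn x2 0≤β) ⊛ (nn x4 0≤lb) ⊞ (nn x1 0≤ra) ⊛ (le x3 x5 la≤un) ⊞
             (nn x1 0≤ra) ⊛ (le x4 x5 lb≤un)) refl
         e₁′ : - (ra * (ι 2 * un)) ≤ (α - β) * (lb + la)
         e₁′ = lin (β ∷ ra ∷ α ∷ la ∷ lb ∷ un ∷ []) 0 (⊝ (x1 :* (nat 2 :* x5))) ((x2 :- x0) :* (x4 :+ x3)) ((le x0 x1 β≤) ⊛ (nn x3 0≤la)
             ⊞ (le x0 x1 β≤) ⊛ (nn x4 0≤lb) ⊞ (nn x2 0≤α) ⊛ (nn x3 0≤la) ⊞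
             (nn x2 0≤α) ⊛ (nn x4 0≤lb) ⊞ (nn x1 0≤ra) ⊛ (le x3 x5 la≤un) ⊞
             (nn x1 0≤ra) ⊛ (le x4 x5 lb≤un)) refl
         e₂ : ℓ * (β - α) - ι 2 * (ℓ * τ) ≤ ι 3 * (ℓ * ra)
         e₂ = lin (ℓ ∷ β ∷ ra ∷ α ∷ τ ∷ []) 0 (x0 :* (x1 :- x3) :- nat 2 :* (x0 :* x4)) (nat 3 :* (x0 :* x2)) ((nn x0 0≤ℓ) ⊛ (le x1 x2 β≤)
             ⊞ (nn x0 0≤ℓ) ⊛ (nn x3 0≤α) ⊞
             2 ⊠ ((nn x0 0≤ℓ) ⊛ (le (⊝ x2) x4 -ra≤τ))) refl
         e₂′ : - (ι 3 * (ℓ * ra)) ≤ ℓ * (β - α) - ι 2 * (ℓ * τ)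
         e₂′ = lin (ℓ ∷ α ∷ ra ∷ β ∷ τ ∷ []) 0 (⊝ (nat 3 :* (x0 :* x2))) (x0 :* (x3 :- x1) :- nat 2 :* (x0 :* x4)) ((nn x0 0≤ℓ) ⊛ (le x1 x2 α≤)
             ⊞ (nn x0 0≤ℓ) ⊛ (nn x3 0≤β) ⊞
             2 ⊠ ((nn x0 0≤ℓ) ⊛ (le x4 x2 τ≤))) refl
         e₃ : 0ℚ ≤ ι 2 * κ * θ
         e₃ = 0≤* (0≤* (0≤ι 2) 0≤κ) 0≤θ
         e₄ : ι x * (ι 2 * κ * θ) ≤ ι 2 * κ * ι n
         e₄ = lin ((ι x) ∷ θ ∷ (ι n) ∷ κ ∷ []) 0 (x0 :* (nat 2 :* x3 :* x1)) (nat 2 :* x3 :* x2) (2 ⊠ ((le (x0 :* x1) x2 xθ≤n) ⊛ (nn x3 0≤κ))) refl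
         total : ι x * ((ι 4 * un + ι 2 + ι 3 * ℓ) * ra) + ι 2 * κ * ι n ≤ ι 2 * (ι n * (ι 4 * un + C))
         total = lin ((ι x) ∷ ra ∷ (ι n) ∷ un ∷ ℓ ∷ κ ∷ ρ ∷ []) 0 (x0 :* ((nat 4 :* x3 :+ nat 2 :+ nat 3 :* x4) :* x1) :+ nat 2 :* x5 :* x2) (nat 2 :* (x2 :* (nat 4 :* x3 :+ (nat 2 :+ nat 9 :* x6 :+ nat 2 :* (x6 :* x6))))) (2 ⊠ (le (x0 :* x1) (nat 2 :* x2) xra≤2n)
             ⊞ 8 ⊠ (nn (x2 :* x6) (0≤* (0≤ι n) 0≤ρ)) ⊞
             3 ⊠ (nn (x2 :* (x6 :* x6)) (0≤* (0≤ι n) (0≤* 0≤ρ 0≤ρ))) ⊞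
             4 ⊠ ((le (x0 :* x1) (nat 2 :* x2) xra≤2n) ⊛ (nn x3 0≤un)) ⊞
             3 ⊠ ((le (x0 :* x1) (nat 2 :* x2) xra≤2n) ⊛ (nn x4 0≤ℓ)) ⊞
             (le (nat 2 :* x5) (x6 :* x6 :+ nat 4 :* x6) κ≤) ⊛ (nn x2 (0≤ι n)) ⊞
             6 ⊠ ((nn x2 (0≤ι n)) ⊛ (le x4 x6 ℓ≤ρ))) refl
         near : ι x * E ≤ ι n * (ι 4 * u n + C) × ι x * (- E) ≤ ι n * (ι 4 * u n + C)
         near = ≤-cancel 1 (lin (E ∷ q ∷ lb ∷ la ∷ α ∷ β ∷ ℓ ∷ τ ∷ κ ∷ θ ∷ (ι x) ∷ un ∷ ra ∷ (ι n) ∷ C ∷ []) 0 (nat 2 :* (x10 :* x0)) (nat 2 :* (x13 :* (nat 4 :* x11 :+ x14))) (le (x10 :* (nat 2 :* x0)) (x10 :* (nat 2 :* x1 :- (x2 :* x2 :- x3 :* x3) :+ ((x4 :- x5) :* (x2 :+ x3) :+ x6 :* (x5 :- x4) :- nat 2 :* (x6 :* x7) :- nat 2 :* x8 :* x9))) (≤-reflexive (cong (ι x *_) expand))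
             ⊞
             le (x10 :* ((nat 4 :* x11 :+ nat 2 :+ nat 3 :* x6) :* x12) :+ nat 2 :* x8 :* x13) (nat 2 :* (x13 :* (nat 4 :* x11 :+ x14))) total
             ⊞ 2 ⊠ (nn (x8 :* x13) (0≤* 0≤κ (0≤ι n))) ⊞
             (nn x10 (0≤ι x)) ⊛ (le (nat 2 :* x1 :- (x2 :* x2 :- x3 :* x3)) ((nat 2 :* x11 :+ nat 2) :* x12) q≤)
             ⊞ (nn x10 (0≤ι x)) ⊛ (le ((x4 :- x5) :* (x2 :+ x3)) (x12 :* (nat 2 :* x11)) e₁) ⊞
             (nn x10 (0≤ι x)) ⊛ (le (x6 :* (x5 :- x4) :- nat 2 :* (x6 :* x7)) (nat 3 :* (x6 :* x12)) e₂)
             ⊞ (nn x10 (0≤ι x)) ⊛ (nn (nat 2 :* x8 :* x9) e₃)) refl) ,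
           ≤-cancel 1 (lin ((ι x) ∷ E ∷ q ∷ lb ∷ la ∷ α ∷ β ∷ ℓ ∷ τ ∷ κ ∷ θ ∷ un ∷ ra ∷ (ι n) ∷ C ∷ []) 0 (nat 2 :* (x0 :* ⊝ x1)) (nat 2 :* (x13 :* (nat 4 :* x11 :+ x14))) (le (x0 :* (nat 2 :* x2 :- (x3 :* x3 :- x4 :* x4) :+ ((x5 :- x6) :* (x3 :+ x4) :+ x7 :* (x6 :- x5) :- nat 2 :* (x7 :* x8) :- nat 2 :* x9 :* x10))) (x0 :* (nat 2 :* x1)) (≤-reflexive (sym (cong (ι x *_) expand)))
               ⊞ le (x0 :* (nat 2 :* x9 :* x10)) (nat 2 :* x9 :* x13) e₄ ⊞
               le (x0 :* ((nat 4 :* x11 :+ nat 2 :+ nat 3 :* x7) :* x12) :+ nat 2 :* x9 :* x13) (nat 2 :* (x13 :* (nat 4 :* x11 :+ x14))) total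
               ⊞
               (nn x0 (0≤ι x)) ⊛ (le (⊝ ((nat 2 :* x11 :+ nat 2) :* x12)) (nat 2 :* x2 :- (x3 :* x3 :- x4 :* x4)) ≤q)
               ⊞ (nn x0 (0≤ι x)) ⊛ (le (⊝ (x12 :* (nat 2 :* x11))) ((x5 :- x6) :* (x3 :+ x4)) e₁′) ⊞
               (nn x0 (0≤ι x)) ⊛ (le (⊝ (nat 3 :* (x7 :* x12))) (x7 :* (x6 :- x5) :- nat 2 :* (x7 :* x8)) e₂′)) refl)
       -- The quotient `x/n` rounds to 0 and `Y/n` to at most `R`, so every quantity is bounded in
       -- terms of `R` alone.
       ... | no n≰x = far
         where
         x<n : x ℕ.< n
         x<n = ℕ.≰⇒> n≰x
         a≡0 : a ≡ 0
         a≡0 = div≡0 n≥1 x<n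
         b≤R : ι b ≤ ρ
         b≤R = ι-mono (ℕ.*-cancelˡ-≤ n {{ℕ.>-nonZero n≥1}} (ℕ.≤-trans (div-≤ Y n) (ℕ.≤-trans Y≤Rx (ℕ.≤-trans (ℕ.*-monoʳ-≤ R (ℕ.<⇒≤ x<n)) (ℕ.≤-reflexive (ℕ.*-comm R n))))))
         Qa≡0 : Q a ≡ 0ℚ
         Qa≡0 = cong Q a≡0
         Qb≤ : Q b ≤ ι b
         Qb≤ = ≤-trans (∑-mono b (λ N p q → (lin ((L N) ∷ (ι N) ∷ (rec N) ∷ []) 0 (x0 :* x2) one (nn x2 (0≤rec N) ⊞
             le (x1 :* x2) one (≤-reflexive (ι*rec′ p)) ⊞
             (le x0 (x1 :- one) (L≤ p (ℕ.≤-trans q b≤X))) ⊛ (nn x2 (0≤rec N))) refl)))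
           (≤-reflexive (trans (∑-const b 1ℚ) (ℚₚ.*-identityʳ (ι b))))
         0≤Qb : 0ℚ ≤ Q b
         0≤Qb = 0≤∑ b (λ N p q → 0≤* (0≤L p (ℕ.≤-trans q b≤X)) (0≤rec N))
         Hb≤ : H b ≤ ι b
         Hb≤ = ≤-trans (∑-mono b (λ N p q → rec≤1 p)) (≤-reflexive (trans (∑-const b 1ℚ) (ℚₚ.*-identityʳ (ι b))))
         0≤Hb : 0ℚ ≤ H b
         0≤Hb = 0≤∑ b (λ N p q → 0≤rec N)
         0≤x : 0ℚ ≤ ι x
         0≤x = 0≤ι x
         x≤n : ι x ≤ ι n
         x≤n = ι-mono (ℕ.<⇒≤ x<n)
         E≤ : E ≤ C
         E≤ = lin ((Q a) ∷ (Q b) ∷ (ι b) ∷ ρ ∷ ℓ ∷ (H b) ∷ w ∷ κ ∷ []) 0 (x1 :- x0 :- x4 :* x5 :+ x7 :* x6) (nat 2 :+ nat 9 :* x3 :+ nat 2 :* (x3 :* x3)) (nn x0 (≤-reflexive (sym Qa≡0))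
             ⊞ le x1 x2 Qb≤ ⊞ le x2 x3 b≤R ⊞ le (nat 0) (x4 :* x5) (0≤* 0≤ℓ 0≤Hb) ⊞
             3 ⊠ (nn x7 0≤κ) ⊞ 2 ⊠ (le (nat 2 :* x7) (x3 :* x3 :+ nat 4 :* x3) κ≤) ⊞
             (le x6 one w≤1) ⊛ (nn x7 0≤κ)) refl
         -E≤ : - E ≤ C
         -E≤ = lin ((Q a) ∷ (Q b) ∷ (H b) ∷ (ι b) ∷ ρ ∷ ℓ ∷ κ ∷ w ∷ []) 0 (⊝ (x1 :- x0 :- x5 :* x2 :+ x6 :* x7)) (nat 2 :+ nat 9 :* x4 :+ nat 2 :* (x4 :* x4)) (le x0 (nat 0) (≤-reflexive Qa≡0)
             ⊞ le (nat 0) x1 0≤Qb ⊞ 9 ⊠ (nn x5 0≤ℓ) ⊞ 9 ⊠ (le x5 x4 ℓ≤ρ) ⊞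
             le (nat 0) (x6 :* x7) (0≤* 0≤κ 0≤w) ⊞ le (nat 0) (x4 :* x4) (0≤* 0≤ρ 0≤ρ) ⊞
             (nn x5 0≤ℓ) ⊛ (le x2 x3 Hb≤) ⊞ (nn x5 0≤ℓ) ⊛ (le x3 x4 b≤R) ⊞
             (le x5 x4 ℓ≤ρ) ⊛ (nn x4 0≤ρ)) refl
         0≤C : 0ℚ ≤ C
         0≤C = lin (ρ ∷ []) 0 (nat 0) (nat 2 :+ nat 9 :* x0 :+ nat 2 :* (x0 :* x0)) (9 ⊠ (nn x0 0≤ρ) ⊞
             2 ⊠ (nn (x0 :* x0) (0≤* 0≤ρ 0≤ρ))) refl
         far : ι x * E ≤ ι n * (ι 4 * u n + C) × ι x * (- E) ≤ ι n * (ι 4 * u n + C)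
         far = (lin (E ∷ C ∷ (ι x) ∷ (ι n) ∷ (u n) ∷ []) 0 (x2 :* x0) (x3 :* (nat 4 :* x4 :+ x1)) (4 ⊠ (nn (x3 :* x4) (0≤* (0≤ι n) 0≤un)) ⊞
             (le x0 x1 E≤) ⊛ (nn x2 0≤x) ⊞ (le x2 x3 x≤n) ⊛ (nn x1 0≤C)) refl) ,
           (lin (E ∷ C ∷ (ι x) ∷ (ι n) ∷ (u n) ∷ []) 0 (x2 :* ⊝ x0) (x3 :* (nat 4 :* x4 :+ x1)) (4 ⊠ (nn (x3 :* x4) (0≤* (0≤ι n) 0≤un)) ⊞
               (le (⊝ x0) x1 -E≤) ⊛ (nn x2 0≤x) ⊞ (le x2 x3 x≤n) ⊛ (nn x1 0≤C)) refl)

       hi : ι x * E ≤ ι n * (ι 4 * u n + C)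
       hi = proj₁ bounds
       lo : ι x * (- E) ≤ ι n * (ι 4 * u n + C)
       lo = proj₂ bounds

     S : ℚ
     S = ∑ Y (λ n → μ n * u n * Φ n)

     V : ℕ → ℚ
     V n = u n * (ι 4 * u n + C)

     -- `|μ| ≤ 1`, together with the moments `U Y ≤ Y` and `U₂ Y ≤ 3 Y`, bounds `x |S|` by
     -- `(12 + C) Y`, and `Y ≤ R x`.
     S-bound : - (ρ * (ι 12 + C)) ≤ S × S ≤ ρ * (ι 12 + C)
     S-bound = lower x≥1 , upper x≥1
       where
       term : ∀ n → 1 ℕ.≤ n → n ℕ.≤ Y → - V n ≤ ι x * (μ n * u n * Φ n) × ι x * (μ n * u n * Φ n) ≤ V n
       term n p q = (lin (v ∷ y ∷ m ∷ (u n) ∷ C ∷ (ι x) ∷ (μ n) ∷ (Φ n) ∷ []) 1 (⊝ (x3 :* (nat 4 :* x3 :+ x4))) (x5 :* (x6 :* x3 :* x7)) (2 ⊠ (le (x3 :* (x2 :* x1)) (x5 :* (x6 :* x3 :* x7)) (≤-reflexive yy))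
           ⊞ 2 ⊠ (le (x3 :* x0) (x3 :* (nat 4 :* x3 :+ x4)) (≤-reflexive uv)) ⊞
           (le (⊝ x0) x1 lo) ⊛ (nn (x3 :* (one :+ x2)) 0≤um) ⊞
           (le x1 x0 hi) ⊛ (nn (x3 :* (one :- x2)) 0≤um′)) refl) ,
         (lin (v ∷ y ∷ m ∷ (u n) ∷ C ∷ (ι x) ∷ (μ n) ∷ (Φ n) ∷ []) 1 (x5 :* (x6 :* x3 :* x7)) (x3 :* (nat 4 :* x3 :+ x4)) (2 ⊠ (le (x5 :* (x6 :* x3 :* x7)) (x3 :* (x2 :* x1)) (≤-reflexive (sym yy)))
             ⊞ 2 ⊠ (le (x3 :* x0) (x3 :* (nat 4 :* x3 :+ x4)) (≤-reflexive uv)) ⊞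
             (le (⊝ x0) x1 lo) ⊛ (nn (x3 :* (one :- x2)) 0≤um′) ⊞
             (le x1 x0 hi) ⊛ (nn (x3 :* (one :+ x2)) 0≤um)) refl)
         where
         v y m : ℚ
         v = ι 4 * u n + C
         y = ι x * Φ n
         m = μ n
         lo : - v ≤ y
         lo = proj₁ (Φ-bound n p q)
         hi : y ≤ v
         hi = proj₂ (Φ-bound n p q)
         m₁ : - 1ℚ ≤ m
         m₁ = proj₁ (möbius-bound (primeFactors n))
         m₂ : m ≤ 1ℚ
         m₂ = proj₂ (möbius-bound (primeFactors n))
         0≤um : 0ℚ ≤ u n * (1ℚ + m)
         0≤um = 0≤* (0≤u p q) (lin (m ∷ []) 0 (nat 0) (one :+ x0) (le (⊝ one) x0 m₁) refl)
         0≤um′ : 0ℚ ≤ u n * (1ℚ - m)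
         0≤um′ = 0≤* (0≤u p q) (lin (m ∷ []) 0 (nat 0) (one :- x0) (le x0 one m₂) refl)
         yy : u n * (m * y) ≡ ι x * (μ n * u n * Φ n)
         yy = ring-eq ((u n) ∷ (μ n) ∷ (ι x) ∷ (Φ n) ∷ []) (x0 :* (x1 :* (x2 :* x3))) (x2 :* (x1 :* x0 :* x3)) refl
         uv : u n * v ≡ u n * (ι 4 * u n + C)
         uv = refl
       V≤ : ∑ Y V ≤ ι x * (ρ * (ι 12 + C))
       V≤ = ≤-trans (≤-reflexive V≡) (lin ((U₂ Y) ∷ (ι Y) ∷ (U Y) ∷ ρ ∷ (ι x) ∷ C ∷ []) 0 (nat 4 :* x0 :+ x5 :* x2) (x4 :* (x3 :* (nat 12 :+ x5))) (4 ⊠ (le x0 (nat 3 :* x1) (U₂≤ Y≥1 Y≤X))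
           ⊞ 12 ⊠ (le x1 (x3 :* x4) Y≤ρx) ⊞ (le x2 x1 (proj₂ (U-bounds Y≥1 Y≤X))) ⊛ (nn x5 0≤C)
           ⊞ (le x1 (x3 :* x4) Y≤ρx) ⊛ (nn x5 0≤C)) refl)
         where
         0≤C : 0ℚ ≤ C
         0≤C = lin (ρ ∷ []) 0 (nat 0) (nat 2 :+ nat 9 :* x0 :+ nat 2 :* (x0 :* x0)) (9 ⊠ (nn x0 0≤ρ) ⊞
             2 ⊠ (nn (x0 :* x0) (0≤* 0≤ρ 0≤ρ))) refl
         V≡ : ∑ Y V ≡ ι 4 * U₂ Y + C * U Y
         V≡ = trans (∑-cong Y (λ n _ _ → (ring-eq ((u n) ∷ C ∷ []) (x0 :* (nat 4 :* x0 :+ x1)) (nat 4 :* (x0 :* x0) :+ x1 :* x0) refl)))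
           (trans (∑-+ Y (λ n → ι 4 * (u n * u n)) (λ n → C * u n)) (cong₂ _+_ (∑-* Y (ι 4) (λ n → u n * u n)) (trans (∑-* Y C u) (cong (C *_) (U-sum Y)))))
       xS : ι x * S ≡ ∑ Y (λ n → ι x * (μ n * u n * Φ n))
       xS = sym (∑-* Y (ι x) (λ n → μ n * u n * Φ n))
       upper : 1 ℕ.≤ x → S ≤ ρ * (ι 12 + C)
       upper x≥1 = cancel x≥1 (≤-trans (≤-reflexive xS) (≤-trans (proj₂ (∑-abs Y {g = V} term)) V≤))
         where
         cancel : ∀ {x a b} → 1 ℕ.≤ x → ι x * a ≤ ι x * b → a ≤ b
         cancel {suc x} _ = ≤-cancel x
       lower : 1 ℕ.≤ x → - (ρ * (ι 12 + C)) ≤ S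
       lower x≥1 = cancel x≥1 (≤-trans (lin ((∑ Y V) ∷ (ι x) ∷ ρ ∷ C ∷ []) 0 (x1 :* ⊝ (x2 :* (nat 12 :+ x3))) (⊝ x0) (le x0 (x1 :* (x2 :* (nat 12 :+ x3))) V≤) refl) (≤-trans (proj₁ (∑-abs Y {g = V} term)) (≤-reflexive (sym xS))))
         where
         cancel : ∀ {x a b} → 1 ℕ.≤ x → ι x * a ≤ ι x * b → a ≤ b
         cancel {suc x} _ = ≤-cancel x

   -- The convolution of the von Mangoldt measure Σ Λ(k)/k with its restriction to (x, Y].
   W : ℚ
   W = ∑ Y (λ k → Λ k * rec k * (Mert (Y div k) - Mert (x div k)))

   private
     -- By `divisorSum-μ-log` with `c = L Y` the weights of the divisors of `k` add up to `Λ k`,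
     -- with a further `L Y` at `k = 1`.
     S≡ : S ≡ F 1 * L Y + (W + (- ℓ * Mert Y + κ * rec Y * ψ Y))
     S≡ = begin
       ∑ Y (λ n → μ n * u n * Φ n) ≡⟨ ∑-cong Y (λ n _ _ → sym (∑-* (Y div n) (μ n * u n) (λ m → F (n ℕ.* m)))) ⟩
       ∑ Y (λ n → ∑ (Y div n) (λ m → μ n * u n * F (n ℕ.* m))) ≡⟨ ∑-divisors Y (λ n k → μ n * u n * F k) ⟩
       ∑ Y (λ k → divisorSum (λ n → μ n * u n * F k) k) ≡⟨ ∑-cong Y (λ k p _ → step k p) ⟩
       ∑ Y (λ k → ⟨ k ℕ.≟ 1 ⟩ * (F k * L Y) + (Λ k * rec k * (Mert (Y div k) - Mert (x div k)) + (- ℓ * (Λ k * rec k) + κ * rec Y * Λ k)))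
         ≡⟨ trans (∑-+ Y _ _) (cong₂ _+_ (∑-point Y (λ k → F k * L Y) Y≥1) (trans (∑-+ Y _ _) (cong (W +_) (trans (∑-+ Y _ _) (cong₂ _+_ (∑-* Y (- ℓ) _) (∑-* Y (κ * rec Y) Λ)))))) ⟩
       F 1 * L Y + (W + (- ℓ * Mert Y + κ * rec Y * ψ Y)) ∎
       where
       open ≡-Reasoning
       step : ∀ k → 1 ℕ.≤ k → divisorSum (λ n → μ n * u n * F k) k ≡
         ⟨ k ℕ.≟ 1 ⟩ * (F k * L Y) + (Λ k * rec k * (Mert (Y div k) - Mert (x div k)) + (- ℓ * (Λ k * rec k) + κ * rec Y * Λ k))
       step k p = begin
         divisorSum (λ n → μ n * u n * F k) k ≡⟨ divisorSum-cong k (λ n _ _ → ℚₚ.*-comm (μ n * u n) (F k)) ⟩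
         divisorSum (λ n → F k * (μ n * u n)) k ≡⟨ divisorSum-* (F k) (λ n → μ n * u n) k ⟩
         F k * divisorSum (λ n → μ n * u n) k ≡⟨ cong (F k *_) (divisorSum-μ-log (L Y) p) ⟩
         (rec k * (Mert (Y div k) - Mert (x div k)) + (- ℓ * rec k + κ * rec Y)) * (⟨ k ℕ.≟ 1 ⟩ * L Y + Λ k)
           ≡⟨ ring-eq ((rec k) ∷ (Mert (Y div k)) ∷ (Mert (x div k)) ∷ ℓ ∷ κ ∷ (rec Y) ∷ (⟨ k ℕ.≟ 1 ⟩) ∷
               (L Y) ∷ (Λ k) ∷ []) ((x0 :* (x1 :- x2) :+ (⊝ x3 :* x0 :+ x4 :* x5)) :* (x6 :* x7 :+ x8)) (x6 :* ((x0 :* (x1 :- x2) :+ (⊝ x3 :* x0 :+ x4 :* x5)) :* x7) :+ (x8 :* x0 :* (x1 :- x2) :+ (⊝ x3 :* (x8 :* x0) :+ x4 :* x5 :* x8))) refl ⟩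
         ⟨ k ℕ.≟ 1 ⟩ * (F k * L Y) + (Λ k * rec k * (Mert (Y div k) - Mert (x div k)) + (- ℓ * (Λ k * rec k) + κ * rec Y * Λ k)) ∎

     div-1 : ∀ n → n div 1 ≡ n
     div-1 n = div-unique (s≤s z≤n) (ℕ.≤-reflexive (ℕ.*-identityˡ n)) (s≤s (ℕ.≤-reflexive (sym (ℕ.+-identityʳ n))))

     F1 : F 1 ≡ Mert Y - Mert x - ℓ + κ * rec Y
     F1 = trans (cong₂ (λ r m → r * m + (- ℓ * r + κ * rec Y)) rec-1 (cong₂ (λ i j → Mert i - Mert j) (div-1 Y) (div-1 x)))
       (ring-eq ((Mert Y) ∷ (Mert x) ∷ ℓ ∷ κ ∷ (rec Y) ∷ []) (one :* (x0 :- x1) :+ (⊝ x2 :* one :+ x3 :* x4)) (x0 :- x1 :- x2 :+ x3 :* x4) refl)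

     lrec ψrec : ℚ
     lrec = κ * (L Y * rec Y)
     ψrec = κ * (ψ Y * rec Y)

     0≤lrec : 0ℚ ≤ lrec
     0≤lrec = 0≤* 0≤κ (0≤* (0≤L Y≥1 Y≤X) (0≤rec Y))
     0≤ψrec : 0ℚ ≤ ψrec
     0≤ψrec = 0≤* 0≤κ (0≤* (0≤ψ Y≤X) (0≤rec Y))
     lrec≤ : lrec ≤ κ
     lrec≤ = lin (κ ∷ (rec Y) ∷ (L Y) ∷ (ι Y) ∷ []) 0 (x0 :* (x2 :* x1)) x0 (nn (x0 :* x1) (0≤* 0≤κ (0≤rec Y)) ⊞
         le (x0 :* (x3 :* x1)) (x0 :* one) (≤-reflexive (cong (κ *_) (ι*rec′ Y≥1))) ⊞
         (nn (x0 :* x1) (0≤* 0≤κ (0≤rec Y))) ⊛ (le x2 (x3 :- one) (L≤ Y≥1 Y≤X))) refl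
     ψrec≤ : ψrec ≤ ι 8 * κ
     ψrec≤ = lin (κ ∷ (rec Y) ∷ (ψ Y) ∷ (ι Y) ∷ []) 0 (x0 :* (x2 :* x1)) (nat 8 :* x0) (8 ⊠ (le (x0 :* (x3 :* x1)) (x0 :* one) (≤-reflexive (cong (κ *_) (ι*rec′ Y≥1))))
         ⊞ (nn (x0 :* x1) (0≤* 0≤κ (0≤rec Y))) ⊛ (le x2 (nat 8 :* x3) (ψ≤ Y Y≤X))) refl

     identity : L Y * (Mert Y - Mert x) + W ≡ S + ℓ * L Y + ℓ * Mert Y - lrec - ψrec
     identity = trans (ring-eq ((L Y) ∷ (Mert Y) ∷ (Mert x) ∷ W ∷ ℓ ∷ κ ∷ (rec Y) ∷ (ψ Y) ∷ []) (x0 :* (x1 :- x2) :+ x3) ((x1 :- x2 :- x4 :+ x5 :* x6) :* x0 :+ (x3 :+ (⊝ x4 :* x1 :+ x5 :* x6 :* x7)) :+ x4 :* x0 :+ x4 :* x1 :- x5 :* (x0 :* x6) :- x5 :* (x7 :* x6)) refl)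
       (cong (λ z → z + ℓ * L Y + ℓ * Mert Y - lrec - ψrec) (trans (cong (λ f → f * L Y + (W + (- ℓ * Mert Y + κ * rec Y * ψ Y))) (sym F1)) (sym S≡)))

   selberg-upper : L Y * (Mert Y - Mert x) + W ≤ ι 2 * (L Y - L x) * L Y + selbergError R
   selberg-upper = lin ((L Y) ∷ (Mert Y) ∷ (Mert x) ∷ W ∷ S ∷ ℓ ∷ lrec ∷ ψrec ∷ ρ ∷ []) 0 (x0 :* (x1 :- x2) :+ x3) (nat 2 :* x5 :* x0 :+ x8 :* (nat 40 :+ nat 14 :* x8 :+ nat 2 :* (x8 :* x8))) (le (x0 :* (x1 :- x2) :+ x3) (x4 :+ x5 :* x0 :+ x5 :* x1 :- x6 :- x7) (≤-reflexive identity)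
       ⊞ le x4 (x8 :* (nat 12 :+ (nat 2 :+ nat 9 :* x8 :+ nat 2 :* (x8 :* x8)))) S≤ ⊞
       18 ⊠ (nn x5 0≤ℓ) ⊞ 26 ⊠ (le x5 x8 ℓ≤ρ) ⊞ le (nat 0) x6 0≤lrec ⊞ le (nat 0) x7 0≤ψrec
       ⊞ 5 ⊠ (nn (x8 :* x8) (0≤* 0≤ρ 0≤ρ)) ⊞
       (le x1 (x0 :+ nat 8) (Mert-upper Y≥1 Y≤X)) ⊛ (nn x5 0≤ℓ)) refl
     where
     S≤ : S ≤ ρ * (ι 12 + C)
     S≤ = proj₂ S-bound

   selberg-lower : ι 2 * (L Y - L x) * L Y ≤ L Y * (Mert Y - Mert x) + W + selbergError R
   selberg-lower = lin ((L Y) ∷ (Mert Y) ∷ (Mert x) ∷ W ∷ S ∷ ℓ ∷ lrec ∷ ψrec ∷ ρ ∷ κ ∷ []) 1 (nat 2 :* x5 :* x0) (x0 :* (x1 :- x2) :+ x3 :+ x8 :* (nat 40 :+ nat 14 :* x8 :+ nat 2 :* (x8 :* x8))) (2 ⊠ (le (x4 :+ x5 :* x0 :+ x5 :* x1 :- x6 :- x7) (x0 :* (x1 :- x2) :+ x3) (≤-reflexive (sym identity)))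
       ⊞ 2 ⊠ (le (⊝ (x8 :* (nat 12 :+ (nat 2 :+ nat 9 :* x8 :+ nat 2 :* (x8 :* x8))))) x4 S≥) ⊞
       14 ⊠ (nn x5 0≤ℓ) ⊞ 16 ⊠ (le x5 x8 ℓ≤ρ) ⊞ 2 ⊠ (le x6 x9 lrec≤) ⊞
       2 ⊠ (le x7 (nat 8 :* x9) ψrec≤) ⊞ le (nat 0) (x8 :* x8) (0≤* 0≤ρ 0≤ρ) ⊞
       9 ⊠ (le (nat 2 :* x9) (x8 :* x8 :+ nat 4 :* x8) κ≤) ⊞
       2 ⊠ ((le (x0 :- one) x1 (Mert-lower Y≥1 Y≤X)) ⊛ (nn x5 0≤ℓ))) refl
     where
     S≥ : - (ρ * (ι 12 + C)) ≤ S
     S≥ = proj₁ S-bound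

   0≤W : 0ℚ ≤ W
   0≤W = 0≤∑ Y (λ k p q → 0≤* (0≤Λrec p (ℕ.≤-trans q Y≤X)) (≤⇒0≤- (Mert-mono (div-mono k x≤Y) (ℕ.≤-trans (div≤ Y k) Y≤X))))

-- Erdős' argument: blocks of windows and their deficits.

module ErdosBlocks where

 open import Relation.Binary.PropositionalEquality
 open RationalArithmetic
 open DivisorSums
 open IntegerLogarithm
 open MertensEstimates
 open SelbergWindows

 search : ∀ {P : ℕ → Set} → (∀ n → Dec (P n)) → ∀ a b → (∃ λ k → a ℕ.< k × k ℕ.≤ b × P k) ⊎ (∀ k → a ℕ.< k → k ℕ.≤ b → ¬ P k)
 search P? a zero = inj₂ (λ { k a<k z≤n → contradiction a<k λ () })
 search P? a (suc b) with search P? a b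
 ... | inj₁ (k , p , q , r) = inj₁ (k , p , ℕ.m≤n⇒m≤1+n q , r)
 ... | inj₂ none with suc a ℕ.≤? suc b | P? (suc b)
 ...   | yes p | yes r = inj₁ (suc b , p , ℕ.≤-refl , r)
 ...   | no ¬p | _ = inj₂ (λ k a<k k≤b → contradiction (ℕ.≤-trans a<k k≤b) ¬p)
 ...   | yes _ | no ¬r = inj₂ none′
   where
   none′ : ∀ k → a ℕ.< k → k ℕ.≤ suc b → ¬ _
   none′ k a<k k≤1+b with ℕ.m≤n⇒m<n∨m≡n k≤1+b
   ... | inj₁ (s≤s k≤b) = none k a<k k≤b
   ... | inj₂ refl = ¬r

 module LogSteps {X : ℕ} (log : Logarithm X) where
   open Estimates log

   -- A discrete intermediate value theorem: at the place where `L` passes `L k + τ`, it overshoots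
   -- by one increment.
   log-step : ∀ {k K τ} → 1 ℕ.≤ k → k ℕ.≤ K → K ℕ.≤ X → 0ℚ ≤ τ → L k + τ ≤ L K →
     ∃ λ u → k ℕ.≤ u × u ℕ.≤ K × L k + τ ≤ L u × L u ≤ L k + τ + rec k
   log-step {k} {K} {τ} k≥1 k≤K K≤X τ≥0 h with ℕ.m≤n⇒m<n∨m≡n k≤K
   ... | inj₂ refl = k , ℕ.≤-refl , ℕ.≤-refl , h , (lin (τ ∷ (rec k) ∷ (L k) ∷ []) 0 x2 (x2 :+ x0 :+ x1) (nn x0 τ≥0 ⊞
       le (nat 0) x1 (0≤rec k)) refl)
   log-step {k} {suc K} {τ} k≥1 k≤K K≤X τ≥0 h | inj₁ (s≤s k≤K′) with L k + τ ≤? L K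
   ... | yes h′ with log-step k≥1 k≤K′ (ℕ.<⇒≤ K≤X) τ≥0 h′
   ...   | u , p , q , r , s = u , p , ℕ.m≤n⇒m≤1+n q , r , s
   log-step {k} {suc K} {τ} k≥1 k≤K K≤X τ≥0 h | inj₁ (s≤s k≤K′) | no ¬h′ = suc K , k≤K , ℕ.≤-refl , h ,
     (lin ((L K) ∷ (L k) ∷ τ ∷ (L (suc K)) ∷ (rec K) ∷ (rec k) ∷ []) 0 x3 (x1 :+ x2 :+ x5) (le x0 (x1 :+ x2) (<⇒≤ (≰⇒> ¬h′)) ⊞
         le (x3 :- x0) x4 (ΔL≤ (ℕ.≤-trans k≥1 k≤K′) K≤X) ⊞ le x4 x5 (rec-anti k≥1 k≤K′)) refl)

   -- The exponent is `3 k` because `L 2` is only known to be at least `1/3`.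
   L-2^ : 2 ℕ.≤ X → ∀ k → ι k ≤ L (2 ℕ.^ (3 ℕ.* k))
   L-2^ X≥2 zero = ≤-reflexive (sym L-1)
   L-2^ X≥2 (suc k) = lin ((ι k) ∷ (L (2 ℕ.^ (3 ℕ.* k))) ∷ (L (2 ℕ.^ (3 ℕ.* suc k))) ∷ (L 2) ∷ (rec 3) ∷ (L 1) ∷ []) 0 (one :+ x0) x2 (le x0 x1 (L-2^ X≥2 k) ⊞ le (nat 3 :* x3 :+ x1) x2 (≤-reflexive (sym eq))
       ⊞ 3 ⊠ (le x4 (x3 :- x5) (ΔL≥ ℕ.≤-refl X≥2)) ⊞ 3 ⊠ (nn x5 (≤-reflexive (sym L-1))) ⊞
       le one (nat 3 :* x4) (≤-reflexive (sym (ι*rec 2)))) refl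
     where
     m : ℕ
     m = 2 ℕ.^ (3 ℕ.* k)
     m≥1 : 1 ℕ.≤ m
     m≥1 = ℕ.m^n>0 2 (3 ℕ.* k)
     eq : L (2 ℕ.^ (3 ℕ.* suc k)) ≡ ι 3 * L 2 + L m
     eq = trans (cong (λ e → L (2 ℕ.^ e)) (ℕ.*-suc 3 k))
       (trans (L-* (s≤s z≤n) (ℕ.*-mono-≤ {1} {2} (s≤s z≤n) (ℕ.*-mono-≤ {1} {2} (s≤s z≤n) m≥1)))
         (trans (cong (L 2 +_) (trans (L-* (s≤s z≤n) (ℕ.*-mono-≤ {1} {2} (s≤s z≤n) m≥1)) (cong (L 2 +_) (L-* (s≤s z≤n) m≥1))))
           (ring-eq ((L 2) ∷ (L m) ∷ []) (x0 :+ (x0 :+ (x0 :+ x1))) (nat 3 :* x0 :+ x1) refl)))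

   ratio-bound : ∀ {x Y c} → 2 ℕ.≤ X → 1 ℕ.≤ x → Y ℕ.≤ X → L Y - L x ≤ ι c → Y ℕ.≤ 2 ℕ.^ (3 ℕ.* suc c) ℕ.* x
   ratio-bound {x} {Y} {c} X≥2 x≥1 Y≤X h with Y ℕ.≤? 2 ℕ.^ (3 ℕ.* suc c) ℕ.* x
   ... | yes p = p
   ... | no ¬p = contradiction (L-mono (ℕ.*-mono-≤ (ℕ.m^n>0 2 (3 ℕ.* suc c)) x≥1) (ℕ.<⇒≤ (ℕ.≰⇒> ¬p)) Y≤X)
     (λ q → (lin-⊥ ((L (2 ℕ.^ (3 ℕ.* suc c) ℕ.* x)) ∷ (L Y) ∷ (L (2 ℕ.^ (3 ℕ.* suc c))) ∷ (L x) ∷ (ι c)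
         ∷ []) (le x0 x1 q ⊞ le (x2 :+ x3) x0 (≤-reflexive (sym (L-* (ℕ.m^n>0 2 (3 ℕ.* suc c)) x≥1)))
         ⊞ le (one :+ x4) x2 (L-2^ X≥2 (suc c)) ⊞ le (x1 :- x3) x4 h) refl))

   Mert-diff : ∀ {a b} → 1 ℕ.≤ a → a ℕ.≤ b → b ℕ.≤ X → Mert b - Mert a ≤ L b - L a + ι 9 × L b - L a ≤ Mert b - Mert a + ι 9
   Mert-diff {a} {b} a≥1 a≤b b≤X =
     (lin ((Mert b) ∷ (L b) ∷ (L a) ∷ (Mert a) ∷ []) 0 (x0 :- x3) (x1 :- x2 :+ nat 9) (le x0 (x1 :+ nat 8) (Mert-upper (ℕ.≤-trans a≥1 a≤b) b≤X)
         ⊞ le (x2 :- one) x3 (Mert-lower a≥1 (ℕ.≤-trans a≤b b≤X))) refl) ,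
     (lin ((L b) ∷ (Mert b) ∷ (Mert a) ∷ (L a) ∷ []) 0 (x0 :- x3) (x1 :- x2 :+ nat 9) (le (x0 :- one) x1 (Mert-lower (ℕ.≤-trans a≥1 a≤b) b≤X) ⊞
         le x2 (x3 :+ nat 8) (Mert-upper a≥1 (ℕ.≤-trans a≤b b≤X))) refl)

   -- `selberg-upper` with the nonnegative `W` dropped and divided by `L w`: no window has more than
   -- twice its expected mass, up to `η`.
   density-upper : ∀ {y w R η} → 1 ℕ.≤ y → y ℕ.≤ w → w ℕ.≤ R ℕ.* y → 2 ℕ.* w ℕ.≤ X → 0ℚ ≤ η → selbergError R ≤ η * L y → 1ℚ ≤ L y →
     Mert w - Mert y ≤ ι 2 * (L w - L y) + η
   density-upper {y} {w} {R} {η} y≥1 y≤w w≤Ry 2w≤X η≥0 E≤ Ly≥1 = ≤-cancel-* (L w) (ℚₚ.<-≤-trans 0<1 (≤-trans Ly≥1 Ly≤Lw))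
     (lin ((L w) ∷ (Mert w) ∷ (Mert y) ∷ W ∷ (L y) ∷ (selbergError R) ∷ η ∷ []) 0 (x0 :* (x1 :- x2)) (x0 :* (nat 2 :* (x0 :- x4) :+ x6)) (le (x0 :* (x1 :- x2) :+ x3) (nat 2 :* (x0 :- x4) :* x0 :+ x5) selberg-upper
         ⊞ le (nat 0) x3 0≤W ⊞ le x5 (x6 :* x4) E≤ ⊞ (nn x6 η≥0) ⊛ (le x4 x0 Ly≤Lw)) refl)
     where
     open SelbergFormula log {y} {w} {R} y≥1 y≤w w≤Ry 2w≤X using (selberg-upper; W; 0≤W)
     Ly≤Lw : L y ≤ L w
     Ly≤Lw = L-mono y≥1 y≤w (ℕ.≤-trans (ℕ.m≤m+n w _) 2w≤X)

 -- A window (x, Y] of logarithmic length about 3C/4; near a good k (one with small deficit) the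
 -- primes in (x/k, Y/k] have almost twice their expected density.
 module Block {X : ℕ} (log : Logarithm X) {x Y R y₀ : ℕ} (x≥1 : 1 ℕ.≤ x) (x≤Y : x ℕ.≤ Y) (Y≤Rx : Y ℕ.≤ R ℕ.* x) (2Y≤X : 2 ℕ.* Y ℕ.≤ X)
   (y₀≥1 : 1 ℕ.≤ y₀) (η′ : ℚ) (η′≥0 : 0ℚ ≤ η′)
   (E≤ : selbergError (2 ℕ.* R) ≤ η′ * Logarithm.L log y₀) (Ly₀≥1 : 1ℚ ≤ Logarithm.L log y₀) where
   open Estimates log
   open LogSteps log

   y w : ℕ → ℕ
   y k = x div k
   w k = Y div k

   -- For `k ≤ kmax` the windows `(x/k, Y/k]` start at `y₀` or later, where the error of Selberg's
   -- formula is at most `η′` times the logarithm.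
   kmax : ℕ
   kmax = x div y₀

   ℓ η : ℚ
   ℓ = L Y - L x
   η = η′ + ι 2 * rec y₀

   Y≤X : Y ℕ.≤ X
   Y≤X = ℕ.≤-trans (ℕ.m≤m+n Y _) 2Y≤X
   x≤X : x ℕ.≤ X
   x≤X = ℕ.≤-trans x≤Y Y≤X
   2x≤X : 2 ℕ.* x ℕ.≤ X
   2x≤X = ℕ.≤-trans (ℕ.*-monoʳ-≤ 2 x≤Y) 2Y≤X
   w≤X : ∀ k → w k ℕ.≤ X
   w≤X k = ℕ.≤-trans (div≤ Y k) Y≤X
   y≤w : ∀ k → y k ℕ.≤ w k
   y≤w k = div-mono k x≤Y

   k≤x : ∀ {k} → k ℕ.≤ kmax → k ℕ.≤ x
   k≤x h = ℕ.≤-trans h (div≤ x y₀)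

   y₀≤y : ∀ {k} → 1 ℕ.≤ k → k ℕ.≤ kmax → y₀ ℕ.≤ y k
   y₀≤y {k} k≥1 h = ≤-div k≥1 (ℕ.≤-trans (ℕ.*-monoˡ-≤ y₀ h) (ℕ.≤-trans (ℕ.≤-reflexive (ℕ.*-comm kmax y₀)) (div-≤ x y₀)))

   w≤2Ry : ∀ {k} → 1 ℕ.≤ k → k ℕ.≤ kmax → w k ℕ.≤ 2 ℕ.* R ℕ.* y k
   w≤2Ry {k} k≥1 h = ℕ.*-cancelˡ-≤ k {{ℕ.>-nonZero k≥1}} (linᴺ (k ∷ (w k) ∷ Y ∷ R ∷ x ∷ (y k) ∷ []) 0 (x0 :* x1) (x0 :* (nat 2 :* x3 :* x5)) (leᴺ (x0 :* x1) x2 (div-≤ Y k) ⊞ᴺ leᴺ x2 (x3 :* x4) Y≤Rx ⊞ᴺ (leᴺ x4 (x0 :+ x0 :* x5) (ℕ.≤-trans (ℕ.<⇒≤ (div-< x k≥1)) (ℕ.≤-reflexive (ℕ.*-suc k (y k))))) ⊛ᴺ (nnᴺ x3 (z≤n {R})) ⊞ᴺ (leᴺ (nat 1) x5 (ℕ.≤-trans y₀≥1 (y₀≤y k≥1 h))) ⊛ᴺ (nnᴺ (x0 :* x3) (z≤n {k ℕ.* R}))) refl)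

   upper : ∀ {a b} → y₀ ℕ.≤ a → a ℕ.≤ b → b ℕ.≤ 2 ℕ.* R ℕ.* a → b ℕ.≤ Y → Mert b - Mert a ≤ ι 2 * (L b - L a) + η′
   upper {a} {b} y₀≤a a≤b b≤ b≤Y = density-upper {R = 2 ℕ.* R} (ℕ.≤-trans y₀≥1 y₀≤a) a≤b b≤ (ℕ.≤-trans (ℕ.*-monoʳ-≤ 2 b≤Y) 2Y≤X) η′≥0
     (lin ((selbergError (2 ℕ.* R)) ∷ η′ ∷ (L y₀) ∷ (L a) ∷ []) 0 x0 (x1 :* x3) (le x0 (x1 :* x2) E≤ ⊞ (nn x1 η′≥0) ⊛ (le x2 x3 mono)) refl) (≤-trans Ly₀≥1 mono)
     where
     mono : L y₀ ≤ L a
     mono = L-mono y₀≥1 y₀≤a (ℕ.≤-trans a≤b (ℕ.≤-trans b≤Y Y≤X))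

   w-y : ∀ {k} → 1 ℕ.≤ k → k ℕ.≤ kmax → L (w k) - L (y k) ≤ ℓ + rec y₀
   w-y {k} k≥1 h = lin ((L k) ∷ (L (w k)) ∷ (L Y) ∷ (L x) ∷ (L (y k)) ∷ (rec (y k)) ∷ (rec y₀) ∷ []) 0 (x1 :- x4) (x2 :- x3 :+ x6) (le (x0 :+ x1) x2 (proj₁ (L-div k≥1 (ℕ.≤-trans (k≤x h) x≤Y) 2Y≤X))
       ⊞ le x3 (x0 :+ x4 :+ x5) (proj₂ (L-div k≥1 (k≤x h) 2x≤X)) ⊞
       le x5 x6 (rec-anti y₀≥1 (y₀≤y k≥1 h))) refl

   -- The amount by which the window at `k` stays below the maximal mass `2 ℓ + η`, and the total of
   -- these amounts in the measure `Λ(k)/k`.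
   deficit Def : ℕ → ℚ
   deficit k = ι 2 * ℓ + η - (Mert (w k) - Mert (y k))
   Def n = ∑ n (λ k → Λ k * rec k * deficit k)

   0≤deficit : ∀ {k} → 1 ℕ.≤ k → k ℕ.≤ kmax → 0ℚ ≤ deficit k
   0≤deficit {k} k≥1 h = lin ((Mert (w k)) ∷ (Mert (y k)) ∷ (L (w k)) ∷ (L (y k)) ∷ η′ ∷ ℓ ∷ (rec y₀) ∷ []) 0 (nat 0) (nat 2 :* x5 :+ (x4 :+ nat 2 :* x6) :- (x0 :- x1)) (le (x0 :- x1) (nat 2 :* (x2 :- x3) :+ x4) (upper (y₀≤y k≥1 h) (y≤w k) (w≤2Ry k≥1 h) (div≤ Y k))
       ⊞ 2 ⊠ (le (x2 :- x3) (x5 :+ x6) (w-y k≥1 h))) refl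

   kmax≤X : kmax ℕ.≤ X
   kmax≤X = ℕ.≤-trans (div≤ x y₀) x≤X

   Def-mono : ∀ {a b} → a ℕ.≤ b → b ℕ.≤ kmax → Def a ≤ Def b
   Def-mono a≤b b≤ = ∑-grow _ a≤b (λ i p q → 0≤* (0≤Λrec (ℕ.≤-trans (s≤s z≤n) p) (ℕ.≤-trans q (ℕ.≤-trans b≤ kmax≤X))) (0≤deficit (ℕ.≤-trans (s≤s z≤n) p) (ℕ.≤-trans q b≤)))

   Def-window : ∀ {a b ω} → a ℕ.≤ b → b ℕ.≤ kmax → (∀ k → a ℕ.< k → k ℕ.≤ b → ω ≤ deficit k) → ω * (Mert b - Mert a) ≤ Def b - Def a
   Def-window {a} {b} {ω} a≤b b≤ h with ℕ.m≤n⇒m<n∨m≡n a≤b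
   ... | inj₂ refl = lin ((Def a) ∷ ω ∷ (Mert a) ∷ []) 0 (x1 :* (x2 :- x2)) (x0 :- x0) (∅) refl
   Def-window {a} {suc b} {ω} a≤b b≤ h | inj₁ (s≤s a≤b′) = lin (ω ∷ (Mert b) ∷ (Mert a) ∷ (Def b) ∷ (Def a) ∷ (Λ (suc b)) ∷ (rec (suc b)) ∷
       (deficit (suc b)) ∷ []) 0 (x0 :* (x1 :+ x5 :* x6 :- x2)) (x3 :+ x5 :* x6 :* x7 :- x4) (le (x0 :* (x1 :- x2)) (x3 :- x4) (Def-window {a} {b} {ω} a≤b′ (ℕ.<⇒≤ b≤) (λ k p q → h k p (ℕ.m≤n⇒m≤1+n q)))
       ⊞
       (nn (x5 :* x6) (0≤Λrec {suc b} (s≤s z≤n) (ℕ.≤-trans b≤ kmax≤X))) ⊛ (le x0 x7 (h (suc b) (s≤s a≤b′) ℕ.≤-refl))) refl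

   -- In `(s, sϱ]` either some interval of logarithmic length `C` has all its deficits above `ω`,
   -- which costs `ω δ` by the hypothesis `IH`, or good `k` occur with bounded gaps. In the second
   -- case `B` of them are chained to a stretch of density 5/4, which is too long for Mertens'
   -- estimate.
   module Run {C σ ω δ : ℚ} {u₀ s ϱ B : ℕ} (16σ≡C : ι 16 * σ ≡ C) (σ≥0 : 0ℚ ≤ σ) (ω≥0 : 0ℚ ≤ ω) (32ω≤σ : ι 32 * ω ≤ σ) (y₀σ : rec y₀ ≤ σ)
     (3C≤4ℓ : ι 3 * C ≤ ι 4 * ℓ) (s≥1 : 1 ℕ.≤ s) (sσ : ι 2 * rec s ≤ σ) (u₀≤s : u₀ ℕ.≤ s) (ϱ≥1 : 1 ℕ.≤ ϱ)
     (long : ι B * (C + ι 2 * σ) ≤ L ϱ) (Bσ : ι 50 ≤ ι B * σ) (sϱ≤ : s ℕ.* ϱ ℕ.≤ kmax)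
     (IH : ∀ {u v} → u₀ ℕ.≤ u → u ℕ.≤ v → 2 ℕ.* v ℕ.≤ X → C ≤ L v - L u → δ ≤ Mert v - Mert u) where

     s≤sϱ : s ℕ.≤ s ℕ.* ϱ
     s≤sϱ = ℕ.≤-trans (ℕ.≤-reflexive (sym (ℕ.*-identityʳ s))) (ℕ.*-monoʳ-≤ s ϱ≥1)

     end : ℕ
     end = s ℕ.* ϱ

     end≤X : end ℕ.≤ X
     end≤X = ℕ.≤-trans sϱ≤ kmax≤X

     2end≤X : 2 ℕ.* end ℕ.≤ X
     2end≤X = ℕ.≤-trans (ℕ.*-monoʳ-≤ 2 (k≤x sϱ≤)) 2x≤X

     -- After `i` steps `k` lies at a logarithmic distance between `i σ` and `i (C + 2σ)` from `s`,
     -- and the primes between `x/k` and `x/s` have density at least 5/4, up to `ω` for each step.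
     State : ℕ → Set
     State i = ∃ λ k → s ℕ.≤ k × k ℕ.≤ end × L s + ι i * σ ≤ L k × L k ≤ L s + ι i * (C + ι 2 * σ) ×
       ι 5 * (L (y s) - L (y k)) ≤ ι 4 * (Mert (y s) - Mert (y k)) + ι 4 * (ι i * ω)

     C≥0 : 0ℚ ≤ C
     C≥0 = ≤-trans (0≤* (0≤ι 16) σ≥0) (≤-reflexive 16σ≡C)

     start : State 0
     start = s , ℕ.≤-refl , s≤sϱ , (lin ((L s) ∷ σ ∷ []) 0 (x0 :+ nat 0 :* x1) x0 (∅) refl) , (lin ((L s) ∷ C ∷ σ ∷ []) 0 x0 (x0 :+ nat 0 :* (x1 :+ nat 2 :* x2)) (∅) refl) ,
       (lin ((Mert (y s)) ∷ ω ∷ (L (y s)) ∷ []) 0 (nat 5 :* (x2 :- x2)) (nat 4 :* (x0 :- x0) :+ nat 4 :* (nat 0 :* x1)) (∅) refl)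

     Result : ℕ → Set
     Result i = State (suc i) ⊎ (ω * δ ≤ Def end - Def s)

     -- The initial move by `σ` guarantees progress; the good `k′` is then sought in an interval of
     -- length `C`, for which `IH` supplies mass if the search fails.
     advance : ∀ {i} → i ℕ.< B → State i → Result i
     advance {i} i<B (k , s≤k , k≤end , k-lo , k-hi , inv) = from-u (log-step {k} {end} {σ} k≥1 k≤end end≤X σ≥0 room)
       where
       k≥1 : 1 ℕ.≤ k
       k≥1 = ℕ.≤-trans s≥1 s≤k
       room : L k + σ ≤ L end
       room = lin ((L k) ∷ (L s) ∷ (ι i) ∷ C ∷ σ ∷ (L end) ∷ (L ϱ) ∷ (ι B) ∷ []) 0 (x0 :+ x4) x5 (le x0 (x1 :+ x2 :* (x3 :+ nat 2 :* x4)) k-hi ⊞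
           le (x1 :+ x6) x5 (≤-reflexive (sym (L-* s≥1 ϱ≥1))) ⊞ le (x7 :* (x3 :+ nat 2 :* x4)) x6 long ⊞
           le (nat 0) x3 C≥0 ⊞ le (nat 0) x4 σ≥0 ⊞
           (le (one :+ x2) x7 (ι-mono i<B)) ⊛ (nn x3 C≥0) ⊞
           2 ⊠ ((le (one :+ x2) x7 (ι-mono i<B)) ⊛ (nn x4 σ≥0))) refl
       from-u : (∃ λ u → k ℕ.≤ u × u ℕ.≤ end × L k + σ ≤ L u × L u ≤ L k + σ + rec k) → Result i
       from-u (u , k≤u , u≤end , u-lo , u-hi) = from-v (log-step {u} {end} {C} (ℕ.≤-trans (ℕ.≤-trans s≥1 s≤k) k≤u) u≤end end≤X C≥0 room′)
         where
         room′ : L u + C ≤ L end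
         room′ = lin ((L u) ∷ (L k) ∷ σ ∷ (rec k) ∷ (rec s) ∷ (L s) ∷ (ι i) ∷ C ∷ (L end) ∷ (L ϱ) ∷ (ι B) ∷ []) 0 (x0 :+ x7) x8 (le x0 (x1 :+ x2 :+ x3) u-hi ⊞ le x3 x4 (rec-anti s≥1 s≤k) ⊞
             le (nat 2 :* x4) x2 sσ ⊞ le (nat 0) x4 (0≤rec s) ⊞ le x1 (x5 :+ x6 :* (x7 :+ nat 2 :* x2)) k-hi
             ⊞ le (x5 :+ x9) x8 (≤-reflexive (sym (L-* s≥1 ϱ≥1))) ⊞ le (x10 :* (x7 :+ nat 2 :* x2)) x9 long
             ⊞ (le (one :+ x6) x10 (ι-mono i<B)) ⊛ (nn x7 C≥0) ⊞
             2 ⊠ ((le (one :+ x6) x10 (ι-mono i<B)) ⊛ (nn x2 σ≥0))) refl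
         from-v : (∃ λ v → u ℕ.≤ v × v ℕ.≤ end × L u + C ≤ L v × L v ≤ L u + C + rec u) → Result i
         from-v (v , u≤v , v≤end , v-lo , v-hi) = from-search (search (λ k′ → deficit k′ ≤? ω) u v)
           where
           from-search : (∃ λ k′ → u ℕ.< k′ × k′ ℕ.≤ v × deficit k′ ≤ ω) ⊎ (∀ k′ → u ℕ.< k′ → k′ ℕ.≤ v → ¬ deficit k′ ≤ ω) → Result i
           from-search (inj₂ none) = inj₂ (lin (δ ∷ (Mert v) ∷ (Mert u) ∷ ω ∷ (Def v) ∷ (Def u) ∷ (Def end) ∷ (Def s) ∷ []) 0 (x3 :* x0) (x6 :- x7) (le (x3 :* (x1 :- x2)) (x4 :- x5) (Def-window u≤v (ℕ.≤-trans v≤end sϱ≤) (λ k′ p q → <⇒≤ (≰⇒> (none k′ p q))))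
               ⊞ le x4 x6 (Def-mono v≤end sϱ≤) ⊞ le x7 x5 (Def-mono s≤u (ℕ.≤-trans u≤end sϱ≤)) ⊞
               (le x0 (x1 :- x2) (IH (ℕ.≤-trans u₀≤s s≤u) u≤v (ℕ.≤-trans (ℕ.*-monoʳ-≤ 2 v≤end) 2end≤X) C≤)) ⊛ (nn x3 ω≥0)) refl)
             where
             s≤u : s ℕ.≤ u
             s≤u = ℕ.≤-trans s≤k k≤u
             C≤ : C ≤ L v - L u
             C≤ = lin ((L u) ∷ C ∷ (L v) ∷ []) 0 x1 (x2 :- x0) (le (x0 :+ x1) x2 v-lo) refl
           from-search (inj₁ (k′ , u<k′ , k′≤v , small)) = inj₁ (k′ , ℕ.≤-trans s≤k k≤k′ , ℕ.≤-trans k′≤v v≤end ,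
               (lin ((L s) ∷ (ι i) ∷ σ ∷ (L k) ∷ (L u) ∷ (L k′) ∷ []) 0 (x0 :+ (one :+ x1) :* x2) x5 (le (x0 :+ x1 :* x2) x3 k-lo ⊞ le (x3 :+ x2) x4 u-lo ⊞
                   le x4 x5 Lu≤) refl) ,
               (lin ((L k) ∷ (L s) ∷ (ι i) ∷ C ∷ σ ∷ (L k′) ∷ []) 0 x5 (x1 :+ (one :+ x2) :* (x3 :+ nat 2 :* x4)) (le x0 (x1 :+ x2 :* (x3 :+ nat 2 :* x4)) k-hi ⊞
                   le x5 (x0 :+ x3 :+ nat 2 :* x4) step) refl) , inv′)
             where
             s≤u : s ℕ.≤ u
             s≤u = ℕ.≤-trans s≤k k≤u
             k≤k′ : k ℕ.≤ k′
             k≤k′ = ℕ.≤-trans k≤u (ℕ.<⇒≤ u<k′)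
             k′≥1 : 1 ℕ.≤ k′
             k′≥1 = ℕ.≤-trans k≥1 k≤k′
             k′≤end : k′ ℕ.≤ end
             k′≤end = ℕ.≤-trans k′≤v v≤end
             k′≤ : k′ ℕ.≤ kmax
             k′≤ = ℕ.≤-trans k′≤end sϱ≤
             k≤ : k ℕ.≤ kmax
             k≤ = ℕ.≤-trans k≤k′ k′≤
             Lu≤ : L u ≤ L k′
             Lu≤ = L-mono (ℕ.≤-trans s≥1 s≤u) (ℕ.<⇒≤ u<k′) (ℕ.≤-trans k′≤end end≤X)
             step : L k′ ≤ L k + C + ι 2 * σ
             step = lin ((L k′) ∷ (L v) ∷ (L u) ∷ C ∷ (rec u) ∷ (L k) ∷ σ ∷ (rec k) ∷ (rec s) ∷ []) 0 x0 (x5 :+ x3 :+ nat 2 :* x6) (le x0 x1 (L-mono k′≥1 k′≤v (ℕ.≤-trans v≤end end≤X)) ⊞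
                 le x1 (x2 :+ x3 :+ x4) v-hi ⊞ le x2 (x5 :+ x6 :+ x7) u-hi ⊞ le x7 x8 (rec-anti s≥1 s≤k) ⊞
                 le x4 x8 (rec-anti s≥1 s≤u) ⊞ le (nat 2 :* x8) x6 sσ) refl
             yk yk′ wk′ : ℕ
             yk = y k
             yk′ = y k′
             wk′ = w k′
             y≥1 : 1 ℕ.≤ yk′
             y≥1 = ℕ.≤-trans y₀≥1 (y₀≤y k′≥1 k′≤)
             yk≤x : yk ℕ.≤ x
             yk≤x = div≤ x k
             y′≤y : yk′ ℕ.≤ yk
             y′≤y = ≤-div k≥1 (ℕ.≤-trans (ℕ.*-monoˡ-≤ yk′ k≤k′) (div-≤ x k′))
             gap : ℚ
             gap = L yk - L yk′
             0≤gap : 0ℚ ≤ gap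
             0≤gap = ≤⇒0≤- (L-mono y≥1 y′≤y (ℕ.≤-trans yk≤x x≤X))
             gap≤ : gap ≤ C + ι 3 * σ
             gap≤ = lin ((L k) ∷ (L yk) ∷ (L x) ∷ (L k′) ∷ (L yk′) ∷ (rec yk′) ∷ (rec y₀) ∷ σ ∷ C ∷ []) 0 (x1 :- x4) (x8 :+ nat 3 :* x7) (le (x0 :+ x1) x2 (proj₁ (L-div k≥1 (k≤x k≤) 2x≤X)) ⊞
                 le x2 (x3 :+ x4 :+ x5) (proj₂ (L-div k′≥1 (k≤x k′≤) 2x≤X)) ⊞
                 le x5 x6 (rec-anti y₀≥1 (y₀≤y k′≥1 k′≤)) ⊞ le x6 x7 y₀σ ⊞
                 le x3 (x0 :+ x8 :+ nat 2 :* x7) step) refl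
             dense : ι 2 * ℓ + η - ω ≤ Mert wk′ - Mert yk′
             dense = lin (ℓ ∷ η ∷ (Mert wk′) ∷ (Mert yk′) ∷ ω ∷ []) 0 (nat 2 :* x0 :+ x1 :- x4) (x2 :- x3) (le (nat 2 :* x0 :+ x1 :- (x2 :- x3)) x4 small) refl
             -- If the good window at `k′` ends before `x/k`, its mass of about `2ℓ ≥ 3C/2` exceeds
             -- 5/4 of the gap, as the gap is at most `C + 3σ = 19C/16` and `95/64 < 96/64`. This
             -- tunes `3/4`, `5/4` and `σ = C/16`. If the window overshoots `x/k`, the excess has
             -- density at most 2 by `upper`, so density 2 remains below `x/k`, up to `ω`.
             gain : ι 5 * gap ≤ ι 4 * (Mert yk - Mert yk′) + ι 4 * ω
             gain with ℕ.≤-total wk′ yk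
             ... | inj₁ w≤y = lin (ℓ ∷ η′ ∷ (rec y₀) ∷ ω ∷ (Mert wk′) ∷ (Mert yk′) ∷ (Mert yk) ∷ gap ∷ C ∷ σ ∷ []) 0 (nat 5 :* x7) (nat 4 :* (x6 :- x5) :+ nat 4 :* x3) (4 ⊠ (le (nat 2 :* x0 :+ (x1 :+ nat 2 :* x2) :- x3) (x4 :- x5) dense)
                 ⊞ 4 ⊠ (le x4 x6 (Mert-mono w≤y (ℕ.≤-trans yk≤x x≤X))) ⊞ 5 ⊠ (le x7 (x8 :+ nat 3 :* x9) gap≤)
                 ⊞ 2 ⊠ (le (nat 3 :* x8) (nat 4 :* x0) 3C≤4ℓ) ⊞ le (nat 16 :* x9) x8 (≤-reflexive 16σ≡C) ⊞
                 le (nat 0) x9 σ≥0 ⊞ 4 ⊠ (nn x1 η′≥0) ⊞ 8 ⊠ (nn x2 (0≤rec y₀))) refl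
             ... | inj₂ y≤w′ = lin (ℓ ∷ η′ ∷ (rec y₀) ∷ ω ∷ (Mert wk′) ∷ (Mert yk′) ∷ (Mert yk) ∷ (L wk′) ∷ (L yk) ∷
                 (L yk′) ∷ []) 0 (nat 5 :* (x8 :- x9)) (nat 4 :* (x6 :- x5) :+ nat 4 :* x3) (4 ⊠ (le (nat 2 :* x0 :+ (x1 :+ nat 2 :* x2) :- x3) (x4 :- x5) dense)
                 ⊞
                 4 ⊠ (le (x4 :- x6) (nat 2 :* (x7 :- x8) :+ x1) (upper (ℕ.≤-trans (y₀≤y k′≥1 k′≤) y′≤y) y≤w′ (ℕ.≤-trans (w≤2Ry k′≥1 k′≤) (ℕ.*-monoʳ-≤ (2 ℕ.* R) y′≤y)) (div≤ Y k′)))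
                 ⊞ 8 ⊠ (le (x7 :- x9) (x0 :+ x2) (w-y k′≥1 k′≤)) ⊞ 3 ⊠ (nn (x8 :- x9) 0≤gap)) refl
             inv′ : ι 5 * (L (y s) - L yk′) ≤ ι 4 * (Mert (y s) - Mert yk′) + ι 4 * ((1ℚ + ι i) * ω)
             inv′ = lin ((L yk) ∷ (L yk′) ∷ (Mert yk) ∷ (Mert yk′) ∷ ω ∷ (L (y s)) ∷ (Mert (y s)) ∷ (ι i) ∷ []) 0 (nat 5 :* (x5 :- x1)) (nat 4 :* (x6 :- x3) :+ nat 4 :* ((one :+ x7) :* x4)) (le (nat 5 :* (x0 :- x1)) (nat 4 :* (x2 :- x3) :+ nat 4 :* x4) gain
                 ⊞ le (nat 5 :* (x5 :- x0)) (nat 4 :* (x6 :- x2) :+ nat 4 :* (x7 :* x4)) inv) refl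

     run : ∀ i → i ℕ.≤ B → State i ⊎ (ω * δ ≤ Def end - Def s)
     run zero _ = inj₁ start
     run (suc i) i<B with run i (ℕ.<⇒≤ i<B)
     ... | inj₂ h = inj₂ h
     ... | inj₁ st = advance i<B st

     -- The stretch has length at least `Bσ - 1`, while density 5/4 and the error 9 in `Mert-diff`
     -- allow at most `36 + 4Bω ≤ 36 + Bσ/8`. This is impossible once `Bσ ≥ 50`.
     finish : ¬ State B
     finish (k , s≤k , k≤end , k-lo , k-hi , inv) = lin-⊥ ((L (y s)) ∷ (L (y k)) ∷ (Mert (y s)) ∷ (Mert (y k)) ∷ (ι B) ∷ ω ∷ (L k) ∷ (L x) ∷
         (L s) ∷ (rec (y s)) ∷ σ ∷ []) (8 ⊠ (le (nat 5 :* (x0 :- x1)) (nat 4 :* (x2 :- x3) :+ nat 4 :* (x4 :* x5)) inv) ⊞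
         32 ⊠ (le (x2 :- x3) (x0 :- x1 :+ nat 9) (proj₁ (Mert-diff (ℕ.≤-trans y₀≥1 (y₀≤y k≥1 k≤)) ys≥yk (ℕ.≤-trans (div≤ x s) x≤X))))
         ⊞ 8 ⊠ (le (x6 :+ x1) x7 (proj₁ (L-div k≥1 (k≤x k≤) 2x≤X))) ⊞
         8 ⊠ (le x7 (x8 :+ x0 :+ x9) (proj₂ (L-div s≥1 (k≤x (ℕ.≤-trans s≤sϱ sϱ≤)) 2x≤X))) ⊞
         8 ⊠ (le x9 one (rec≤1 (ℕ.≤-trans y₀≥1 (y₀≤y s≥1 (ℕ.≤-trans s≤sϱ sϱ≤))))) ⊞
         8 ⊠ (le (x8 :+ x4 :* x10) x6 k-lo) ⊞ 7 ⊠ (le (nat 50) (x4 :* x10) Bσ) ⊞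
         (le (nat 32 :* x5) x10 32ω≤σ) ⊛ (nn x4 (0≤ι B))) refl
       where
       k≥1 : 1 ℕ.≤ k
       k≥1 = ℕ.≤-trans s≥1 s≤k
       k≤ : k ℕ.≤ kmax
       k≤ = ℕ.≤-trans k≤end sϱ≤
       ys≥yk : y k ℕ.≤ y s
       ys≥yk = ≤-div s≥1 (ℕ.≤-trans (ℕ.*-monoˡ-≤ (y k) s≤k) (div-≤ x k))

     block : ω * δ ≤ Def end - Def s
     block with run B ℕ.≤-refl
     ... | inj₁ st = contradiction st finish
     ... | inj₂ h = h

-- Positive prime mass in shorter and shorter windows.

module DenseWindows where

 open import Relation.Binary.PropositionalEquality
 open RationalArithmetic
 open DivisorSums
 open IntegerLogarithm
 open MertensEstimates
 open SelbergWindows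
 open ErdosBlocks

 ∑-tail : ∀ {a b} (f g : ℕ → ℚ) → a ℕ.≤ b → (∀ i → a ℕ.< i → i ℕ.≤ b → f i ≤ g i) → ∑ b f - ∑ a f ≤ ∑ b g - ∑ a g
 ∑-tail {a} {b} f g a≤b k with ℕ.m≤n⇒m<n∨m≡n a≤b
 ... | inj₂ refl = lin ((∑ a g) ∷ (∑ a f) ∷ []) 0 (x1 :- x1) (x0 :- x0) (∅) refl
 ∑-tail {a} {suc b} f g a≤b k | inj₁ (s≤s a≤b′) = lin ((∑ b f) ∷ (∑ a f) ∷ (∑ b g) ∷ (∑ a g) ∷ (f (suc b)) ∷ (g (suc b)) ∷ []) 0 (x0 :+ x4 :- x1) (x2 :+ x5 :- x3) (le (x0 :- x1) (x2 :- x3) (∑-tail f g a≤b′ (λ i p q → k i p (ℕ.m≤n⇒m≤1+n q)))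
     ⊞ le x4 x5 (k (suc b) (s≤s a≤b′) ℕ.≤-refl)) refl

 -- If `(x, Y]` has mass at most `δ`, `selberg-lower` forces the windows `(x/k, Y/k]` to carry
 -- nearly their maximum together, so the total deficit is at most a small multiple of `L Y` plus a
 -- constant. The `k > kmax`, with `Y/k` bounded by `R y₀`, only enter the constant.
 module Budget {X : ℕ} (log : Logarithm X) {x Y R y₀ : ℕ} (x≥1 : 1 ℕ.≤ x) (x≤Y : x ℕ.≤ Y) (Y≤Rx : Y ℕ.≤ R ℕ.* x) (2Y≤X : 2 ℕ.* Y ℕ.≤ X)
   (y₀≥1 : 1 ℕ.≤ y₀) (η′ : ℚ) (η′≥0 : 0ℚ ≤ η′)
   (E≤ : selbergError (2 ℕ.* R) ≤ η′ * Logarithm.L log y₀) (Ly₀≥1 : 1ℚ ≤ Logarithm.L log y₀) (kmax≥1 : 1 ℕ.≤ x div y₀) where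
   open Estimates log
   open LogSteps log
   open Block log {x} {Y} {R} {y₀} x≥1 x≤Y Y≤Rx 2Y≤X y₀≥1 η′ η′≥0 E≤ Ly₀≥1
   open SelbergFormula log {x} {Y} {R} x≥1 x≤Y Y≤Rx 2Y≤X using (W; selberg-lower)

   r : ℚ
   r = ι R * ι y₀

   0≤r : 0ℚ ≤ r
   0≤r = 0≤* (0≤ι R) (0≤ι y₀)

   Y≥1 : 1 ℕ.≤ Y
   Y≥1 = ℕ.≤-trans x≥1 x≤Y

   kmax≤Y : kmax ℕ.≤ Y
   kmax≤Y = ℕ.≤-trans (div≤ x y₀) x≤Y

   Y≤2rkmax : ι Y ≤ ι 2 * r * ι kmax
   Y≤2rkmax = lin ((ι Y) ∷ (ι R) ∷ (ι x) ∷ (ι y₀) ∷ (ι kmax) ∷ []) 0 x0 (nat 2 :* (x1 :* x3) :* x4) (le x0 (x1 :* x2) (subst (ι Y ≤_) (ι-* R x) (ι-mono Y≤Rx))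
       ⊞
       (le x2 (x3 :* (one :+ x4)) (subst (ι x ≤_) (ι-* y₀ (suc kmax)) (ι-mono (ℕ.<⇒≤ (div-< x y₀≥1))))) ⊛ (nn x1 (0≤ι R))
       ⊞ (le one x4 (1≤ι kmax≥1)) ⊛ (nn (x1 :* x3) 0≤r)) refl

   LY≤ : L Y ≤ L kmax + ι 2 * r
   LY≤ = lin ((L Y) ∷ (L kmax) ∷ (ι Y) ∷ (ι kmax) ∷ (rec kmax) ∷ r ∷ []) 0 x0 (x1 :+ nat 2 :* x5) (le x0 (x1 :+ (x2 :- x3) :* x4) (L-growth kmax≥1 kmax≤Y Y≤X) ⊞
       le (nat 2 :* x5 :* (x3 :* x4)) (nat 2 :* x5 :* one) (≤-reflexive (cong (ι 2 * r *_) (ι*rec′ kmax≥1)))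
       ⊞ le one (x3 :* x4) (≤-reflexive (sym (ι*rec′ kmax≥1))) ⊞
       (le x2 (nat 2 :* x5 :* x3) Y≤2rkmax) ⊛ (nn x4 (0≤rec kmax))) refl

   far : ∀ k → kmax ℕ.< k → k ℕ.≤ Y → Mert (w k) - Mert (y k) ≤ r + ι 8
   far k kmax<k k≤Y = lin ((Mert (w k)) ∷ (L (w k)) ∷ (ι (w k)) ∷ (ι R) ∷ (ι y₀) ∷ (Mert (y k)) ∷ r ∷ []) 0 (x0 :- x5) (x6 :+ nat 8) (le x0 (x1 :+ nat 8) (Mert-upper b≥1 (w≤X k)) ⊞
       le x1 (x2 :- one) (L≤ b≥1 (w≤X k)) ⊞
       le x2 (x3 :* x4) (subst (ι (w k) ≤_) (ι-* R y₀) (ι-mono b≤)) ⊞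
       le (nat 0) x5 (0≤∑ (y k) (λ i p q → 0≤Λrec p (ℕ.≤-trans q (ℕ.≤-trans (div≤ x k) x≤X)))) ⊞
       le (x3 :* x4) x6 (≤-reflexive (sym refl))) refl
     where
     k≥1 : 1 ℕ.≤ k
     k≥1 = ℕ.≤-trans (s≤s z≤n) kmax<k
     b≥1 : 1 ℕ.≤ w k
     b≥1 = ≤-div {Y} {k} {1} k≥1 (subst (ℕ._≤ Y) (sym (ℕ.*-identityʳ k)) k≤Y)
     x≤y₀k : x ℕ.≤ y₀ ℕ.* k
     x≤y₀k = ℕ.≤-trans (ℕ.<⇒≤ (div-< x y₀≥1)) (ℕ.*-monoʳ-≤ y₀ kmax<k)
     b≤ : w k ℕ.≤ R ℕ.* y₀
     b≤ = ℕ.*-cancelˡ-≤ k {{ℕ.>-nonZero k≥1}} (ℕ.≤-trans (div-≤ Y k) (ℕ.≤-trans Y≤Rx (ℕ.≤-trans (ℕ.*-monoʳ-≤ R x≤y₀k) (ℕ.≤-reflexive (ring-eqᴺ (R ∷ y₀ ∷ k ∷ []) (x0 :* (x1 :* x2)) (x2 :* (x0 :* x1)) refl)))))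

   f : ℕ → ℚ
   f k = Λ k * rec k * (Mert (w k) - Mert (y k))

   tail : W - ∑ kmax f ≤ (r + ι 8) * (ι 2 * r + ι 9)
   tail = lin (W ∷ (∑ kmax f) ∷ (∑ Y (λ k → (r + ι 8) * (Λ k * rec k))) ∷
       (∑ kmax (λ k → (r + ι 8) * (Λ k * rec k))) ∷ r ∷ (Mert Y) ∷ (Mert kmax) ∷ (L Y) ∷ (L kmax)
       ∷ []) 0 (x0 :- x1) ((x4 :+ nat 8) :* (nat 2 :* x4 :+ nat 9)) (le (x0 :- x1) (x2 :- x3) (∑-tail f (λ k → (r + ι 8) * (Λ k * rec k)) kmax≤Y bound)
       ⊞ le x2 ((x4 :+ nat 8) :* x5) (≤-reflexive (∑-* Y (r + ι 8) (λ k → Λ k * rec k))) ⊞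
       le ((x4 :+ nat 8) :* x6) x3 (≤-reflexive (sym (∑-* kmax (r + ι 8) (λ k → Λ k * rec k)))) ⊞
       8 ⊠ (le (x5 :- x6) (x7 :- x8 :+ nat 9) (proj₁ (Mert-diff kmax≥1 kmax≤Y Y≤X))) ⊞
       8 ⊠ (le x7 (x8 :+ nat 2 :* x4) LY≤) ⊞
       (le (x5 :- x6) (x7 :- x8 :+ nat 9) (proj₁ (Mert-diff kmax≥1 kmax≤Y Y≤X))) ⊛ (nn x4 0≤r)
       ⊞ (le x7 (x8 :+ nat 2 :* x4) LY≤) ⊛ (nn x4 0≤r)) refl
     where
     bound : ∀ k → kmax ℕ.< k → k ℕ.≤ Y → f k ≤ (r + ι 8) * (Λ k * rec k)
     bound k p q = lin ((Λ k) ∷ (rec k) ∷ (Mert (w k)) ∷ (Mert (y k)) ∷ r ∷ []) 0 (x0 :* x1 :* (x2 :- x3)) ((x4 :+ nat 8) :* (x0 :* x1)) ((nn (x0 :* x1) (0≤Λrec (ℕ.≤-trans (s≤s z≤n) p) (ℕ.≤-trans q Y≤X))) ⊛ (le (x2 :- x3) (x4 :+ nat 8) (far k p q))) refl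

   Def≡ : Def kmax ≡ (ι 2 * ℓ + η) * Mert kmax - ∑ kmax f
   Def≡ = trans (∑-cong kmax (λ k _ _ → (ring-eq ((Λ k) ∷ (rec k) ∷ ℓ ∷ η ∷ (Mert (w k)) ∷ (Mert (y k)) ∷ []) (x0 :* x1 :* (nat 2 :* x2 :+ x3 :- (x4 :- x5))) ((nat 2 :* x2 :+ x3) :* (x0 :* x1) :+ ⊝ nat 1 :* (x0 :* x1 :* (x4 :- x5))) refl)))
     (trans (∑-+ kmax (λ k → (ι 2 * ℓ + η) * (Λ k * rec k)) (λ k → - ι 1 * f k))
       (trans (cong₂ _+_ (∑-* kmax (ι 2 * ℓ + η) (λ k → Λ k * rec k)) (∑-* kmax (- ι 1) f)) (ring-eq (ℓ ∷ η ∷ (Mert kmax) ∷ (∑ kmax f) ∷ []) ((nat 2 :* x0 :+ x1) :* x2 :+ ⊝ nat 1 :* x3) ((nat 2 :* x0 :+ x1) :* x2 :- x3) refl)))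

   budget : ∀ {δ} → Mert Y - Mert x ≤ δ →
     Def kmax ≤ (η + δ) * L Y + ((ι 2 * ℓ + η) * ι 8 + selbergError R + (r + ι 8) * (ι 2 * r + ι 9))
   budget {δ} gap = lin ((Def kmax) ∷ ℓ ∷ η ∷ (Mert kmax) ∷ (∑ kmax f) ∷ W ∷ r ∷ (L Y) ∷ (Mert Y) ∷ (Mert x) ∷
       (selbergError R) ∷ δ ∷ []) 0 x0 ((x2 :+ x11) :* x7 :+ ((nat 2 :* x1 :+ x2) :* nat 8 :+ x10 :+ (x6 :+ nat 8) :* (nat 2 :* x6 :+ nat 9))) (le x0 ((nat 2 :* x1 :+ x2) :* x3 :- x4) (≤-reflexive Def≡)
       ⊞ le (x5 :- x4) ((x6 :+ nat 8) :* (nat 2 :* x6 :+ nat 9)) tail ⊞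
       le (nat 2 :* x1 :* x7) (x7 :* (x8 :- x9) :+ x5 :+ x10) selberg-lower ⊞
       (le (x8 :- x9) x11 gap) ⊛ (nn x7 (0≤L Y≥1 Y≤X)) ⊞
       (le x3 (x7 :+ nat 8) Mk) ⊛ (nn (nat 2 :* x1 :+ x2) slack)) refl
     where
     Mk : Mert kmax ≤ L Y + ι 8
     Mk = ≤-trans (Mert-mono kmax≤Y Y≤X) (Mert-upper Y≥1 Y≤X)
     slack : 0ℚ ≤ ι 2 * ℓ + η
     slack = lin ((L x) ∷ (L Y) ∷ η′ ∷ (rec y₀) ∷ []) 0 (nat 0) (nat 2 :* (x1 :- x0) :+ (x2 :+ nat 2 :* x3)) (2 ⊠ (le x0 x1 (L-mono x≥1 x≤Y Y≤X))
         ⊞ le (nat 0) x2 η′≥0 ⊞ 2 ⊠ (nn x3 (0≤rec y₀))) refl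

 -- The claim covers all approximations at once, because the range `X` grows with the window while
 -- `u₀` and `d` must stay fixed. `c` and `1/e` enclose `C`, so that all constants can be chosen as
 -- integers.
 record Dense (C : ℚ) : Set where
   field
     c e d u₀ : ℕ
     C≤c : C ≤ ι c
     1≤eC : 1ℚ ≤ ι e * C
     e≥1 : 1 ℕ.≤ e
     d≥1 : 1 ℕ.≤ d
     u₀≥1 : 1 ℕ.≤ u₀
     dense : ∀ {X} (log : Logarithm X) {u v} → u₀ ℕ.≤ u → u ℕ.≤ v → 2 ℕ.* v ℕ.≤ X → C ≤ Logarithm.L log v - Logarithm.L log u →
       rec d ≤ Estimates.Mert log v - Estimates.Mert log u

 -- The bootstrap starts at length 10 because `Mert-diff` has error 9.
 dense₀ : Dense (ι 10)
 dense₀ = record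
   { c = 10 ; e = 1 ; d = 1 ; u₀ = 1 ; C≤c = ≤-refl ; 1≤eC = (lin ([]) 0 one (nat 1 :* nat 10) (∅) refl) ; e≥1 = ℕ.≤-refl ; d≥1 = ℕ.≤-refl ; u₀≥1 = ℕ.≤-refl
   ; dense = λ log {u} {v} u≥1 u≤v 2v≤X h → go log u≥1 u≤v (ℕ.≤-trans (ℕ.m≤m+n v _) 2v≤X) h }
   where
   go : ∀ {X} (log : Logarithm X) {u v} → 1 ℕ.≤ u → u ℕ.≤ v → v ℕ.≤ X → ι 10 ≤ Logarithm.L log v - Logarithm.L log u → rec 1 ≤ Estimates.Mert log v - Estimates.Mert log u
   go log {u} {v} u≥1 u≤v v≤X h = lin ((L v) ∷ (L u) ∷ (Mert v) ∷ (Mert u) ∷ (rec 1) ∷ []) 0 x4 (x2 :- x3) (le (nat 10) (x0 :- x1) h ⊞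
       le (x0 :- x1) (x2 :- x3 :+ nat 9) (proj₂ (Mert-diff u≥1 u≤v v≤X)) ⊞
       le x4 one (≤-reflexive rec-1)) refl
     where
     open Estimates log
     open LogSteps log

 n≤2^n : ∀ n → n ℕ.≤ 2 ℕ.^ n
 n≤2^n zero = z≤n
 n≤2^n (suc n) = linᴺ (n ∷ (2 ℕ.^ n) ∷ []) 0 (nat 1 :+ x0) (nat 2 :* x1) (leᴺ x0 x1 (n≤2^n n) ⊞ᴺ leᴺ (nat 1) x1 (ℕ.m^n>0 2 n)) refl

 errorℕ : ℕ → ℕ
 errorℕ R = R ℕ.* (40 ℕ.+ 14 ℕ.* R ℕ.+ 2 ℕ.* (R ℕ.* R))

 errorℕ-correct : ∀ R → ι (errorℕ R) ≡ selbergError R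
 errorℕ-correct R = cast (R ∷ []) (var 0 :* (nat 40 :+ nat 14 :* var 0 :+ nat 2 :* (var 0 :* var 0))) _

 -- `B = 800 e` gives `Bσ ≥ 50` and `ω = 1/(512 e)` gives `32ω ≤ σ`. The logarithm of `ϱ` is at
 -- least `2Bc ≥ B (C + 2σ)`, room for `B` steps. One block costs `ω δ = 1/D′`. `y₀` is so large
 -- that Selberg's error there is at most `L y₀ / M`, and `M = 8 D′ ϱ` makes the slope of the budget
 -- half of the cost of the blocks.
 module Improve {C : ℚ} (D : Dense C) where
   open Dense D

   C′ σ : ℚ
   C′ = rec 4 * (ι 3 * C)
   σ = rec 16 * C

   -- The constants of the argument, opaque so that the powers of two are never evaluated.
   opaque
     B ϱ R D′ M K y₀ s₀ d′ C₅ C₇ blocks : ℕ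
     B = 800 ℕ.* e
     ϱ = 2 ℕ.^ (3 ℕ.* (2 ℕ.* B ℕ.* c))
     R = 2 ℕ.^ (3 ℕ.* suc (suc c))
     D′ = 512 ℕ.* e ℕ.* d
     M = 8 ℕ.* D′ ℕ.* ϱ
     K = (errorℕ (2 ℕ.* R) ℕ.+ 2) ℕ.* M
     y₀ = 2 ℕ.^ (3 ℕ.* K)
     s₀ = u₀ ℕ.+ 32 ℕ.* e
     d′ = 4 ℕ.* D′ ℕ.* ϱ
     C₅ = (2 ℕ.* suc c ℕ.+ 3) ℕ.* 8 ℕ.+ errorℕ R ℕ.+ (R ℕ.* y₀ ℕ.+ 8) ℕ.* (2 ℕ.* (R ℕ.* y₀) ℕ.+ 9)
     C₇ = s₀ ℕ.+ ϱ ℕ.+ 2 ℕ.* (R ℕ.* y₀)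
     blocks = suc (2 ℕ.* D′ ℕ.* (C₅ ℕ.+ C₇))

     B≡ : B ≡ 800 ℕ.* e
     B≡ = refl
     ϱ≡ : ϱ ≡ 2 ℕ.^ (3 ℕ.* (2 ℕ.* B ℕ.* c))
     ϱ≡ = refl
     R≡ : R ≡ 2 ℕ.^ (3 ℕ.* suc (suc c))
     R≡ = refl
     D′≡ : D′ ≡ 512 ℕ.* e ℕ.* d
     D′≡ = refl
     M≡ : M ≡ 8 ℕ.* D′ ℕ.* ϱ
     M≡ = refl
     K≡ : K ≡ (errorℕ (2 ℕ.* R) ℕ.+ 2) ℕ.* M
     K≡ = refl
     y₀≡ : y₀ ≡ 2 ℕ.^ (3 ℕ.* K)
     y₀≡ = refl
     s₀≡ : s₀ ≡ u₀ ℕ.+ 32 ℕ.* e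
     s₀≡ = refl
     d′≡ : d′ ≡ 4 ℕ.* D′ ℕ.* ϱ
     d′≡ = refl
     C₅≡ : C₅ ≡ (2 ℕ.* suc c ℕ.+ 3) ℕ.* 8 ℕ.+ errorℕ R ℕ.+ (R ℕ.* y₀ ℕ.+ 8) ℕ.* (2 ℕ.* (R ℕ.* y₀) ℕ.+ 9)
     C₅≡ = refl
     C₇≡ : C₇ ≡ s₀ ℕ.+ ϱ ℕ.+ 2 ℕ.* (R ℕ.* y₀)
     C₇≡ = refl
     blocks≡ : blocks ≡ suc (2 ℕ.* D′ ℕ.* (C₅ ℕ.+ C₇))
     blocks≡ = refl

   ω η′ : ℚ
   ω = rec (512 ℕ.* e)
   η′ = rec M

   C≥0 : 0ℚ ≤ C
   C≥0 = 0≤-cancel′ e≥1 (≤-trans 0≤1 1≤eC)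
     where
     0≤-cancel′ : ∀ {e} → 1 ℕ.≤ e → 0ℚ ≤ ι e * C → 0ℚ ≤ C
     0≤-cancel′ {suc e} _ = 0≤-cancel e C

   rec-e≤C : rec e ≤ C
   rec-e≤C = lin ((ι e) ∷ C ∷ (rec e) ∷ []) 0 x2 x1 (le (x0 :* x2 :* x1) (one :* x1) (≤-reflexive (cong (_* C) (ι*rec′ e≥1))) ⊞
       (le one (x0 :* x1) 1≤eC) ⊛ (nn x2 (0≤rec e))) refl

   16σ≡C : ι 16 * σ ≡ C
   16σ≡C = trans (ring-eq ((rec 16) ∷ C ∷ []) (nat 16 :* (x0 :* x1)) (nat 16 :* x0 :* x1) refl) (trans (cong (_* C) (ι*rec 15)) (ℚₚ.*-identityˡ C))

   4C′≡3C : ι 4 * C′ ≡ ι 3 * C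
   4C′≡3C = trans (ring-eq ((rec 4) ∷ C ∷ []) (nat 4 :* (x0 :* (nat 3 :* x1))) (nat 4 :* x0 :* (nat 3 :* x1)) refl) (trans (cong (_* (ι 3 * C)) (ι*rec 3)) (ℚₚ.*-identityˡ (ι 3 * C)))

   σ≥0 : 0ℚ ≤ σ
   σ≥0 = 0≤* (0≤rec 16) C≥0

   32ω≤σ : ι 32 * ω ≤ σ
   32ω≤σ = ≤-cancel 15 (lin (σ ∷ C ∷ (rec e) ∷ ω ∷ (rec 512) ∷ []) 0 (nat 16 :* (nat 32 :* x3)) (nat 16 :* x0) (le x1 (nat 16 :* x0) (≤-reflexive (sym 16σ≡C))
       ⊞ le x2 x1 rec-e≤C ⊞ 512 ⊠ (le x3 (x4 :* x2) (≤-reflexive (rec-* 512 e))) ⊞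
       le (nat 512 :* x4 :* x2) (one :* x2) (≤-reflexive (cong (_* rec e) (ι*rec 511)))) refl)

   B≥1 : 1 ℕ.≤ B
   B≥1 = subst (1 ℕ.≤_) (sym B≡) (ℕ.*-mono-≤ {1} {800} (s≤s z≤n) e≥1)

   ϱ≥1 : 1 ℕ.≤ ϱ
   ϱ≥1 = subst (1 ℕ.≤_) (sym ϱ≡) (ℕ.m^n>0 2 (3 ℕ.* (2 ℕ.* B ℕ.* c)))

   D′≥1 : 1 ℕ.≤ D′
   D′≥1 = subst (1 ℕ.≤_) (sym D′≡) (ℕ.*-mono-≤ (ℕ.*-mono-≤ {1} {512} (s≤s z≤n) e≥1) d≥1)

   ωδ : ω * rec d ≡ rec D′
   ωδ = trans (sym (rec-* (512 ℕ.* e) d)) (cong rec (sym D′≡))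

   M≥D′ : D′ ℕ.≤ M
   M≥D′ = subst (D′ ℕ.≤_) (sym M≡) (linᴺ (ϱ ∷ D′ ∷ []) 0 x1 (nat 8 :* x1 :* x0) (7 ⊠ᴺ (nnᴺ x1 (z≤n {D′})) ⊞ᴺ 8 ⊠ᴺ ((leᴺ (nat 1) x0 ϱ≥1) ⊛ᴺ (nnᴺ x1 (z≤n {D′})))) refl)

   M≥1 : 1 ℕ.≤ M
   M≥1 = ℕ.≤-trans D′≥1 M≥D′

   M≥512e : 512 ℕ.* e ℕ.≤ M
   M≥512e = ℕ.≤-trans (ℕ.m≤m*n (512 ℕ.* e) d {{ℕ.>-nonZero d≥1}}) (subst (ℕ._≤ M) D′≡ M≥D′)

   K≥2M : 2 ℕ.* M ℕ.≤ K
   K≥2M = subst (2 ℕ.* M ℕ.≤_) (sym K≡) (ℕ.*-monoˡ-≤ M (ℕ.m≤n+m 2 (errorℕ (2 ℕ.* R))))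

   K≤y₀ : K ℕ.≤ y₀
   K≤y₀ = subst (K ℕ.≤_) (sym y₀≡) (ℕ.≤-trans (n≤2^n K) (ℕ.^-monoʳ-≤ 2 (ℕ.m≤n*m K 3)))

   2M≤y₀ : 2 ℕ.* M ℕ.≤ y₀
   2M≤y₀ = ℕ.≤-trans K≥2M K≤y₀

   2M≥1 : 1 ℕ.≤ 2 ℕ.* M
   2M≥1 = ℕ.≤-trans M≥1 (ℕ.m≤n*m M 2)

   y₀≥1 : 1 ℕ.≤ y₀
   y₀≥1 = ℕ.≤-trans 2M≥1 2M≤y₀

   2rec-y₀ : ι 2 * rec y₀ ≤ rec M
   2rec-y₀ = lin ((rec y₀) ∷ (rec (2 ℕ.* M)) ∷ (rec 2) ∷ (rec M) ∷ []) 0 (nat 2 :* x0) x3 (2 ⊠ (le x0 x1 (rec-anti 2M≥1 2M≤y₀)) ⊞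
       2 ⊠ (le x1 (x2 :* x3) (≤-reflexive (rec-* 2 M))) ⊞
       le (nat 2 :* x2 :* x3) (one :* x3) (≤-reflexive (cong (_* rec M) (ι*rec 1)))) refl

   e512≥1 : 1 ℕ.≤ 512 ℕ.* e
   e512≥1 = ℕ.*-mono-≤ {1} {512} (s≤s z≤n) e≥1

   rec-y₀≤σ : rec y₀ ≤ σ
   rec-y₀≤σ = lin ((rec y₀) ∷ (rec M) ∷ ω ∷ σ ∷ []) 0 x0 x3 (32 ⊠ (le (nat 2 :* x0) x1 2rec-y₀) ⊞
       32 ⊠ (le x1 x2 (rec-anti e512≥1 M≥512e)) ⊞ le (nat 32 :* x2) x3 32ω≤σ ⊞
       63 ⊠ (nn x0 (0≤rec y₀))) refl

   s₀≥1 : 1 ℕ.≤ s₀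
   s₀≥1 = subst (1 ℕ.≤_) (sym s₀≡) (ℕ.≤-trans u₀≥1 (ℕ.m≤m+n u₀ _))

   u₀≤s₀ : u₀ ℕ.≤ s₀
   u₀≤s₀ = subst (u₀ ℕ.≤_) (sym s₀≡) (ℕ.m≤m+n u₀ _)

   rec-s₀≤ : ∀ {s} → s₀ ℕ.≤ s → ι 2 * rec s ≤ σ
   rec-s₀≤ {s} h = ≤-cancel 15 (lin (σ ∷ C ∷ (rec e) ∷ (rec (32 ℕ.* e)) ∷ (rec 32) ∷ (rec s) ∷ []) 0 (nat 16 :* (nat 2 :* x5)) (nat 16 :* x0) (le x1 (nat 16 :* x0) (≤-reflexive (sym 16σ≡C))
       ⊞ le x2 x1 rec-e≤C ⊞ 32 ⊠ (le x3 (x4 :* x2) (≤-reflexive (rec-* 32 e))) ⊞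
       le (nat 32 :* x4 :* x2) (one :* x2) (≤-reflexive (cong (_* rec e) (ι*rec 31))) ⊞
       32 ⊠ (le x5 x3 (rec-anti e32≥1 (ℕ.≤-trans (ℕ.m≤n+m (32 ℕ.* e) u₀) (subst (ℕ._≤ s) s₀≡ h))))) refl)
     where
     e32≥1 : 1 ℕ.≤ 32 ℕ.* e
     e32≥1 = ℕ.*-mono-≤ {1} {32} (s≤s z≤n) e≥1

   Bσ : ι 50 ≤ ι B * σ
   Bσ = ≤-cancel 15 (lin ((ι B) ∷ (ι e) ∷ C ∷ σ ∷ []) 0 (nat 16 :* nat 50) (nat 16 :* (x0 :* x3)) (800 ⊠ (le one (x1 :* x2) 1≤eC) ⊞
       le (nat 800 :* x1 :* x2) (x0 :* (nat 16 :* x3)) (≤-reflexive (sym (cong₂ _*_ (trans (cong ι B≡) (ι-* 800 e)) 16σ≡C)))) refl)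

   d′≥1 : 1 ℕ.≤ d′
   d′≥1 = subst (1 ℕ.≤_) (sym d′≡) (ℕ.*-mono-≤ (ℕ.*-mono-≤ {1} {4} (s≤s z≤n) D′≥1) ϱ≥1)

   1<2^ : ∀ n → 1 ℕ.≤ n → 2 ℕ.≤ 2 ℕ.^ n
   1<2^ (suc n) _ = ℕ.*-monoʳ-≤ 2 {1} (ℕ.m^n>0 2 n)

   -- The window must have length barely above `C′`: the upper bound on its length keeps `Y/x` below
   -- the fixed `R`.
   module Main {X : ℕ} (log : Logarithm X) {x Y : ℕ} (big : y₀ ℕ.* (s₀ ℕ.* ϱ ℕ.^ blocks) ℕ.≤ x) (x≤Y : x ℕ.≤ Y) (2Y≤X : 2 ℕ.* Y ℕ.≤ X)
     (C′≤ : C′ ≤ Logarithm.L log Y - Logarithm.L log x) (≤C′ : Logarithm.L log Y ≤ Logarithm.L log x + C′ + rec x) where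
     open Estimates log
     open LogSteps log

     kmax≥ : s₀ ℕ.* ϱ ℕ.^ blocks ℕ.≤ x div y₀
     kmax≥ = ≤-div y₀≥1 big

     kmax≥1 : 1 ℕ.≤ x div y₀
     kmax≥1 = ℕ.≤-trans (ℕ.*-mono-≤ s₀≥1 (ℕ.m^n>0 ϱ {{ℕ.>-nonZero ϱ≥1}} blocks)) kmax≥

     x≥y₀ : y₀ ℕ.≤ x
     x≥y₀ = ℕ.≤-trans (ℕ.m≤m*n y₀ (s₀ ℕ.* ϱ ℕ.^ blocks) {{ℕ.>-nonZero (ℕ.*-mono-≤ s₀≥1 (ℕ.m^n>0 ϱ {{ℕ.>-nonZero ϱ≥1}} blocks))}}) big

     x≥1 : 1 ℕ.≤ x
     x≥1 = ℕ.≤-trans y₀≥1 x≥y₀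

     X≥2 : 2 ℕ.≤ X
     X≥2 = ℕ.≤-trans (ℕ.*-monoʳ-≤ 2 {1} (ℕ.≤-trans x≥1 x≤Y)) 2Y≤X

     ℓ≤ : L Y - L x ≤ ι (suc c)
     ℓ≤ = lin ((L Y) ∷ (L x) ∷ C′ ∷ (rec x) ∷ C ∷ (ι c) ∷ []) 3 (x0 :- x1) (one :+ x5) (4 ⊠ (le x0 (x1 :+ x2 :+ x3) ≤C′) ⊞ 4 ⊠ (le x3 one (rec≤1 x≥1)) ⊞
         le (nat 4 :* x2) (nat 3 :* x4) (≤-reflexive 4C′≡3C) ⊞ 4 ⊠ (le x4 x5 C≤c) ⊞
         le (nat 0) x4 C≥0) refl

     Y≤Rx : Y ℕ.≤ R ℕ.* x
     Y≤Rx = subst (λ R → Y ℕ.≤ R ℕ.* x) (sym R≡) (ratio-bound {c = suc c} X≥2 x≥1 (ℕ.≤-trans (ℕ.m≤m+n Y _) 2Y≤X) ℓ≤)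

     Ly₀ : ι K ≤ L y₀
     Ly₀ = subst (λ a → ι K ≤ L a) (sym y₀≡) (L-2^ X≥2 K)

     Ly₀≥1 : 1ℚ ≤ L y₀
     Ly₀≥1 = ≤-trans (1≤ι (ℕ.≤-trans 2M≥1 K≥2M)) Ly₀

     E≤ : selbergError (2 ℕ.* R) ≤ η′ * L y₀
     E≤ = lin ((ι K) ∷ (L y₀) ∷ (rec M) ∷ (selbergError (2 ℕ.* R)) ∷ (ι M) ∷ []) 0 x3 (x2 :* x1) (le ((x3 :+ nat 2) :* one) ((x3 :+ nat 2) :* (x4 :* x2)) (≤-reflexive (sym (cong ((selbergError (2 ℕ.* R) + ι 2) *_) (ι*rec′ M≥1))))
         ⊞ le ((x3 :+ nat 2) :* x4 :* x2) (x0 :* x2) (≤-reflexive (sym (cong (_* rec M) ιK))) ⊞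
         (le x0 x1 Ly₀) ⊛ (nn x2 (0≤rec M))) refl
       where
       ιK : ι K ≡ (selbergError (2 ℕ.* R) + ι 2) * ι M
       ιK = trans (cong ι K≡) (trans (ι-* (errorℕ (2 ℕ.* R) ℕ.+ 2) M) (cong (_* ι M) (trans (ι-+ (errorℕ (2 ℕ.* R)) 2) (cong (_+ ι 2) (errorℕ-correct (2 ℕ.* R))))))

     open Block log {x} {Y} {R} {y₀} x≥1 x≤Y Y≤Rx 2Y≤X y₀≥1 η′ (0≤rec M) E≤ Ly₀≥1
     open Budget log {x} {Y} {R} {y₀} x≥1 x≤Y Y≤Rx 2Y≤X y₀≥1 η′ (0≤rec M) E≤ Ly₀≥1 kmax≥1 using (budget; LY≤; r)

     s : ℕ → ℕ
     s i = s₀ ℕ.* ϱ ℕ.^ i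

     s≥s₀ : ∀ i → s₀ ℕ.≤ s i
     s≥s₀ i = ℕ.m≤m*n s₀ (ϱ ℕ.^ i) {{ℕ.>-nonZero (ℕ.m^n>0 ϱ {{ℕ.>-nonZero ϱ≥1}} i)}}

     s-suc : ∀ i → s i ℕ.* ϱ ≡ s (suc i)
     s-suc i = ring-eqᴺ (s₀ ∷ (ϱ ℕ.^ i) ∷ ϱ ∷ []) (x0 :* x1 :* x2) (x0 :* (x2 :* x1)) refl

     long : ι B * (C + ι 2 * σ) ≤ L ϱ
     long = ≤-trans (≤-cancel 7 (lin ((ι B) ∷ σ ∷ C ∷ (ι c) ∷ []) 0 (nat 8 :* (x0 :* (x2 :+ nat 2 :* x1))) (nat 8 :* (nat 2 :* x0 :* x3)) (le (x0 :* (nat 16 :* x1)) (x0 :* x2) (≤-reflexive (cong (ι B *_) 16σ≡C))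
         ⊞ 7 ⊠ (nn (x0 :* x2) (0≤* (0≤ι B) C≥0)) ⊞
         16 ⊠ ((le x2 x3 C≤c) ⊛ (nn x0 (0≤ι B)))) refl))
       (≤-trans (≤-reflexive (sym (trans (ι-* (2 ℕ.* B) c) (cong (_* ι c) (ι-* 2 B))))) (subst (λ a → ι (2 ℕ.* B ℕ.* c) ≤ L a) (sym ϱ≡) (L-2^ X≥2 (2 ℕ.* B ℕ.* c))))

     block-gain : ∀ i → s (suc i) ℕ.≤ kmax → rec D′ ≤ Def (s (suc i)) - Def (s i)
     block-gain i h = subst₂ (λ a b → a ≤ Def b - Def (s i)) ωδ (s-suc i) block
       where
       open Run {C} {σ} {ω} {rec d} {u₀} {s i} {ϱ} {B} 16σ≡C σ≥0 (0≤rec (512 ℕ.* e)) 32ω≤σ rec-y₀≤σ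
         (lin (C′ ∷ C ∷ (L Y) ∷ (L x) ∷ []) 0 (nat 3 :* x1) (nat 4 :* (x2 :- x3)) (le (nat 3 :* x1) (nat 4 :* x0) (≤-reflexive (sym 4C′≡3C))
             ⊞ 4 ⊠ (le x0 (x2 :- x3) C′≤)) refl)
         (ℕ.≤-trans s₀≥1 (s≥s₀ i)) (rec-s₀≤ (s≥s₀ i)) (ℕ.≤-trans u₀≤s₀ (s≥s₀ i)) ϱ≥1 long Bσ
         (subst (ℕ._≤ kmax) (sym (s-suc i)) h) (dense log)

     total-gain : ∀ i → s i ℕ.≤ kmax → ι i * rec D′ ≤ Def (s i)
     total-gain zero h = lin ((Def 0) ∷ (Def (s 0)) ∷ (rec D′) ∷ []) 0 (nat 0 :* x2) x1 (le x0 x1 (Def-mono {0} z≤n h) ⊞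
         le (nat 0) x0 (≤-reflexive (sym refl))) refl
     total-gain (suc i) h = lin ((ι i) ∷ (rec D′) ∷ (Def (s i)) ∷ (Def (s (suc i))) ∷ []) 0 ((one :+ x0) :* x1) x3 (le (x0 :* x1) x2 (total-gain i (ℕ.≤-trans si≤ h)) ⊞
         le x1 (x3 :- x2) (block-gain i h)) refl
       where
       si≤ : s i ℕ.≤ s (suc i)
       si≤ = ℕ.*-monoʳ-≤ s₀ (ℕ.m≤n*m (ϱ ℕ.^ i) ϱ {{ℕ.>-nonZero ϱ≥1}})

     L-s : ∀ i → s i ℕ.≤ kmax → L (s i) ≤ ι s₀ + ι i * ι ϱ
     L-s zero h = lin ((L (s 0)) ∷ (ι (s 0)) ∷ (ι s₀) ∷ (ι ϱ) ∷ []) 0 x0 (x2 :+ nat 0 :* x3) (le x0 (x1 :- one) (L≤ (ℕ.≤-trans s₀≥1 (s≥s₀ 0)) (ℕ.≤-trans h kmax≤X))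
         ⊞ le x1 x2 (≤-reflexive (cong ι (ℕ.*-identityʳ s₀)))) refl
     L-s (suc i) h = lin ((L (s i)) ∷ (ι s₀) ∷ (ι i) ∷ (ι ϱ) ∷ (L (s (suc i))) ∷ (L ϱ) ∷ []) 0 x4 (x1 :+ (one :+ x2) :* x3) (le x0 (x1 :+ x2 :* x3) (L-s i (ℕ.≤-trans si≤ h)) ⊞
         le x4 (x0 :+ x5) (≤-reflexive (trans (cong L (sym (s-suc i))) (L-* (ℕ.≤-trans s₀≥1 (s≥s₀ i)) ϱ≥1)))
         ⊞ le x5 (x3 :- one) (L≤ ϱ≥1 (ℕ.≤-trans ϱ≤ (ℕ.≤-trans h kmax≤X)))) refl
       where
       si≤ : s i ℕ.≤ s (suc i)
       si≤ = ℕ.*-monoʳ-≤ s₀ (ℕ.m≤n*m (ϱ ℕ.^ i) ϱ {{ℕ.>-nonZero ϱ≥1}})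
       ϱ≤ : ϱ ℕ.≤ s (suc i)
       ϱ≤ = ℕ.≤-trans (ℕ.m≤m*n ϱ (ϱ ℕ.^ i) {{ℕ.>-nonZero (ℕ.m^n>0 ϱ {{ℕ.>-nonZero ϱ≥1}} i)}}) (ℕ.m≤n*m (ϱ ℕ.^ suc i) s₀ {{ℕ.>-nonZero s₀≥1}})

     ϱ≥2 : 2 ℕ.≤ ϱ
     ϱ≥2 = subst (2 ℕ.≤_) (sym ϱ≡) (1<2^ _ (ℕ.≤-trans Bc≥1 (ℕ.≤-trans (ℕ.≤-trans (ℕ.m≤n*m (B ℕ.* c) 2) (ℕ.≤-reflexive (sym (ℕ.*-assoc 2 B c)))) (ℕ.m≤n*m (2 ℕ.* B ℕ.* c) 3))))
       where
       c≥1 : 1 ℕ.≤ c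
       c≥1 with 1 ℕ.≤? c
       ... | yes p = p
       ... | no ¬p = contradiction C≤c (λ h → (lin-⊥ (C ∷ (ι c) ∷ (ι e) ∷ []) (le one (x2 :* x0) 1≤eC ⊞
           le (x2 :* x1) (x2 :* nat 0) (≤-reflexive (cong (ι e *_) (cong ι (ℕ.n<1⇒n≡0 (ℕ.≰⇒> ¬p))))) ⊞
           (le x0 x1 h) ⊛ (nn x2 (0≤ι e))) refl))
       Bc≥1 : 1 ℕ.≤ B ℕ.* c
       Bc≥1 = ℕ.*-mono-≤ B≥1 c≥1

     last-block : ∃ λ i → s i ℕ.≤ kmax × ¬ s (suc i) ℕ.≤ kmax
     last-block = lastTrue (λ i → s i ℕ.≤? kmax) (ℕ.≤-trans (ℕ.*-monoʳ-≤ s₀ (ℕ.m^n>0 ϱ {{ℕ.>-nonZero ϱ≥1}} blocks)) kmax≥) kmax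
       (λ h → ℕ.<⇒≱ (ℕ.<-≤-trans (n<ϱ^n kmax) (ℕ.m≤n*m (ϱ ℕ.^ kmax) s₀ {{ℕ.>-nonZero s₀≥1}})) h)
       where
       n<ϱ^n : ∀ n → n ℕ.< ϱ ℕ.^ n
       n<ϱ^n zero = s≤s z≤n
       n<ϱ^n (suc n) = linᴺ (n ∷ (ϱ ℕ.^ n) ∷ ϱ ∷ []) 0 (nat 1 :+ (nat 1 :+ x0)) (x2 :* x1) (2 ⊠ᴺ (leᴺ (nat 1 :+ x0) x1 (n<ϱ^n n)) ⊞ᴺ leᴺ (nat 2) x2 ϱ≥2 ⊞ᴺ leᴺ (nat 0) x0 (z≤n {n}) ⊞ᴺ (leᴺ (nat 1 :+ x0) x1 (n<ϱ^n n)) ⊛ᴺ (leᴺ (nat 2) x2 ϱ≥2) ⊞ᴺ (leᴺ (nat 2) x2 ϱ≥2) ⊛ᴺ (nnᴺ x0 (z≤n {n}))) refl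

     -- The `i` completed blocks cost at least `i/D′`. With mass at most `1/d′` the budget is at
     -- most `(4/M)(i ϱ + C₇) + C₅`, and `4ϱ/M = 1/(2D′)`; hence `i ≤ 2D′ (C₅ + C₇)`, which is less
     -- than `blocks`.
     contradiction-at : ∀ i → s i ℕ.≤ kmax → ¬ s (suc i) ℕ.≤ kmax → ¬ Mert Y - Mert x ≤ rec d′
     contradiction-at i si≤ si> gap = lin-⊥ ((ι i) ∷ (rec (2 ℕ.* D′)) ∷ (ι C₇) ∷ (ι C₅) ∷ (ι (2 ℕ.* D′)) ∷ []) (le (one :* x0) (x4 :* x1 :* x0) (≤-reflexive (sym (cong (_* ι i) (ι*rec′ 2D′≥1)))) ⊞
         le (one :+ x4 :* (x3 :+ x2)) x0 (subst (_≤ ι i) ιblocks (ι-mono i≥)) ⊞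
         (le (x0 :* x1) (x2 :+ x3) final) ⊛ (nn x4 (0≤ι (2 ℕ.* D′)))) refl
       where
       2D′≥1 : 1 ℕ.≤ 2 ℕ.* D′
       2D′≥1 = ℕ.≤-trans D′≥1 (ℕ.m≤n*m D′ 2)
       ιblocks : ι blocks ≡ 1ℚ + ι (2 ℕ.* D′) * (ι C₅ + ι C₇)
       ιblocks = trans (cong ι blocks≡) (cong (1ℚ +_) (trans (ι-* (2 ℕ.* D′) (C₅ ℕ.+ C₇)) (cong (ι (2 ℕ.* D′) *_) (ι-+ C₅ C₇))))
       i≥ : blocks ℕ.≤ i
       i≥ with blocks ℕ.≤? i
       ... | yes p = p
       ... | no ¬p = contradiction (ℕ.≤-trans (ℕ.*-monoʳ-≤ s₀ (ℕ.^-monoʳ-≤ ϱ {{ℕ.>-nonZero ϱ≥1}} (ℕ.≰⇒> ¬p))) kmax≥) si>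
       si≥1 : 1 ℕ.≤ s i
       si≥1 = ℕ.≤-trans s₀≥1 (s≥s₀ i)
       Lkmax : L kmax ≤ ι s₀ + ι i * ι ϱ + ι ϱ
       Lkmax = lin ((L kmax) ∷ (L (s i)) ∷ (ι kmax) ∷ (ι (s i)) ∷ (rec (s i)) ∷ (ι s₀) ∷ (ι i) ∷ (ι ϱ) ∷ []) 0 x0 (x5 :+ x6 :* x7 :+ x7) (le x0 (x1 :+ (x2 :- x3) :* x4) (L-growth si≥1 si≤ kmax≤X) ⊞
           le x1 (x5 :+ x6 :* x7) (L-s i si≤) ⊞
           le (x3 :* x4 :* x7) (one :* x7) (≤-reflexive (cong (_* ι ϱ) (ι*rec′ si≥1))) ⊞
           le one (x3 :* x4) (≤-reflexive (sym (ι*rec′ si≥1))) ⊞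
           (le x2 (x3 :* x7) kmax≤siϱ) ⊛ (nn x4 (0≤rec (s i)))) refl
         where
         kmax≤siϱ : ι kmax ≤ ι (s i) * ι ϱ
         kmax≤siϱ = subst (ι kmax ≤_) (trans (cong ι (sym (s-suc i))) (ι-* (s i) ϱ)) (ι-mono (ℕ.<⇒≤ (ℕ.≰⇒> si>)))
       ιr : ι (R ℕ.* y₀) ≡ r
       ιr = ι-* R y₀
       LY : L Y ≤ ι i * ι ϱ + ι C₇
       LY = lin ((L Y) ∷ (L kmax) ∷ r ∷ (ι s₀) ∷ (ι i) ∷ (ι ϱ) ∷ (ι C₇) ∷ (ι (R ℕ.* y₀)) ∷ []) 0 x0 (x4 :* x5 :+ x6) (le x0 (x1 :+ nat 2 :* x2) LY≤ ⊞ le x1 (x3 :+ x4 :* x5 :+ x5) Lkmax ⊞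
           le (x3 :+ x5 :+ nat 2 :* x7) x6 (≤-reflexive (sym (trans (cong ι C₇≡) (cast (s₀ ∷ ϱ ∷ R ℕ.* y₀
           ∷ []) (var 0 :+ var 1 :+ nat 2 :* var 2) _)))) ⊞ 2 ⊠ (le x2 x7 (≤-reflexive (sym ιr)))) refl
       ιC₅ : ι C₅ ≡ (ι 2 * (1ℚ + ι c) + ι 3) * ι 8 + ι (errorℕ R) + (ι (R ℕ.* y₀) + ι 8) * (ι 2 * ι (R ℕ.* y₀) + ι 9)
       ιC₅ = trans (cong ι C₅≡) (trans (cast (suc c ∷ errorℕ R ∷ R ℕ.* y₀ ∷ []) ((nat 2 :* var 0 :+ nat 3) :* nat 8 :+ var 1 :+ (var 2 :+ nat 8) :* (nat 2 :* var 2 :+ nat 9)) _) refl)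
       η≤ : η ≤ ι 2 * rec M
       η≤ = lin ((rec y₀) ∷ (rec M) ∷ []) 0 (x1 :+ nat 2 :* x0) (nat 2 :* x1) (le (nat 2 :* x0) x1 2rec-y₀) refl
       rec-d′ : rec d′ ≡ ι 2 * rec M
       rec-d′ = trans (sym (ℚₚ.*-identityˡ (rec d′))) (trans (cong (_* rec d′) (sym (ι*rec 1))) (trans (ℚₚ.*-assoc (ι 2) (rec 2) (rec d′))
         (cong (ι 2 *_) (trans (sym (rec-* 2 d′)) (cong rec (trans (cong (2 ℕ.*_) d′≡) (trans (ring-eqᴺ (D′ ∷ ϱ ∷ []) (nat 2 :* (nat 4 :* x0 :* x1)) (nat 8 :* x0 :* x1) refl) (sym M≡))))))))
       recM : ι 8 * ι ϱ * rec M ≡ rec D′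
       recM = trans (cong (ι 8 * ι ϱ *_) (trans (cong rec M≡) (trans (rec-* (8 ℕ.* D′) ϱ) (cong (_* rec ϱ) (rec-* 8 D′)))))
         (trans (ring-eq ((ι ϱ) ∷ (rec 8) ∷ (rec D′) ∷ (rec ϱ) ∷ []) (nat 8 :* x0 :* (x1 :* x2 :* x3)) (nat 8 :* x1 :* (x0 :* x3) :* x2) refl)
           (trans (cong₂ (λ a b → a * b * rec D′) (ι*rec 7) (ι*rec′ ϱ≥1)) (ring-eq ((rec D′) ∷ []) (one :* one :* x0) x0 refl)))
       rec2D′ : ι 2 * rec (2 ℕ.* D′) ≡ rec D′
       rec2D′ = trans (cong (ι 2 *_) (rec-* 2 D′)) (trans (sym (ℚₚ.*-assoc (ι 2) (rec 2) (rec D′))) (trans (cong (_* rec D′) (ι*rec 1)) (ℚₚ.*-identityˡ (rec D′))))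
       recM≤1 : ι 4 * rec M ≤ 1ℚ
       recM≤1 = lin ((ι ϱ) ∷ (rec M) ∷ (rec D′) ∷ []) 0 (nat 4 :* x1) one (le (nat 8 :* x0 :* x1) x2 (≤-reflexive recM) ⊞ le x2 one (rec≤1 D′≥1)
           ⊞ 4 ⊠ (nn x1 (0≤rec M)) ⊞
           8 ⊠ ((le one x0 (1≤ι ϱ≥1)) ⊛ (nn x1 (0≤rec M)))) refl
       Def≤ : ι i * rec D′ ≤ (η + rec d′) * L Y + ((ι 2 * ℓ + η) * ι 8 + selbergError R + (r + ι 8) * (ι 2 * r + ι 9))
       Def≤ = ≤-trans (total-gain i si≤) (≤-trans (Def-mono si≤ ℕ.≤-refl) (budget gap))
       err≤ : (ι 2 * ℓ + η) * ι 8 + selbergError R + (r + ι 8) * (ι 2 * r + ι 9) ≤ ι C₅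
       err≤ = lin ((ι C₅) ∷ (ι c) ∷ (selbergError R) ∷ r ∷ ℓ ∷ η ∷ (rec M) ∷ []) 0 ((nat 2 :* x4 :+ x5) :* nat 8 :+ x2 :+ (x3 :+ nat 8) :* (nat 2 :* x3 :+ nat 9)) x0 (le ((nat 2 :* (one :+ x1) :+ nat 3) :* nat 8 :+ x2 :+ (x3 :+ nat 8) :* (nat 2 :* x3 :+ nat 9)) x0 (≤-reflexive (sym (trans ιC₅ (cong₂ (λ a b → (ι 2 * (1ℚ + ι c) + ι 3) * ι 8 + a + (b + ι 8) * (ι 2 * b + ι 9)) (errorℕ-correct R) ιr))))
           ⊞ 16 ⊠ (le x4 (one :+ x1) ℓ≤) ⊞ 8 ⊠ (le x5 (nat 2 :* x6) η≤) ⊞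
           4 ⊠ (le (nat 4 :* x6) one recM≤1)) refl
       0≤LY : 0ℚ ≤ L Y
       0≤LY = 0≤L (ℕ.≤-trans x≥1 x≤Y) Y≤X
       final : ι i * rec (2 ℕ.* D′) ≤ ι C₇ + ι C₅
       final = lin ((ι i) ∷ (rec D′) ∷ η ∷ (rec d′) ∷ (L Y) ∷ ℓ ∷ (selbergError R) ∷ r ∷ (ι C₅) ∷ (rec M)
           ∷ (ι ϱ) ∷ (ι C₇) ∷ (rec (2 ℕ.* D′)) ∷ []) 1 (x0 :* x12) (x11 :+ x8) (2 ⊠ (le (x0 :* x1) ((x2 :+ x3) :* x4 :+ ((nat 2 :* x5 :+ x2) :* nat 8 :+ x6 :+ (x7 :+ nat 8) :* (nat 2 :* x7 :+ nat 9))) Def≤)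
           ⊞ 2 ⊠ (le ((nat 2 :* x5 :+ x2) :* nat 8 :+ x6 :+ (x7 :+ nat 8) :* (nat 2 :* x7 :+ nat 9)) x8 err≤) ⊞
           le (x0 :* (nat 8 :* x10 :* x9)) (x0 :* x1) (≤-reflexive (cong (ι i *_) recM)) ⊞
           le (x0 :* (nat 2 :* x12)) (x0 :* x1) (≤-reflexive (cong (ι i *_) rec2D′)) ⊞
           2 ⊠ ((le (x2 :+ x3) (nat 4 :* x9) slope) ⊛ (nn x4 0≤LY)) ⊞
           8 ⊠ ((le x4 (x0 :* x10 :+ x11) LY) ⊛ (nn x9 (0≤rec M))) ⊞
           2 ⊠ ((le (nat 4 :* x9) one recM≤1) ⊛ (nn x11 (0≤ι C₇)))) refl
         where
         slope : η + rec d′ ≤ ι 4 * rec M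
         slope = lin (η ∷ (rec M) ∷ (rec d′) ∷ []) 0 (x0 :+ x2) (nat 4 :* x1) (le x0 (nat 2 :* x1) η≤ ⊞
             le x2 (nat 2 :* x1) (≤-reflexive rec-d′)) refl

     dense′ : rec d′ ≤ Mert Y - Mert x
     dense′ with rec d′ ≤? Mert Y - Mert x
     ... | yes p = p
     ... | no ¬p = contradiction (<⇒≤ (≰⇒> ¬p)) (contradiction-at (proj₁ last-block) (proj₁ (proj₂ last-block)) (proj₂ (proj₂ last-block)))

   improve : Dense C′
   improve = record
     { c = c ; e = 2 ℕ.* e ; d = d′ ; u₀ = y₀ ℕ.* (s₀ ℕ.* ϱ ℕ.^ blocks)
     ; C≤c = lin (C′ ∷ C ∷ (ι c) ∷ []) 3 x0 x2 (le (nat 4 :* x0) (nat 3 :* x1) (≤-reflexive 4C′≡3C) ⊞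
         4 ⊠ (le x1 x2 C≤c) ⊞ le (nat 0) x1 C≥0) refl
     ; 1≤eC = lin ((ι (2 ℕ.* e)) ∷ (ι e) ∷ C′ ∷ C ∷ []) 3 one (x0 :* x2) (le (nat 2 :* x1 :* (nat 3 :* x3)) (x0 :* (nat 4 :* x2)) (≤-reflexive (sym (cong₂ _*_ (ι-* 2 e) 4C′≡3C)))
         ⊞ 6 ⊠ (le one (x1 :* x3) 1≤eC)) refl
     ; e≥1 = ℕ.≤-trans e≥1 (ℕ.m≤n*m e 2) ; d≥1 = d′≥1
     ; u₀≥1 = start≥1
     ; dense = go
     }
     where
     start≥1 : 1 ℕ.≤ y₀ ℕ.* (s₀ ℕ.* ϱ ℕ.^ blocks)
     start≥1 = ℕ.*-mono-≤ y₀≥1 (ℕ.*-mono-≤ s₀≥1 (ℕ.m^n>0 ϱ {{ℕ.>-nonZero ϱ≥1}} blocks))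
     go : ∀ {X} (log : Logarithm X) {u v} → y₀ ℕ.* (s₀ ℕ.* ϱ ℕ.^ blocks) ℕ.≤ u → u ℕ.≤ v → 2 ℕ.* v ℕ.≤ X → C′ ≤ Logarithm.L log v - Logarithm.L log u →
       rec d′ ≤ Estimates.Mert log v - Estimates.Mert log u
     -- A longer window is first cut down to length about `C′`; monotonicity of `Mert` restores the
     -- rest.
     go {X} log {u} {v} big u≤v 2v≤X h = from-Y (LogSteps.log-step log (ℕ.≤-trans start≥1 big) u≤v v≤X (0≤* (0≤rec 4) (0≤* (0≤ι 3) C≥0)) (lin (C′ ∷ (L v) ∷ (L u) ∷ []) 0 (x2 :+ x0) x1 (le x0 (x1 :- x2) h) refl))
       where
       open Logarithm log
       v≤X : v ℕ.≤ X
       v≤X = ℕ.≤-trans (ℕ.m≤m+n v _) 2v≤X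
       from-Y : (∃ λ Y → u ℕ.≤ Y × Y ℕ.≤ v × L u + C′ ≤ L Y × L Y ≤ L u + C′ + rec u) → rec d′ ≤ Estimates.Mert log v - Estimates.Mert log u
       from-Y (Y , u≤Y , Y≤v , lo , hi) = lin ((rec d′) ∷ (Mert Y) ∷ (Mert u) ∷ (Mert v) ∷ []) 0 x0 (x3 :- x2) (le x0 (x1 :- x2) dense′
           ⊞ le x1 x3 (Mert-mono Y≤v v≤X)) refl
         where
         open Estimates log using (Mert; Mert-mono)
         open Main log {u} {Y} big u≤Y (ℕ.≤-trans (ℕ.*-monoʳ-≤ 2 Y≤v) 2v≤X) (lin ((L u) ∷ C′ ∷ (L Y) ∷ []) 0 x1 (x2 :- x0) (le (x0 :+ x1) x2 lo) refl) hi using (dense′)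

-- Primes just below every large number.

module PrimeGaps where

 open import Data.Nat.Primality using (Prime; prime?; prime⇒nonTrivial)
 open import Relation.Binary.PropositionalEquality hiding (J)
 open RationalArithmetic
 open DivisorSums
 open MoebiusMangoldt
 open IntegerLogarithm
 open MertensEstimates
 open ErdosBlocks
 open DenseWindows

 -- As `3/4 ≤ (3+n)/(4+n)`, the lengths shrink at least like `30/(3+n)`, a form that avoids powers
 -- of `3/4`.
 dense-small : ∀ n → ∃ λ C → Dense C × ι (3 ℕ.+ n) * C ≤ ι 30
 dense-small zero = ι 10 , dense₀ , (lin ([]) 0 (nat 3 :* nat 10) (nat 30) (∅) refl)
 dense-small (suc n) with dense-small n
 ... | C , D , h = rec 4 * (ι 3 * C) , Improve.improve D ,
   ≤-cancel 3 (lin ((ι (3 ℕ.+ n)) ∷ C ∷ (rec 4) ∷ []) 0 (nat 4 :* ((one :+ x0) :* (x2 :* (nat 3 :* x1)))) (nat 4 :* nat 30) (4 ⊠ (le (x0 :* x1) (nat 30) h)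
       ⊞
       le ((one :+ x0) :* (nat 4 :* x2 :* (nat 3 :* x1))) ((one :+ x0) :* (one :* (nat 3 :* x1))) (≤-reflexive (cong (λ z → (1ℚ + ι (3 ℕ.+ n)) * (z * (ι 3 * C))) (ι*rec 3)))
       ⊞ le (nat 3 :* x1) (x0 :* x1) 3C≤) refl)
   where
   3C≤ : ι 3 * C ≤ ι (3 ℕ.+ n) * C
   3C≤ = lin ((ι (3 ℕ.+ n)) ∷ C ∷ []) 0 (nat 3 :* x1) (x0 :* x1) ((le (nat 3) x0 (ι-mono (ℕ.m≤m+n 3 n))) ⊛ (nn x1 (Improve.C≥0 D))) refl

 ∑-≟ : ∀ n m → ∑ n (λ k → ⟨ k ℕ.≟ m ⟩) ≤ 1ℚ
 ∑-≟ n m = proj₁ (go n)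
   where
   go : ∀ n → ∑ n (λ k → ⟨ k ℕ.≟ m ⟩) ≤ 1ℚ × (n ℕ.< m → ∑ n (λ k → ⟨ k ℕ.≟ m ⟩) ≡ 0ℚ)
   go zero = 0≤1 , λ _ → refl
   go (suc n) with suc n ℕ.≟ m
   ... | yes refl = ≤-reflexive (trans (cong (_+ 1ℚ) (proj₂ (go n) ℕ.≤-refl)) (ℚₚ.+-identityˡ 1ℚ)) , λ h → contradiction h (ℕ.<-irrefl refl)
   ... | no _ = ≤-trans (≤-reflexive (ℚₚ.+-identityʳ _)) (proj₁ (go n)) , λ h → trans (ℚₚ.+-identityʳ _) (proj₂ (go n) (ℕ.<⇒≤ h))

 ∑-≥-term : ∀ n (f : ℕ → ℚ) → (∀ i → 0ℚ ≤ f i) → ∀ {i} → 1 ℕ.≤ i → i ℕ.≤ n → f i ≤ ∑ n f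
 ∑-≥-term zero f h (s≤s _) ()
 ∑-≥-term (suc n) f h {i} p q with ℕ.m≤n⇒m<n∨m≡n q
 ... | inj₂ refl = lin ((∑ n f) ∷ (f i) ∷ []) 0 x1 (x0 :+ x1) (nn x0 (0≤∑ n (λ j _ _ → h j))) refl
 ... | inj₁ (s≤s i≤n) = lin ((f i) ∷ (∑ n f) ∷ (f (suc n)) ∷ []) 0 x0 (x1 :+ x2) (le x0 x1 (∑-≥-term n f h p i≤n) ⊞
     le (nat 0) x2 (h (suc n))) refl

 -- If (x, Y] contains no prime, the Mertens mass of the window comes from the at most z J
 -- proper prime powers p ^ j up to Y, where p ≤ z = ⌊√Y⌋ and j ≤ J = ⌊log₂ Y⌋.
 module NoPrimes {Y : ℕ} (log : Logarithm (2 ℕ.* Y)) {x z J : ℕ} (x≥1 : 1 ℕ.≤ x) (x≤Y : x ℕ.≤ Y) (none : ∀ n → x ℕ.< n → n ℕ.≤ Y → ¬ Prime n)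
   (z> : Y ℕ.< suc z ℕ.* suc z) (J≤ : 2 ℕ.^ J ℕ.≤ Y) (J> : Y ℕ.< 2 ℕ.^ suc J) where
   open Estimates log

   Y≤X : Y ℕ.≤ 2 ℕ.* Y
   Y≤X = ℕ.m≤n*m Y 2

   Y≥1 : 1 ℕ.≤ Y
   Y≥1 = ℕ.≤-trans x≥1 x≤Y

   powers : ℕ → ℚ
   powers n = ∑ z (λ p → ∑ J (λ j → ⟨ n ℕ.≟ p ℕ.^ j ⟩))

   0≤powers : ∀ n → 0ℚ ≤ powers n
   0≤powers n = 0≤∑ z (λ p _ _ → 0≤∑ J (λ j _ _ → 0≤⟨⟩ (n ℕ.≟ p ℕ.^ j)))

   1≤powers : ∀ {n p j} → n ℕ.≤ Y → 2 ℕ.≤ p → n ≡ p ℕ.^ suc (suc j) → 1ℚ ≤ powers n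
   1≤powers {n} {p} {j} n≤Y p≥2 eq = ≤-trans (≤-reflexive (sym (⟨⟩-yes (n ℕ.≟ p ℕ.^ suc (suc j)) eq)))
     (≤-trans (∑-≥-term J (λ j → ⟨ n ℕ.≟ p ℕ.^ j ⟩) (λ j → 0≤⟨⟩ (n ℕ.≟ p ℕ.^ j)) (s≤s z≤n) j≤J)
       (∑-≥-term z (λ p → ∑ J (λ j → ⟨ n ℕ.≟ p ℕ.^ j ⟩)) (λ p → 0≤∑ J (λ j _ _ → 0≤⟨⟩ (n ℕ.≟ p ℕ.^ j))) (ℕ.≤-trans (s≤s z≤n) p≥2) p≤z))
     where
     p≤z : p ℕ.≤ z
     p≤z with p ℕ.≤? z
     ... | yes h = h
     ... | no ¬h = contradiction z> (ℕ.≤⇒≯ (ℕ.≤-trans (ℕ.*-mono-≤ (ℕ.≰⇒> ¬h) (ℕ.≰⇒> ¬h)) (ℕ.≤-trans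
       (ℕ.≤-trans (ℕ.m≤m*n (p ℕ.* p) (p ℕ.^ j) {{ℕ.>-nonZero (ℕ.m^n>0 p {{ℕ.>-nonZero (ℕ.≤-trans (s≤s z≤n) p≥2)}} j)}}) (ℕ.≤-reflexive (trans (ℕ.*-assoc p p (p ℕ.^ j)) (sym eq)))) n≤Y)))
     j≤J : suc (suc j) ℕ.≤ J
     j≤J with suc (suc j) ℕ.≤? J
     ... | yes h = h
     ... | no ¬h = contradiction J> (ℕ.≤⇒≯ (ℕ.≤-trans (ℕ.^-monoʳ-≤ 2 (ℕ.≰⇒> ¬h)) (ℕ.≤-trans (ℕ.^-monoˡ-≤ (suc (suc j)) p≥2) (ℕ.≤-trans (ℕ.≤-reflexive (sym eq)) n≤Y))))

   term : ∀ n → x ℕ.< n → n ℕ.≤ Y → Λ n * rec n ≤ (L Y * rec x) * powers n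
   term n x<n n≤Y with Λ-cases (ℕ.≤-trans x≥1 (ℕ.<⇒≤ x<n))
   ... | inj₁ eq = lin ((Λ n) ∷ (rec n) ∷ (L Y) ∷ (rec x) ∷ (powers n) ∷ []) 0 (x0 :* x1) (x2 :* x3 :* x4) (le (x0 :* x1) (nat 0 :* x1) (≤-reflexive (cong (_* rec n) eq))
       ⊞ le (nat 0) (x2 :* x3 :* x4) (0≤* (0≤* (0≤L Y≥1 Y≤X) (0≤rec x)) (0≤powers n))) refl
   ... | inj₂ (p , zero , pr , eq , _) = contradiction (subst Prime (sym (trans eq (ℕ.*-identityʳ p))) pr) (none n x<n n≤Y)
   ... | inj₂ (p , suc j , pr , eq , eq′) = lin ((Λ n) ∷ (rec n) ∷ (L p) ∷ (L Y) ∷ (rec x) ∷ (powers n) ∷ []) 0 (x0 :* x1) (x3 :* x4 :* x5) (le (x0 :* x1) (x2 :* x1) (≤-reflexive (cong (_* rec n) eq′))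
       ⊞ (le x2 x3 (L-mono (prime≥1 pr) p≤Y Y≤X)) ⊛ (nn x1 (0≤rec n)) ⊞
       (nn x3 (0≤L Y≥1 Y≤X)) ⊛ (le x1 x4 (rec-anti x≥1 (ℕ.<⇒≤ x<n))) ⊞
       (nn (x3 :* x4) (0≤* (0≤L Y≥1 Y≤X) (0≤rec x))) ⊛ (le one x5 (1≤powers {j = j} n≤Y p≥2 eq))) refl
     where
     p≥2 : 2 ℕ.≤ p
     p≥2 = ℕ.nonTrivial⇒n>1 p {{prime⇒nonTrivial pr}}
     p≤Y : p ℕ.≤ Y
     p≤Y = ℕ.≤-trans (ℕ.m≤m*n p (p ℕ.^ suc j) {{ℕ.>-nonZero (ℕ.m^n>0 p {{ℕ.>-nonZero (prime≥1 pr)}} (suc j))}}) (ℕ.≤-trans (ℕ.≤-reflexive (sym eq)) n≤Y)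

   powers-sum : ∑ Y powers ≤ ι z * ι J
   powers-sum = ≤-trans (≤-reflexive (trans (∑-swap Y z (λ n p → ∑ J (λ j → ⟨ n ℕ.≟ p ℕ.^ j ⟩))) (∑-cong z (λ p _ _ → ∑-swap Y J (λ n j → ⟨ n ℕ.≟ p ℕ.^ j ⟩)))))
     (≤-trans (∑-mono z (λ p _ _ → ≤-trans (∑-mono J {λ j → ∑ Y (λ n → ⟨ n ℕ.≟ p ℕ.^ j ⟩)} (λ j _ _ → ∑-≟ Y (p ℕ.^ j))) (≤-reflexive (trans (∑-const J 1ℚ) (ℚₚ.*-identityʳ (ι J))))))
       (≤-reflexive (∑-const z (ι J))))

   LY≤J : L Y ≤ 1ℚ + ι J
   LY≤J = ≤-trans (L-mono Y≥1 (ℕ.<⇒≤ J>) (ℕ.*-monoʳ-≤ 2 J≤)) (L-2^≤ (suc J))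
     where
     L-2^≤ : ∀ j → L (2 ℕ.^ j) ≤ ι j
     L-2^≤ zero = ≤-reflexive L-1
     L-2^≤ (suc j) = lin ((L (2 ℕ.^ suc j)) ∷ (L 2) ∷ (L (2 ℕ.^ j)) ∷ (ι j) ∷ []) 0 x0 (one :+ x3) (le x0 (x1 :+ x2) (≤-reflexive (L-* {2} (s≤s z≤n) (ℕ.m^n>0 2 j))) ⊞
         le x2 x3 (L-2^≤ j) ⊞ le x1 (nat 2 :- one) (L≤ (s≤s z≤n) (ℕ.*-monoʳ-≤ 2 Y≥1))) refl

   mass : Mert Y - Mert x ≤ (1ℚ + ι J) * rec x * (ι z * ι J)
   mass = lin ((Mert Y) ∷ (Mert x) ∷ (∑ Y (λ n → (L Y * rec x) * powers n)) ∷ (L Y) ∷ (rec x) ∷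
       (∑ Y powers) ∷ (ι z) ∷ (ι J) ∷ []) 0 (x0 :- x1) ((one :+ x7) :* x4 :* (x6 :* x7)) (le (x0 :- x1) x2 (∑-window (λ n → Λ n * rec n) (λ n → (L Y * rec x) * powers n) x≤Y (λ n _ _ → 0≤* 0≤c (0≤powers n)) term)
       ⊞ le x2 (x3 :* x4 :* x5) (≤-reflexive (∑-* Y (L Y * rec x) powers)) ⊞
       (nn (x3 :* x4) 0≤c) ⊛ (le x5 (x6 :* x7) powers-sum) ⊞
       (le x3 (one :+ x7) LY≤J) ⊛ (nn (x4 :* (x6 :* x7)) (0≤* (0≤rec x) (0≤* (0≤ι z) (0≤ι J))))) refl
     where
     0≤c : 0ℚ ≤ L Y * rec x
     0≤c = 0≤* (0≤L Y≥1 Y≤X) (0≤rec x)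

 n<2^n : ∀ n → suc n ℕ.≤ 2 ℕ.^ n
 n<2^n zero = ℕ.≤-refl
 n<2^n (suc n) = linᴺ (n ∷ (2 ℕ.^ n) ∷ []) 0 (nat 1 :+ (nat 1 :+ x0)) (nat 2 :* x1) (2 ⊠ᴺ (leᴺ (nat 1 :+ x0) x1 (n<2^n n)) ⊞ᴺ leᴺ (nat 0) x0 (z≤n {n})) refl

 -- With `b = ⌊J/8⌋ + 1` one has `b^8 ≤ 2^J` and `J + 1 ≤ 8b`, so the inequality would give
 -- `b^4 ≤ 65536 d²`, whereas `b ≥ 128 d`.
 power-beats-quartic : ∀ d {J} → 1 ℕ.≤ d → 1024 ℕ.* d ℕ.≤ J → ¬ 2 ℕ.^ J ℕ.≤ 16 ℕ.* (d ℕ.* d) ℕ.* (suc J ℕ.* suc J ℕ.* (suc J ℕ.* suc J))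
 power-beats-quartic d {J} d≥1 big h = ℕ.<⇒≱ small fourth
   where
   a b b² b⁴ : ℕ
   a = J div 8
   b = suc a
   b² = b ℕ.* b
   b⁴ = b² ℕ.* b²
   regroup : ∀ u v x y → u ℕ.* x ℕ.* (v ℕ.* y) ≡ y ℕ.* (u ℕ.* v ℕ.* x)
   regroup u v x y = ring-eqᴺ (u ∷ x ∷ v ∷ y ∷ []) (x0 :* x1 :* (x2 :* x3)) (x3 :* (x0 :* x2 :* x1)) refl
   squares : ∀ u x → (u ℕ.* x) ℕ.* (u ℕ.* x) ≡ (u ℕ.* u) ℕ.* (x ℕ.* x)
   squares u x = ring-eqᴺ (u ∷ x ∷ []) (x0 :* x1 :* (x0 :* x1)) (x0 :* x0 :* (x1 :* x1)) refl
   b⁸ : b⁴ ℕ.* b⁴ ℕ.≤ 2 ℕ.^ J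
   b⁸ = ℕ.≤-trans (ℕ.*-mono-≤ p⁴ p⁴) (ℕ.≤-trans (ℕ.≤-reflexive e) (ℕ.^-monoʳ-≤ 2 (div-≤ J 8)))
     where
     t : ℕ
     t = 2 ℕ.^ a
     p² : b² ℕ.≤ t ℕ.* t
     p² = ℕ.*-mono-≤ (n<2^n a) (n<2^n a)
     p⁴ : b⁴ ℕ.≤ (t ℕ.* t) ℕ.* (t ℕ.* t)
     p⁴ = ℕ.*-mono-≤ p² p²
     e : ((t ℕ.* t) ℕ.* (t ℕ.* t)) ℕ.* ((t ℕ.* t) ℕ.* (t ℕ.* t)) ≡ 2 ℕ.^ (8 ℕ.* a)
     e = trans (ring-eqᴺ (t ∷ []) (x0 :* x0 :* (x0 :* x0) :* (x0 :* x0 :* (x0 :* x0))) (x0 :* (x0 :* (x0 :* (x0 :* (x0 :* (x0 :* (x0 :* (x0 :* nat 1)))))))) refl) (trans (ℕ.^-*-assoc 2 a 8) (cong (2 ℕ.^_) (ℕ.*-comm a 8)))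
   J≤8b : suc J ℕ.≤ 8 ℕ.* b
   J≤8b = div-< J {8} (s≤s z≤n)
   J²≤ : suc J ℕ.* suc J ℕ.≤ 64 ℕ.* b²
   J²≤ = ℕ.≤-trans (ℕ.*-mono-≤ J≤8b J≤8b) (ℕ.≤-reflexive (squares 8 b))
   J⁴≤ : suc J ℕ.* suc J ℕ.* (suc J ℕ.* suc J) ℕ.≤ 4096 ℕ.* b⁴
   J⁴≤ = ℕ.≤-trans (ℕ.*-mono-≤ J²≤ J²≤) (ℕ.≤-reflexive (squares 64 b²))
   fourth : b⁴ ℕ.≤ 65536 ℕ.* (d ℕ.* d)
   fourth = ℕ.*-cancelˡ-≤ b⁴ (ℕ.≤-trans b⁸ (ℕ.≤-trans h (ℕ.≤-trans (ℕ.*-monoʳ-≤ (16 ℕ.* (d ℕ.* d)) J⁴≤)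
     (ℕ.≤-reflexive (regroup 16 4096 (d ℕ.* d) b⁴)))))
   b≥ : 128 ℕ.* d ℕ.≤ b
   b≥ = ℕ.m≤n⇒m≤1+n (≤-div {J} {8} (s≤s z≤n) (ℕ.≤-trans (ℕ.≤-reflexive (sym (ℕ.*-assoc 8 128 d))) big))
   b²≥ : 16384 ℕ.* (d ℕ.* d) ℕ.≤ b²
   b²≥ = ℕ.≤-trans (ℕ.≤-reflexive (sym (squares 128 d))) (ℕ.*-mono-≤ b≥ b≥)
   small : 65536 ℕ.* (d ℕ.* d) ℕ.< b⁴
   small = subst (ℕ._< b⁴) (sym (ℕ.*-assoc 4 16384 (d ℕ.* d))) (beats (ℕ.≤-trans (ℕ.≤ᵇ⇒≤ 5 16384 _) (ℕ.m≤m*n 16384 (d ℕ.* d) {{ℕ.>-nonZero (ℕ.*-mono-≤ d≥1 d≥1)}})) b²≥)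
     where
     beats : ∀ {c B} → 5 ℕ.≤ c → c ℕ.≤ B → 4 ℕ.* c ℕ.< B ℕ.* B
     beats {c} {B} c≥5 c≤B = linᴺ (c ∷ B ∷ []) 0 (nat 1 :+ nat 4 :* x0) (x1 :* x1) (6 ⊠ᴺ (leᴺ (nat 5) x0 c≥5) ⊞ᴺ 10 ⊠ᴺ (leᴺ x0 x1 c≤B) ⊞ᴺ (leᴺ (nat 5) x0 c≥5) ⊛ᴺ (leᴺ (nat 5) x0 c≥5) ⊞ᴺ 2 ⊠ᴺ ((leᴺ (nat 5) x0 c≥5) ⊛ᴺ (leᴺ x0 x1 c≤B)) ⊞ᴺ (leᴺ x0 x1 c≤B) ⊛ᴺ (leᴺ x0 x1 c≤B)) refl

 -- The prime is sought in `(Y - h, Y]` with `h = ⌊Y/(k+1)⌋`. This window has logarithmic length at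
 -- least `1/(8(k+1))`, and 240 is 8 times the constant 30 of `dense-small`.
 module PrimeGap (k : ℕ) (k≥1 : 1 ℕ.≤ k) where

   private
     small : ∃ λ C → Dense C × ι (3 ℕ.+ 240 ℕ.* suc k) * C ≤ ι 30
     small = dense-small (240 ℕ.* suc k)
     C : ℚ
     C = proj₁ small
     open Dense (proj₁ (proj₂ small))

     C≤rec : C ≤ rec (8 ℕ.* suc k)
     C≤rec = lin ((ι (8 ℕ.* suc k)) ∷ C ∷ (rec (8 ℕ.* suc k)) ∷ []) 0 x1 x2 (le (one :* x1) (x0 :* x2 :* x1) (≤-reflexive (sym (cong (_* C) (ι*rec′ {8 ℕ.* suc k} (s≤s z≤n)))))
         ⊞ (le (x0 :* x1) one bound) ⊛ (nn x2 (0≤rec (8 ℕ.* suc k)))) refl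
       where
       0≤C : 0ℚ ≤ C
       0≤C = Improve.C≥0 (proj₁ (proj₂ small))
       bound : ι (8 ℕ.* suc k) * C ≤ 1ℚ
       bound = ≤-cancel 29 (lin ((ι (3 ℕ.+ 240 ℕ.* suc k)) ∷ C ∷ (ι (8 ℕ.* suc k)) ∷ []) 0 (nat 30 :* (x2 :* x1)) (nat 30 :* one) (le (x0 :* x1) (nat 30) (proj₂ (proj₂ small)) ⊞
           3 ⊠ (nn x1 0≤C) ⊞
           le ((nat 3 :+ nat 30 :* x2) :* x1) (x0 :* x1) (≤-reflexive (sym (cong (_* C) (trans (ι-+ 3 (240 ℕ.* suc k)) (cong (ι 3 +_) (trans (cong ι (ℕ.*-assoc 30 8 (suc k))) (ι-* 30 (8 ℕ.* suc k))))))))) refl)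

   opaque
     start : ℕ
     -- The three summands secure `u₀ ≤ x`, `1024 d ≤ J` and `1 ≤ h`.
     start = 2 ℕ.* u₀ ℕ.+ (2 ℕ.^ (1024 ℕ.* d) ℕ.+ suc k)

     start≡ : start ≡ 2 ℕ.* u₀ ℕ.+ (2 ℕ.^ (1024 ℕ.* d) ℕ.+ suc k)
     start≡ = refl

   module _ (Y : ℕ) (Y≥ : start ℕ.≤ Y) where
     private
       Y≥′ : 2 ℕ.* u₀ ℕ.+ (2 ℕ.^ (1024 ℕ.* d) ℕ.+ suc k) ℕ.≤ Y
       Y≥′ = subst (ℕ._≤ Y) start≡ Y≥
       Y≥k : suc k ℕ.≤ Y
       Y≥k = linᴺ (u₀ ∷ (2 ℕ.^ (1024 ℕ.* d)) ∷ k ∷ Y ∷ []) 0 (nat 1 :+ x2) x3 (leᴺ (nat 2 :* x0 :+ (x1 :+ (nat 1 :+ x2))) x3 Y≥′ ⊞ᴺ 2 ⊠ᴺ (nnᴺ x0 (z≤n {u₀})) ⊞ᴺ leᴺ (nat 0) x1 (z≤n {2 ℕ.^ (1024 ℕ.* d)})) refl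
       Y≥2^ : 2 ℕ.^ (1024 ℕ.* d) ℕ.≤ Y
       Y≥2^ = linᴺ (u₀ ∷ (2 ℕ.^ (1024 ℕ.* d)) ∷ k ∷ Y ∷ []) 0 x1 x3 (leᴺ (nat 2 :* x0 :+ (x1 :+ (nat 1 :+ x2))) x3 Y≥′ ⊞ᴺ 2 ⊠ᴺ (nnᴺ x0 (z≤n {u₀})) ⊞ᴺ leᴺ (nat 0) x2 (z≤n {k})) refl
       Y≥u : 2 ℕ.* u₀ ℕ.≤ Y
       Y≥u = linᴺ (u₀ ∷ (2 ℕ.^ (1024 ℕ.* d)) ∷ k ∷ Y ∷ []) 0 (nat 2 :* x0) x3 (leᴺ (nat 2 :* x0 :+ (x1 :+ (nat 1 :+ x2))) x3 Y≥′ ⊞ᴺ leᴺ (nat 0) x1 (z≤n {2 ℕ.^ (1024 ℕ.* d)}) ⊞ᴺ leᴺ (nat 0) x2 (z≤n {k})) refl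
       h x : ℕ
       h = Y div suc k
       x = Y ℕ.∸ h
       x+h : x ℕ.+ h ≡ Y
       x+h = ℕ.m∸n+n≡m (div≤ Y (suc k))
       h≤ : suc k ℕ.* h ℕ.≤ Y
       h≤ = div-≤ Y (suc k)
       h≥1 : 1 ℕ.≤ h
       h≥1 = ≤-div {Y} {suc k} {1} (s≤s z≤n) (ℕ.≤-trans (ℕ.≤-reflexive (ℕ.*-identityʳ (suc k))) Y≥k)
       Y≤2x : Y ℕ.≤ 2 ℕ.* x
       Y≤2x = linᴺ (x ∷ h ∷ Y ∷ k ∷ []) 0 x2 (nat 2 :* x0) (2 ⊠ᴺ (leᴺ x2 (x0 :+ x1) (≤-reflexiveᴺ (sym x+h))) ⊞ᴺ leᴺ ((nat 1 :+ x3) :* x1) x2 h≤ ⊞ᴺ (leᴺ (nat 1) x3 k≥1) ⊛ᴺ (nnᴺ x1 (z≤n {h}))) refl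
       x≤Y : x ℕ.≤ Y
       x≤Y = ℕ.m∸n≤m Y h
       u₀≤x : u₀ ℕ.≤ x
       u₀≤x = ℕ.*-cancelˡ-≤ 2 (ℕ.≤-trans Y≥u Y≤2x)
       x≥1 : 1 ℕ.≤ x
       x≥1 = ℕ.≤-trans u₀≥1 u₀≤x
       Y≥1 : 1 ℕ.≤ Y
       Y≥1 = ℕ.≤-trans x≥1 x≤Y

       log : Logarithm (2 ℕ.* Y)
       log = logarithm (2 ℕ.* Y)

       open Estimates log

       L-lower : ∀ {a b} → 1 ℕ.≤ a → a ℕ.≤ b → b ℕ.≤ Y → (ι b - ι a) * rec (suc Y) ≤ L b - L a
       L-lower {a} a≥1 = range-induction (λ b → (ι b - ι a) * rec (suc Y) ≤ L b - L a) (lin ((L a) ∷ (ι a) ∷ (rec (suc Y)) ∷ []) 0 ((x1 :- x1) :* x2) (x0 :- x0) (∅) refl) step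
         where
         step : ∀ {n} → a ℕ.≤ n → n ℕ.< Y → (ι n - ι a) * rec (suc Y) ≤ L n - L a → (ι (suc n) - ι a) * rec (suc Y) ≤ L (suc n) - L a
         step {n} p q IH = lin ((ι n) ∷ (ι a) ∷ (rec (suc Y)) ∷ (L n) ∷ (L a) ∷ (rec (2 ℕ.+ n)) ∷ (L (suc n)) ∷ []) 0 ((one :+ x0 :- x1) :* x2) (x6 :- x4) (le ((x0 :- x1) :* x2) (x3 :- x4) IH ⊞
             le x5 (x6 :- x3) (ΔL≥ (ℕ.≤-trans a≥1 p) (ℕ.≤-trans q (ℕ.m≤n*m Y 2))) ⊞
             le x2 x5 (rec-anti {2 ℕ.+ n} (s≤s z≤n) (s≤s q))) refl

       long : C ≤ L Y - L x
       long = ≤-trans C≤rec (≤-trans ratio (≤-trans (≤-reflexive (cong (_* rec (suc Y)) hq)) (L-lower x≥1 x≤Y ℕ.≤-refl)))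
         where
         hq : ι h ≡ ι Y - ι x
         hq = trans (ring-eq ((ι h) ∷ (ι x) ∷ []) x0 (x1 :+ x0 :- x1) refl) (cong (_- ι x) (trans (sym (ι-+ x h)) (cong ι x+h)))
         Y<4 : suc Y ℕ.≤ 8 ℕ.* suc k ℕ.* h
         Y<4 = linᴺ (Y ∷ k ∷ h ∷ []) 0 (nat 1 :+ x0) (nat 8 :* (nat 1 :+ x1) :* x2) (leᴺ (nat 1 :+ x0) ((nat 1 :+ x1) :* (nat 1 :+ x2)) (div-< Y {suc k} (s≤s z≤n)) ⊞ᴺ 6 ⊠ᴺ (nnᴺ (nat 1 :+ x1) (z≤n {suc k})) ⊞ᴺ 7 ⊠ᴺ ((leᴺ (nat 1) x2 h≥1) ⊛ᴺ (nnᴺ (nat 1 :+ x1) (z≤n {suc k})))) refl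
         ratio : rec (8 ℕ.* suc k) ≤ ι h * rec (suc Y)
         ratio = lin ((ι Y) ∷ (ι (8 ℕ.* suc k)) ∷ (ι h) ∷ (rec (8 ℕ.* suc k)) ∷ (rec (suc Y)) ∷ []) 0 x3 (x2 :* x4) (le (x3 :* one) (x3 :* ((one :+ x0) :* x4)) (≤-reflexive (sym (cong (rec (8 ℕ.* suc k) *_) (ι*rec Y))))
             ⊞
             le (x1 :* x3 :* (x2 :* x4)) (one :* (x2 :* x4)) (≤-reflexive (cong (_* (ι h * rec (suc Y))) (ι*rec′ {8 ℕ.* suc k} (s≤s z≤n))))
             ⊞
             (le (one :+ x0) (x1 :* x2) (subst (ι (suc Y) ≤_) (ι-* (8 ℕ.* suc k) h) (ι-mono Y<4))) ⊛ (nn (x3 :* x4) (0≤* (0≤rec (8 ℕ.* suc k)) (0≤rec (suc Y))))) refl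

       mass≥ : rec d ≤ Mert Y - Mert x
       mass≥ = dense log u₀≤x x≤Y ℕ.≤-refl long

       -- Without primes the mass, at least `1/d`, would be at most `(1+J) J z / x`. Squaring
       -- `Y ≤ 2 d z (J+1)²` and using `z² ≤ Y` bounds `Y` by a quartic in `J`, although `2^J ≤ Y`.
       some-prime : ¬ (∀ n → x ℕ.< n → n ℕ.≤ Y → ¬ Prime n)
       some-prime none = power-beats-quartic d {J} d≥1 J≥ (ℕ.≤-trans J≤ bound)
         where
         Jmax : ∃ λ J → 2 ℕ.^ J ℕ.≤ Y × ¬ 2 ℕ.^ suc J ℕ.≤ Y
         Jmax = lastTrue (λ J → 2 ℕ.^ J ℕ.≤? Y) Y≥1 Y (λ p → ℕ.<⇒≱ (n<2^n Y) p)
         zmax : ∃ λ z → z ℕ.* z ℕ.≤ Y × ¬ suc z ℕ.* suc z ℕ.≤ Y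
         zmax = lastTrue (λ z → z ℕ.* z ℕ.≤? Y) z≤n (suc Y) (λ p → ℕ.<⇒≱ (ℕ.m≤m*n (suc Y) (suc Y)) p)
         J z : ℕ
         J = proj₁ Jmax
         z = proj₁ zmax
         J≤ : 2 ℕ.^ J ℕ.≤ Y
         J≤ = proj₁ (proj₂ Jmax)
         J> : Y ℕ.< 2 ℕ.^ suc J
         J> = ℕ.≰⇒> (proj₂ (proj₂ Jmax))
         J≥ : 1024 ℕ.* d ℕ.≤ J
         J≥ = ℕ.≮⇒≥ λ J< → ℕ.<⇒≱ J> (ℕ.≤-trans (ℕ.^-monoʳ-≤ 2 J<) Y≥2^)
         open NoPrimes log {x} {z} {J} x≥1 x≤Y none (ℕ.≰⇒> (proj₂ (proj₂ zmax))) J≤ J> using (mass)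
         lin₁ : ι x ≤ ι d * ((1ℚ + ι J) * (ι z * ι J))
         lin₁ = lin ((rec d) ∷ (Mert Y) ∷ (Mert x) ∷ (ι J) ∷ (rec x) ∷ (ι z) ∷ (ι x) ∷ (ι d) ∷ []) 0 x6 (x7 :* ((one :+ x3) :* (x5 :* x3))) (le (x6 :* one) (x6 :* (x7 :* x0)) (≤-reflexive (sym (cong (ι x *_) (ι*rec′ d≥1))))
             ⊞
             le (x7 :* ((one :+ x3) :* (x5 :* x3)) :* (x6 :* x4)) (x7 :* ((one :+ x3) :* (x5 :* x3)) :* one) (≤-reflexive (cong (ι d * ((1ℚ + ι J) * (ι z * ι J)) *_) (ι*rec′ x≥1)))
             ⊞ (nn (x6 :* x7) (0≤* (0≤ι x) (0≤ι d))) ⊛ (le x0 (x1 :- x2) mass≥) ⊞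
             (nn (x6 :* x7) (0≤* (0≤ι x) (0≤ι d))) ⊛ (le (x1 :- x2) ((one :+ x3) :* x4 :* (x5 :* x3)) mass)) refl
         lin₂ : x ℕ.≤ d ℕ.* (suc J ℕ.* (z ℕ.* J))
         lin₂ = ι-cancel-≤ (subst (ι x ≤_) (sym (cast (d ∷ J ∷ z ∷ []) (var 0 :* ((one :+ var 1) :* (var 2 :* var 1))) _)) lin₁)
         s s⁴ : ℕ
         s = suc J
         s⁴ = s ℕ.* s ℕ.* (s ℕ.* s)
         lin₃ : Y ℕ.≤ z ℕ.* (2 ℕ.* d ℕ.* (s ℕ.* s))
         lin₃ = linᴺ (Y ∷ x ∷ d ∷ J ∷ z ∷ []) 0 x0 (x4 :* (nat 2 :* x2 :* ((nat 1 :+ x3) :* (nat 1 :+ x3)))) (leᴺ x0 (nat 2 :* x1) Y≤2x ⊞ᴺ 2 ⊠ᴺ (leᴺ x1 (x2 :* ((nat 1 :+ x3) :* (x4 :* x3))) lin₂) ⊞ᴺ 2 ⊠ᴺ (nnᴺ (x2 :* x4) (z≤n {d ℕ.* z})) ⊞ᴺ 2 ⊠ᴺ (nnᴺ (x2 :* x4 :* x3) (z≤n {d ℕ.* z ℕ.* J}))) refl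
         bound : Y ℕ.≤ 16 ℕ.* (d ℕ.* d) ℕ.* s⁴
         bound = ℕ.≤-trans (ℕ.*-cancelˡ-≤ Y {{ℕ.>-nonZero Y≥1}} (ℕ.≤-trans (ℕ.*-mono-≤ lin₃ lin₃) (ℕ.≤-trans
           (ℕ.≤-reflexive (ring-eqᴺ (z ∷ d ∷ s ∷ []) (x0 :* (nat 2 :* x1 :* (x2 :* x2)) :* (x0 :* (nat 2 :* x1 :* (x2 :* x2)))) (x0 :* x0 :* (nat 4 :* (x1 :* x1) :* (x2 :* x2 :* (x2 :* x2)))) refl))
           (ℕ.*-monoˡ-≤ (4 ℕ.* (d ℕ.* d) ℕ.* s⁴) (proj₁ (proj₂ zmax)))))) (linᴺ (d ∷ s⁴ ∷ []) 0 (nat 4 :* (x0 :* x0) :* x1) (nat 16 :* (x0 :* x0) :* x1) (12 ⊠ᴺ (nnᴺ (x0 :* x0 :* x1) (z≤n {d ℕ.* d ℕ.* s⁴}))) refl)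

     prime-near : ∃ λ q → Prime q × q ℕ.≤ Y × k ℕ.* Y ℕ.≤ suc k ℕ.* q
     prime-near with search prime? x Y
     ... | inj₁ (q , x<q , q≤Y , pr) = q , pr , q≤Y , (linᴺ (x ∷ h ∷ Y ∷ k ∷ q ∷ []) 0 (x3 :* x2) ((nat 1 :+ x3) :* x4) (leᴺ ((nat 1 :+ x3) :* x1) x2 h≤ ⊞ᴺ leᴺ ((nat 1 :+ x3) :* x2) ((nat 1 :+ x3) :* (x0 :+ x1)) (≤-reflexiveᴺ (sym (cong (suc k ℕ.*_) x+h))) ⊞ᴺ (leᴺ x0 x4 (ℕ.<⇒≤ x<q)) ⊛ᴺ (nnᴺ (nat 1 :+ x3) (z≤n {suc k}))) refl)
     ... | inj₂ none = contradiction none some-prime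

 prime-gap : ∀ k → 1 ℕ.≤ k → ∃ λ N → ∀ Y → N ℕ.≤ Y → ∃ λ q → Prime q × q ℕ.≤ Y × k ℕ.* Y ℕ.≤ suc k ℕ.* q
 prime-gap k k≥1 = PrimeGap.start k k≥1 , PrimeGap.prime-near k k≥1

-- The Frobenius map and polynomial functions.

module FrobeniusPolynomials where

 open import Data.Fin as Fin using (Fin; zero; suc; toℕ; inject₁; fromℕ)
 open import Data.Nat.Combinatorics using (_C_; nCk+nC[k+1]≡[n+1]C[k+1]; nC1≡n; nCn≡1; k>n⇒nCk≡0)
 open import Data.Nat.Divisibility using (_∣_; divides; ∣⇒≤; m∣m*n)
 open import Data.Nat.Primality using (Prime; euclidsLemma; prime⇒nonTrivial)
 open import Data.Vec.Functional using (replicate)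
 open ≡ using (_≡_)
 import Level

 absorption : ∀ n k → suc k ℕ.* (suc n C suc k) ≡ suc n ℕ.* (n C k)
 absorption n zero = ≡.trans (ℕ.+-identityʳ (suc n C 1)) (≡.trans (nC1≡n (suc n)) (≡.sym (ℕ.*-identityʳ (suc n))))
 absorption zero (suc k) = ≡.trans (≡.cong (suc (suc k) ℕ.*_) (k>n⇒nCk≡0 {1} {suc (suc k)} (s≤s (s≤s z≤n)))) (≡.trans (ℕ.*-zeroʳ (suc (suc k))) (≡.sym (≡.cong (1 ℕ.*_) (k>n⇒nCk≡0 {0} {suc k} (s≤s z≤n)))))
 absorption (suc n) (suc k) = begin
   suc (suc k) ℕ.* (suc (suc n) C suc (suc k)) ≡⟨ ≡.cong (suc (suc k) ℕ.*_) (≡.sym (nCk+nC[k+1]≡[n+1]C[k+1] (suc n) (suc k))) ⟩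
   suc (suc k) ℕ.* (a ℕ.+ b) ≡⟨ distribute ⟩
   a ℕ.+ (suc k ℕ.* a ℕ.+ suc (suc k) ℕ.* b) ≡⟨ ≡.cong (a ℕ.+_) (≡.cong₂ ℕ._+_ (absorption n k) (absorption n (suc k))) ⟩
   a ℕ.+ (suc n ℕ.* (n C k) ℕ.+ suc n ℕ.* (n C suc k)) ≡⟨ ≡.cong (a ℕ.+_) (ℕ.*-distribˡ-+ (suc n) (n C k) (n C suc k)) ⟨
   a ℕ.+ suc n ℕ.* ((n C k) ℕ.+ (n C suc k)) ≡⟨ ≡.cong (λ z → a ℕ.+ suc n ℕ.* z) (nCk+nC[k+1]≡[n+1]C[k+1] n k) ⟩
   suc (suc n) ℕ.* a ∎
   where
   open ≡.≡-Reasoning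
   a b : ℕ
   a = suc n C suc k
   b = suc n C suc (suc k)
   distribute : suc (suc k) ℕ.* (a ℕ.+ b) ≡ a ℕ.+ (suc k ℕ.* a ℕ.+ suc (suc k) ℕ.* b)
   distribute = ≡.trans (ℕ.*-distribˡ-+ (suc (suc k)) a b) (ℕ.+-assoc a (suc k ℕ.* a) (suc (suc k) ℕ.* b))

 prime∣C : ∀ {q k} → Prime q → suc k ℕ.< q → q ∣ q C suc k
 prime∣C {suc q} {k} pr k<q with euclidsLemma (suc k) (suc q C suc k) pr (≡.subst (suc q ∣_) (≡.sym (absorption q k)) (m∣m*n (q C k)))
 ... | inj₁ q∣k = contradiction (∣⇒≤ q∣k) (ℕ.<⇒≱ k<q)
 ... | inj₂ h = h

 module Frobenius {c ℓ} (R : CommutativeRing c ℓ) {q : ℕ} (pr : Prime q)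
   (char : CommutativeRing._≈_ R (RingNormaliser.ι R q) (CommutativeRing.0# R)) where
   open CommutativeRing R hiding (zero)
   open RingNormaliser R
   open import Algebra.Properties.Semiring.Mult semiring using (×-congʳ; ×-assocˡ; ×-homo-1) renaming (_×_ to _·_)
   open import Algebra.Properties.Semiring.Sum semiring using (sum; sum-cong-≋; sum-replicate-zero; sum-init-last)
   open import Algebra.Properties.CommutativeSemiring.Exp commutativeSemiring using (_^_; ^-distrib-*; ^-congˡ)
   open import Algebra.Properties.CommutativeSemiring.Binomial commutativeSemiring using (theorem)
   open import Algebra.Properties.Semiring.Binomial semiring using (binomialTerm)
   open import Algebra.Properties.Semiring.Mult semiring using (×-assoc-*)
   open import Relation.Binary.Reasoning.Setoid setoid

   q·≈0 : ∀ m x → (m ℕ.* q) · x ≈ 0#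
   q·≈0 m x = begin
     (m ℕ.* q) · x ≈⟨ ×-assocˡ x m q ⟨
     m · (q · x) ≈⟨ ×-congʳ m (trans (×-congʳ q (sym (*-identityˡ x))) (trans (sym (×-assoc-* q 1# x)) (trans (*-congʳ char) (zeroˡ x)))) ⟩
     m · 0# ≈⟨ zeros m ⟩
     0# ∎
     where
     zeros : ∀ m → m · 0# ≈ 0#
     zeros zero = refl
     zeros (suc m) = trans (+-identityˡ _) (zeros m)

   φ : Carrier → Carrier
   φ x = x ^ q

   φ-cong : ∀ {x y} → x ≈ y → φ x ≈ φ y
   φ-cong = ^-congˡ q

   φ-* : ∀ x y → φ (x * y) ≈ φ x * φ y
   φ-* x y = ^-distrib-* x y q

   φ-+ : ∀ x y → φ (x + y) ≈ φ x + φ y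
   φ-+ x y = go q pr ≡.refl
     where
     -- The exponent becomes a variable so that it can be matched as `suc (suc m)`, which exposes
     -- the first and the last binomial term; `q` stays fixed as the characteristic.
     go : ∀ n → Prime n → n ≡ q → (x + y) ^ n ≈ x ^ n + y ^ n
     go zero pr _ = contradiction (ℕ.nonTrivial⇒n>1 0 {{prime⇒nonTrivial pr}}) λ ()
     go (suc zero) pr _ = contradiction (ℕ.nonTrivial⇒n>1 1 {{prime⇒nonTrivial pr}}) λ { (s≤s ()) }
     go n@(suc (suc m)) pr n≡q = begin
       (x + y) ^ n ≈⟨ theorem n x y ⟩
       t zero + sum (λ i → t (suc i)) ≈⟨ +-congˡ (sum-init-last (λ i → t (suc i))) ⟩
       t zero + (sum (λ i → t (suc (inject₁ i))) + t (suc (fromℕ (suc m))))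
         ≈⟨ +-cong first (+-cong (trans (sum-cong-≋ {suc m} {λ i → t (suc (inject₁ i))} {replicate (suc m) 0#} middle) (sum-replicate-zero (suc m))) last) ⟩
       y ^ n + (0# + x ^ n) ≈⟨ ring-eq ((y ^ n) ∷ (x ^ n) ∷ []) (x0 :+ (nat 0 :+ x1)) (x1 :+ x0) ≡.refl ⟩
       x ^ n + y ^ n ∎
       where
       t : Fin (suc n) → Carrier
       t = binomialTerm x y n
       first : t zero ≈ y ^ n
       first = trans (×-homo-1 _) (*-identityˡ _)
       middle : ∀ i → t (suc (inject₁ i)) ≈ 0#
       middle i with prime∣C {n} {toℕ (inject₁ i)} pr (s≤s (≡.subst (ℕ._< suc m) (≡.sym (Fin.toℕ-inject₁ i)) (Fin.toℕ<n i)))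
       ... | divides k eq = trans (reflexive (≡.cong (_· (x ^ suc (toℕ (inject₁ i)) * y ^ (suc m ℕ.∸ toℕ (inject₁ i)))) (≡.trans eq (≡.cong (k ℕ.*_) n≡q)))) (q·≈0 k (x ^ suc (toℕ (inject₁ i)) * y ^ (suc m ℕ.∸ toℕ (inject₁ i))))
       last : t (suc (fromℕ (suc m))) ≈ x ^ n
       last = begin
         (n C toℕ (fromℕ n)) · (x ^ toℕ (fromℕ n) * y ^ (n ℕ.∸ toℕ (fromℕ n))) ≡⟨ ≡.cong (λ k → (n C k) · (x ^ k * y ^ (n ℕ.∸ k))) (Fin.toℕ-fromℕ n) ⟩
         (n C n) · (x ^ n * y ^ (n ℕ.∸ n)) ≡⟨ ≡.cong₂ (λ a b → a · (x ^ n * y ^ b)) (nCn≡1 n) (ℕ.n∸n≡0 n) ⟩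
         1 · (x ^ n * 1#) ≈⟨ trans (×-homo-1 _) (*-identityʳ _) ⟩
         x ^ n ∎

   φ-0 : φ 0# ≈ 0#
   φ-0 = go (ℕ.≤-trans (s≤s z≤n) (ℕ.nonTrivial⇒n>1 q {{prime⇒nonTrivial pr}}))
     where
     go : ∀ {n} → 1 ℕ.≤ n → 0# ^ n ≈ 0#
     go {suc n} _ = zeroˡ _

   φ-1 : φ 1# ≈ 1#
   φ-1 = go q
     where
     go : ∀ n → 1# ^ n ≈ 1#
     go zero = refl
     go (suc n) = trans (*-identityˡ _) (go n)

   φ-ι : ∀ n → φ (ι n) ≈ ι n
   φ-ι zero = φ-0
   φ-ι (suc n) = trans (φ-+ 1# (ι n)) (+-cong φ-1 (φ-ι n))

   φ-neg : ∀ x → φ (- x) ≈ - φ x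
   φ-neg x = begin
     φ (- x) ≈⟨ ring-eq (φ (- x) ∷ φ x ∷ []) x0 (⊝ x1 :+ (x1 :+ x0)) ≡.refl ⟩
     - φ x + (φ x + φ (- x)) ≈⟨ +-congˡ (trans (sym (φ-+ x (- x))) (trans (φ-cong (-‿inverseʳ x)) φ-0)) ⟩
     - φ x + 0# ≈⟨ +-identityʳ _ ⟩
     - φ x ∎

   φ-sub : ∀ x y → φ (x - y) ≈ φ x - φ y
   φ-sub x y = trans (φ-+ x (- y)) (+-congˡ (φ-neg y))

   φ^ : ℕ → Carrier → Carrier
   φ^ zero x = x
   φ^ (suc i) x = φ (φ^ i x)

   φ^-cong : ∀ i {x y} → x ≈ y → φ^ i x ≈ φ^ i y
   φ^-cong zero h = h
   φ^-cong (suc i) h = φ-cong (φ^-cong i h)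

   φ^-+ : ∀ i x y → φ^ i (x + y) ≈ φ^ i x + φ^ i y
   φ^-+ zero x y = refl
   φ^-+ (suc i) x y = trans (φ-cong (φ^-+ i x y)) (φ-+ _ _)

   φ^-* : ∀ i x y → φ^ i (x * y) ≈ φ^ i x * φ^ i y
   φ^-* zero x y = refl
   φ^-* (suc i) x y = trans (φ-cong (φ^-* i x y)) (φ-* _ _)

   φ^-neg : ∀ i x → φ^ i (- x) ≈ - φ^ i x
   φ^-neg zero x = refl
   φ^-neg (suc i) x = trans (φ-cong (φ^-neg i x)) (φ-neg _)

   φ^-fixed : ∀ i {x} → φ x ≈ x → φ^ i x ≈ x
   φ^-fixed zero h = refl
   φ^-fixed (suc i) h = trans (φ-cong (φ^-fixed i h)) h

   φ^-∘ : ∀ i j x → φ^ (i ℕ.+ j) x ≡ φ^ i (φ^ j x)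
   φ^-∘ zero j x = ≡.refl
   φ^-∘ (suc i) j x = ≡.cong φ (φ^-∘ i j x)

 -- Functions R → R given by polynomials, through divided differences: IsPoly n c G says that
 -- G has degree at most n and n-th coefficient c.
 module Polynomial {c ℓ} (R : CommutativeRing c ℓ) where
   open CommutativeRing R hiding (zero)
   open RingNormaliser R
   open import Algebra.Properties.Semiring.Exp semiring using (_^_)
   open import Relation.Binary.Reasoning.Setoid setoid
   open Level using (_⊔_)

   IsPoly : ℕ → Carrier → (Carrier → Carrier) → Set (c ⊔ ℓ)
   IsPoly zero k G = Level.Lift c (∀ y → G y ≈ k)
   IsPoly (suc n) k G = ∀ y₀ → ∃ λ G′ → IsPoly n k G′ × (∀ y → G y - G y₀ ≈ (y - y₀) * G′ y)

   isPoly-resp : ∀ n {k k′ G G′} → k ≈ k′ → (∀ y → G y ≈ G′ y) → IsPoly n k G → IsPoly n k′ G′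
   isPoly-resp zero k≈ G≈ (Level.lift h) = Level.lift λ y → trans (sym (G≈ y)) (trans (h y) k≈)
   isPoly-resp (suc n) k≈ G≈ h y₀ = proj₁ (h y₀) , isPoly-resp n k≈ (λ _ → refl) (proj₁ (proj₂ (h y₀))) ,
     λ y → trans (+-cong (sym (G≈ y)) (-‿cong (sym (G≈ y₀)))) (proj₂ (proj₂ (h y₀)) y)

   isPoly-+ : ∀ {n m k l G H} → IsPoly n k G → IsPoly m l H → m ℕ.< n → IsPoly n k (λ y → G y + H y)
   isPoly-+ {suc n} {zero} {k} {l} {G} {H} p (Level.lift r) _ y₀ = proj₁ (p y₀) , proj₁ (proj₂ (p y₀)) , λ y → begin
     (G y + H y) - (G y₀ + H y₀) ≈⟨ +-cong (+-congˡ (r y)) (-‿cong (+-congˡ (r y₀))) ⟩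
     (G y + l) - (G y₀ + l) ≈⟨ ring-eq ((G y) ∷ l ∷ (G y₀) ∷ []) (x0 :+ x1 :- (x2 :+ x1)) (x0 :- x2) ≡.refl ⟩
     G y - G y₀ ≈⟨ proj₂ (proj₂ (p y₀)) y ⟩
     (y - y₀) * proj₁ (p y₀) y ∎
   isPoly-+ {suc n} {suc m} {k} {l} {G} {H} p r (s≤s m<n) y₀ = (λ y → G′ y + H′ y) , isPoly-+ (proj₁ (proj₂ (p y₀))) (proj₁ (proj₂ (r y₀))) m<n , λ y → begin
     (G y + H y) - (G y₀ + H y₀) ≈⟨ ring-eq ((G y) ∷ (H y) ∷ (G y₀) ∷ (H y₀) ∷ []) (x0 :+ x1 :- (x2 :+ x3)) (x0 :- x2 :+ (x1 :- x3)) ≡.refl ⟩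
     (G y - G y₀) + (H y - H y₀) ≈⟨ +-cong (proj₂ (proj₂ (p y₀)) y) (proj₂ (proj₂ (r y₀)) y) ⟩
     (y - y₀) * G′ y + (y - y₀) * H′ y ≈⟨ distribˡ _ _ _ ⟨
     (y - y₀) * (G′ y + H′ y) ∎
     where
     G′ H′ : Carrier → Carrier
     G′ = proj₁ (p y₀)
     H′ = proj₁ (r y₀)

   -- The product rule for divided differences. Powers and norms along a line are built from affine
   -- factors by it.
   isPoly-linear : ∀ n {k G} u v → IsPoly n k G → IsPoly (suc n) (k * v) (λ y → G y * (u + y * v))
   isPoly-linear zero {k} {G} u v (Level.lift h) y₀ = (λ _ → k * v) , Level.lift (λ _ → refl) , λ y → begin
     G y * (u + y * v) - G y₀ * (u + y₀ * v) ≈⟨ +-cong (*-congʳ (h y)) (-‿cong (*-congʳ (h y₀))) ⟩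
     k * (u + y * v) - k * (u + y₀ * v) ≈⟨ ring-eq (k ∷ u ∷ y ∷ v ∷ y₀ ∷ []) (x0 :* (x1 :+ x2 :* x3) :- x0 :* (x1 :+ x4 :* x3)) ((x2 :- x4) :* (x0 :* x3)) ≡.refl ⟩
     (y - y₀) * (k * v) ∎
   isPoly-linear (suc n) {k} {G} u v h y₀ = (λ y → G′ y * (u + y * v) + G y₀ * v) , isPoly-+ (isPoly-linear n u v (proj₁ (proj₂ (h y₀)))) (Level.lift {ℓ = c} (λ _ → refl)) (s≤s z≤n) , λ y → begin
     G y * (u + y * v) - G y₀ * (u + y₀ * v) ≈⟨ ring-eq ((G y) ∷ u ∷ y ∷ v ∷ (G y₀) ∷ y₀ ∷ []) (x0 :* (x1 :+ x2 :* x3) :- x4 :* (x1 :+ x5 :* x3)) ((x0 :- x4) :* (x1 :+ x2 :* x3) :+ (x2 :- x5) :* (x4 :* x3)) ≡.refl ⟩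
     (G y - G y₀) * (u + y * v) + (y - y₀) * (G y₀ * v) ≈⟨ +-congʳ (*-congʳ (proj₂ (proj₂ (h y₀)) y)) ⟩
     (y - y₀) * G′ y * (u + y * v) + (y - y₀) * (G y₀ * v) ≈⟨ ring-eq (y ∷ y₀ ∷ (G′ y) ∷ u ∷ v ∷ (G y₀) ∷ []) ((x0 :- x1) :* x2 :* (x3 :+ x0 :* x4) :+ (x0 :- x1) :* (x5 :* x4)) ((x0 :- x1) :* (x2 :* (x3 :+ x0 :* x4) :+ x5 :* x4)) ≡.refl ⟩
     (y - y₀) * (G′ y * (u + y * v) + G y₀ * v) ∎
     where
     G′ : Carrier → Carrier
     G′ = proj₁ (h y₀)

   isPoly-const : ∀ k → IsPoly 0 k (λ _ → k)
   isPoly-const k = Level.lift λ _ → refl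

   isPoly-affine : ∀ u v → IsPoly 1 v (λ y → u + y * v)
   isPoly-affine u v = isPoly-resp 1 (*-identityˡ v) (λ y → *-identityˡ _) (isPoly-linear 0 u v (isPoly-const 1#))

   isPoly-^ : ∀ n → IsPoly n 1# (_^ n)
   isPoly-^ zero = isPoly-const 1#
   isPoly-^ (suc n) = isPoly-resp (suc n) (*-identityˡ 1#) (λ y → trans (*-congˡ (trans (+-identityˡ _) (*-identityʳ y))) (*-comm (y ^ n) y))
     (isPoly-linear n 0# 1# (isPoly-^ n))

   isPoly-scale : ∀ n {k G} a → IsPoly n k G → IsPoly n (a * k) (λ y → a * G y)
   isPoly-scale zero a (Level.lift h) = Level.lift λ y → *-congˡ (h y)
   isPoly-scale (suc n) {G = G} a h y₀ = (λ y → a * G′ y) , isPoly-scale n a (proj₁ (proj₂ (h y₀))) , λ y → begin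
     a * G y - a * G y₀ ≈⟨ ring-eq (a ∷ (G y) ∷ (G y₀) ∷ []) (x0 :* x1 :- x0 :* x2) (x0 :* (x1 :- x2)) ≡.refl ⟩
     a * (G y - G y₀) ≈⟨ *-congˡ (proj₂ (proj₂ (h y₀)) y) ⟩
     a * ((y - y₀) * G′ y) ≈⟨ ring-eq (a ∷ y ∷ y₀ ∷ (G′ y) ∷ []) (x0 :* ((x1 :- x2) :* x3)) ((x1 :- x2) :* (x0 :* x3)) ≡.refl ⟩
     (y - y₀) * (a * G′ y) ∎
     where
     G′ : Carrier → Carrier
     G′ = proj₁ (h y₀)

   module Roots (domain : ∀ x y → x * y ≈ 0# → ¬ x ≈ 0# → y ≈ 0#) where

     -- Dividing out the last root lowers the degree and keeps the top coefficient; in a domain the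
     -- quotient vanishes at the remaining roots.
     roots : ∀ n {k G} → IsPoly n k G → (ρ : ℕ → Carrier) → (∀ {i} → i ℕ.≤ n → G (ρ i) ≈ 0#) → (∀ {i j} → i ℕ.< j → j ℕ.≤ n → ¬ ρ i ≈ ρ j) → k ≈ 0#
     roots zero (Level.lift h) ρ zero-at distinct = trans (sym (h (ρ 0))) (zero-at z≤n)
     roots (suc n) {k} {G} h ρ zero-at distinct = roots n (proj₁ (proj₂ (h (ρ (suc n))))) ρ zero-at′ (λ i<j j≤n → distinct i<j (ℕ.m≤n⇒m≤1+n j≤n))
       where
       G′ : Carrier → Carrier
       G′ = proj₁ (h (ρ (suc n)))
       zero-at′ : ∀ {i} → i ℕ.≤ n → G′ (ρ i) ≈ 0#
       zero-at′ {i} i≤n = domain (ρ i - ρ (suc n)) (G′ (ρ i))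
         (trans (sym (proj₂ (proj₂ (h (ρ (suc n)))) (ρ i))) (trans (+-cong (zero-at (ℕ.m≤n⇒m≤1+n i≤n)) (-‿cong (zero-at ℕ.≤-refl))) (-‿inverseʳ 0#)))
         (λ eq → distinct (s≤s i≤n) ℕ.≤-refl (trans (ring-eq (ρ i ∷ ρ (suc n) ∷ []) x0 ((x0 :- x1) :+ x1) ≡.refl) (trans (+-congʳ eq) (+-identityˡ _))))

-- Extension fields of prime fields and their norm forms.

module AnisotropicForms where

 open import Algebra.Bundles using (Semiring)
 open import Data.Nat.Induction using (<-rec)
 open import Data.Nat.Primality using (Prime; prime⇒nonTrivial)
 open ≡ using (_≡_)
 open FrobeniusPolynomials

 ¬¬-least : ∀ {P : ℕ → Set} {n} → P n → ¬ ¬ (∃ λ r → P r × (∀ {s} → s ℕ.< r → ¬ P s))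
 ¬¬-least {P} {n} pn none = <-rec (λ n → ¬ P n) (λ n rec p → none (n , p , λ s<n → rec s<n)) n pn

 decide-below : ∀ {P : ℕ → Set} → (∀ n → Dec (P n)) → ∀ N → (∀ {n} → n ℕ.< N → P n) ⊎ (∃ λ n → n ℕ.< N × ¬ P n)
 decide-below P? zero = inj₁ λ ()
 decide-below {P} P? (suc N) with decide-below P? N | P? N
 ... | inj₂ (n , n<N , ¬p) | _ = inj₂ (n , ℕ.m≤n⇒m≤1+n n<N , ¬p)
 ... | inj₁ _ | no ¬p = inj₂ (N , ℕ.≤-refl , ¬p)
 ... | inj₁ all | yes p = inj₁ all′
   where
   all′ : ∀ {n} → n ℕ.< suc N → P n
   all′ (s≤s n≤N) with ℕ.m≤n⇒m<n∨m≡n n≤N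
   ... | inj₁ n<N = all n<N
   ... | inj₂ ≡.refl = p

 -- ℤ[X] acting on sequences, X being the shift. Two operators are identified when they agree on
 -- a fixed sequence f, which presents the cyclic module generated by f as a quotient ring.
 module Operators (F : CommutativeRing 0ℓ 0ℓ) where
   open CommutativeRing F hiding (zero)
   open RingNormaliser F
   open import Relation.Binary.Reasoning.Setoid setoid

   infixl 6 _+ᵒ_
   infixl 7 _*ᵒ_

   data Op : Set where
     con : Carrier → Op
     X : Op
     _+ᵒ_ _*ᵒ_ : Op → Op → Op
     -ᵒ_ : Op → Op

   Seq : Set
   Seq = ℕ → Carrier

   act : Op → Seq → Seq
   act (con c) f n = c * f n
   act X f n = f (suc n)
   act (a +ᵒ b) f n = act a f n + act b f n
   act (a *ᵒ b) f = act a (act b f)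
   act (-ᵒ a) f n = - act a f n

   act-cong : ∀ a {f g} → (∀ n → f n ≈ g n) → ∀ n → act a f n ≈ act a g n
   act-cong (con c) h n = *-congˡ (h n)
   act-cong X h n = h (suc n)
   act-cong (a +ᵒ b) h n = +-cong (act-cong a h n) (act-cong b h n)
   act-cong (a *ᵒ b) h = act-cong a (act-cong b h)
   act-cong (-ᵒ a) h n = -‿cong (act-cong a h n)

   act-+ : ∀ a f g n → act a (λ m → f m + g m) n ≈ act a f n + act a g n
   act-+ (con c) f g n = distribˡ c (f n) (g n)
   act-+ X f g n = refl
   act-+ (a +ᵒ b) f g n = trans (+-cong (act-+ a f g n) (act-+ b f g n))
     (ring-eq ((act a f n) ∷ (act a g n) ∷ (act b f n) ∷ (act b g n) ∷ []) (x0 :+ x1 :+ (x2 :+ x3)) (x0 :+ x2 :+ (x1 :+ x3)) ≡.refl)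
   act-+ (a *ᵒ b) f g n = trans (act-cong a (act-+ b f g) n) (act-+ a (act b f) (act b g) n)
   act-+ (-ᵒ a) f g n = trans (-‿cong (act-+ a f g n)) (ring-eq ((act a f n) ∷ (act a g n) ∷ []) (⊝ (x0 :+ x1)) (⊝ x0 :- x1) ≡.refl)

   act-* : ∀ a c f n → act a (λ m → c * f m) n ≈ c * act a f n
   act-* (con b) c f n = ring-eq (b ∷ c ∷ (f n) ∷ []) (x0 :* (x1 :* x2)) (x1 :* (x0 :* x2)) ≡.refl
   act-* X c f n = refl
   act-* (a +ᵒ b) c f n = trans (+-cong (act-* a c f n) (act-* b c f n)) (sym (distribˡ c (act a f n) (act b f n)))
   act-* (a *ᵒ b) c f n = trans (act-cong a (act-* b c f) n) (act-* a c (act b f) n)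
   act-* (-ᵒ a) c f n = trans (-‿cong (act-* a c f n)) (ring-eq (c ∷ (act a f n) ∷ []) (⊝ (x0 :* x1)) (x0 :* ⊝ x1) ≡.refl)

   act-0 : ∀ a {f} → (∀ n → f n ≈ 0#) → ∀ n → act a f n ≈ 0#
   act-0 a {f} h n = trans (act-cong a (λ m → trans (h m) (sym (zeroˡ (f m)))) n) (trans (act-* a 0# f n) (zeroˡ _))

   act-shift : ∀ a f n → act a (λ m → f (suc m)) n ≈ act a f (suc n)
   act-shift (con c) f n = refl
   act-shift X f n = refl
   act-shift (a +ᵒ b) f n = +-cong (act-shift a f n) (act-shift b f n)
   act-shift (a *ᵒ b) f n = trans (act-cong a (act-shift b f) n) (act-shift a (act b f) n)
   act-shift (-ᵒ a) f n = -‿cong (act-shift a f n)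

   act-shifts : ∀ a i f n → act a (λ m → f (i ℕ.+ m)) n ≈ act a f (i ℕ.+ n)
   act-shifts a zero f n = refl
   act-shifts a (suc i) f n = trans (act-shifts a i (λ m → f (suc m)) n) (act-shift a f (i ℕ.+ n))

   act-comm : ∀ a b f n → act a (act b f) n ≈ act b (act a f) n
   act-comm (con c) b f n = sym (act-* b c f n)
   act-comm X b f n = sym (act-shift b f n)
   act-comm (a +ᵒ a′) b f n = trans (+-cong (act-comm a b f n) (act-comm a′ b f n)) (sym (act-+ b (act a f) (act a′ f) n))
   act-comm (a *ᵒ a′) b f n = trans (act-cong a (act-comm a′ b f) n) (act-comm a b (act a′ f) n)
   act-comm (-ᵒ a) b f n = begin
     - act a (act b f) n ≈⟨ -‿cong (act-comm a b f n) ⟩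
     - act b (act a f) n ≈⟨ ring-eq ((act b (act a f) n) ∷ []) (⊝ x0) (⊝ one :* x0) ≡.refl ⟩
     (- 1#) * act b (act a f) n ≈⟨ act-* b (- 1#) (act a f) n ⟨
     act b (λ m → (- 1#) * act a f m) n ≈⟨ act-cong b (λ m → (ring-eq ((act a f m) ∷ []) (⊝ one :* x0) (⊝ x0) ≡.refl)) n ⟩
     act b (λ m → - act a f m) n ∎

   cyclic : Seq → CommutativeRing 0ℓ 0ℓ
   cyclic f = record
     { Carrier = Op ; _≈_ = λ a b → ∀ n → act a f n ≈ act b f n
     ; _+_ = _+ᵒ_ ; _*_ = _*ᵒ_ ; -_ = -ᵒ_ ; 0# = con 0# ; 1# = con 1#
     ; isCommutativeRing = record
       { isRing = record
         { +-isAbelianGroup = record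
           { isGroup = record
             { isMonoid = record
               { isSemigroup = record
                 { isMagma = record
                   { isEquivalence = record { refl = λ n → refl ; sym = λ h n → sym (h n) ; trans = λ h k n → trans (h n) (k n) }
                   ; ∙-cong = λ h k n → +-cong (h n) (k n) }
                 ; assoc = λ a b c n → +-assoc _ _ _ }
               ; identity = (λ a n → trans (+-congʳ (zeroˡ (f n))) (+-identityˡ _)) , (λ a n → trans (+-congˡ (zeroˡ (f n))) (+-identityʳ _)) }
             ; inverse = (λ a n → trans (-‿inverseˡ _) (sym (zeroˡ (f n)))) , (λ a n → trans (-‿inverseʳ _) (sym (zeroˡ (f n))))
             ; ⁻¹-cong = λ h n → -‿cong (h n) }
           ; comm = λ a b n → +-comm _ _ }
         -- `a` and `a′` agree only on `f` and not on other sequences, so the inner operator is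
         -- moved outside by `act-comm` before they are exchanged.
         ; *-cong = λ {a} {a′} {b} {b′} h k n → trans (act-cong a k n) (trans (act-comm a b′ f n) (trans (act-cong b′ h n) (act-comm b′ a′ f n)))
         ; *-assoc = λ a b c n → refl
         ; *-identity = (λ a n → *-identityˡ _) , (λ a n → trans (act-* a 1# f n) (*-identityˡ _))
         ; distrib = (λ a b c n → act-+ a (act b f) (act c f) n) , (λ a b c n → refl) }
       ; *-comm = λ a b n → act-comm a b f n } }

   Σ< : ℕ → (ℕ → Carrier) → Carrier
   Σ< zero g = 0#
   Σ< (suc n) g = Σ< n g + g n

   Σ<-cong : ∀ n {g h} → (∀ {i} → i ℕ.< n → g i ≈ h i) → Σ< n g ≈ Σ< n h
   Σ<-cong zero e = refl
   Σ<-cong (suc n) e = +-cong (Σ<-cong n (λ p → e (ℕ.m≤n⇒m≤1+n p))) (e ℕ.≤-refl)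

   Σ<-+ : ∀ n g h → Σ< n (λ i → g i + h i) ≈ Σ< n g + Σ< n h
   Σ<-+ zero g h = sym (+-identityˡ 0#)
   Σ<-+ (suc n) g h = trans (+-congʳ (Σ<-+ n g h)) (ring-eq ((Σ< n g) ∷ (Σ< n h) ∷ (g n) ∷ (h n) ∷ []) (x0 :+ x1 :+ (x2 :+ x3)) (x0 :+ x2 :+ (x1 :+ x3)) ≡.refl)

   Σ<-* : ∀ n c g → Σ< n (λ i → c * g i) ≈ c * Σ< n g
   Σ<-* zero c g = sym (zeroʳ c)
   Σ<-* (suc n) c g = trans (+-congʳ (Σ<-* n c g)) (sym (distribˡ c (Σ< n g) (g n)))

   Σ<-0 : ∀ n {g} → (∀ {i} → i ℕ.< n → g i ≈ 0#) → Σ< n g ≈ 0#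
   Σ<-0 zero h = refl
   Σ<-0 (suc n) h = trans (+-cong (Σ<-0 n (λ p → h (ℕ.m≤n⇒m≤1+n p))) (h ℕ.≤-refl)) (+-identityˡ 0#)

   Σ<-head : ∀ n g → Σ< (suc n) g ≈ g 0 + Σ< n (λ i → g (suc i))
   Σ<-head zero g = +-comm 0# (g 0)
   Σ<-head (suc n) g = trans (+-congʳ (Σ<-head n g)) (+-assoc _ _ _)

   -- The polynomial in `X` of degree less than `r` with coefficients `c`, applied to `f`.
   combine : ℕ → (ℕ → Carrier) → Seq → Seq
   combine r c f n = Σ< r (λ i → c i * f (i ℕ.+ n))

   act-combine : ∀ a r c f n → act a (combine r c f) n ≈ combine r c (act a f) n
   act-combine a zero c f n = act-0 a (λ _ → refl) n
   act-combine a (suc r) c f n = trans (act-+ a (combine r c f) (λ m → c r * f (r ℕ.+ m)) n)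
     (+-cong (act-combine a r c f n) (trans (act-* a (c r) (λ m → f (r ℕ.+ m)) n) (*-congˡ (act-shifts a r f n))))

   Recurrent : ℕ → Seq → Set
   Recurrent r f = ∃ λ h → ∀ n → f (r ℕ.+ n) ≈ combine r h f n

   -- Division with remainder by the recurrence: every operator acts on `f` like a polynomial of
   -- degree below the order. Multiplication by `X` overflows only in the top coefficient, and the
   -- recurrence folds that one back.
   reduce : ∀ {r f} → Recurrent (suc r) f → ∀ a c → ∃ λ c′ → ∀ n → act a (combine (suc r) c f) n ≈ combine (suc r) c′ f n
   reduce {r} {f} rec (con b) c = (λ i → b * c i) , λ n → trans (sym (Σ<-* (suc r) b _)) (Σ<-cong (suc r) (λ _ → sym (*-assoc b _ _)))
   reduce {r} {f} (h , hrec) X c = c′ , eq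
     where
     prev c′ : ℕ → Carrier
     prev zero = 0#
     prev (suc i) = c i
     c′ i = prev i + c r * h i
     eq : ∀ n → combine (suc r) c f (suc n) ≈ combine (suc r) c′ f n
     eq n = begin
       Σ< r (λ i → c i * f (i ℕ.+ suc n)) + c r * f (r ℕ.+ suc n)
         ≈⟨ +-cong (Σ<-cong r (λ {i} _ → *-congˡ (reflexive (≡.cong f (ℕ.+-suc i n))))) (*-congˡ (trans (reflexive (≡.cong f (ℕ.+-suc r n))) (hrec n))) ⟩
       Σ< r (λ i → c i * f (suc i ℕ.+ n)) + c r * combine (suc r) h f n
         ≈⟨ +-cong (trans (sym (+-identityˡ _)) (+-congʳ (sym (zeroˡ (f n))))) (sym (Σ<-* (suc r) (c r) _)) ⟩
       0# * f n + Σ< r (λ i → c i * f (suc i ℕ.+ n)) + Σ< (suc r) (λ i → c r * (h i * f (i ℕ.+ n)))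
         ≈⟨ +-congʳ (Σ<-head r (λ i → prev i * f (i ℕ.+ n))) ⟨
       Σ< (suc r) (λ i → prev i * f (i ℕ.+ n)) + Σ< (suc r) (λ i → c r * (h i * f (i ℕ.+ n)))
         ≈⟨ Σ<-+ (suc r) _ _ ⟨
       Σ< (suc r) (λ i → prev i * f (i ℕ.+ n) + c r * (h i * f (i ℕ.+ n)))
         ≈⟨ Σ<-cong (suc r) (λ {i} _ → (ring-eq ((prev i) ∷ (f (i ℕ.+ n)) ∷ (c r) ∷ (h i) ∷ []) (x0 :* x1 :+ x2 :* (x3 :* x1)) ((x0 :+ x2 :* x3) :* x1) ≡.refl)) ⟩
       combine (suc r) c′ f n ∎
   reduce {r} {f} rec (a +ᵒ b) c = (λ i → proj₁ (reduce {r} {f} rec a c) i + proj₁ (reduce {r} {f} rec b c) i) , λ n →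
     trans (+-cong (proj₂ (reduce {r} {f} rec a c) n) (proj₂ (reduce {r} {f} rec b c) n)) (trans (sym (Σ<-+ (suc r) _ _)) (Σ<-cong (suc r) (λ _ → sym (distribʳ _ _ _))))
   reduce {r} {f} rec (a *ᵒ b) c = proj₁ (reduce {r} {f} rec a (proj₁ (reduce {r} {f} rec b c))) , λ n →
     trans (act-cong a (proj₂ (reduce {r} {f} rec b c)) n) (proj₂ (reduce {r} {f} rec a (proj₁ (reduce {r} {f} rec b c))) n)
   reduce {r} {f} rec (-ᵒ a) c = (λ i → (- 1#) * proj₁ (reduce {r} {f} rec a c) i) , λ n →
     trans (-‿cong (proj₂ (reduce {r} {f} rec a c) n)) (trans (ring-eq ((combine (suc r) (proj₁ (reduce {r} {f} rec a c)) f n) ∷ []) (⊝ x0) (⊝ one :* x0) ≡.refl)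
       (trans (sym (Σ<-* (suc r) (- 1#) _)) (Σ<-cong (suc r) (λ _ → sym (*-assoc (- 1#) _ _)))))

 module PrimeField (F : CommutativeRing 0ℓ 0ℓ) {q : ℕ} (pr : Prime q)
   (char : CommutativeRing._≈_ F (RingNormaliser.ι F q) (CommutativeRing.0# F))
   (_≟_ : ∀ x y → Dec (CommutativeRing._≈_ F x y))
   (domain : ∀ {x y} → CommutativeRing._≈_ F (CommutativeRing._*_ F x y) (CommutativeRing.0# F) → ¬ CommutativeRing._≈_ F x (CommutativeRing.0# F) → CommutativeRing._≈_ F y (CommutativeRing.0# F))
   (representative : ∀ x → ∃ λ n → CommutativeRing._≈_ F x (RingNormaliser.ι F n))
   (ι-injective : ∀ {i j} → i ℕ.< j → j ℕ.< q → ¬ CommutativeRing._≈_ F (RingNormaliser.ι F i) (RingNormaliser.ι F j)) where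
   open CommutativeRing F hiding (zero)
   open RingNormaliser F
   open Operators F public
   open import Algebra.Properties.Semiring.Exp semiring using (_^_)
   open import Relation.Binary.Reasoning.Setoid setoid
   module FrobF = Frobenius F pr char

   q≥2 : 2 ℕ.≤ q
   q≥2 = ℕ.nonTrivial⇒n>1 q {{prime⇒nonTrivial pr}}

   1≉0 : ¬ 1# ≈ 0#
   1≉0 h = ι-injective {0} {1} (s≤s z≤n) q≥2 (trans (sym h) (sym (+-identityʳ 1#)))

   -- Every element is a sum of ones, and Frobenius is additive and fixes 1.
   fermat : ∀ x → x ^ q ≈ x
   fermat x with representative x
   ... | n , x≈ = trans (FrobF.φ-cong x≈) (trans (FrobF.φ-ι n) (sym x≈))

   inv : Carrier → Carrier
   inv x = x ^ (q ℕ.∸ 2)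

   *-inv : ∀ {x} → ¬ x ≈ 0# → x * inv x ≈ 1#
   *-inv {x} x≉0 = trans (ring-eq (x ∷ (inv x) ∷ []) (x0 :* x1) (x0 :* x1 :- one :+ one) ≡.refl) (trans (+-congʳ (domain zero-product x≉0)) (+-identityˡ 1#))
     where
     xq : x * (x * inv x) ≈ x
     xq = trans (reflexive (≡.cong (x ^_) (ℕ.m+[n∸m]≡n q≥2))) (fermat x)
     zero-product : x * (x * inv x - 1#) ≈ 0#
     zero-product = trans (ring-eq (x ∷ (inv x) ∷ []) (x0 :* (x0 :* x1 :- one)) (x0 :* (x0 :* x1) :- x0) ≡.refl) (trans (+-congʳ xq) (-‿inverseʳ x))

   top : ∀ r (c : ℕ → Carrier) → (∀ {i} → i ℕ.< r → c i ≈ 0#) ⊎ (∃ λ i → i ℕ.< r × ¬ c i ≈ 0# × (∀ {j} → i ℕ.< j → j ℕ.< r → c j ≈ 0#))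
   top zero c = inj₁ λ ()
   top (suc r) c with c r ≟ 0# | top r c
   ... | no c≉0 | _ = inj₂ (r , ℕ.≤-refl , c≉0 , λ r<j j<1+r → contradiction r<j (ℕ.<⇒≱ j<1+r))
   ... | yes c≈0 | inj₂ (i , i<r , h , k) = inj₂ (i , ℕ.m≤n⇒m≤1+n i<r , h , above)
     where
     above : ∀ {j} → i ℕ.< j → j ℕ.< suc r → c j ≈ 0#
     above i<j (s≤s j≤r) with ℕ.m≤n⇒m<n∨m≡n j≤r
     ... | inj₁ j<r = k i<j j<r
     ... | inj₂ ≡.refl = c≈0
   ... | yes c≈0 | inj₁ all = inj₁ all′
     where
     all′ : ∀ {i} → i ℕ.< suc r → c i ≈ 0#
     all′ (s≤s i≤r) with ℕ.m≤n⇒m<n∨m≡n i≤r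
     ... | inj₁ i<r = all i<r
     ... | inj₂ ≡.refl = c≈0

   Null : Seq → Set
   Null f = ∀ n → f n ≈ 0#

   combine-top : ∀ {r i} c f → i ℕ.< r → (∀ {j} → i ℕ.< j → j ℕ.< r → c j ≈ 0#) → ∀ n → combine r c f n ≈ combine (suc i) c f n
   combine-top {suc r} {i} c f (s≤s i≤r) above n with ℕ.m≤n⇒m<n∨m≡n i≤r
   ... | inj₂ ≡.refl = refl
   ... | inj₁ i<r = trans (+-cong (combine-top c f i<r (λ p p′ → above p (ℕ.m≤n⇒m≤1+n p′)) n) (trans (*-congʳ (above i<r ℕ.≤-refl)) (zeroˡ _))) (+-identityʳ _)

   -- Dividing by its top coefficient turns an annihilating polynomial into a recurrence whose order
   -- is its degree.
   solve-top : ∀ {i c g} → ¬ c i ≈ 0# → (∀ n → combine (suc i) c g n ≈ 0#) → Recurrent i g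
   solve-top {i} {c} {g} c≉0 h = (λ j → - inv (c i) * c j) , λ n → begin
     g (i ℕ.+ n) ≈⟨ ring-eq ((g (i ℕ.+ n)) ∷ []) x0 (one :* x0) ≡.refl ⟩
     1# * g (i ℕ.+ n) ≈⟨ *-congʳ (*-inv c≉0) ⟨
     c i * inv (c i) * g (i ℕ.+ n) ≈⟨ ring-eq ((c i) ∷ (inv (c i)) ∷ (g (i ℕ.+ n)) ∷ (combine i c g n) ∷ []) (x0 :* x1 :* x2) (x1 :* (x3 :+ x0 :* x2) :+ ⊝ x1 :* x3) ≡.refl ⟩
     inv (c i) * combine (suc i) c g n + - inv (c i) * combine i c g n ≈⟨ +-cong (trans (*-congˡ (h n)) (zeroʳ _)) (sym (Σ<-* i (- inv (c i)) _)) ⟩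
     0# + Σ< i (λ j → - inv (c i) * (c j * g (j ℕ.+ n))) ≈⟨ +-identityˡ _ ⟩
     Σ< i (λ j → - inv (c i) * (c j * g (j ℕ.+ n))) ≈⟨ Σ<-cong i (λ _ → sym (*-assoc (- inv (c i)) _ _)) ⟩
     combine i (λ j → - inv (c i) * c j) g n ∎

   act-ι : ∀ k f n → act (RingNormaliser.ι (cyclic f) k) f n ≈ ι k * f n
   act-ι zero f n = refl
   act-ι (suc k) f n = trans (+-congˡ (act-ι k f n)) (sym (distribʳ (f n) 1# (ι k)))

   char-cyclic : ∀ f n → act (RingNormaliser.ι (cyclic f) q) f n ≈ 0# * f n
   char-cyclic f n = trans (act-ι q f n) (*-congʳ char)

   module FrobK (f : Seq) = Frobenius (cyclic f) pr (char-cyclic f)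

   infixr 8 _^ᵒ_
   _^ᵒ_ : Op → ℕ → Op
   a ^ᵒ zero = con 1#
   a ^ᵒ suc n = a *ᵒ a ^ᵒ n

   ShiftsBy : ℕ → Op → Set
   ShiftsBy m a = ∀ g n → act a g n ≈ g (m ℕ.+ n)

   shiftsBy-^ : ∀ {m a} → ShiftsBy m a → ∀ k → ShiftsBy (k ℕ.* m) (a ^ᵒ k)
   shiftsBy-^ h zero g n = *-identityˡ (g n)
   shiftsBy-^ {m} {a} h (suc k) g n = trans (h (act (a ^ᵒ k) g) n) (trans (shiftsBy-^ h k g (m ℕ.+ n))
     (reflexive (≡.cong g (≡.trans (≡.sym (ℕ.+-assoc (k ℕ.* m) m n)) (≡.cong (ℕ._+ n) (ℕ.+-comm (k ℕ.* m) m))))))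

   φ^X-shifts : ∀ f i → ShiftsBy (q ℕ.^ i) (FrobK.φ^ f i X)
   φ^X-shifts f zero g n = refl
   φ^X-shifts f (suc i) = power f q (FrobK.φ^ f i X) (φ^X-shifts f i)
     where
     open import Algebra.Definitions.RawSemiring using () renaming (_^_ to pow)
     power : ∀ f k a {m} → ShiftsBy m a → ShiftsBy (k ℕ.* m) (pow (Semiring.rawSemiring (CommutativeRing.semiring (cyclic f))) a k)
     power f zero a h g n = *-identityˡ (g n)
     power f (suc k) a {m} h g n = trans (h _ n) (trans (power f k a h g (m ℕ.+ n))
       (reflexive (≡.cong g (≡.trans (≡.sym (ℕ.+-assoc (k ℕ.* m) m n)) (≡.cong (ℕ._+ n) (ℕ.+-comm (k ℕ.* m) m))))))

   φ-con : ∀ f c n → act (FrobK.φ f (con c)) f n ≈ act (con c) f n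
   φ-con f c n = trans (power q n) (*-congʳ (fermat c))
     where
     open import Algebra.Definitions.RawSemiring using () renaming (_^_ to pow)
     power : ∀ k n → act (pow (Semiring.rawSemiring (CommutativeRing.semiring (cyclic f))) (con c) k) f n ≈ (c ^ k) * f n
     power zero n = refl
     power (suc k) n = trans (*-congˡ (power k n)) (sym (*-assoc c _ _))

   -- On sequences of period `q^d - 1` the operator `X^(q^d)` acts as `X`. The image of `B`, the
   -- product of `X^(q^e) - X` over `0 < e < d`, excludes the modules on which `X` has fewer than
   -- `d` conjugates; a sequence of minimal order in this image generates the field with `q^d`
   -- elements.
   module Degree (d′ : ℕ) where
     d M : ℕ
     d = suc d′
     M = ℕ.pred (q ℕ.^ d)

     1+M : suc M ≡ q ℕ.^ d
     1+M = ℕ.suc-pred (q ℕ.^ d) {{ℕ.>-nonZero (ℕ.m^n>0 q {{ℕ.>-nonZero (ℕ.≤-trans (s≤s z≤n) q≥2)}} d)}}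

     Periodic : Seq → Set
     Periodic f = ∀ n → f (M ℕ.+ n) ≈ f n

     act-periodic : ∀ a {f} → Periodic f → Periodic (act a f)
     act-periodic a {f} h n = trans (sym (act-shifts a M f n)) (act-cong a h n)

     φ^d : ∀ f → Periodic f → ∀ a n → act (FrobK.φ^ f d a) f n ≈ act a f n
     φ^d f h (con c) n = FrobK.φ^-fixed f d {con c} (φ-con f c) n
     φ^d f h X n = trans (φ^X-shifts f d f n) (trans (reflexive (≡.cong f (≡.trans (≡.cong (ℕ._+ n) (≡.sym 1+M)) (≡.sym (ℕ.+-suc M n))))) (h (suc n)))
     φ^d f h (a +ᵒ b) n = trans (FrobK.φ^-+ f d a b n) (+-cong (φ^d f h a n) (φ^d f h b n))
     φ^d f h (a *ᵒ b) n = trans (FrobK.φ^-* f d a b n) (CommutativeRing.*-cong (cyclic f) {FrobK.φ^ f d a} {a} {FrobK.φ^ f d b} {b} (φ^d f h a) (φ^d f h b) n)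
     φ^d f h (-ᵒ a) n = trans (FrobK.φ^-neg f d a n) (-‿cong (φ^d f h a n))

     factor : ℕ → Op
     factor e = X ^ᵒ (q ℕ.^ e) +ᵒ -ᵒ X

     X^-shifts : ∀ k g n → act (X ^ᵒ k) g n ≈ g (k ℕ.+ n)
     X^-shifts k g n = trans (shiftsBy-^ {1} {X} (λ _ _ → refl) k g n) (reflexive (≡.cong (λ z → g (z ℕ.+ n)) (ℕ.*-identityʳ k)))

     act-factor : ∀ e g n → act (factor e) g n ≈ g (q ℕ.^ e ℕ.+ n) - g (suc n)
     act-factor e g n = +-congʳ (X^-shifts (q ℕ.^ e) g n)

     product : ℕ → Op
     product zero = con 1#
     product (suc k) = product k *ᵒ factor (suc k)

     degree : ℕ → ℕ
     degree zero = 0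
     degree (suc k) = degree k ℕ.+ q ℕ.^ suc k

     degree< : ∀ k → suc (degree k) ℕ.< q ℕ.^ suc k
     degree< zero = ℕ.≤-trans q≥2 (ℕ.≤-reflexive (≡.sym (ℕ.*-identityʳ q)))
     degree< (suc k) = ℕ.≤-trans (ℕ.+-monoˡ-≤ (q ℕ.^ suc k) (degree< k)) (ℕ.≤-trans (ℕ.≤-reflexive (≡.cong (q ℕ.^ suc k ℕ.+_) (≡.sym (ℕ.+-identityʳ (q ℕ.^ suc k))))) (ℕ.*-monoˡ-≤ (q ℕ.^ suc k) q≥2))

     -- Monic of degree `m`, expressed through the action: on a sequence beginning with `k + m`
     -- zeros only the leading term can reach the next entry, and it does so at position `k`.
     Monic : ℕ → Op → Set
     Monic m a = ∀ g k → (∀ {i} → i ℕ.< k ℕ.+ m → g i ≈ 0#) → (∀ {i} → i ℕ.< k → act a g i ≈ 0#) × act a g k ≈ g (k ℕ.+ m)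

     monic-factor : ∀ e → Monic (q ℕ.^ suc e) (factor (suc e))
     monic-factor e g k h = (λ {i} i<k → trans (act-factor (suc e) g i)
         (trans (+-cong (h (ℕ.≤-trans (ℕ.≤-reflexive (≡.trans (≡.sym (ℕ.+-suc Q i)) (ℕ.+-comm Q (suc i)))) (ℕ.+-monoˡ-≤ Q i<k))) (-‿cong (h (ℕ.≤-trans (s≤s i<k) (k<k+Q k))))) (-‿inverseʳ 0#))) ,
       trans (act-factor (suc e) g k) (trans (+-cong (reflexive (≡.cong g (ℕ.+-comm Q k))) (trans (-‿cong (h (1+k<k+Q k))) neg-zero)) (+-identityʳ _))
       where
       Q : ℕ
       Q = q ℕ.^ suc e
       Q≥2 : 2 ℕ.≤ Q
       Q≥2 = ℕ.≤-trans q≥2 (ℕ.m≤m*n q (q ℕ.^ e) {{ℕ.>-nonZero (ℕ.m^n>0 q {{ℕ.>-nonZero (ℕ.≤-trans (s≤s z≤n) q≥2)}} e)}})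
       1+k<k+Q : ∀ k → suc k ℕ.< k ℕ.+ Q
       1+k<k+Q k = ℕ.≤-trans (ℕ.≤-reflexive (ℕ.+-comm 2 k)) (ℕ.+-monoʳ-≤ k Q≥2)
       k<k+Q : ∀ k → suc k ℕ.≤ k ℕ.+ Q
       k<k+Q k = ℕ.<⇒≤ (1+k<k+Q k)
       neg-zero : - 0# ≈ 0#
       neg-zero = ring-eq ([]) (⊝ nat 0) (nat 0) ≡.refl

     monic-product : ∀ k → Monic (degree k) (product k)
     monic-product zero g k h = (λ i<k → trans (*-identityˡ _) (h (ℕ.≤-trans i<k (ℕ.m≤m+n k 0)))) , trans (*-identityˡ _) (reflexive (≡.cong g (≡.sym (ℕ.+-identityʳ k))))
     monic-product (suc m) g k h = proj₁ outer , trans (proj₂ outer) (trans (proj₂ inner) (reflexive (≡.cong g (ℕ.+-assoc k (degree m) (q ℕ.^ suc m)))))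
       where
       inner : (∀ {i} → i ℕ.< k ℕ.+ degree m → act (factor (suc m)) g i ≈ 0#) × act (factor (suc m)) g (k ℕ.+ degree m) ≈ g (k ℕ.+ degree m ℕ.+ q ℕ.^ suc m)
       inner = monic-factor m g (k ℕ.+ degree m) (λ p → h (ℕ.≤-trans p (ℕ.≤-reflexive (ℕ.+-assoc k (degree m) (q ℕ.^ suc m)))))
       outer : (∀ {i} → i ℕ.< k → act (product m) (act (factor (suc m)) g) i ≈ 0#) × act (product m) (act (factor (suc m)) g) k ≈ act (factor (suc m)) g (k ℕ.+ degree m)
       outer = monic-product m (act (factor (suc m)) g) k (proj₁ inner)

     B : Op
     B = product d′

     deg<M : degree d′ ℕ.< M
     deg<M = ℕ.s≤s⁻¹ (ℕ.≤-trans (degree< d′) (ℕ.≤-reflexive (≡.sym 1+M)))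

     M≥1 : 1 ℕ.≤ M
     M≥1 = ℕ.≤-trans (s≤s z≤n) deg<M

     open import Data.Nat.DivMod using (_%_; m<n⇒m%n≡m; [m+n]%n≡m%n)

     instance
       M-nonZero : ℕ.NonZero M
       M-nonZero = ℕ.>-nonZero M≥1

     δ : ℕ → ℕ → Carrier
     δ m n with n ℕ.≟ m
     ... | yes _ = 1#
     ... | no _ = 0#

     δ-≡ : ∀ m → δ m m ≡ 1#
     δ-≡ m with m ℕ.≟ m
     ... | yes _ = ≡.refl
     ... | no h = contradiction ≡.refl h

     δ-≢ : ∀ {m n} → ¬ n ≡ m → δ m n ≡ 0#
     δ-≢ {m} {n} h with n ℕ.≟ m
     ... | yes e = contradiction e h
     ... | no _ = ≡.refl

     -- A periodic impulse at the degree of `B`, which is less than the period. As `B` is monic,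
     -- `act B seed` has the value 1 at 0.
     seed : Seq
     seed n = δ (degree d′) (n % M)

     seed-periodic : Periodic seed
     seed-periodic n = reflexive (≡.cong (δ (degree d′)) (≡.trans (≡.cong (_% M) (ℕ.+-comm M n)) ([m+n]%n≡m%n n M)))

     B-seed : ¬ Null (act B seed)
     B-seed h = 1≉0 (trans (trans (sym (reflexive (≡.trans (≡.cong (δ (degree d′)) (m<n⇒m%n≡m deg<M)) (δ-≡ (degree d′)))))
       (sym (proj₂ (monic-product d′ seed 0 (λ {i} i<m → reflexive (≡.trans (≡.cong (δ (degree d′)) (m<n⇒m%n≡m (ℕ.<-trans i<m deg<M))) (δ-≢ (λ e → ℕ.<⇒≢ i<m e)))))))) (h 0))

     Admissible : Seq → Set
     Admissible f = ¬ Null f × (∃ λ v → Periodic v × (∀ n → f n ≈ act B v n))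

     Candidate : ℕ → Set
     Candidate r = ∃ λ f → Admissible f × Recurrent r f

     candidate : Candidate M
     candidate = act B seed , (B-seed , seed , seed-periodic , λ _ → refl) , δ 0 , λ n →
       trans (act-periodic B seed-periodic n) (sym (go n M≥1))
       where
       go : ∀ n {M} → 1 ℕ.≤ M → combine M (δ 0) (act B seed) n ≈ act B seed n
       go n {suc M} _ = trans (Σ<-head M _) (trans (+-cong (*-identityˡ _) (Σ<-0 M (λ _ → zeroˡ _))) (+-identityʳ _))

     module Field {r f} (adm : Admissible f) (rec : Recurrent r f) (minimal : ∀ {s} → s ℕ.< r → ¬ Candidate s) where
       v : Seq
       v = proj₁ (proj₂ adm)
       v-periodic : Periodic v
       v-periodic = proj₁ (proj₂ (proj₂ adm))
       f≈Bv : ∀ n → f n ≈ act B v n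
       f≈Bv = proj₂ (proj₂ (proj₂ adm))
       f-nonnull : ¬ Null f
       f-nonnull = proj₁ adm

       f-periodic : Periodic f
       f-periodic n = trans (f≈Bv (M ℕ.+ n)) (trans (act-periodic B v-periodic n) (sym (f≈Bv n)))

       K : CommutativeRing 0ℓ 0ℓ
       K = cyclic f
       module K = CommutativeRing K

       periodic-null : ∀ {g} → Periodic g → (∀ {n} → n ℕ.< M → g n ≈ 0#) → Null g
       periodic-null {g} h k = <-rec _ go
         where
         go : ∀ n → (∀ {m} → m ℕ.< n → g m ≈ 0#) → g n ≈ 0#
         go n IH with n ℕ.<? M
         ... | yes n<M = k n<M
         ... | no n≮M with ℕ.m≤n⇒∃[o]m+o≡n (ℕ.≮⇒≥ n≮M)
         ... | m , ≡.refl = trans (h m) (IH (ℕ.+-monoˡ-≤ m M≥1))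

       null? : ∀ {g} → Periodic g → Dec (Null g)
       null? {g} h with decide-below (λ n → g n ≟ 0#) M
       ... | inj₁ all = yes (periodic-null h all)
       ... | inj₂ (n , _ , ¬p) = no (λ all → ¬p (all n))

       zero? : ∀ a → Dec (a K.≈ K.0#)
       zero? a with null? (act-periodic a f-periodic)
       ... | yes h = yes (λ n → trans (h n) (sym (zeroˡ (f n))))
       ... | no h = no (λ k → h (λ n → trans (k n) (zeroˡ (f n))))

       -- If `a` does not kill `f`, then `a f` is admissible as well. Reduced by the recurrence, `b`
       -- becomes a polynomial of degree below `r` that annihilates `a f`; were it nonzero, `a f`
       -- would have a recurrence of smaller order.
       K-domain : ∀ a b → a K.* b K.≈ K.0# → ¬ a K.≈ K.0# → b K.≈ K.0#
       K-domain a b ab≈0 a≉0 = go rec minimal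
         where
         g : Seq
         g = act a f
         g-admissible : Admissible g
         g-admissible = (λ h → a≉0 (λ n → trans (h n) (sym (zeroˡ (f n))))) , act a v , act-periodic a v-periodic , λ n → trans (act-cong a f≈Bv n) (act-comm a B v n)
         go : ∀ {r} → Recurrent r f → (∀ {s} → s ℕ.< r → ¬ Candidate s) → b K.≈ K.0#
         go {zero} (h , hrec) _ = contradiction hrec f-nonnull
         go {suc r} rec minimal with reduce {r} {f} rec b (δ 0)
         ... | c , c-eq with top (suc r) c
         ...   | inj₁ all = λ n → trans (b-eq n) (trans (Σ<-0 (suc r) (λ p → trans (*-congʳ (all p)) (zeroˡ _))) (sym (zeroˡ (f n))))
           where
           b-eq : ∀ n → act b f n ≈ combine (suc r) c f n
           b-eq n = trans (act-cong b (λ m → sym (trans (Σ<-head r _) (trans (+-cong (*-identityˡ _) (Σ<-0 r (λ _ → zeroˡ _))) (+-identityʳ _)))) n) (c-eq n)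
         ...   | inj₂ (i , i<1+r , ci≉0 , above) = contradiction (g , g-admissible , solve-top {i} {c} {g} ci≉0 annihilates) (minimal i<1+r)
           where
           b-eq : ∀ n → act b f n ≈ combine (suc i) c f n
           b-eq n = trans (act-cong b (λ m → sym (trans (Σ<-head r _) (trans (+-cong (*-identityˡ _) (Σ<-0 r (λ _ → zeroˡ _))) (+-identityʳ _)))) n)
             (trans (c-eq n) (combine-top c f i<1+r above n))
           annihilates : ∀ n → combine (suc i) c g n ≈ 0#
           annihilates n = trans (sym (act-combine a (suc i) c f n)) (trans (sym (act-cong a b-eq n)) (trans (ab≈0 n) (zeroˡ (f n))))

       open FrobK f using (φ; φ-cong; φ-+; φ-*; φ-sub; φ-0; φ^; φ^-cong; φ^-+; φ^-*; φ^-fixed; φ^-∘; φ^-neg)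

       B-kills : ∀ {e} g → (∀ n → g (q ℕ.^ suc e ℕ.+ n) ≈ g (suc n)) → ∀ k → suc e ℕ.≤ k → Null (act (product k) g)
       B-kills {e} g h (suc k) (s≤s e≤k) with ℕ.m≤n⇒m<n∨m≡n e≤k
       ... | inj₂ ≡.refl = act-0 (product e) (λ n → trans (act-factor (suc e) g n) (trans (+-congʳ (h n)) (-‿inverseʳ _)))
       ... | inj₁ e<k = λ n → trans (act-comm (product k) (factor (suc k)) g n) (act-0 (factor (suc k)) (B-kills g h k e<k) n)

       -- If `X^(q^e)` were `X` on `f = B v`, then `B` would kill `f`, so `B² = 0` on `v`. But `φ^d`
       -- fixes every operator on `v` and factors through `B^q` with `q ≥ 2`; hence `B v`, which is
       -- `f`, would vanish.
       X-moves : ∀ {e} → 1 ℕ.≤ e → e ℕ.< d → ¬ φ^ e X K.≈ X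
       X-moves {suc e} _ (s≤s e<d) eq = f-nonnull (λ n → trans (f≈Bv n) (Bv-null n))
         where
         f-shift : ∀ n → f (q ℕ.^ suc e ℕ.+ n) ≈ f (suc n)
         f-shift n = trans (sym (φ^X-shifts f (suc e) f n)) (eq n)
         BBv : Null (act B (act B v))
         BBv n = trans (act-cong B (λ m → sym (f≈Bv m)) n) (B-kills f f-shift d′ e<d n)
         module V = CommutativeRing (cyclic v)
         open FrobK v using () renaming (φ^ to ψ^; φ to ψ; φ^-∘ to ψ^-∘; φ^-fixed to ψ^-fixed; φ-0 to ψ-0; φ^-cong to ψ^-cong)
         open import Algebra.Properties.Semiring.Exp V.semiring using () renaming (_^_ to _^ᵛ_)
         BB≈0 : B V.* B V.≈ V.0#
         BB≈0 n = trans (BBv n) (sym (zeroˡ (v n)))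
         B^≈0 : ∀ {k} → 2 ℕ.≤ k → B ^ᵛ k V.≈ V.0#
         B^≈0 {suc zero} (s≤s ())
         B^≈0 {suc (suc k)} _ = V.trans {B V.* (B V.* B ^ᵛ k)} {V.0# V.* B ^ᵛ k} {V.0#} (V.*-congʳ {B ^ᵛ k} {B V.* B} {V.0#} BB≈0) (V.zeroˡ (B ^ᵛ k))
         Bv-null : Null (act B v)
         Bv-null n = begin
           act B v n ≈⟨ φ^d v v-periodic B n ⟨
           act (ψ^ d B) v n ≡⟨ ≡.cong (λ a → act a v n) (≡.trans (≡.cong (λ k → ψ^ k B) (ℕ.+-comm 1 d′)) (ψ^-∘ d′ 1 B)) ⟩
           act (ψ^ d′ (ψ B)) v n ≈⟨ ψ^-cong d′ {ψ B} {V.0#} (B^≈0 q≥2) n ⟩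
           act (ψ^ d′ (con 0#)) v n ≈⟨ ψ^-fixed d′ {con 0#} ψ-0 n ⟩
           0# * v n ≈⟨ zeroˡ (v n) ⟩
           0# ∎

       open Polynomial K using (IsPoly; isPoly-resp; isPoly-+; isPoly-linear; isPoly-const; isPoly-affine; isPoly-^; isPoly-scale; module Roots)
       open Roots K-domain using (roots)
       module NK = RingNormaliser K
       open import Algebra.Properties.Semiring.Exp K.semiring using () renaming (_^_ to _^ᴷ_)

       con-null : ∀ {c} → con c K.≈ K.0# → c ≈ 0#
       con-null {c} h with c ≟ 0#
       ... | yes p = p
       ... | no c≉0 = contradiction (λ n → domain (trans (h n) (zeroˡ (f n))) c≉0) f-nonnull

       con-injective : ∀ {a b} → con a K.≈ con b → a ≈ b
       con-injective {a} {b} h = trans (ring-eq (a ∷ b ∷ []) x0 (x0 :- x1 :+ x1) ≡.refl) (trans (+-congʳ (con-null {a - b} (λ n → trans (ring-eq (a ∷ b ∷ (f n) ∷ []) ((x0 :- x1) :* x2) (x0 :* x2 :- x1 :* x2) ≡.refl) (trans (+-congʳ (h n)) (trans (-‿inverseʳ _) (sym (zeroˡ (f n)))))))) (+-identityˡ b))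

       con-cong : ∀ {a b} → a ≈ b → con a K.≈ con b
       con-cong h n = *-congʳ h

       1≉0ᴷ : ¬ K.1# K.≈ K.0#
       1≉0ᴷ h = 1≉0 (con-null h)

       pow≈0 : ∀ k {a} → a ^ᴷ k K.≈ K.0# → a K.≈ K.0#
       pow≈0 zero h = contradiction h 1≉0ᴷ
       pow≈0 (suc k) {a} h with zero? a
       ... | yes p = p
       ... | no a≉0 = pow≈0 k {a} (K-domain a (a ^ᴷ k) h a≉0)

       sub≈0 : ∀ {a b} → a K.- b K.≈ K.0# → a K.≈ b
       sub≈0 {a} {b} h = K.trans {a} {(a K.- b) K.+ b} {b} (NK.ring-eq (a ∷ b ∷ []) NK.x0 ((NK.x0 NK.:- NK.x1) NK.:+ NK.x1) ≡.refl)
         (K.trans {(a K.- b) K.+ b} {K.0# K.+ b} {b} (K.+-congʳ {b} {a K.- b} {K.0#} h) (K.+-identityˡ b))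

       φ-injective : ∀ {a b} → φ a K.≈ φ b → a K.≈ b
       φ-injective {a} {b} h = sub≈0 {a} {b} (pow≈0 q {a K.- b} (K.trans {φ (a K.- b)} {φ a K.- φ b} {K.0#} (φ-sub a b)
         (K.trans {φ a K.- φ b} {φ b K.- φ b} {K.0#} (K.+-congʳ {K.- φ b} {φ a} {φ b} h) (K.-‿inverseʳ (φ b)))))

       φ^-injective : ∀ i {a b} → φ^ i a K.≈ φ^ i b → a K.≈ b
       φ^-injective zero h = h
       φ^-injective (suc i) {a} {b} h = φ^-injective i {a} {b} (φ-injective {φ^ i a} {φ^ i b} h)

       conjugates-distinct : ∀ {i j} → i ℕ.< j → j ℕ.< d → ¬ φ^ i X K.≈ φ^ j X
       conjugates-distinct {i} {j} i<j j<d h with ℕ.m≤n⇒∃[o]m+o≡n (ℕ.<⇒≤ i<j)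
       ... | zero , eq = contradiction (≡.trans (≡.sym (ℕ.+-identityʳ i)) eq) (ℕ.<⇒≢ i<j)
       ... | suc k , eq = X-moves {suc k} (s≤s z≤n) (ℕ.≤-trans (s≤s (ℕ.≤-trans (ℕ.m≤n+m (suc k) i) (ℕ.≤-reflexive eq))) j<d)
         (K.sym {X} {φ^ (suc k) X} (φ^-injective i {X} {φ^ (suc k) X} (K.trans {φ^ i X} {φ^ j X} {φ^ i (φ^ (suc k) X)} h
           (K.reflexive (≡.trans (≡.cong (λ z → φ^ z X) (≡.sym eq)) (φ^-∘ i (suc k) X))))))

       poly : ℕ → (ℕ → Carrier) → Op → Op
       poly zero x y = K.0#
       poly (suc t) x y = poly t x y K.+ con (x t) K.* (y ^ᴷ t)

       poly-isPoly : ∀ t x → IsPoly t (con (x t)) (poly (suc t) x)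
       poly-isPoly zero x = isPoly-resp 0 {con (x 0)} {con (x 0)} {λ _ → con (x 0)} {poly 1 x} (K.refl {con (x 0)})
         (λ y → NK.ring-eq (con (x 0) ∷ []) NK.x0 (NK.nat 0 NK.:+ NK.x0 NK.:* NK.one) ≡.refl) (isPoly-const (con (x 0)))
       poly-isPoly (suc t) x = isPoly-resp (suc t) {con (x (suc t)) K.* K.1#} {con (x (suc t))} {λ y → con (x (suc t)) K.* (y ^ᴷ suc t) K.+ poly (suc t) x y} {poly (suc (suc t)) x}
         (K.*-identityʳ (con (x (suc t)))) (λ y → K.+-comm (con (x (suc t)) K.* (y ^ᴷ suc t)) (poly (suc t) x y))
         (isPoly-+ {suc t} {t} {con (x (suc t)) K.* K.1#} {con (x t)} {λ y → con (x (suc t)) K.* (y ^ᴷ suc t)} {poly (suc t) x} (isPoly-scale (suc t) {K.1#} {_^ᴷ suc t} (con (x (suc t))) (isPoly-^ (suc t))) (poly-isPoly t x) ℕ.≤-refl)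

       φ^-pow : ∀ i n y → φ^ i (y ^ᴷ n) K.≈ φ^ i y ^ᴷ n
       φ^-pow i zero y = φ^-fixed i {K.1#} (FrobK.φ-1 f)
       φ^-pow i (suc n) y = K.trans {φ^ i (y K.* y ^ᴷ n)} {φ^ i y K.* φ^ i (y ^ᴷ n)} {φ^ i y K.* φ^ i y ^ᴷ n} (φ^-* i y (y ^ᴷ n))
         (K.*-congˡ {φ^ i y} {φ^ i (y ^ᴷ n)} {φ^ i y ^ᴷ n} (φ^-pow i n y))

       φ^-con : ∀ i c → φ^ i (con c) K.≈ con c
       φ^-con i c = φ^-fixed i {con c} (φ-con f c)

       φ^-poly : ∀ i t x y → φ^ i (poly t x y) K.≈ poly t x (φ^ i y)
       φ^-poly i zero x y = φ^-con i 0#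
       φ^-poly i (suc t) x y = K.trans {φ^ i (poly t x y K.+ con (x t) K.* y ^ᴷ t)} {φ^ i (poly t x y) K.+ φ^ i (con (x t) K.* y ^ᴷ t)} {poly (suc t) x (φ^ i y)}
         (φ^-+ i (poly t x y) (con (x t) K.* y ^ᴷ t))
         (K.+-cong {φ^ i (poly t x y)} {poly t x (φ^ i y)} {φ^ i (con (x t) K.* y ^ᴷ t)} {con (x t) K.* φ^ i y ^ᴷ t} (φ^-poly i t x y)
           (K.trans {φ^ i (con (x t) K.* y ^ᴷ t)} {φ^ i (con (x t)) K.* φ^ i (y ^ᴷ t)} {con (x t) K.* φ^ i y ^ᴷ t} (φ^-* i (con (x t)) (y ^ᴷ t))
             (K.*-cong {φ^ i (con (x t))} {con (x t)} {φ^ i (y ^ᴷ t)} {φ^ i y ^ᴷ t} (φ^-con i (x t)) (φ^-pow i t y))))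

       -- A relation of degree below `d` among the powers of `X` has all `d` distinct conjugates of
       -- `X` as roots, so its top coefficient is 0 and the degree drops.
       poly-independent : ∀ t x → t ℕ.≤ d → poly t x X K.≈ K.0# → ∀ {i} → i ℕ.< t → x i ≈ 0#
       poly-independent (suc t) x t<d h {i} (s≤s i≤t) with ℕ.m≤n⇒m<n∨m≡n i≤t
       ... | inj₂ ≡.refl = con-null (roots i (poly-isPoly i x) (λ j → φ^ j X)
         (λ {j} _ → K.trans {poly (suc i) x (φ^ j X)} {φ^ j (poly (suc i) x X)} {K.0#} (K.sym {φ^ j (poly (suc i) x X)} {poly (suc i) x (φ^ j X)} (φ^-poly j (suc i) x X))
           (K.trans {φ^ j (poly (suc i) x X)} {φ^ j K.0#} {K.0#} (φ^-cong j {poly (suc i) x X} {K.0#} h) (φ^-con j 0#)))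
         (λ {j} {k} j<k k≤i → conjugates-distinct j<k (ℕ.≤-trans (s≤s k≤i) t<d)))
       ... | inj₁ i<t = poly-independent t x (ℕ.<⇒≤ t<d) lower i<t
         where
         xt≈0 : x t ≈ 0#
         xt≈0 = poly-independent-top
           where
           poly-independent-top : x t ≈ 0#
           poly-independent-top = con-null (roots t (poly-isPoly t x) (λ j → φ^ j X)
             (λ {j} _ → K.trans {poly (suc t) x (φ^ j X)} {φ^ j (poly (suc t) x X)} {K.0#} (K.sym {φ^ j (poly (suc t) x X)} {poly (suc t) x (φ^ j X)} (φ^-poly j (suc t) x X))
               (K.trans {φ^ j (poly (suc t) x X)} {φ^ j K.0#} {K.0#} (φ^-cong j {poly (suc t) x X} {K.0#} h) (φ^-con j 0#)))
             (λ {j} {k} j<k k≤t → conjugates-distinct j<k (ℕ.≤-trans (s≤s k≤t) t<d)))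
         lower : poly t x X K.≈ K.0#
         lower = K.trans {poly t x X} {poly (suc t) x X} {K.0#} (λ n → sym (trans (+-congˡ (trans (*-congʳ xt≈0) (zeroˡ _))) (+-identityʳ _))) h

       norm : ℕ → Op → Op
       norm zero y = K.1#
       norm (suc i) y = norm i y K.* φ^ i y

       norm-cong : ∀ i {y y′} → y K.≈ y′ → norm i y K.≈ norm i y′
       norm-cong zero h = K.refl {K.1#}
       norm-cong (suc i) {y} {y′} h = K.*-cong {norm i y} {norm i y′} {φ^ i y} {φ^ i y′} (norm-cong i {y} {y′} h) (φ^-cong i {y} {y′} h)

       -- `φ` shifts the product by one factor. At `i = d` the last factor `φ^d y` is `y` again,
       -- which makes the norm a fixed point.
       norm-shift : ∀ i y → φ (norm i y) K.* y K.≈ norm (suc i) y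
       norm-shift zero y = K.*-congʳ {y} {φ K.1#} {K.1#} (FrobK.φ-1 f)
       norm-shift (suc i) y = K.trans {φ (norm i y K.* φ^ i y) K.* y} {(φ (norm i y) K.* φ^ (suc i) y) K.* y} {norm (suc i) y K.* φ^ (suc i) y}
         (K.*-congʳ {y} {φ (norm i y K.* φ^ i y)} {φ (norm i y) K.* φ^ (suc i) y} (φ-* (norm i y) (φ^ i y)))
         (K.trans {(φ (norm i y) K.* φ^ (suc i) y) K.* y} {(φ (norm i y) K.* y) K.* φ^ (suc i) y} {norm (suc i) y K.* φ^ (suc i) y}
           (NK.ring-eq (φ (norm i y) ∷ φ^ (suc i) y ∷ y ∷ []) ((NK.x0 NK.:* NK.x1) NK.:* NK.x2) ((NK.x0 NK.:* NK.x2) NK.:* NK.x1) ≡.refl)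
           (K.*-congʳ {φ^ (suc i) y} {φ (norm i y) K.* y} {norm (suc i) y} (norm-shift i y)))

       norm-fixed : ∀ y → φ (norm d y) K.≈ norm d y
       norm-fixed y = K.trans {φ (norm d′ y K.* φ^ d′ y)} {φ (norm d′ y) K.* φ^ d y} {norm d y} (φ-* (norm d′ y) (φ^ d′ y))
         (K.trans {φ (norm d′ y) K.* φ^ d y} {φ (norm d′ y) K.* y} {norm d y} (K.*-congˡ {φ (norm d′ y)} {φ^ d y} {y} (φ^d f f-periodic y)) (norm-shift d′ y))

       norm≈0 : ∀ i {y} → norm i y K.≈ K.0# → y K.≈ K.0#
       norm≈0 zero h = contradiction h 1≉0ᴷ
       norm≈0 (suc i) {y} h with zero? (norm i y)
       ... | yes p = norm≈0 i {y} p
       ... | no ¬p = φ^-injective i {y} {K.0#} (K.trans {φ^ i y} {K.0#} {φ^ i K.0#} (K-domain (norm i y) (φ^ i y) h ¬p) (K.sym {φ^ i K.0#} {K.0#} (φ^-con i 0#)))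

       _≟ᴷ_ : ∀ a b → Dec (a K.≈ b)
       a ≟ᴷ b with zero? (a K.- b)
       ... | yes h = yes (sub≈0 {a} {b} h)
       ... | no h = no (λ e → h (K.trans {a K.- b} {b K.- b} {K.0#} (K.+-congʳ {K.- b} {a} {b} e) (K.-‿inverseʳ b)))

       -- A fixed point is a root of `z^q - z`. This polynomial already has the `q` constants as
       -- roots, and one root more would make its leading coefficient 1 vanish.
       fixed-constant : ∀ y → φ y K.≈ y → ∃ λ c → y K.≈ con (ι c)
       fixed-constant y φy≈y with decide-below (λ c → ¬? (y ≟ᴷ con (ι c))) q
         where open import Relation.Nullary.Decidable using (¬?)
       ... | inj₂ (c , _ , ¬¬p) = c , decidable-stable (y ≟ᴷ con (ι c)) ¬¬p
         where open import Relation.Nullary.Decidable using (decidable-stable)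
       ... | inj₁ none = contradiction (roots q frob-isPoly ρ root distinct) 1≉0ᴷ
         where
         frob-isPoly : IsPoly q K.1# (λ z → φ z K.+ (K.0# K.+ z K.* (K.- K.1#)))
         frob-isPoly = isPoly-+ {q} {1} {K.1#} {K.- K.1#} {φ} {λ z → K.0# K.+ z K.* (K.- K.1#)} (isPoly-^ q) (isPoly-affine K.0# (K.- K.1#)) q≥2
         ρ : ℕ → Op
         ρ i with i ℕ.<? q
         ... | yes _ = con (ι i)
         ... | no _ = y
         φρ : ∀ i → φ (ρ i) K.≈ ρ i
         φρ i with i ℕ.<? q
         ... | yes _ = φ-con f (ι i)
         ... | no _ = φy≈y
         root : ∀ {i} → i ℕ.≤ q → φ (ρ i) K.+ (K.0# K.+ ρ i K.* (K.- K.1#)) K.≈ K.0#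
         root {i} _ = K.trans {φ (ρ i) K.+ (K.0# K.+ ρ i K.* (K.- K.1#))} {ρ i K.+ (K.0# K.+ ρ i K.* (K.- K.1#))} {K.0#}
           (K.+-congʳ {K.0# K.+ ρ i K.* (K.- K.1#)} {φ (ρ i)} {ρ i} (φρ i))
           (NK.ring-eq (ρ i ∷ []) (NK.x0 NK.:+ (NK.nat 0 NK.:+ NK.x0 NK.:* (NK.⊝ NK.one))) (NK.nat 0) ≡.refl)
         distinct : ∀ {i j} → i ℕ.< j → j ℕ.≤ q → ¬ ρ i K.≈ ρ j
         distinct {i} {j} i<j j≤q h with i ℕ.<? q | j ℕ.<? q
         ... | yes _ | yes j<q = ι-injective i<j j<q (con-injective h)
         ... | yes i<q | no _ = none i<q (K.sym {con (ι i)} {y} h)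
         ... | no i≮q | _ = i≮q (ℕ.≤-trans i<j j≤q)

       N : (ℕ → Carrier) → Carrier
       N x = ι (proj₁ (fixed-constant (norm d (poly d x X)) (norm-fixed (poly d x X))))

       con-N : ∀ x → norm d (poly d x X) K.≈ con (N x)
       con-N x = proj₂ (fixed-constant (norm d (poly d x X)) (norm-fixed (poly d x X)))

       poly-cong : ∀ t {x y} → (∀ {i} → i ℕ.< t → x i ≈ y i) → poly t x X K.≈ poly t y X
       poly-cong zero h n = refl
       poly-cong (suc t) {x} {y} h = K.+-cong {poly t x X} {poly t y X} {con (x t) K.* X ^ᴷ t} {con (y t) K.* X ^ᴷ t} (poly-cong t (λ p → h (ℕ.m≤n⇒m≤1+n p)))
         (K.*-congʳ {X ^ᴷ t} {con (x t)} {con (y t)} (con-cong (h ℕ.≤-refl)))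

       N-cong : ∀ {x y} → (∀ {i} → i ℕ.< d → x i ≈ y i) → N x ≈ N y
       N-cong {x} {y} h = con-injective (K.trans {con (N x)} {norm d (poly d x X)} {con (N y)} (K.sym {norm d (poly d x X)} {con (N x)} (con-N x))
         (K.trans {norm d (poly d x X)} {norm d (poly d y X)} {con (N y)} (norm-cong d {poly d x X} {poly d y X} (poly-cong d h)) (con-N y)))

       N-anisotropic : ∀ {x} → N x ≈ 0# → ∀ {i} → i ℕ.< d → x i ≈ 0#
       N-anisotropic {x} h = poly-independent d x ℕ.≤-refl (norm≈0 d {poly d x X} (K.trans {norm d (poly d x X)} {con (N x)} {K.0#} (con-N x) (con-cong h)))

       -- The norm of `a + z b` as a polynomial in `z`. It agrees with the norm for constant `z`,
       -- which `φ` fixes, and its leading coefficient is the norm of `b`.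
       line : ℕ → Op → Op → Op → Op
       line zero a b z = K.1#
       line (suc i) a b z = line i a b z K.* (φ^ i a K.+ z K.* φ^ i b)

       line-isPoly : ∀ i a b → IsPoly i (norm i b) (line i a b)
       line-isPoly zero a b = isPoly-const K.1#
       line-isPoly (suc i) a b = isPoly-linear i {norm i b} {line i a b} (φ^ i a) (φ^ i b) (line-isPoly i a b)

       norm-line : ∀ i a b s → norm i (a K.+ con s K.* b) K.≈ line i a b (con s)
       norm-line zero a b s = K.refl {K.1#}
       norm-line (suc i) a b s = K.*-cong {norm i (a K.+ con s K.* b)} {line i a b (con s)} {φ^ i (a K.+ con s K.* b)} {φ^ i a K.+ con s K.* φ^ i b} (norm-line i a b s)
         (K.trans {φ^ i (a K.+ con s K.* b)} {φ^ i a K.+ φ^ i (con s K.* b)} {φ^ i a K.+ con s K.* φ^ i b} (φ^-+ i a (con s K.* b))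
           (K.+-congˡ {φ^ i a} {φ^ i (con s K.* b)} {con s K.* φ^ i b} (K.trans {φ^ i (con s K.* b)} {φ^ i (con s) K.* φ^ i b} {con s K.* φ^ i b} (φ^-* i (con s) b)
             (K.*-congʳ {φ^ i b} {φ^ i (con s)} {con s} (φ^-con i s)))))

       poly-line : ∀ t a b s → poly t (λ i → a i + s * b i) X K.≈ poly t a X K.+ con s K.* poly t b X
       poly-line zero a b s n = ring-eq ((f n) ∷ s ∷ []) (nat 0 :* x0) (nat 0 :* x0 :+ x1 :* (nat 0 :* x0)) ≡.refl
       poly-line (suc t) a b s n = trans (+-congʳ (poly-line t a b s n))
         (ring-eq ((act (poly t a X) f n) ∷ s ∷ (act (poly t b X) f n) ∷ (a t) ∷ (b t) ∷
             (act (X ^ᴷ t) f n) ∷ []) (x0 :+ x1 :* x2 :+ (x3 :+ x1 :* x4) :* x5) (x0 :+ x3 :* x5 :+ x1 :* (x2 :+ x4 :* x5)) ≡.refl)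

       N-line : ∀ a b s → con (N (λ i → a i + s * b i)) K.≈ line d (poly d a X) (poly d b X) (con s)
       N-line a b s = K.trans {con (N (λ i → a i + s * b i))} {norm d (poly d (λ i → a i + s * b i) X)} {line d (poly d a X) (poly d b X) (con s)}
         (K.sym {norm d (poly d (λ i → a i + s * b i) X)} {con (N (λ i → a i + s * b i))} (con-N (λ i → a i + s * b i)))
         (K.trans {norm d (poly d (λ i → a i + s * b i) X)} {norm d (poly d a X K.+ con s K.* poly d b X)} {line d (poly d a X) (poly d b X) (con s)}
           (norm-cong d {poly d (λ i → a i + s * b i) X} {poly d a X K.+ con s K.* poly d b X} (poly-line d a b s)) (norm-line d (poly d a X) (poly d b X) s))

   -- Iterated divided differences at the points s₀, …, sₙ of functions from F to an F-algebra.
   module Differences (A : CommutativeRing 0ℓ 0ℓ) (inj : Carrier → CommutativeRing.Carrier A) (s : ℕ → Carrier)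
     (inj-unit : ∀ {a b} → ¬ a ≈ b → CommutativeRing._≈_ A (CommutativeRing._*_ A (CommutativeRing._-_ A (inj a) (inj b)) (inj (inv (a - b)))) (CommutativeRing.1# A)) where
     private module A = CommutativeRing A
     open Polynomial A using (IsPoly)
     private module NA = RingNormaliser A

     Δ : ℕ → (Carrier → A.Carrier) → A.Carrier
     Δ zero G = G (s 0)
     Δ (suc n) G = Δ n (λ x → (G x A.- G (s (suc n))) A.* inj (inv (x - s (suc n))))

     Δ-cong : ∀ n {G H} → (∀ {i} → i ℕ.≤ n → G (s i) A.≈ H (s i)) → Δ n G A.≈ Δ n H
     Δ-cong zero h = h z≤n
     Δ-cong (suc n) h = Δ-cong n (λ i≤n → A.*-congʳ (A.+-cong (h (ℕ.m≤n⇒m≤1+n i≤n)) (A.-‿cong (h ℕ.≤-refl))))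

     Δ-+ : ∀ n G H → Δ n (λ x → G x A.+ H x) A.≈ Δ n G A.+ Δ n H
     Δ-+ zero G H = A.refl
     Δ-+ (suc n) G H = A.trans (Δ-cong n (λ {i} _ → NA.ring-eq (G (s i) ∷ H (s i) ∷ G (s (suc n)) ∷ H (s (suc n)) ∷ inj (inv (s i - s (suc n))) ∷ [])
       ((NA.x0 NA.:+ NA.x1 NA.:- (NA.x2 NA.:+ NA.x3)) NA.:* NA.x4) ((NA.x0 NA.:- NA.x2) NA.:* NA.x4 NA.:+ (NA.x1 NA.:- NA.x3) NA.:* NA.x4) ≡.refl)) (Δ-+ n (λ x → (G x A.- G (s (suc n))) A.* inj (inv (x - s (suc n)))) (λ x → (H x A.- H (s (suc n))) A.* inj (inv (x - s (suc n)))))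

     Δ-0 : ∀ n {G} → (∀ {i} → i ℕ.≤ n → G (s i) A.≈ A.0#) → Δ n G A.≈ A.0#
     Δ-0 zero h = h z≤n
     Δ-0 (suc n) h = Δ-0 n (λ i≤n → A.trans (A.*-congʳ (A.trans (A.+-cong (h (ℕ.m≤n⇒m≤1+n i≤n)) (A.-‿cong (h ℕ.≤-refl))) (A.-‿inverseʳ A.0#))) (A.zeroˡ _))

     Distinct : ℕ → Set
     Distinct n = ∀ {i j} → i ℕ.< j → j ℕ.≤ n → ¬ s i ≈ s j

     -- Each divided difference cancels one linear factor: the degree drops by one and the top
     -- coefficient stays.
     Δ-poly : ∀ n m {k G} → Distinct n → IsPoly m k G → (m ℕ.< n → Δ n (λ x → G (inj x)) A.≈ A.0#) × (m ≡ n → Δ n (λ x → G (inj x)) A.≈ k)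
     Δ-poly zero m distinct p = (λ ()) , λ { ≡.refl → Level.lower p (inj (s 0)) }
     Δ-poly (suc n) zero {k} {G} distinct p = (λ _ → Δ-0 n {λ x → (G (inj x) A.- G (inj (s (suc n)))) A.* inj (inv (x - s (suc n)))} (λ {i} _ → A.trans (A.*-congʳ (A.trans (A.+-cong (Level.lower p _) (A.-‿cong (Level.lower p _))) (A.-‿inverseʳ _))) (A.zeroˡ _))) , λ ()
     Δ-poly (suc n) (suc m) {k} {G} distinct p = (λ m<n → A.trans step (proj₁ IH (ℕ.s≤s⁻¹ m<n))) , λ eq → A.trans step (proj₂ IH (ℕ.suc-injective eq))
       where
       G′ : A.Carrier → A.Carrier
       G′ = proj₁ (p (inj (s (suc n))))
       IH : (m ℕ.< n → Δ n (λ x → G′ (inj x)) A.≈ A.0#) × (m ≡ n → Δ n (λ x → G′ (inj x)) A.≈ k)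
       IH = Δ-poly n m (λ i<j j≤n → distinct i<j (ℕ.m≤n⇒m≤1+n j≤n)) (proj₁ (proj₂ (p (inj (s (suc n))))))
       step : Δ (suc n) (λ x → G (inj x)) A.≈ Δ n (λ x → G′ (inj x))
       step = Δ-cong n {λ x → (G (inj x) A.- G (inj (s (suc n)))) A.* inj (inv (x - s (suc n)))} {λ x → G′ (inj x)} (λ {i} i≤n → A.trans (A.*-congʳ (proj₂ (proj₂ (p (inj (s (suc n))))) (inj (s i))))
         (A.trans (NA.ring-eq (inj (s i) A.- inj (s (suc n)) ∷ G′ (inj (s i)) ∷ inj (inv (s i - s (suc n))) ∷ []) (NA.x0 NA.:* NA.x1 NA.:* NA.x2) ((NA.x0 NA.:* NA.x2) NA.:* NA.x1) ≡.refl)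
           (A.trans (A.*-congʳ (inj-unit (distinct (s≤s i≤n) ℕ.≤-refl))) (A.*-identityˡ _))))

   -≉0 : ∀ {a b} → ¬ a ≈ b → ¬ a - b ≈ 0#
   -≉0 {a} {b} a≉b h = a≉b (trans (ring-eq (a ∷ b ∷ []) x0 (x0 :- x1 :+ x1) ≡.refl) (trans (+-congʳ h) (+-identityˡ b)))

   module ΔF (s : ℕ → Carrier) = Differences F (λ x → x) s (λ a≉b → *-inv (-≉0 a≉b))

   -- `N-differences` is what the geometry retains of the degree: along a line `N` is a polynomial
   -- of degree `d` with leading coefficient `N b`. Unlike derivatives, divided differences keep
   -- this meaning in small characteristic.
   record NormForm (d : ℕ) : Set where
     field
       N : (ℕ → Carrier) → Carrier
       N-cong : ∀ {x y : ℕ → Carrier} → (∀ {i} → i ℕ.< d → x i ≈ y i) → N x ≈ N y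
       N-anisotropic : ∀ {x : ℕ → Carrier} → N x ≈ 0# → ∀ {i} → i ℕ.< d → x i ≈ 0#
       N-differences : ∀ s n → ΔF.Distinct s n → ∀ (a b : ℕ → Carrier) →
         (d ℕ.< n → ΔF.Δ s n (λ z → N (λ i → a i + z * b i)) ≈ 0#) × (d ≡ n → ΔF.Δ s n (λ z → N (λ i → a i + z * b i)) ≈ N b)

   normForm : ∀ d′ → ¬ ¬ NormForm (suc d′)
   normForm d′ none = ¬¬-least {Degree.Candidate d′} (Degree.candidate d′) λ { (r , (f , adm , rec) , minimal) → none (build f adm rec minimal) }
     where
     open Degree d′
     build : ∀ {r} f → Admissible f → Recurrent r f → (∀ {s} → s ℕ.< r → ¬ Candidate s) → NormForm d
     build {r} f adm rec minimal = record { N = N ; N-cong = N-cong ; N-anisotropic = λ {x} → N-anisotropic {x} ; N-differences = differences }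
       where
       open Field adm rec minimal
       -- The polynomial `line` has coefficients in `K`, so the differences are computed there and
       -- brought back to `F` by injectivity of `con`.
       module _ (s : ℕ → Carrier) where
         inj-unit : ∀ {a b} → ¬ a ≈ b → (con a K.- con b) K.* con (inv (a - b)) K.≈ K.1#
         inj-unit {a} {b} a≉b n = trans (ring-eq (a ∷ (inv (a - b)) ∷ (f n) ∷ b ∷ []) (x0 :* (x1 :* x2) :- x3 :* (x1 :* x2)) ((x0 :- x3) :* x1 :* x2) ≡.refl) (*-congʳ (*-inv (-≉0 a≉b)))
         module DK = Differences K con s inj-unit
         con-Δ : ∀ n G → con (ΔF.Δ s n G) K.≈ DK.Δ n (λ x → con (G x))
         con-Δ zero G = K.refl {con (G (s 0))}
         con-Δ (suc n) G = K.trans {con (ΔF.Δ s (suc n) G)} {DK.Δ n (λ x → con ((G x - G (s (suc n))) * inv (x - s (suc n))))} {DK.Δ (suc n) (λ x → con (G x))}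
           (con-Δ n (λ x → (G x - G (s (suc n))) * inv (x - s (suc n))))
           (DK.Δ-cong n {λ x → con ((G x - G (s (suc n))) * inv (x - s (suc n)))} {λ x → (con (G x) K.- con (G (s (suc n)))) K.* con (inv (x - s (suc n)))}
             (λ {i} _ m → (ring-eq ((G (s i)) ∷ (G (s (suc n))) ∷ (inv (s i - s (suc n))) ∷ (f m) ∷ []) ((x0 :- x1) :* x2 :* x3) (x0 :* (x2 :* x3) :- x1 :* (x2 :* x3)) ≡.refl)))
         transfer : ∀ n a b → con (ΔF.Δ s n (λ z → N (λ i → a i + z * b i))) K.≈ DK.Δ n (λ x → line d (poly d a X) (poly d b X) (con x))
         transfer n a b = K.trans {con (ΔF.Δ s n (λ z → N (λ i → a i + z * b i)))} {DK.Δ n (λ z → con (N (λ i → a i + z * b i)))} {DK.Δ n (λ x → line d (poly d a X) (poly d b X) (con x))}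
           (con-Δ n (λ z → N (λ i → a i + z * b i)))
           (DK.Δ-cong n {λ z → con (N (λ i → a i + z * b i))} {λ x → line d (poly d a X) (poly d b X) (con x)} (λ {i} _ → N-line a b (s i)))
       differences : ∀ s n → ΔF.Distinct s n → ∀ a b →
         (d ℕ.< n → ΔF.Δ s n (λ z → N (λ i → a i + z * b i)) ≈ 0#) × (d ≡ n → ΔF.Δ s n (λ z → N (λ i → a i + z * b i)) ≈ N b)
       differences s n distinct a b = (λ d<n → con-null (K.trans {con (ΔF.Δ s n G)} {DK.Δ s n P} {K.0#} (transfer s n a b) (proj₁ both d<n))) ,
         (λ d≡n → con-injective (K.trans {con (ΔF.Δ s n G)} {DK.Δ s n P} {con (N b)} (transfer s n a b) (K.trans {DK.Δ s n P} {norm d (poly d b X)} {con (N b)} (proj₂ both d≡n) (con-N b))))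
         where
         G : Carrier → Carrier
         G z = N (λ i → a i + z * b i)
         P : Carrier → Op
         P x = line d (poly d a X) (poly d b X) (con x)
         both : (d ℕ.< n → DK.Δ s n P K.≈ K.0#) × (d ≡ n → DK.Δ s n P K.≈ norm d (poly d b X))
         both = DK.Δ-poly s n d {norm d (poly d b X)} {line d (poly d a X) (poly d b X)} distinct (line-isPoly d (poly d a X) (poly d b X))

-- Integers modulo a prime.

module ResidueRing where

 open import Data.Integer as ℤ using (ℤ; +_; _+_; _*_; -_; _-_; 0ℤ; 1ℤ; ∣_∣)
 import Data.Integer.Properties as ℤ
 open import Data.Integer.DivMod using (_%ℕ_; _/ℕ_; n%ℕd<d; a≡a%ℕn+[a/ℕn]*n)
 open import Data.Integer.Divisibility.Signed using (_∣_; divides; _∣?_; ∣⇒∣ᵤ; ∣ᵤ⇒∣)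
 import Data.Nat.Divisibility as ℕ
 open import Data.Nat.Combinatorics using (_C_; nCk+nC[k+1]≡[n+1]C[k+1]; nC1≡n)
 open import Data.Nat.Primality using (Prime; euclidsLemma; prime⇒nonZero)
 open ≡ using (_≡_)
 open import Relation.Nullary.Decidable using (map′)
 open import Function using (_$_)

 module Residues (q : ℕ) where
   open RingNormaliser ℤ.+-*-commutativeRing

   infix 4 _≈_
   -- Residues are integers under a setoid equality; the record keeps `a` and `b` inferable from the
   -- type.
   record _≈_ (a b : ℤ) : Set where
     constructor mod
     field divisible : + q ∣ a - b
   open _≈_

   ≡⇒≈ : ∀ {a b} → a ≡ b → a ≈ b
   ≡⇒≈ {a} ≡.refl = mod $ divides 0ℤ (≡.trans (ℤ.+-inverseʳ a) (≡.sym (ℤ.*-zeroˡ (+ q))))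

   residues : CommutativeRing 0ℓ 0ℓ
   residues = record
     { Carrier = ℤ ; _≈_ = _≈_ ; _+_ = _+_ ; _*_ = _*_ ; -_ = -_ ; 0# = 0ℤ ; 1# = 1ℤ
     ; isCommutativeRing = record
       { isRing = record
         { +-isAbelianGroup = record
           { isGroup = record
             { isMonoid = record
               { isSemigroup = record
                 { isMagma = record
                   { isEquivalence = record
                     { refl = ≡⇒≈ ≡.refl
                     ; sym = λ { {a} {b} (mod (divides k eq)) → mod $ divides (- k) (≡.trans (ring-eq (b ∷ a ∷ []) (x0 :- x1) (⊝ (x1 :- x0)) ≡.refl) (≡.trans (≡.cong -_ eq) (ring-eq (k ∷ (ℤ.+ q) ∷ []) (⊝ (x0 :* x1)) (⊝ x0 :* x1) ≡.refl))) }
                     ; trans = λ { {a} {b} {c} (mod (divides k eq)) (mod (divides l eq′)) → mod $ divides (k + l) (≡.trans (ring-eq (a ∷ c ∷ b ∷ []) (x0 :- x1) (x0 :- x2 :+ (x2 :- x1)) ≡.refl) (≡.trans (≡.cong₂ _+_ eq eq′) (ring-eq (k ∷ (ℤ.+ q) ∷ l ∷ []) (x0 :* x1 :+ x2 :* x1) ((x0 :+ x2) :* x1) ≡.refl))) } }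
                   ; ∙-cong = λ { {a} {b} {c} {d} (mod (divides k eq)) (mod (divides l eq′)) → mod $ divides (k + l) (≡.trans (ring-eq (a ∷ c ∷ b ∷ d ∷ []) (x0 :+ x1 :- (x2 :+ x3)) (x0 :- x2 :+ (x1 :- x3)) ≡.refl) (≡.trans (≡.cong₂ _+_ eq eq′) (ring-eq (k ∷ (ℤ.+ q) ∷ l ∷ []) (x0 :* x1 :+ x2 :* x1) ((x0 :+ x2) :* x1) ≡.refl))) } }
                 ; assoc = λ a b c → ≡⇒≈ (ℤ.+-assoc a b c) }
               ; identity = (λ a → ≡⇒≈ (ℤ.+-identityˡ a)) , (λ a → ≡⇒≈ (ℤ.+-identityʳ a)) }
             ; inverse = (λ a → ≡⇒≈ (ℤ.+-inverseˡ a)) , (λ a → ≡⇒≈ (ℤ.+-inverseʳ a))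
             ; ⁻¹-cong = λ { {a} {b} (mod (divides k eq)) → mod $ divides (- k) (≡.trans (ring-eq (a ∷ b ∷ []) (⊝ x0 :- ⊝ x1) (⊝ (x0 :- x1)) ≡.refl) (≡.trans (≡.cong -_ eq) (ring-eq (k ∷ (ℤ.+ q) ∷ []) (⊝ (x0 :* x1)) (⊝ x0 :* x1) ≡.refl))) } }
           ; comm = λ a b → ≡⇒≈ (ℤ.+-comm a b) }
         ; *-cong = λ { {a} {b} {c} {d} (mod (divides k eq)) (mod (divides l eq′)) → mod $ divides (k * c + b * l) (≡.trans (ring-eq (a ∷ c ∷ b ∷ d ∷ []) (x0 :* x1 :- x2 :* x3) ((x0 :- x2) :* x1 :+ x2 :* (x1 :- x3)) ≡.refl)
             (≡.trans (≡.cong₂ (λ u v → u * c + b * v) eq eq′) (ring-eq (k ∷ (ℤ.+ q) ∷ c ∷ b ∷ l ∷ []) (x0 :* x1 :* x2 :+ x3 :* (x4 :* x1)) ((x0 :* x2 :+ x3 :* x4) :* x1) ≡.refl))) }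
         ; *-assoc = λ a b c → ≡⇒≈ (ℤ.*-assoc a b c)
         ; *-identity = (λ a → ≡⇒≈ (ℤ.*-identityˡ a)) , (λ a → ≡⇒≈ (ℤ.*-identityʳ a))
         ; distrib = (λ a b c → ≡⇒≈ (ℤ.*-distribˡ-+ a b c)) , (λ a b c → ≡⇒≈ (ℤ.*-distribʳ-+ a b c)) }
       ; *-comm = λ a b → ≡⇒≈ (ℤ.*-comm a b) } }

   ι≡+ : ∀ n → RingNormaliser.ι residues n ≡ + n
   ι≡+ zero = ≡.refl
   ι≡+ (suc n) = ≡.cong (λ z → 1ℤ + z) (ι≡+ n)

   _≟_ : ∀ a b → Dec (a ≈ b)
   a ≟ b = map′ mod divisible (+ q ∣? (a - b))

   char : RingNormaliser.ι residues q ≈ 0ℤ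
   char = mod $ divides 1ℤ (≡.trans (≡.cong (λ z → z - 0ℤ) (ι≡+ q)) (≡.trans (ℤ.+-identityʳ (+ q)) (≡.sym (ℤ.*-identityˡ (+ q)))))

   below-injective : ∀ {i j} → i ℕ.< j → j ℕ.< q → ¬ + j ≈ + i
   below-injective {i} {j} i<j j<q h = ℕ.<⇒≱ (ℕ.≤-<-trans (ℕ.m∸n≤m j i) j<q) (ℕ.∣⇒≤ {{ℕ.>-nonZero (ℕ.m<n⇒0<n∸m i<j)}}
     (≡.subst (q ℕ.∣_) (≡.trans (≡.cong ∣_∣ (ℤ.m-n≡m⊖n j i)) (≡.cong ∣_∣ (ℤ.⊖-≥ (ℕ.<⇒≤ i<j)))) (∣⇒∣ᵤ (divisible h))))

   module _ (pr : Prime q) where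
     private
       instance
         q-nonZero : ℕ.NonZero q
         q-nonZero = prime⇒nonZero pr

     zero-divisor-free : ∀ {a b} → a * b ≈ 0ℤ → ¬ a ≈ 0ℤ → b ≈ 0ℤ
     zero-divisor-free {a} {b} h a≉0 with euclidsLemma ∣ a ∣ ∣ b ∣ pr (≡.subst (q ℕ.∣_) (≡.trans (≡.cong ∣_∣ (ℤ.+-identityʳ (a * b))) (ℤ.abs-* a b)) (∣⇒∣ᵤ (divisible h)))
     ... | inj₁ p = contradiction (mod $ ∣ᵤ⇒∣ (≡.subst (q ℕ.∣_) (≡.cong ∣_∣ (≡.sym (ℤ.+-identityʳ a))) p)) a≉0
     ... | inj₂ p = mod $ ∣ᵤ⇒∣ (≡.subst (q ℕ.∣_) (≡.cong ∣_∣ (≡.sym (ℤ.+-identityʳ b))) p)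

     remainder≈ : ∀ a → a ≈ + (a %ℕ q)
     remainder≈ a = mod $ divides (a /ℕ q) (≡.trans (≡.cong (λ z → z - + (a %ℕ q)) (a≡a%ℕn+[a/ℕn]*n a q)) (cancel (+ (a %ℕ q)) ((a /ℕ q) * + q)))
       where
       cancel : ∀ r s → r + s - r ≡ s
       cancel r s = ring-eq (r ∷ s ∷ []) (x0 :+ x1 :- x0) x1 ≡.refl

     reduce : ∀ a → ∃ λ n → n ℕ.< q × a ≈ RingNormaliser.ι residues n
     reduce a = a %ℕ q , n%ℕd<d a q , ≡.subst (a ≈_) (≡.sym (ι≡+ (a %ℕ q))) (remainder≈ a)

     ι-injective : ∀ {i j} → i ℕ.< j → j ℕ.< q → ¬ RingNormaliser.ι residues i ≈ RingNormaliser.ι residues j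
     ι-injective {i} {j} i<j j<q h = below-injective i<j j<q (CommutativeRing.sym residues (≡.subst₂ _≈_ (ι≡+ i) (ι≡+ j) h))

 -- The number 2 + … + (k + 1) of variables of a sum of forms of degrees 2, …, k + 1.
 size : ℕ → ℕ
 size zero = 0
 size (suc k) = size k ℕ.+ suc (suc k)

 -- With `t = k + 1` this turns `j ≤ C(t+1, 2)` into `j - 1 ≤ size k`. The induction step is
 -- Pascal's rule.
 size-binomial : ∀ k → suc (size k) ≡ suc (suc k) C 2
 size-binomial zero = ≡.refl
 size-binomial (suc k) = ≡.trans (≡.cong (ℕ._+ suc (suc k)) (size-binomial k)) (≡.trans (ℕ.+-comm (suc (suc k) C 2) (suc (suc k)))
   (≡.trans (≡.cong (ℕ._+ (suc (suc k) C 2)) (≡.sym (nC1≡n (suc (suc k))))) (nCk+nC[k+1]≡[n+1]C[k+1] (suc (suc k)) 1)))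

-- Graphs of sums of norm forms and their point-line geometry.

module NormSurface where

 open import Data.Fin as Fin using (Fin; toℕ; fromℕ<)
 open import Data.Nat.Primality using (Prime)
 open ≡ using (_≡_)
 open FrobeniusPolynomials
 open AnisotropicForms
 open ResidueRing using (size)

 module Geometry (F : CommutativeRing 0ℓ 0ℓ) {q : ℕ} (pr : Prime q)
   (char : CommutativeRing._≈_ F (RingNormaliser.ι F q) (CommutativeRing.0# F))
   (_≟_ : ∀ x y → Dec (CommutativeRing._≈_ F x y))
   (domain : ∀ {x y} → CommutativeRing._≈_ F (CommutativeRing._*_ F x y) (CommutativeRing.0# F) → ¬ CommutativeRing._≈_ F x (CommutativeRing.0# F) → CommutativeRing._≈_ F y (CommutativeRing.0# F))
   (representative : ∀ x → ∃ λ n → CommutativeRing._≈_ F x (RingNormaliser.ι F n))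
   (ι-injective : ∀ {i j} → i ℕ.< j → j ℕ.< q → ¬ CommutativeRing._≈_ F (RingNormaliser.ι F i) (RingNormaliser.ι F j)) where
   open CommutativeRing F hiding (zero)
   open RingNormaliser F
   open Polynomial F using (isPoly-affine)
   open PrimeField F pr char _≟_ domain representative ι-injective
   open import Relation.Binary.Reasoning.Setoid setoid

   Forms : ℕ → Set
   Forms k = ∀ {i} → i ℕ.< k → NormForm (suc (suc i))

   forms : ∀ k → ¬ ¬ Forms k
   forms zero none = none λ ()
   forms (suc k) none = forms k λ fs → normForm (suc k) λ f → none (extend fs f)
     where
     extend : Forms k → NormForm (suc (suc k)) → Forms (suc k)
     extend fs f (s≤s i≤k) with ℕ.m≤n⇒m<n∨m≡n i≤k
     ... | inj₁ i<k = fs i<k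
     ... | inj₂ ≡.refl = f

   previous : ∀ {k} → Forms (suc k) → Forms k
   previous fs i<k = fs (ℕ.m≤n⇒m≤1+n i<k)

   surface : ∀ {k} → Forms k → (ℕ → Carrier) → Carrier
   surface {zero} fs x = 0#
   surface {suc k} fs x = surface (previous fs) x + NormForm.N (fs ℕ.≤-refl) (λ i → x (size k ℕ.+ i))

   surface-cong : ∀ {k} (fs : Forms k) {x y} → (∀ i → x i ≈ y i) → surface fs x ≈ surface fs y
   surface-cong {zero} fs h = refl
   surface-cong {suc k} fs h = +-cong (surface-cong (previous fs) h) (NormForm.N-cong (fs ℕ.≤-refl) (λ {i} _ → h (size k ℕ.+ i)))

   surface-Δ : ∀ {k} (fs : Forms k) s n → suc k ℕ.< n → ΔF.Distinct s n → ∀ (a b : ℕ → Carrier) → ΔF.Δ s n (λ z → surface fs (λ i → a i + z * b i)) ≈ 0#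
   surface-Δ {zero} fs s n _ distinct a b = ΔF.Δ-0 s n (λ _ → refl)
   surface-Δ {suc k} fs s n k<n distinct a b = trans (ΔF.Δ-+ s n (λ z → surface (previous fs) (λ i → a i + z * b i)) (λ z → NormForm.N (fs ℕ.≤-refl) (λ i → a (size k ℕ.+ i) + z * b (size k ℕ.+ i))))
     (trans (+-cong (surface-Δ (previous fs) s n (ℕ.<⇒≤ k<n) distinct a b)
       (proj₁ (NormForm.N-differences (fs ℕ.≤-refl) s n distinct (λ i → a (size k ℕ.+ i)) (λ i → b (size k ℕ.+ i))) k<n)) (+-identityˡ 0#))

   -- A line meets the graph of the surface in at most k + 1 points: the divided difference of order
   -- k + 1 annihilates everything but the leading coefficient N b of the last block.
   surface-line : ∀ {k} (fs : Forms k) s → ΔF.Distinct s (suc k) → ∀ (a b : ℕ → Carrier) α β → (∀ {i} → i ℕ.≤ suc k → surface fs (λ l → a l + s i * b l) ≈ α + s i * β) →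
     ∀ {i} → i ℕ.< size k → b i ≈ 0#
   surface-line {suc k} fs s distinct a b α β h {i} i<size with i ℕ.<? size k
   ... | yes i<size′ = surface-line (previous fs) s (λ p p′ → distinct p (ℕ.m≤n⇒m≤1+n p′)) a b (α - N (λ l → a (size k ℕ.+ l))) β lower i<size′
     where
     open NormForm (fs ℕ.≤-refl)
     top-null : ∀ {l} → l ℕ.< suc (suc k) → b (size k ℕ.+ l) ≈ 0#
     top-null = N-anisotropic (begin
       N (λ l → b (size k ℕ.+ l)) ≈⟨ proj₂ (N-differences s (suc (suc k)) distinct (λ l → a (size k ℕ.+ l)) (λ l → b (size k ℕ.+ l))) ≡.refl ⟨
       ΔF.Δ s n P ≈⟨ +-identityˡ _ ⟨
       0# + ΔF.Δ s n P ≈⟨ +-congʳ (surface-Δ (previous fs) s n ℕ.≤-refl distinct a b) ⟨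
       ΔF.Δ s n G + ΔF.Δ s n P ≈⟨ ΔF.Δ-+ s n G P ⟨
       ΔF.Δ s n (λ z → G z + P z) ≈⟨ ΔF.Δ-cong s n (λ {l} l≤ → h l≤) ⟩
       ΔF.Δ s n (λ z → α + z * β) ≈⟨ proj₁ (ΔF.Δ-poly s n 1 distinct (isPoly-affine α β)) (s≤s (s≤s z≤n)) ⟩
       0# ∎)
       where
       n : ℕ
       n = suc (suc k)
       G P : Carrier → Carrier
       G z = surface (previous fs) (λ l → a l + z * b l)
       P z = N (λ l → a (size k ℕ.+ l) + z * b (size k ℕ.+ l))
     -- As the direction vanishes on the last block, the last form is constant along the line and is
     -- absorbed into `α`.
     lower : ∀ {i} → i ℕ.≤ suc k → surface (previous fs) (λ l → a l + s i * b l) ≈ (α - N (λ l → a (size k ℕ.+ l))) + s i * β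
     lower {i} i≤ = begin
       G ≈⟨ ring-eq (G ∷ A ∷ []) x0 (x0 :+ x1 :- x1) ≡.refl ⟩
       (G + A) - A ≈⟨ +-congʳ (+-congˡ (N-cong λ {l} l< → trans (sym (+-identityʳ _)) (+-congˡ (trans (sym (zeroʳ (s i))) (*-congˡ (sym (top-null l<))))))) ⟩
       (G + N (λ l → a (size k ℕ.+ l) + s i * b (size k ℕ.+ l))) - A ≈⟨ +-congʳ (h (ℕ.m≤n⇒m≤1+n i≤)) ⟩
       (α + s i * β) - A ≈⟨ ring-eq (α ∷ (s i) ∷ β ∷ A ∷ []) (x0 :+ x1 :* x2 :- x3) (x0 :- x3 :+ x1 :* x2) ≡.refl ⟩
       (α - A) + s i * β ∎
       where
       G A : Carrier
       G = surface (previous fs) (λ l → a l + s i * b l)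
       A = N (λ l → a (size k ℕ.+ l))
   ... | no i≮size′ with ℕ.m≤n⇒∃[o]m+o≡n (ℕ.≮⇒≥ i≮size′)
   ... | l , ≡.refl = N-anisotropic (begin
       N (λ l → b (size k ℕ.+ l)) ≈⟨ proj₂ (N-differences s (suc (suc k)) distinct (λ l → a (size k ℕ.+ l)) (λ l → b (size k ℕ.+ l))) ≡.refl ⟨
       ΔF.Δ s n P ≈⟨ +-identityˡ _ ⟨
       0# + ΔF.Δ s n P ≈⟨ +-congʳ (surface-Δ (previous fs) s n ℕ.≤-refl distinct a b) ⟨
       ΔF.Δ s n G + ΔF.Δ s n P ≈⟨ ΔF.Δ-+ s n G P ⟨
       ΔF.Δ s n (λ z → G z + P z) ≈⟨ ΔF.Δ-cong s n (λ {l} l≤ → h l≤) ⟩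
       ΔF.Δ s n (λ z → α + z * β) ≈⟨ proj₁ (ΔF.Δ-poly s n 1 distinct (isPoly-affine α β)) (s≤s (s≤s z≤n)) ⟩
       0# ∎) (ℕ.+-cancelˡ-< (size k) l (suc (suc k)) i<size)
       where
       open NormForm (fs ℕ.≤-refl)
       n : ℕ
       n = suc (suc k)
       G P : Carrier → Carrier
       G z = surface (previous fs) (λ l → a l + z * b l)
       P z = N (λ l → a (size k ℕ.+ l) + z * b (size k ℕ.+ l))

   -- `j` is one less than in the theorem, so points have `j + 2` and lines `2j + 1` coordinates.
   -- The abscissas of a line are padded with zeros, since the surface takes `size k ≥ j` variables.
   module Incidence {k : ℕ} (fs : Forms k) {j : ℕ} (j≤ : j ℕ.≤ size k) where

     record Point : Set where
       constructor point
       field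
         s : Carrier
         w : ℕ → Carrier

     record Line : Set where
       field
         x y : ℕ → Carrier
         x-support : ∀ {i} → j ℕ.≤ i → x i ≈ 0#

     open Point
     open Line

     direction : (ℕ → Carrier) → ℕ → Carrier
     direction x zero = surface fs x
     direction x (suc i) = x i

     On : Point → Line → Set
     On p l = ∀ {i} → i ℕ.≤ j → w p i ≈ y l i + s p * direction (x l) i

     SamePoint : Point → Point → Set
     SamePoint p p′ = s p ≈ s p′ × (∀ {i} → i ℕ.≤ j → w p i ≈ w p′ i)

     SameLine : Line → Line → Set
     SameLine l l′ = (∀ {i} → i ℕ.< j → x l i ≈ x l′ i) × (∀ {i} → i ℕ.≤ j → y l i ≈ y l′ i)

     x-everywhere : ∀ l l′ → (∀ {i} → i ℕ.< j → x l i ≈ x l′ i) → ∀ i → x l i ≈ x l′ i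
     x-everywhere l l′ h i with i ℕ.<? j
     ... | yes i<j = h i<j
     ... | no i≮j = trans (x-support l (ℕ.≮⇒≥ i≮j)) (sym (x-support l′ (ℕ.≮⇒≥ i≮j)))

     direction-cong : ∀ l l′ → (∀ {i} → i ℕ.< j → x l i ≈ x l′ i) → ∀ i → direction (x l) i ≈ direction (x l′) i
     direction-cong l l′ h zero = surface-cong fs (x-everywhere l l′ h)
     direction-cong l l′ h (suc i) = x-everywhere l l′ h i

     same-line : ∀ {p} l l′ → On p l → On p l′ → (∀ {i} → i ℕ.< j → x l i ≈ x l′ i) → SameLine l l′
     same-line {p} l l′ o o′ h = h , λ {i} i≤j → begin
       y l i ≈⟨ ring-eq ((y l i) ∷ (s p) ∷ (direction (x l) i) ∷ []) x0 (x0 :+ x1 :* x2 :- x1 :* x2) ≡.refl ⟩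
       (y l i + s p * direction (x l) i) - s p * direction (x l) i ≈⟨ +-cong (trans (sym (o i≤j)) (o′ i≤j)) (-‿cong (*-congˡ (direction-cong l l′ h i))) ⟩
       (y l′ i + s p * direction (x l′) i) - s p * direction (x l′) i ≈⟨ ring-eq ((y l′ i) ∷ (s p) ∷ (direction (x l′) i) ∷ []) (x0 :+ x1 :* x2 :- x1 :* x2) x0 ≡.refl ⟩
       y l′ i ∎

     same-point : ∀ {p p′} l → On p l → On p′ l → s p ≈ s p′ → SamePoint p p′
     same-point l o o′ h = h , λ i≤j → trans (o i≤j) (trans (+-congˡ (*-congʳ h)) (sym (o′ i≤j)))

     two-points : ∀ {p p′} l l′ → On p l → On p′ l → On p l′ → On p′ l′ → SamePoint p p′ ⊎ SameLine l l′
     two-points {p} {p′} l l′ a b c d with s p ≟ s p′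
     ... | yes e = inj₁ (same-point l a b e)
     ... | no e = inj₂ (same-line l l′ a c (λ {i} i<j → trans (ring-eq ((x l i) ∷ (x l′ i) ∷ []) x0 (x0 :- x1 :+ x1) ≡.refl)
       (trans (+-congʳ (domain {s p - s p′} (begin
         (s p - s p′) * (x l i - x l′ i) ≈⟨ ring-eq ((s p) ∷ (s p′) ∷ (x l i) ∷ (x l′ i) ∷ (y l (suc i)) ∷ (y l′ (suc i)) ∷ []) ((x0 :- x1) :* (x2 :- x3)) (x4 :+ x0 :* x2 :- (x4 :+ x1 :* x2) :- (x5 :+ x0 :* x3 :- (x5 :+ x1 :* x3))) ≡.refl ⟩
         ((y l (suc i) + s p * x l i) - (y l (suc i) + s p′ * x l i)) - ((y l′ (suc i) + s p * x l′ i) - (y l′ (suc i) + s p′ * x l′ i))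
           ≈⟨ +-cong (+-cong (sym (a i<j)) (-‿cong (sym (b i<j)))) (-‿cong (+-cong (sym (c i<j)) (-‿cong (sym (d i<j))))) ⟩
         (w p (suc i) - w p′ (suc i)) - (w p (suc i) - w p′ (suc i)) ≈⟨ -‿inverseʳ _ ⟩
         0# ∎) (-≉0 e))) (+-identityˡ _))))

     -- A theta whose paths lead from `P` through `ℓs i` and `Ps i` to `ℓ`. The direction of `ℓs i`
     -- is that of `ℓ` displaced by a multiple of one fixed vector, so together with `ℓ` they give
     -- `t + 1` collinear points on the graph of the surface.
     module ParallelPaths (P : Point) (ℓ : Line) (Ps : Fin (suc k) → Point) (ℓs : Fin (suc k) → Line)
       (P∈ℓs : ∀ i → On P (ℓs i)) (Ps∈ℓs : ∀ i → On (Ps i) (ℓs i)) (Ps∈ℓ : ∀ i → On (Ps i) ℓ)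
       (distinct-lines : ∀ {i i′} → SameLine (ℓs i) (ℓs i′) → i ≡ i′) (≢ℓ : ∀ i → ¬ SameLine (ℓs i) ℓ) (≢P : ∀ i → ¬ SamePoint (Ps i) P) where
       private
         t : ℕ
         t = suc k
       s≉ : ∀ i → ¬ s P ≈ s (Ps i)
       s≉ i h = ≢P i (same-point (ℓs i) (Ps∈ℓs i) (P∈ℓs i) (sym h))
       -- u is the displacement of P from ℓ; it is a multiple of the difference of directions of ℓs i and ℓ.
       u : ℕ → Carrier
       u i = w P i - (y ℓ i + s P * direction (x ℓ) i)
       displacement : ∀ l {i} → i ℕ.≤ j → u i ≈ (s P - s (Ps l)) * (direction (x (ℓs l)) i - direction (x ℓ) i)
       displacement l {i} i≤j = begin
         w P i - (y ℓ i + s P * D) ≈⟨ ring-eq ((w P i) ∷ (y ℓ i) ∷ (s P) ∷ D ∷ (s (Ps l)) ∷ []) (x0 :- (x1 :+ x2 :* x3)) (x0 :- (x1 :+ x4 :* x3 :+ (x2 :- x4) :* x3)) ≡.refl ⟩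
         w P i - ((y ℓ i + s (Ps l) * D) + (s P - s (Ps l)) * D) ≈⟨ +-cong (P∈ℓs l i≤j) (-‿cong (+-congʳ (trans (sym (Ps∈ℓ l i≤j)) (Ps∈ℓs l i≤j)))) ⟩
         (y (ℓs l) i + s P * D′) - ((y (ℓs l) i + s (Ps l) * D′) + (s P - s (Ps l)) * D)
           ≈⟨ ring-eq ((y (ℓs l) i) ∷ (s P) ∷ D′ ∷ (s (Ps l)) ∷ D ∷ []) (x0 :+ x1 :* x2 :- (x0 :+ x3 :* x2 :+ (x1 :- x3) :* x4)) ((x1 :- x3) :* (x2 :- x4)) ≡.refl ⟩
         (s P - s (Ps l)) * (D′ - D) ∎
         where
         D D′ : Carrier
         D = direction (x ℓ) i
         D′ = direction (x (ℓs l)) i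
       c : Fin t → Carrier
       c l = inv (s P - s (Ps l))
       direction-along : ∀ l {i} → i ℕ.≤ j → direction (x (ℓs l)) i ≈ direction (x ℓ) i + c l * u i
       direction-along l {i} i≤j = sym (begin
         D + c l * u i ≈⟨ +-congˡ (*-congˡ (displacement l i≤j)) ⟩
         D + c l * ((s P - s (Ps l)) * (D′ - D)) ≈⟨ ring-eq (D ∷ (c l) ∷ (s P) ∷ (s (Ps l)) ∷ D′ ∷ []) (x0 :+ x1 :* ((x2 :- x3) :* (x4 :- x0))) (x0 :+ (x2 :- x3) :* x1 :* (x4 :- x0)) ≡.refl ⟩
         D + ((s P - s (Ps l)) * c l) * (D′ - D) ≈⟨ +-congˡ (*-congʳ (*-inv (-≉0 (s≉ l)))) ⟩
         D + 1# * (D′ - D) ≈⟨ ring-eq (D ∷ D′ ∷ []) (x0 :+ one :* (x1 :- x0)) x1 ≡.refl ⟩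
         D′ ∎)
         where
         D D′ : Carrier
         D = direction (x ℓ) i
         D′ = direction (x (ℓs l)) i
       -- Coordinate 0 of a direction is the value of the surface; it is separated from the
       -- abscissas, whose displacement is `v`.
       vf : Carrier
       vf = u 0
       v : ℕ → Carrier
       v i with i ℕ.<? j
       ... | yes _ = u (suc i)
       ... | no _ = 0#
       x-along : ∀ l i → x (ℓs l) i ≈ x ℓ i + c l * v i
       x-along l i with i ℕ.<? j
       ... | yes i<j = direction-along l i<j
       ... | no i≮j = trans (x-support (ℓs l) (ℕ.≮⇒≥ i≮j)) (sym (trans (+-cong (x-support ℓ (ℕ.≮⇒≥ i≮j)) (zeroʳ (c l))) (+-identityˡ 0#)))
       v-inside : ∀ {i} → i ℕ.< j → v i ≈ u (suc i)
       v-inside {i} i<j with i ℕ.<? j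
       ... | yes _ = refl
       ... | no i≮j = contradiction i<j i≮j
       -- `ℓs l` would be parallel to `ℓ` and meet it in `Ps l`, hence coincide with it.
       zero-step : ∀ l → (∀ i → c l * v i ≈ 0#) → ⊥
       zero-step l h = ≢ℓ l (x≈ , λ {i} i≤j → begin
           y (ℓs l) i ≈⟨ ring-eq ((y (ℓs l) i) ∷ (s (Ps l)) ∷ (direction (x (ℓs l)) i) ∷ []) x0 (x0 :+ x1 :* x2 :- x1 :* x2) ≡.refl ⟩
           (y (ℓs l) i + s (Ps l) * direction (x (ℓs l)) i) - s (Ps l) * direction (x (ℓs l)) i
             ≈⟨ +-cong (trans (sym (Ps∈ℓs l i≤j)) (Ps∈ℓ l i≤j)) (-‿cong (*-congˡ (direction-cong (ℓs l) ℓ x≈ i))) ⟩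
           (y ℓ i + s (Ps l) * direction (x ℓ) i) - s (Ps l) * direction (x ℓ) i ≈⟨ ring-eq ((y ℓ i) ∷ (s (Ps l)) ∷ (direction (x ℓ) i) ∷ []) (x0 :+ x1 :* x2 :- x1 :* x2) x0 ≡.refl ⟩
           y ℓ i ∎)
         where
         x≈ : ∀ {i} → i ℕ.< j → x (ℓs l) i ≈ x ℓ i
         x≈ {i} _ = trans (x-along l i) (trans (+-congˡ (h i)) (+-identityʳ _))
       not-all-equal : (∀ {i} → i ℕ.< size k → v i ≈ 0#) → ⊥
       not-all-equal h = zero-step Fin.zero (λ i → trans (*-congˡ (v≈0 i)) (zeroʳ _))
         where
         v≈0 : ∀ i → v i ≈ 0#
         v≈0 i with i ℕ.<? j in eq
         ... | no _ = refl
         ... | yes i<j = trans (sym (v-inside i<j)) (h (ℕ.≤-trans i<j j≤))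
       -- The parameter of `ℓ` itself comes first and those of the `ℓs` follow. The value 0 past `t`
       -- is a filler.
       points : ℕ → Carrier
       points zero = 0#
       points (suc i) with i ℕ.<? t
       ... | yes i<t = c (fromℕ< i<t)
       ... | no _ = 0#
       point-step : ∀ {i} → i ℕ.≤ k → ∃ λ l → toℕ l ≡ i × points (suc i) ≈ c l
       point-step {i} i≤k with i ℕ.<? t
       ... | yes i<t = fromℕ< i<t , Fin.toℕ-fromℕ< i<t , refl
       ... | no i≮t = contradiction (s≤s i≤k) i≮t
       -- Equal parameters mean equal directions, and both lines pass through `P`.
       c-distinct : ∀ {l l′} → c l ≈ c l′ → l ≡ l′
       c-distinct {l} {l′} h = distinct-lines (same-line {P} (ℓs l) (ℓs l′) (P∈ℓs l) (P∈ℓs l′)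
         (λ {i} _ → trans (x-along l i) (trans (+-congˡ (*-congʳ h)) (sym (x-along l′ i)))))
       distinct-points : ∀ {i i′} → i ℕ.< i′ → i′ ℕ.≤ t → ¬ points i ≈ points i′
       distinct-points {zero} {suc i′} _ (s≤s i′≤k) h with point-step i′≤k
       ... | l , _ , e = zero-step l (λ i → trans (*-congʳ (trans (sym e) (sym h))) (zeroˡ (v i)))
       distinct-points {suc i} {suc i′} (s≤s i<i′) (s≤s i′≤k) h with point-step (ℕ.<⇒≤ (ℕ.<-≤-trans i<i′ i′≤k)) | point-step i′≤k
       ... | l , ≡.refl , e | l′ , ≡.refl , e′ = ℕ.<⇒≢ i<i′ (≡.cong toℕ (c-distinct (trans (sym e) (trans h e′))))
       distinct : ΔF.Distinct points t
       distinct = distinct-points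
       on-step : ∀ z l → z ≈ c l → surface fs (λ m → x ℓ m + z * v m) ≈ surface fs (x ℓ) + z * vf
       on-step z l e = trans (surface-cong fs (λ m → sym (trans (x-along l m) (+-congˡ (*-congʳ (sym e))))))
         (trans (direction-along l z≤n) (+-congˡ (*-congʳ (sym e))))
       on-surface : ∀ {i} → i ℕ.≤ t → surface fs (λ l → x ℓ l + points i * v l) ≈ surface fs (x ℓ) + points i * vf
       on-surface {zero} _ = trans (surface-cong fs (λ l → trans (+-congˡ (zeroˡ (v l))) (+-identityʳ _))) (sym (trans (+-congˡ (zeroˡ vf)) (+-identityʳ _)))
       on-surface {suc i} (s≤s i≤k) = on-step (points (suc i)) (proj₁ step) (proj₂ (proj₂ step))
         where
         step : ∃ λ l → toℕ l ≡ i × points (suc i) ≈ c l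
         step = point-step i≤k
       impossible : ⊥
       impossible = not-all-equal (surface-line fs points distinct (x ℓ) v (surface fs (x ℓ)) vf on-surface)

open import Defs

-- Squares and thetas in bipartite graphs.

module Configurations where

 open import Data.Bool using (Bool; true; false; if_then_else_; _∧_)
 open import Data.Fin as Fin using (Fin; zero; suc; punchIn; punchOut)
 open import Data.List using (List; map; allFin; tabulate)
 import Data.List.Properties as List
 import Data.Nat.ListAction as List
 open import Data.Sum.Properties using (inj₁-injective; inj₂-injective)
 open ≡ using (_≡_; _≢_)
 open import Function using (_∘_; id)

 open import Algebra.Properties.CommutativeMonoid.Sum ℕ.+-0-commutativeMonoid public using (sum; sum-remove; sum-cong-≗; ∑-comm)

 𝟙 : Bool → ℕ
 𝟙 x = if x then 1 else 0

 𝟙≤1 : ∀ x → 𝟙 x ℕ.≤ 1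
 𝟙≤1 true = ℕ.≤-refl
 𝟙≤1 false = z≤n

 𝟙-∧ : ∀ x y → 𝟙 (x ∧ y) ≡ 𝟙 x ℕ.* 𝟙 y
 𝟙-∧ true y = ≡.sym (ℕ.+-identityʳ (𝟙 y))
 𝟙-∧ false y = ≡.refl

 1≤𝟙 : ∀ {x} → 1 ℕ.≤ 𝟙 x → x ≡ true
 1≤𝟙 {true} _ = ≡.refl

 sum-allFin : ∀ n (f : Fin n → ℕ) → List.sum (map f (allFin n)) ≡ sum f
 sum-allFin n f = ≡.trans (≡.cong List.sum (List.map-tabulate id f)) (sum-tabulate n f)
   where
   sum-tabulate : ∀ n (f : Fin n → ℕ) → List.sum (tabulate f) ≡ sum f
   sum-tabulate zero f = ≡.refl
   sum-tabulate (suc n) f = ≡.cong (f zero ℕ.+_) (sum-tabulate n (f ∘ suc))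

 edges-sum : ∀ {m n} (E : BipGraph m n) → edges E ≡ sum (λ a → sum (λ b → 𝟙 (E a b)))
 edges-sum {m} {n} E = ≡.trans (sum-allFin m _) (sum-cong-≗ (λ a → sum-allFin n (λ b → 𝟙 (E a b))))

 sum-injection : ∀ {K n} (f : Fin n → ℕ) c (g : Fin K → Fin n) → (∀ {i i′} → g i ≡ g i′ → i ≡ i′) → (∀ i → c ℕ.≤ f (g i)) → K ℕ.* c ℕ.≤ sum f
 sum-injection {zero} f c g injective above = z≤n
 sum-injection {suc K} {zero} f c g injective above with g zero
 ... | ()
 sum-injection {suc K} {suc n} f c g injective above = ℕ.≤-trans (ℕ.+-mono-≤ (above zero)
   (sum-injection (f ∘ punchIn (g zero)) c (λ i → punchOut (apart i)) (λ e → Fin.suc-injective (injective (Fin.punchOut-injective (apart _) (apart _) e)))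
     (λ i → ≡.subst (λ x → c ℕ.≤ f x) (≡.sym (Fin.punchIn-punchOut (apart i))) (above (suc i)))))
   (ℕ.≤-reflexive (≡.sym (sum-remove {i = g zero} f)))
   where
   apart : ∀ i → g zero ≢ g (suc i)
   apart i e = Fin.0≢1+n (injective e)

 edges-≥ : ∀ {m n K L} (E : BipGraph m n) (g : Fin K → Fin m) → (∀ {i i′} → g i ≡ g i′ → i ≡ i′) →
   (h : Fin K → Fin L → Fin n) → (∀ i {l l′} → h i l ≡ h i l′ → l ≡ l′) → (∀ i l → E (g i) (h i l) ≡ true) → K ℕ.* L ℕ.≤ edges E
 edges-≥ {L = L} E g g-injective h h-injective present = ℕ.≤-trans (sum-injection (λ a → sum (λ b → 𝟙 (E a b))) L g g-injective λ i →
     ≡.subst (ℕ._≤ _) (ℕ.*-identityʳ L) (sum-injection (λ b → 𝟙 (E (g i) b)) 1 (h i) (h-injective i) λ l → ≡.subst (λ z → 1 ℕ.≤ 𝟙 z) (≡.sym (present i l)) ℕ.≤-refl))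
   (ℕ.≤-reflexive (≡.sym (edges-sum E)))

 selection : ∀ {t n} (f : Fin n → ℕ) → (∀ i → f i ℕ.≤ 1) → t ℕ.≤ sum f → ∃ λ (g : Fin t → Fin n) → (∀ {i i′} → g i ≡ g i′ → i ≡ i′) × (∀ i → 1 ℕ.≤ f (g i))
 selection {zero} f _ _ = (λ ()) , (λ { {()} }) , λ ()
 selection {suc t} {zero} f _ ()
 selection {suc t} {suc n} f f≤1 h = split (f zero) ≡.refl (f≤1 zero)
   where
   split : ∀ x → f zero ≡ x → x ℕ.≤ 1 → ∃ λ (g : Fin (suc t) → Fin (suc n)) → (∀ {i i′} → g i ≡ g i′ → i ≡ i′) × (∀ i → 1 ℕ.≤ f (g i))
   split zero e _ with selection (f ∘ suc) (f≤1 ∘ suc) (≡.subst (λ x → suc t ℕ.≤ x ℕ.+ sum (f ∘ suc)) e h)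
   ... | g , injective , holds = suc ∘ g , (λ e′ → injective (Fin.suc-injective e′)) , holds
   split (suc zero) e _ with selection (f ∘ suc) (f≤1 ∘ suc) (ℕ.s≤s⁻¹ (≡.subst (λ x → suc t ℕ.≤ x ℕ.+ sum (f ∘ suc)) e h))
   ... | g , injective , holds = g′ , injective′ , holds′
     where
     g′ : Fin (suc t) → Fin (suc n)
     g′ zero = zero
     g′ (suc i) = suc (g i)
     injective′ : ∀ {i i′} → g′ i ≡ g′ i′ → i ≡ i′
     injective′ {zero} {zero} _ = ≡.refl
     injective′ {suc i} {suc i′} e′ = ≡.cong suc (injective (Fin.suc-injective e′))
     holds′ : ∀ i → 1 ℕ.≤ f (g′ i)
     holds′ zero = ℕ.≤-reflexive (≡.sym e)
     holds′ (suc i) = holds i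
   split (suc (suc _)) _ (s≤s ())

 module _ {m n} (E : BipGraph m n) where

   record Square : Set where
     field
       a a′ : Fin m
       b b′ : Fin n
       a≢a′ : a ≢ a′
       b≢b′ : b ≢ b′
       ab : E a b ≡ true
       ab′ : E a b′ ≡ true
       a′b : E a′ b ≡ true
       a′b′ : E a′ b′ ≡ true

   -- The paths are `a`, `bs i`, `as i`, `b`. Since paths of length 3 join opposite sides, an
   -- embedding with `end₁` on the right is brought to this form by reading it backwards.
   record Theta (t : ℕ) : Set where
     field
       a : Fin m
       b : Fin n
       as : Fin t → Fin m
       bs : Fin t → Fin n
       as-injective : ∀ {i i′} → as i ≡ as i′ → i ≡ i′
       bs-injective : ∀ {i i′} → bs i ≡ bs i′ → i ≡ i′
       as≢a : ∀ i → as i ≢ a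
       bs≢b : ∀ i → bs i ≢ b
       a-bs : ∀ i → E a (bs i) ≡ true
       as-bs : ∀ i → E (as i) (bs i) ≡ true
       as-b : ∀ i → E (as i) b ≡ true

   private
     step₁ : ∀ {u v a} → u ≡ inj₁ a → Adj (toGraph E) u v → ∃ λ b → v ≡ inj₂ b × E a b ≡ true
     step₁ {v = inj₂ b} ≡.refl e = b , ≡.refl , e

     step₂ : ∀ {u v b} → u ≡ inj₂ b → Adj (toGraph E) u v → ∃ λ a → v ≡ inj₁ a × E a b ≡ true
     step₂ {v = inj₁ a} ≡.refl e = a , ≡.refl , e

     step₁₂ : ∀ {u v a b} → u ≡ inj₁ a → v ≡ inj₂ b → Adj (toGraph E) u v → E a b ≡ true
     step₁₂ ≡.refl ≡.refl e = e

     step₂₁ : ∀ {u v a b} → u ≡ inj₂ b → v ≡ inj₁ a → Adj (toGraph E) u v → E a b ≡ true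
     step₂₁ ≡.refl ≡.refl e = e

     same : ∀ {A B : Set} {f : A → B} {x y v w} → (∀ {x y} → f x ≡ f y → x ≡ y) → f x ≡ v → f y ≡ w → v ≡ w → x ≡ y
     same injective p q r = injective (≡.trans p (≡.trans r (≡.sym q)))

     mid₀-injective : ∀ {t} {i i′ : Fin t} → mid₀ i ≡ mid₀ i′ → i ≡ i′
     mid₀-injective ≡.refl = ≡.refl

     mid₁-injective : ∀ {t} {i i′ : Fin t} → mid₁ i ≡ mid₁ i′ → i ≡ i′
     mid₁-injective ≡.refl = ≡.refl

   embedding⇒square : C4 ⊆G toGraph E → Square
   embedding⇒square (φ , injective , adj) = start (φ zero) ≡.refl
     where
     start : ∀ v → φ zero ≡ v → Square
     start (inj₁ a) p₀ with step₁ p₀ (adj {zero} {suc zero} _)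
     ... | b , p₁ , ab with step₂ p₁ (adj {suc zero} {suc (suc zero)} _)
     ... | a′ , p₂ , a′b with step₁ p₂ (adj {suc (suc zero)} {suc (suc (suc zero))} _)
     ... | b′ , p₃ , a′b′ = record { a = a ; a′ = a′ ; b = b ; b′ = b′
       ; a≢a′ = λ e → contradiction (same injective p₀ p₂ (≡.cong inj₁ e)) λ ()
       ; b≢b′ = λ e → contradiction (same injective p₁ p₃ (≡.cong inj₂ e)) λ ()
       ; ab = ab ; a′b = a′b ; a′b′ = a′b′ ; ab′ = step₂₁ p₃ p₀ (adj {suc (suc (suc zero))} {zero} _) }
     start (inj₂ b) p₀ with step₂ p₀ (adj {zero} {suc zero} _)
     ... | a , p₁ , ab with step₁ p₁ (adj {suc zero} {suc (suc zero)} _)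
     ... | b′ , p₂ , ab′ with step₂ p₂ (adj {suc (suc zero)} {suc (suc (suc zero))} _)
     ... | a′ , p₃ , a′b′ = record { a = a ; a′ = a′ ; b = b ; b′ = b′
       ; a≢a′ = λ e → contradiction (same injective p₁ p₃ (≡.cong inj₁ e)) λ ()
       ; b≢b′ = λ e → contradiction (same injective p₀ p₂ (≡.cong inj₂ e)) λ ()
       ; ab = ab ; ab′ = ab′ ; a′b′ = a′b′ ; a′b = step₁₂ p₃ p₀ (adj {suc (suc (suc zero))} {zero} _) }

   square⇒embedding : Square → C4 ⊆G toGraph E
   square⇒embedding s = φ , injective , λ {x} {y} → adj x y
     where
     open Square s
     φ : Fin 4 → Fin m ⊎ Fin n
     φ zero = inj₁ a
     φ (suc zero) = inj₂ b
     φ (suc (suc zero)) = inj₁ a′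
     φ (suc (suc (suc zero))) = inj₂ b′
     injective : ∀ {x y} → φ x ≡ φ y → x ≡ y
     injective {zero} {zero} _ = ≡.refl
     injective {zero} {suc (suc zero)} e = contradiction (inj₁-injective e) a≢a′
     injective {zero} {suc (suc (suc zero))} ()
     injective {suc zero} {suc zero} _ = ≡.refl
     injective {suc zero} {suc (suc zero)} ()
     injective {suc zero} {suc (suc (suc zero))} e = contradiction (inj₂-injective e) b≢b′
     injective {suc (suc zero)} {zero} e = contradiction (≡.sym (inj₁-injective e)) a≢a′
     injective {suc (suc zero)} {suc (suc zero)} _ = ≡.refl
     injective {suc (suc zero)} {suc (suc (suc zero))} ()
     injective {suc (suc (suc zero))} {suc zero} e = contradiction (≡.sym (inj₂-injective e)) b≢b′
     injective {suc (suc (suc zero))} {suc (suc zero)} ()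
     injective {suc (suc (suc zero))} {suc (suc (suc zero))} _ = ≡.refl
     adj : ∀ x y → C4adj x y → Adj (toGraph E) (φ x) (φ y)
     adj zero (suc zero) _ = ab
     adj (suc zero) zero _ = ab
     adj (suc zero) (suc (suc zero)) _ = a′b
     adj (suc (suc zero)) (suc zero) _ = a′b
     adj (suc (suc zero)) (suc (suc (suc zero))) _ = a′b′
     adj (suc (suc (suc zero))) (suc (suc zero)) _ = a′b′
     adj (suc (suc (suc zero))) zero _ = ab′
     adj zero (suc (suc (suc zero))) _ = ab′

   embedding⇒theta : ∀ {k} → θ3 (suc k) ⊆G toGraph E → Theta (suc k)
   embedding⇒theta {k} (φ , injective , adj) = start (φ end₁) ≡.refl
     where
     start : ∀ v → φ end₁ ≡ v → Theta (suc k)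
     start (inj₁ a) p₀ = record { a = a ; b = proj₁ last ; as = proj₁ ∘ third ; bs = proj₁ ∘ second
       ; as-injective = λ {i} {i′} e → mid₁-injective (same injective (proj₁ (proj₂ (third i))) (proj₁ (proj₂ (third i′))) (≡.cong inj₁ e))
       ; bs-injective = λ {i} {i′} e → mid₀-injective (same injective (proj₁ (proj₂ (second i))) (proj₁ (proj₂ (second i′))) (≡.cong inj₂ e))
       ; as≢a = λ i e → contradiction (same injective (proj₁ (proj₂ (third i))) p₀ (≡.cong inj₁ e)) λ ()
       ; bs≢b = λ i e → contradiction (same injective (proj₁ (proj₂ (second i))) (proj₁ (proj₂ last)) (≡.cong inj₂ e)) λ ()
       ; a-bs = λ i → proj₂ (proj₂ (second i))
       ; as-bs = λ i → proj₂ (proj₂ (third i))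
       ; as-b = λ i → step₁₂ (proj₁ (proj₂ (third i))) (proj₁ (proj₂ last)) (adj (e₃ i)) }
       where
       second : ∀ i → ∃ λ b → φ (mid₀ i) ≡ inj₂ b × E a b ≡ true
       second i = step₁ p₀ (adj (e₁ i))
       third : ∀ i → ∃ λ a′ → φ (mid₁ i) ≡ inj₁ a′ × E a′ (proj₁ (second i)) ≡ true
       third i = step₂ (proj₁ (proj₂ (second i))) (adj (e₂ i))
       -- The path with index `zero` shows on which side `end₂` lies.
       last : ∃ λ b → φ end₂ ≡ inj₂ b × E (proj₁ (third zero)) b ≡ true
       last = step₁ (proj₁ (proj₂ (third zero))) (adj (e₃ zero))
     start (inj₂ b) p₀ = record { a = proj₁ last ; b = b ; as = proj₁ ∘ second ; bs = proj₁ ∘ third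
       ; as-injective = λ {i} {i′} e → mid₀-injective (same injective (proj₁ (proj₂ (second i))) (proj₁ (proj₂ (second i′))) (≡.cong inj₁ e))
       ; bs-injective = λ {i} {i′} e → mid₁-injective (same injective (proj₁ (proj₂ (third i))) (proj₁ (proj₂ (third i′))) (≡.cong inj₂ e))
       ; as≢a = λ i e → contradiction (same injective (proj₁ (proj₂ (second i))) (proj₁ (proj₂ last)) (≡.cong inj₁ e)) λ ()
       ; bs≢b = λ i e → contradiction (same injective (proj₁ (proj₂ (third i))) p₀ (≡.cong inj₂ e)) λ ()
       ; a-bs = λ i → step₂₁ (proj₁ (proj₂ (third i))) (proj₁ (proj₂ last)) (adj (e₃ i))
       ; as-bs = λ i → proj₂ (proj₂ (third i))
       ; as-b = λ i → proj₂ (proj₂ (second i)) }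
       where
       second : ∀ i → ∃ λ a → φ (mid₀ i) ≡ inj₁ a × E a b ≡ true
       second i = step₂ p₀ (adj (e₁ i))
       third : ∀ i → ∃ λ b′ → φ (mid₁ i) ≡ inj₂ b′ × E (proj₁ (second i)) b′ ≡ true
       third i = step₁ (proj₁ (proj₂ (second i))) (adj (e₂ i))
       last : ∃ λ a → φ end₂ ≡ inj₁ a × E a (proj₁ (third zero)) ≡ true
       last = step₂ (proj₁ (proj₂ (third zero))) (adj (e₃ zero))

   theta⇒embedding : ∀ {t} → Theta t → θ3 t ⊆G toGraph E
   theta⇒embedding {t} s = φ , injective , adj
     where
     open Theta s
     φ : ThetaV t → Fin m ⊎ Fin n
     φ end₁ = inj₁ a
     φ end₂ = inj₂ b
     φ (mid₀ i) = inj₂ (bs i)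
     φ (mid₁ i) = inj₁ (as i)
     injective : ∀ {x y} → φ x ≡ φ y → x ≡ y
     injective {end₁} {end₁} _ = ≡.refl
     injective {end₁} {mid₁ i} e = contradiction (≡.sym (inj₁-injective e)) (as≢a i)
     injective {end₂} {end₂} _ = ≡.refl
     injective {end₂} {mid₀ i} e = contradiction (≡.sym (inj₂-injective e)) (bs≢b i)
     injective {mid₀ i} {end₂} e = contradiction (inj₂-injective e) (bs≢b i)
     injective {mid₀ i} {mid₀ i′} e = ≡.cong mid₀ (bs-injective (inj₂-injective e))
     injective {mid₁ i} {end₁} e = contradiction (inj₁-injective e) (as≢a i)
     injective {mid₁ i} {mid₁ i′} e = ≡.cong mid₁ (as-injective (inj₁-injective e))
     adj : ∀ {x y} → ThetaAdj x y → Adj (toGraph E) (φ x) (φ y)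
     adj (e₁ i) = a-bs i
     adj (e₁' i) = a-bs i
     adj (e₂ i) = as-bs i
     adj (e₂' i) = as-bs i
     adj (e₃ i) = as-b i
     adj (e₃' i) = as-b i

-- The point-line incidence graph.

module PointLineGraph where

 open import Data.Bool using (true)
 open import Data.Fin as Fin using (Fin; toℕ; fromℕ<; inject≤)
 open import Data.Nat using (_<_; _≤_; _^_)
 open import Data.Nat.DivMod
 import Data.Nat.Divisibility as ℕ
 open import Data.Nat.Primality using (Prime; prime⇒nonZero)
 open import Data.Unit using (tt)
 open import Relation.Binary.Definitions using (tri<; tri≈; tri>)
 open ≡ using (_≡_)
 open import Relation.Nullary using (does; _×-dec_)
 open import Relation.Nullary.Decidable using (map′; dec-true)
 open import Function using (_∘_)
 open ResidueRing using (size)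
 open NormSurface
 open Configurations

 -- Digits in base `q` serve as coordinates, identifying initial segments of the vertex sets with
 -- all points and all lines.
 module Digits (q : ℕ) .{{_ : ℕ.NonZero q}} where

   digit : ℕ → ℕ → ℕ
   digit n zero = n % q
   digit n (suc i) = digit (n / q) i

   digit<q : ∀ n i → digit n i < q
   digit<q n zero = m%n<n n q
   digit<q n (suc i) = digit<q (n / q) i

   private
     quotient< : ∀ J {n} → n < q ^ suc J → n / q < q ^ J
     quotient< J {n} n< = m<n*o⇒m/o<n (≡.subst (λ z → n < z) (ℕ.*-comm q (q ^ J)) n<)

   digit-injective : ∀ J {n n′} → n < q ^ J → n′ < q ^ J → (∀ {i} → i < J → digit n i ≡ digit n′ i) → n ≡ n′
   digit-injective zero (s≤s z≤n) (s≤s z≤n) _ = ≡.refl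
   digit-injective (suc J) {n} {n′} n< n′< h = ≡.trans (m≡m%n+[m/n]*n n q) (≡.trans
     (≡.cong₂ (λ r d → r ℕ.+ d ℕ.* q) (h (s≤s z≤n)) (digit-injective J (quotient< J n<) (quotient< J n′<) (λ i<J → h (s≤s i<J))))
     (≡.sym (m≡m%n+[m/n]*n n′ q)))

   encode : ℕ → (ℕ → ℕ) → ℕ
   encode zero a = 0
   encode (suc J) a = a 0 ℕ.+ encode J (a ∘ suc) ℕ.* q

   encode< : ∀ J {a} → (∀ i → a i < q) → encode J a < q ^ J
   encode< zero a< = s≤s z≤n
   encode< (suc J) {a} a< = ℕ.≤-trans (ℕ.+-monoˡ-≤ (encode J (a ∘ suc) ℕ.* q) (a< 0))
     (ℕ.≤-trans (ℕ.*-monoˡ-≤ q (encode< J (a< ∘ suc))) (ℕ.≤-reflexive (ℕ.*-comm (q ^ J) q)))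

   digit-encode : ∀ J {a} → (∀ i → a i < q) → ∀ {i} → i < J → digit (encode J a) i ≡ a i
   digit-encode (suc J) {a} a< {zero} _ = ≡.trans ([m+kn]%n≡m%n (a 0) (encode J (a ∘ suc)) q) (m<n⇒m%n≡m (a< 0))
   digit-encode (suc J) {a} a< {suc i} (s≤s i<J) = ≡.trans (≡.cong (λ z → digit z i) quotient) (digit-encode J (a< ∘ suc) i<J)
     where
     quotient : (a 0 ℕ.+ encode J (a ∘ suc) ℕ.* q) / q ≡ encode J (a ∘ suc)
     quotient = ≡.trans (+-distrib-/-∣ʳ (a 0) (ℕ.n∣m*n (encode J (a ∘ suc)))) (≡.cong₂ ℕ._+_ (m<n⇒m/n≡0 (a< 0)) (m*n/n≡m (encode J (a ∘ suc)) q))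

 split-below : ∀ (P : ℕ → Set) j {J} → (∀ {i} → i < j → P i) → (∀ l → j ℕ.+ l < J → P (j ℕ.+ l)) → ∀ {i} → i < J → P i
 split-below P j low high {i} i<J with ℕ.<-≤-connex i j
 ... | inj₁ i<j = low i<j
 ... | inj₂ j≤i = ≡.subst P (ℕ.m+[n∸m]≡n j≤i) (high (i ℕ.∸ j) (≡.subst (_< _) (≡.sym (ℕ.m+[n∸m]≡n j≤i)) i<J))

 join : {A : Set} → ℕ → (ℕ → A) → (ℕ → A) → ℕ → A
 join j f g i with i ℕ.<? j
 ... | yes _ = f i
 ... | no _ = g (i ℕ.∸ j)

 join-∀ : {A : Set} (P : A → Set) (j : ℕ) {f g : ℕ → A} → (∀ i → P (f i)) → (∀ i → P (g i)) → ∀ i → P (join j f g i)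
 join-∀ P j pf pg i with i ℕ.<? j
 ... | yes _ = pf i
 ... | no _ = pg (i ℕ.∸ j)

 join-low : {A : Set} (j : ℕ) (f g : ℕ → A) {i : ℕ} → i < j → join j f g i ≡ f i
 join-low j f g {i} i<j with i ℕ.<? j
 ... | yes _ = ≡.refl
 ... | no i≮j = contradiction i<j i≮j

 join-high : {A : Set} (j : ℕ) (f g : ℕ → A) (i : ℕ) → join j f g (j ℕ.+ i) ≡ g i
 join-high j f g i with (j ℕ.+ i) ℕ.<? j
 ... | yes j+i<j = contradiction j+i<j (ℕ.m+n≮m j i)
 ... | no _ = ≡.cong g (ℕ.m+n∸m≡n j i)

 module Construction (F : CommutativeRing 0ℓ 0ℓ) {q : ℕ} (pr : Prime q)
   (char : CommutativeRing._≈_ F (RingNormaliser.ι F q) (CommutativeRing.0# F))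
   (_≟_ : ∀ x y → Dec (CommutativeRing._≈_ F x y))
   (domain : ∀ {x y} → CommutativeRing._≈_ F (CommutativeRing._*_ F x y) (CommutativeRing.0# F) → ¬ CommutativeRing._≈_ F x (CommutativeRing.0# F) → CommutativeRing._≈_ F y (CommutativeRing.0# F))
   (representative : ∀ x → ∃ λ n → CommutativeRing._≈_ F x (RingNormaliser.ι F n))
   (ι-injective : ∀ {i j} → i ℕ.< j → j ℕ.< q → ¬ CommutativeRing._≈_ F (RingNormaliser.ι F i) (RingNormaliser.ι F j))
   (reduce : ∀ x → ∃ λ n → n < q × CommutativeRing._≈_ F x (RingNormaliser.ι F n)) where
   private
     instance
       q-nonZero : ℕ.NonZero q
       q-nonZero = prime⇒nonZero pr
   open Geometry F pr char _≟_ domain representative ι-injective public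
   open Digits q
   open CommutativeRing F hiding (zero)
   open RingNormaliser F using (ι; ring-eq; var; _:+_; _:*_; _:-_; ⊝_; x0; x1; x2; x3)

   module _ {k} (fs : Forms k) {j} (j≤ : j ≤ size k) {m n} (m≥ : q ^ suc (suc j) ≤ m) (n≥ : q ^ (j ℕ.+ suc j) ≤ n) where
     open Incidence fs j≤
     open Point
     open Line

     digit-≈ : ∀ n n′ {i i′} → ι (digit n i) ≈ ι (digit n′ i′) → digit n i ≡ digit n′ i′
     digit-≈ n n′ {i} {i′} h with ℕ.<-cmp (digit n i) (digit n′ i′)
     ... | tri< d<d′ _ _ = contradiction h (ι-injective d<d′ (digit<q n′ i′))
     ... | tri≈ _ d≡d′ _ = d≡d′
     ... | tri> _ _ d>d′ = contradiction (sym h) (ι-injective d>d′ (digit<q n i))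

     pointOf : ℕ → Point
     pointOf c = point (ι (digit c 0)) (λ i → ι (digit c (suc i)))

     pointOf-injective : ∀ {c c′} → c < q ^ suc (suc j) → c′ < q ^ suc (suc j) → SamePoint (pointOf c) (pointOf c′) → c ≡ c′
     pointOf-injective {c} {c′} c< c′< (s≈ , w≈) = digit-injective (suc (suc j)) c< c′< coordinate
       where
       coordinate : ∀ {i} → i < suc (suc j) → digit c i ≡ digit c′ i
       coordinate {zero} _ = digit-≈ c c′ {0} {0} s≈
       coordinate {suc i} (s≤s (s≤s i≤j)) = digit-≈ c c′ {suc i} {suc i} (w≈ i≤j)

     abscissa : ℕ → ℕ → Carrier
     abscissa e = join j (λ i → ι (digit e i)) (λ _ → 0#)

     abscissa-digit : ∀ e {i} → i < j → abscissa e i ≡ ι (digit e i)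
     abscissa-digit e = join-low j (λ i → ι (digit e i)) (λ _ → 0#)

     abscissa-support : ∀ e {i} → j ≤ i → abscissa e i ≡ 0#
     abscissa-support e {i} j≤i = ≡.subst (λ z → abscissa e z ≡ 0#) (ℕ.m+[n∸m]≡n j≤i) (join-high j (λ i → ι (digit e i)) (λ _ → 0#) (i ℕ.∸ j))

     lineOf : ℕ → Line
     lineOf e = record { x = abscissa e ; y = λ i → ι (digit e (j ℕ.+ i)) ; x-support = λ h → reflexive (abscissa-support e h) }

     lineOf-injective : ∀ {e e′} → e < q ^ (j ℕ.+ suc j) → e′ < q ^ (j ℕ.+ suc j) → SameLine (lineOf e) (lineOf e′) → e ≡ e′
     lineOf-injective {e} {e′} e< e′< (x≈ , y≈) = digit-injective (j ℕ.+ suc j) e< e′< (split-below (λ i → digit e i ≡ digit e′ i) j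
       (λ {i} i<j → digit-≈ e e′ {i} {i} (≡.subst₂ _≈_ (abscissa-digit e i<j) (abscissa-digit e′ i<j) (x≈ i<j)))
       (λ l j+l< → digit-≈ e e′ {j ℕ.+ l} {j ℕ.+ l} (y≈ (ℕ.s≤s⁻¹ (ℕ.+-cancelˡ-< j l (suc j) j+l<)))))

     OnCoordinate : Point → Line → ℕ → Set
     OnCoordinate p l i = w p i ≈ y l i + s p * direction (x l) i

     onCoordinate? : ∀ p l i → Dec (OnCoordinate p l i)
     onCoordinate? p l i = w p i ≟ (y l i + s p * direction (x l) i)

     On? : ∀ p l → Dec (On p l)
     On? p l = map′ (λ h {i} i≤j → h {i} (s≤s i≤j)) (λ h {i} i<1+j → h {i} (ℕ.s≤s⁻¹ i<1+j)) (ℕ.allUpTo? {P = OnCoordinate p l} (onCoordinate? p l) (suc j))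

     -- Vertices beyond the `q^(j+2)` points and the `q^(2j+1)` lines are isolated, so the two parts
     -- may be larger than the geometry.
     Edge : ℕ → ℕ → Set
     Edge a b = a < q ^ suc (suc j) × b < q ^ (j ℕ.+ suc j) × On (pointOf a) (lineOf b)

     edge? : ∀ a b → Dec (Edge a b)
     edge? a b = (a ℕ.<? q ^ suc (suc j)) ×-dec ((b ℕ.<? q ^ (j ℕ.+ suc j)) ×-dec On? (pointOf a) (lineOf b))

     graph : BipGraph m n
     graph a b = does (edge? (toℕ a) (toℕ b))

     edge : ∀ {a b} → graph a b ≡ true → Edge (toℕ a) (toℕ b)
     edge {a} {b} h = holds (edge? (toℕ a) (toℕ b)) h
       where
       holds : ∀ {P : Set} (d : Dec P) → does d ≡ true → P
       holds (yes p) _ = p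

     no-square : ¬ Square graph
     no-square sq = separate (two-points (lineOf (toℕ b)) (lineOf (toℕ b′)) (proj₂ (proj₂ (edge ab))) (proj₂ (proj₂ (edge a′b))) (proj₂ (proj₂ (edge ab′))) (proj₂ (proj₂ (edge a′b′))))
       where
       open Square sq
       separate : SamePoint (pointOf (toℕ a)) (pointOf (toℕ a′)) ⊎ SameLine (lineOf (toℕ b)) (lineOf (toℕ b′)) → ⊥
       separate (inj₁ h) = a≢a′ (Fin.toℕ-injective (pointOf-injective (proj₁ (edge ab)) (proj₁ (edge a′b)) h))
       separate (inj₂ h) = b≢b′ (Fin.toℕ-injective (lineOf-injective (proj₁ (proj₂ (edge ab))) (proj₁ (proj₂ (edge ab′))) h))

     no-theta : ¬ Theta graph (suc k)
     no-theta θ = impossible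
       where
       open Theta θ renaming (a to a₀; b to b₀)
       open Incidence.ParallelPaths fs j≤ (pointOf (toℕ a₀)) (lineOf (toℕ b₀)) (λ i → pointOf (toℕ (as i))) (λ i → lineOf (toℕ (bs i)))
         (λ i → proj₂ (proj₂ (edge (a-bs i)))) (λ i → proj₂ (proj₂ (edge (as-bs i)))) (λ i → proj₂ (proj₂ (edge (as-b i))))
         (λ {i} {i′} h → bs-injective (Fin.toℕ-injective (lineOf-injective (proj₁ (proj₂ (edge (a-bs i)))) (proj₁ (proj₂ (edge (a-bs i′)))) h)))
         (λ i h → bs≢b i (Fin.toℕ-injective (lineOf-injective (proj₁ (proj₂ (edge (a-bs i)))) (proj₁ (proj₂ (edge (as-b i)))) h)))
         (λ i h → as≢a i (Fin.toℕ-injective (pointOf-injective (proj₁ (edge (as-bs i))) (proj₁ (edge (a-bs i))) h)))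

     free : Free (C4 ∷ᶠ (θ3 (suc k) ∷ᶠ []ᶠ)) (toGraph graph)
     free = (λ c → no-square (embedding⇒square graph c)) , (λ θ → no-theta (embedding⇒theta graph θ)) , tt

     -- Through a given point there is one line for each of the `q^j` choices of abscissas:
     -- incidence determines the ordinates.
     module _ (c e : ℕ) where

       intercept : ℕ → Carrier
       intercept i = w (pointOf c) i - s (pointOf c) * direction (abscissa e) i

       intercept′ : ℕ → ℕ
       intercept′ i = proj₁ (reduce (intercept i))

       coordinates : ℕ → ℕ
       coordinates = join j (digit e) intercept′

       coordinates<q : ∀ i → coordinates i < q
       coordinates<q = join-∀ (_< q) j (digit<q e) (λ i → proj₁ (proj₂ (reduce (intercept i))))

       coordinates-abscissa : ∀ {i} → i < j → coordinates i ≡ digit e i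
       coordinates-abscissa = join-low j (digit e) intercept′

       coordinates-ordinate : ∀ i → coordinates (j ℕ.+ i) ≡ intercept′ i
       coordinates-ordinate = join-high j (digit e) intercept′

       lineThrough : ℕ
       lineThrough = encode (j ℕ.+ suc j) coordinates

       lineThrough< : lineThrough < q ^ (j ℕ.+ suc j)
       lineThrough< = encode< (j ℕ.+ suc j) coordinates<q

       digit-lineThrough : ∀ {i} → i < j → digit lineThrough i ≡ digit e i
       digit-lineThrough i<j = ≡.trans (digit-encode (j ℕ.+ suc j) coordinates<q (ℕ.<-≤-trans i<j (ℕ.m≤m+n j (suc j)))) (coordinates-abscissa i<j)

       on-lineThrough : On (pointOf c) (lineOf lineThrough)
       on-lineThrough {i} i≤j = sym (trans (+-cong ordinate (*-congˡ (direction-cong (lineOf lineThrough) (lineOf e) same-abscissa i))) (cancel W σ D))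
         where
         W σ D : Carrier
         W = w (pointOf c) i
         σ = s (pointOf c)
         D = direction (abscissa e) i
         same-abscissa : ∀ {i} → i < j → abscissa lineThrough i ≈ abscissa e i
         same-abscissa i<j = reflexive (≡.trans (abscissa-digit lineThrough i<j) (≡.trans (≡.cong ι (digit-lineThrough i<j)) (≡.sym (abscissa-digit e i<j))))
         ordinate : ι (digit lineThrough (j ℕ.+ i)) ≈ W - σ * D
         ordinate = trans (reflexive (≡.cong ι (≡.trans (digit-encode (j ℕ.+ suc j) coordinates<q (ℕ.+-monoʳ-< j (s≤s i≤j))) (coordinates-ordinate i)))) (sym (proj₂ (proj₂ (reduce (intercept i)))))
         cancel : ∀ W σ D → (W - σ * D) + σ * D ≈ W
         cancel W σ D = ring-eq (W ∷ σ ∷ D ∷ []) (x0 :- x1 :* x2 :+ x1 :* x2) x0 ≡.refl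

     column : Fin (q ^ suc (suc j)) → Fin (q ^ j) → Fin n
     column c e = fromℕ< (ℕ.<-≤-trans (lineThrough< (toℕ c) (toℕ e)) n≥)

     toℕ-column : ∀ c e → toℕ (column c e) ≡ lineThrough (toℕ c) (toℕ e)
     toℕ-column c e = Fin.toℕ-fromℕ< (ℕ.<-≤-trans (lineThrough< (toℕ c) (toℕ e)) n≥)

     column-injective : ∀ c {e e′} → column c e ≡ column c e′ → e ≡ e′
     column-injective c {e} {e′} h = Fin.toℕ-injective (digit-injective j (Fin.toℕ<n e) (Fin.toℕ<n e′) λ {i} i<j →
       ≡.trans (≡.sym (digit-lineThrough (toℕ c) (toℕ e) i<j)) (≡.trans (≡.cong (λ z → digit z i) (≡.trans (≡.sym (toℕ-column c e)) (≡.trans (≡.cong toℕ h) (toℕ-column c e′))))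
         (digit-lineThrough (toℕ c) (toℕ e′) i<j)))

     graph-true : ∀ a b → Edge (toℕ a) (toℕ b) → graph a b ≡ true
     graph-true a b = dec-true (edge? (toℕ a) (toℕ b))

     present : ∀ c e → graph (inject≤ c m≥) (column c e) ≡ true
     present c e = graph-true (inject≤ c m≥) (column c e) (≡.subst₂ Edge (≡.sym (Fin.toℕ-inject≤ c m≥)) (≡.sym (toℕ-column c e))
       (Fin.toℕ<n c , lineThrough< (toℕ c) (toℕ e) , on-lineThrough (toℕ c) (toℕ e)))

     many-edges : q ^ suc (suc j) ℕ.* q ^ j ≤ edges graph
     many-edges = edges-≥ graph (λ c → inject≤ c m≥) (λ e → Fin.inject≤-injective m≥ m≥ _ _ e) column column-injective present

   exists : ∀ {k j m n} → j ≤ size k → q ^ suc (suc j) ≤ m → q ^ (j ℕ.+ suc j) ≤ n →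
     ¬ ¬ ∃ λ (E : BipGraph m n) → Free (C4 ∷ᶠ (θ3 (suc k) ∷ᶠ []ᶠ)) (toGraph E) × q ^ suc (suc j) ℕ.* q ^ j ≤ edges E
   exists {k} j≤ m≥ n≥ none = forms k λ fs → none (graph fs j≤ m≥ n≥ , free fs j≤ m≥ n≥ , many-edges fs j≤ m≥ n≥)

-- The lower bound.

module LowerEstimate where

 open import Data.Nat using (_+_; _*_; _^_; _≤_; _<_; _⊔_)
 open import Data.Nat.Primality using (Prime)
 open import Data.Product using (Σ)
 open ≡ using (_≡_)
 open import Relation.Nullary.Decidable using (decidable-stable)
 open RationalArithmetic using (module ℚₚ)
 open ResidueRing
 open PointLineGraph
 open PrimeGaps using (prime-gap)

 open ℕ.≤-Reasoning

 *-^ : ∀ x y n → (x * y) ^ n ≡ x ^ n * y ^ n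
 *-^ x y zero = ≡.refl
 *-^ x y (suc n) = ≡.trans (≡.cong (x * y *_) (*-^ x y n)) (ℕ.[m*n]*[o*p]≡[m*o]*[n*p] x y (x ^ n) (y ^ n))

 ^-swap : ∀ x m n → (x ^ m) ^ n ≡ (x ^ n) ^ m
 ^-swap x m n = ≡.trans (ℕ.^-*-assoc x m n) (≡.trans (≡.cong (x ^_) (ℕ.*-comm m n)) (≡.sym (ℕ.^-*-assoc x n m)))

 ^-cancel-< : ∀ n {x y} → x ^ n < y ^ n → x < y
 ^-cancel-< n h = ℕ.≰⇒> λ y≤x → ℕ.<⇒≱ h (ℕ.^-monoˡ-≤ n y≤x)

 root : ∀ D n → ∃ λ Y → Y ^ suc D ≤ n × n < suc Y ^ suc D
 root D zero = 0 , z≤n , ℕ.m^n>0 1 (suc D)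
 root D (suc n) with root D n
 ... | Y , Y≤ , n< with suc Y ^ suc D ℕ.≤? suc n
 ... | yes h = suc Y , h , ℕ.≤-<-trans n< (ℕ.^-monoˡ-< (suc D) (ℕ.n<1+n (suc Y)))
 ... | no h = Y , ℕ.m≤n⇒m≤1+n Y≤ , ℕ.≰⇒> h

 -- `(1 + 1/K)^d ≤ (c+d)/c`: the factor `(K+1)/K` is at most each of `(c+1)/c`, `(c+2)/(c+1)` and so
 -- on, as long as the denominators do not exceed `K`.
 bernoulli : ∀ K d c → c + d ≤ suc K → suc K ^ d * c ≤ K ^ d * (c + d)
 bernoulli K zero c _ = ℕ.≤-reflexive (≡.cong (_+ 0) (≡.sym (ℕ.+-identityʳ c)))
 bernoulli K (suc d) c h = begin
   suc K ^ suc d * c ≡⟨ ≡.trans (≡.cong (_* c) (ℕ.*-comm (suc K) (suc K ^ d))) (ℕ.*-assoc (suc K ^ d) (suc K) c) ⟩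
   suc K ^ d * (suc K * c) ≤⟨ ℕ.*-monoʳ-≤ (suc K ^ d) step ⟩
   suc K ^ d * (suc c * K) ≡⟨ ℕ.*-assoc (suc K ^ d) (suc c) K ⟨
   suc K ^ d * suc c * K ≤⟨ ℕ.*-monoˡ-≤ K (bernoulli K d (suc c) (≡.subst (_≤ suc K) (ℕ.+-suc c d) h)) ⟩
   K ^ d * suc (c + d) * K ≡⟨ ≡.trans (ℕ.*-comm (K ^ d * suc (c + d)) K) (≡.sym (ℕ.*-assoc K (K ^ d) (suc (c + d)))) ⟩
   K ^ suc d * suc (c + d) ≡⟨ ≡.cong (K ^ suc d *_) (ℕ.+-suc c d) ⟨
   K ^ suc d * (c + suc d) ∎
   where
   step : suc K * c ≤ suc c * K
   step = begin
     c + K * c ≤⟨ ℕ.+-mono-≤ (ℕ.≤-trans (ℕ.m≤m+n c d) (ℕ.s≤s⁻¹ (≡.subst (_≤ suc K) (ℕ.+-suc c d) h))) (ℕ.≤-reflexive (ℕ.*-comm K c)) ⟩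
     K + c * K ∎

 -- `c = p d + 1` is large enough for `p (c+d) < (p+1) c`.
 close-ratio : ∀ {p r} d → p < r → ∃ λ K → 1 ≤ K × p * suc K ^ d ≤ r * K ^ d
 close-ratio {p} {r} d p<r = K , s≤s z≤n , ℕ.*-cancelʳ-≤ (p * suc K ^ d) (r * K ^ d) c (begin
   p * suc K ^ d * c ≡⟨ ℕ.*-assoc p (suc K ^ d) c ⟩
   p * (suc K ^ d * c) ≤⟨ ℕ.*-monoʳ-≤ p (bernoulli K d c (ℕ.n≤1+n K)) ⟩
   p * (K ^ d * (c + d)) ≡⟨ ≡.trans (≡.cong (p *_) (ℕ.*-comm (K ^ d) (c + d))) (≡.sym (ℕ.*-assoc p (c + d) (K ^ d))) ⟩
   p * (c + d) * K ^ d ≤⟨ ℕ.*-monoˡ-≤ (K ^ d) ratio ⟩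
   r * c * K ^ d ≡⟨ ≡.trans (ℕ.*-assoc r c (K ^ d)) (≡.trans (≡.cong (r *_) (ℕ.*-comm c (K ^ d))) (≡.sym (ℕ.*-assoc r (K ^ d) c))) ⟩
   r * K ^ d * c ∎)
   where
   c K : ℕ
   c = suc (p * d)
   K = c + d
   ratio : p * (c + d) ≤ r * c
   ratio = begin
     p * (c + d) ≡⟨ ℕ.*-distribˡ-+ p c d ⟩
     p * c + p * d ≤⟨ ℕ.+-monoʳ-≤ (p * c) (ℕ.n≤1+n (p * d)) ⟩
     p * c + c ≡⟨ ℕ.+-comm (p * c) c ⟩
     suc p * c ≤⟨ ℕ.*-monoˡ-≤ c p<r ⟩
     r * c ∎

 module _ {k j : ℕ} (j≤ : j ≤ size k) where
   private
     -- The exponents `2j - 1` and `2j` of the theorem, whose `j` is `suc j` here.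
     D e : ℕ
     D = j + suc j
     e = suc (suc j) + j

   -- That the points fit, `q^(j+2) ≤ m`, is seen by raising to the power `D`. The graph exists only
   -- up to double negation, which the decidable conclusion absorbs.
   dense-graph : ∀ {q n m x} → Prime q → q ^ D ≤ n → n ^ suc (suc j) < suc m ^ D → IsBipEx n m (C4 ∷ᶠ (θ3 (suc k) ∷ᶠ []ᶠ)) x → q ^ e ≤ x
   dense-graph {q} {n} {m} {x} pr q≤n n<m (_ , maximal) = decidable-stable (q ^ e ℕ.≤? x) λ few →
     Construction.exists residues pr char _≟_ (zero-divisor-free pr) (λ a → proj₁ (reduce pr a) , proj₂ (proj₂ (reduce pr a))) (ι-injective pr) (reduce pr)
       j≤ (ℕ.s≤s⁻¹ (^-cancel-< D (begin-strict
         (q ^ suc (suc j)) ^ D ≡⟨ ^-swap q (suc (suc j)) D ⟩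
         (q ^ D) ^ suc (suc j) ≤⟨ ℕ.^-monoˡ-≤ (suc (suc j)) q≤n ⟩
         n ^ suc (suc j) <⟨ n<m ⟩
         suc m ^ D ∎))) q≤n
       λ { (E , free , many) → few (ℕ.≤-trans (ℕ.≤-reflexive (ℕ.^-distribˡ-+-* q (suc (suc j)) j)) (ℕ.≤-trans many (maximal E free))) }
     where open Residues q

   -- For the integer root `Y` of `n`, going from `Y + 1` to `Y` and from `Y` to the prime `q` costs
   -- a factor `(K+1)/K` each. Raised to the power `e`, this is the exponent `e + e` in
   -- `close-ratio`.
   lower-bound : ∀ p r → p < r → Σ ℕ λ N → ∀ n m x → N ≤ n → n ^ suc (suc j) < suc m ^ D → IsBipEx n m (C4 ∷ᶠ (θ3 (suc k) ∷ᶠ []ᶠ)) x →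
     p ^ D * n ^ e ≤ r ^ D * x ^ D
   lower-bound p r p<r with close-ratio (e + e) p<r
   ... | K , 1≤K , K-close with prime-gap K 1≤K
   ... | N , gap = (N ⊔ K) ^ D , bound
     where
     bound : ∀ n m x → (N ⊔ K) ^ D ≤ n → n ^ suc (suc j) < suc m ^ D → IsBipEx n m (C4 ∷ᶠ (θ3 (suc k) ∷ᶠ []ᶠ)) x → p ^ D * n ^ e ≤ r ^ D * x ^ D
     bound n m x N≤n n<m ex with root (j + j) n
     ... | Y , Y≤n , n<Y = with-prime (gap Y (ℕ.≤-trans (ℕ.m≤m⊔n N K) M≤Y))
       where
       D≡ : suc (j + j) ≡ D
       D≡ = ≡.sym (ℕ.+-suc j j)
       n<Y′ : n < suc Y ^ D
       n<Y′ = ≡.subst (λ z → n < suc Y ^ z) D≡ n<Y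
       M≤Y : N ⊔ K ≤ Y
       M≤Y = ℕ.s≤s⁻¹ (^-cancel-< D (ℕ.≤-<-trans N≤n n<Y′))
       with-prime : (∃ λ q → Prime q × q ≤ Y × K * Y ≤ suc K * q) → p ^ D * n ^ e ≤ r ^ D * x ^ D
       with-prime (q , pr , q≤Y , close) = begin
         p ^ D * n ^ e ≤⟨ ℕ.*-monoʳ-≤ (p ^ D) (ℕ.^-monoˡ-≤ e (ℕ.<⇒≤ n<Y′)) ⟩
         p ^ D * (suc Y ^ D) ^ e ≡⟨ ≡.trans (≡.cong (p ^ D *_) (^-swap (suc Y) D e)) (≡.sym (*-^ p (suc Y ^ e) D)) ⟩
         (p * suc Y ^ e) ^ D ≤⟨ ℕ.^-monoˡ-≤ D main ⟩
         (r * q ^ e) ^ D ≡⟨ *-^ r (q ^ e) D ⟩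
         r ^ D * (q ^ e) ^ D ≤⟨ ℕ.*-monoʳ-≤ (r ^ D) (ℕ.^-monoˡ-≤ D (dense-graph pr (≡.subst (λ z → q ^ z ≤ n) D≡ (ℕ.≤-trans (ℕ.^-monoˡ-≤ (suc (j + j)) q≤Y) Y≤n)) n<m ex)) ⟩
         r ^ D * x ^ D ∎
         where
         near : K * K * suc Y ≤ suc K * suc K * q
         near = begin
           K * K * suc Y ≡⟨ ℕ.*-assoc K K (suc Y) ⟩
           K * (K * suc Y) ≡⟨ ≡.cong (K *_) (ℕ.*-suc K Y) ⟩
           K * (K + K * Y) ≤⟨ ℕ.*-monoʳ-≤ K (ℕ.+-monoˡ-≤ (K * Y) (ℕ.≤-trans (ℕ.m≤n⊔m N K) M≤Y)) ⟩
           K * (suc K * Y) ≡⟨ ≡.trans (≡.sym (ℕ.*-assoc K (suc K) Y)) (≡.trans (≡.cong (_* Y) (ℕ.*-comm K (suc K))) (ℕ.*-assoc (suc K) K Y)) ⟩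
           suc K * (K * Y) ≤⟨ ℕ.*-monoʳ-≤ (suc K) close ⟩
           suc K * (suc K * q) ≡⟨ ℕ.*-assoc (suc K) (suc K) q ⟨
           suc K * suc K * q ∎
         square : ∀ z → (z * z) ^ e ≡ z ^ (e + e)
         square z = ≡.trans (*-^ z z e) (≡.sym (ℕ.^-distribˡ-+-* z e e))
         main : p * suc Y ^ e ≤ r * q ^ e
         main = ℕ.*-cancelˡ-≤ (K ^ (e + e)) {{ℕ.m^n≢0 K (e + e) {{ℕ.>-nonZero 1≤K}}}} (begin
           K ^ (e + e) * (p * suc Y ^ e) ≡⟨ move (K ^ (e + e)) p (suc Y ^ e) ⟩
           p * (K ^ (e + e) * suc Y ^ e) ≡⟨ ≡.cong (p *_) (≡.trans (≡.cong (_* suc Y ^ e) (≡.sym (square K))) (≡.sym (*-^ (K * K) (suc Y) e))) ⟩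
           p * (K * K * suc Y) ^ e ≤⟨ ℕ.*-monoʳ-≤ p (ℕ.^-monoˡ-≤ e near) ⟩
           p * (suc K * suc K * q) ^ e ≡⟨ ≡.cong (p *_) (≡.trans (*-^ (suc K * suc K) q e) (≡.cong (_* q ^ e) (square (suc K)))) ⟩
           p * (suc K ^ (e + e) * q ^ e) ≡⟨ ℕ.*-assoc p (suc K ^ (e + e)) (q ^ e) ⟨
           p * suc K ^ (e + e) * q ^ e ≤⟨ ℕ.*-monoˡ-≤ (q ^ e) K-close ⟩
           r * K ^ (e + e) * q ^ e ≡⟨ ≡.trans (ℕ.*-assoc r (K ^ (e + e)) (q ^ e)) (move r (K ^ (e + e)) (q ^ e)) ⟩
           K ^ (e + e) * (r * q ^ e) ∎)
           where
           move : ∀ a b c → a * (b * c) ≡ b * (a * c)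
           move a b c = ≡.trans (≡.sym (ℕ.*-assoc a b c)) (≡.trans (≡.cong (_* c) (ℕ.*-comm a b)) (ℕ.*-assoc b a c))

-- Counting paths of length 3.

module PathCount where

 open import Data.Bool using (Bool; true; _∧_)
 open import Data.Fin as Fin using (Fin; zero; suc; punchIn)
 open import Data.Nat using (_*_; _∸_; _≤_)
 open ≡ using (_≡_; _≢_)
 open import Relation.Nullary using (does; ¬?)
 open import Relation.Nullary.Decidable using (dec-true)
 open import Function using (_∘_)
 open Configurations
 open import Algebra.Properties.Semiring.Sum ℕ.+-*-semiring using (*-distribˡ-sum; *-distribʳ-sum)

 sum-mono : ∀ {n} {f g : Fin n → ℕ} → (∀ i → f i ≤ g i) → sum f ≤ sum g
 sum-mono {zero} h = z≤n
 sum-mono {suc n} h = ℕ.+-mono-≤ (h zero) (sum-mono (h ∘ suc))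

 sum-≤-const : ∀ {n c} {f : Fin n → ℕ} → (∀ i → f i ≤ c) → sum f ≤ n * c
 sum-≤-const {zero} h = z≤n
 sum-≤-const {suc n} h = ℕ.+-mono-≤ (h zero) (sum-≤-const (h ∘ suc))

 _≢ᵇ_ : ∀ {n} → Fin n → Fin n → Bool
 i ≢ᵇ j = does (¬? (i Fin.≟ j))

 ≢ᵇ-sound : ∀ {n} {i j : Fin n} → i ≢ᵇ j ≡ true → i ≢ j
 ≢ᵇ-sound {i = i} {j} h with i Fin.≟ j
 ... | no i≢j = i≢j

 sum-others : ∀ {n} (j : Fin n) (f : Fin n → Bool) → sum (𝟙 ∘ f) ∸ 1 ≤ sum (λ i → 𝟙 (j ≢ᵇ i ∧ f i))
 sum-others {suc n} j f = ℕ.≤-trans (ℕ.≤-reflexive (≡.cong (_∸ 1) (sum-remove {i = j} (𝟙 ∘ f))))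
   (ℕ.≤-trans (ℕ.∸-monoˡ-≤ 1 (ℕ.+-monoˡ-≤ (sum (𝟙 ∘ f ∘ punchIn j)) (𝟙≤1 (f j))))
     (ℕ.≤-trans (sum-mono {n} (λ i → ℕ.≤-reflexive (≡.cong (λ z → 𝟙 (z ∧ f (punchIn j i))) (≡.sym (dec-true (¬? (j Fin.≟ punchIn j i)) (λ e → Fin.punchInᵢ≢i j i (≡.sym e)))))))
       (ℕ.≤-trans (ℕ.m≤n+m (sum (λ i → 𝟙 (j ≢ᵇ punchIn j i ∧ f (punchIn j i)))) (𝟙 (j ≢ᵇ j ∧ f j))) (ℕ.≤-reflexive (≡.sym (sum-remove {i = j} (λ i → 𝟙 (j ≢ᵇ i ∧ f i))))))))

 ∧-true : ∀ {x y} → x ∧ y ≡ true → x ≡ true × y ≡ true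
 ∧-true {true} {true} _ = ≡.refl , ≡.refl

 module _ {m n} (E : BipGraph m n) where

   rowDegree : Fin m → ℕ
   rowDegree a = sum (λ b → 𝟙 (E a b))

   columnDegree : Fin n → ℕ
   columnDegree b = sum (λ a → 𝟙 (E a b))

   -- The path `a`, `b′`, `a′`, `b`. The grouping makes the count for a fixed middle edge a product
   -- of a sum over `a` and a sum over `b`.
   path : Fin m → Fin n → Fin n → Fin m → Bool
   path a b b′ a′ = E a′ b′ ∧ ((a′ ≢ᵇ a ∧ E a b′) ∧ (b′ ≢ᵇ b ∧ E a′ b))

   record Path (a : Fin m) (b b′ : Fin n) (a′ : Fin m) : Set where
     field
       ≢a : a′ ≢ a
       ≢b : b′ ≢ b
       first : E a b′ ≡ true
       middle : E a′ b′ ≡ true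
       last : E a′ b ≡ true

   path-sound : ∀ {a b b′ a′} → path a b b′ a′ ≡ true → Path a b b′ a′
   path-sound {a} {b} {b′} {a′} h with ∧-true {E a′ b′} h
   ... | middle , h′ with ∧-true {a′ ≢ᵇ a ∧ E a b′} h′
   ... | p , p′ with ∧-true {a′ ≢ᵇ a} p | ∧-true {b′ ≢ᵇ b} p′
   ... | ≢a , first | ≢b , last = record { ≢a = ≢ᵇ-sound ≢a ; ≢b = ≢ᵇ-sound ≢b ; first = first ; middle = middle ; last = last }

   pathsThrough : Fin m → Fin n → Fin n → ℕ
   pathsThrough a b b′ = sum (λ a′ → 𝟙 (path a b b′ a′))

   paths-from-edge : ∀ a′ b′ → 𝟙 (E a′ b′) * ((columnDegree b′ ∸ 1) * (rowDegree a′ ∸ 1)) ≤ sum (λ a → sum (λ b → 𝟙 (path a b b′ a′)))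
   paths-from-edge a′ b′ = ℕ.≤-trans (ℕ.*-monoʳ-≤ x (ℕ.*-mono-≤ (sum-others a′ (λ a → E a b′)) (sum-others b′ (λ b → E a′ b)))) (ℕ.≤-reflexive (≡.sym equal))
     where
     x : ℕ
     x = 𝟙 (E a′ b′)
     u : Fin m → ℕ
     u a = 𝟙 (a′ ≢ᵇ a ∧ E a b′)
     v : Fin n → ℕ
     v b = 𝟙 (b′ ≢ᵇ b ∧ E a′ b)
     equal : sum (λ a → sum (λ b → 𝟙 (path a b b′ a′))) ≡ x * (sum u * sum v)
     equal = ≡.trans (sum-cong-≗ (λ a → ≡.trans (sum-cong-≗ (λ b → ≡.trans (𝟙-∧ (E a′ b′) _) (≡.cong (x *_) (𝟙-∧ (a′ ≢ᵇ a ∧ E a b′) (b′ ≢ᵇ b ∧ E a′ b)))))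
         (≡.trans (≡.sym (*-distribˡ-sum x (λ b → u a * v b))) (≡.cong (x *_) (≡.sym (*-distribˡ-sum (u a) v))))))
       (≡.trans (≡.sym (*-distribˡ-sum x (λ a → u a * sum v))) (≡.cong (x *_) (≡.sym (*-distribʳ-sum (sum v) u))))

   sum-rotate : ∀ (f : Fin m → Fin n → Fin m → Fin n → ℕ) →
     sum (λ a′ → sum (λ b′ → sum (λ a → sum (λ b → f a′ b′ a b)))) ≡ sum (λ a → sum (λ b → sum (λ b′ → sum (λ a′ → f a′ b′ a b))))
   sum-rotate f = ≡.trans (sum-cong-≗ (λ a′ → ∑-comm (λ b′ a → sum (λ b → f a′ b′ a b))))
     (≡.trans (∑-comm (λ a′ a → sum (λ b′ → sum (λ b → f a′ b′ a b))))
       (sum-cong-≗ (λ a → ≡.trans (sum-cong-≗ (λ a′ → ∑-comm (λ b′ b → f a′ b′ a b)))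
         (≡.trans (∑-comm (λ a′ b → sum (λ b′ → f a′ b′ a b))) (sum-cong-≗ (λ b → ∑-comm (λ a′ b′ → f a′ b′ a b)))))))

   module _ (no-square : ¬ Square E) {k} (no-theta : ¬ Theta E (suc k)) where

     -- Two choices of `a′` would both be adjacent to `b` and to `b′`.
     pathsThrough≤1 : ∀ a b b′ → pathsThrough a b b′ ≤ 1
     pathsThrough≤1 a b b′ = ℕ.≮⇒≥ λ two → two-paths (selection _ (λ a′ → 𝟙≤1 (path a b b′ a′)) two)
       where
       two-paths : ¬ ∃ λ (g : Fin 2 → Fin m) → (∀ {i i′} → g i ≡ g i′ → i ≡ i′) × (∀ i → 1 ≤ 𝟙 (path a b b′ (g i)))
       two-paths (g , injective , h) = no-square record { a = g zero ; a′ = g (suc zero) ; b = b ; b′ = b′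
         ; a≢a′ = λ e → contradiction (injective e) λ () ; b≢b′ = λ e → Path.≢b p (≡.sym e)
         ; ab = Path.last p ; ab′ = Path.middle p ; a′b = Path.last p′ ; a′b′ = Path.middle p′ }
         where
         p : Path a b b′ (g zero)
         p = path-sound (1≤𝟙 (h zero))
         p′ : Path a b b′ (g (suc zero))
         p′ = path-sound (1≤𝟙 (h (suc zero)))

     -- Paths with different `b′` also have different `a′`, for a common one would form a square
     -- with `a`. Hence `k + 1` paths would be internally disjoint.
     few-paths : ∀ a b → sum (pathsThrough a b) ≤ k
     few-paths a b = ℕ.≮⇒≥ λ many → theta (selection (pathsThrough a b) (pathsThrough≤1 a b) many)
       where
       theta : ¬ ∃ λ (g : Fin (suc k) → Fin n) → (∀ {i i′} → g i ≡ g i′ → i ≡ i′) × (∀ i → 1 ≤ pathsThrough a b (g i))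
       theta (bs , injective , h) = no-theta record { a = a ; b = b ; as = as ; bs = bs ; as-injective = as-injective ; bs-injective = injective
         ; as≢a = λ i → Path.≢a (p i) ; bs≢b = λ i → Path.≢b (p i) ; a-bs = λ i → Path.first (p i) ; as-bs = λ i → Path.middle (p i) ; as-b = λ i → Path.last (p i) }
         where
         chosen : ∀ i → ∃ λ (g : Fin 1 → Fin m) → (∀ {i i′} → g i ≡ g i′ → i ≡ i′) × (∀ l → 1 ≤ 𝟙 (path a b (bs i) (g l)))
         chosen i = selection _ (λ a′ → 𝟙≤1 (path a b (bs i) a′)) (h i)
         as : Fin (suc k) → Fin m
         as i = proj₁ (chosen i) zero
         p : ∀ i → Path a b (bs i) (as i)
         p i = path-sound (1≤𝟙 (proj₂ (proj₂ (chosen i)) zero))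
         as-injective : ∀ {i i′} → as i ≡ as i′ → i ≡ i′
         as-injective {i} {i′} e with i Fin.≟ i′
         ... | yes i≡i′ = i≡i′
         ... | no i≢i′ = contradiction (record { a = a ; a′ = as i ; b = bs i ; b′ = bs i′
           ; a≢a′ = λ e′ → Path.≢a (p i) (≡.sym e′) ; b≢b′ = λ e′ → i≢i′ (injective e′)
           ; ab = Path.first (p i) ; ab′ = Path.first (p i′) ; a′b = Path.middle (p i) ; a′b′ = ≡.subst (λ z → E z (bs i′) ≡ true) (≡.sym e) (Path.middle (p i′)) }) no-square

     path-count : sum (λ a → sum (λ b → 𝟙 (E a b) * ((columnDegree b ∸ 1) * (rowDegree a ∸ 1)))) ≤ m * (n * k)
     path-count = ℕ.≤-trans (sum-mono (λ a′ → sum-mono (λ b′ → paths-from-edge a′ b′)))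
       (ℕ.≤-trans (ℕ.≤-reflexive (sum-rotate (λ a′ b′ a b → 𝟙 (path a b b′ a′)))) (sum-≤-const (λ a → sum-≤-const (λ b → few-paths a b))))

-- From the path count to a bound for the cube of the number of edges.

module UpperEstimate where

 open import Data.Bool using (true; false)
 open import Data.Fin as Fin using (Fin; zero; suc)
 open import Data.Nat using (_∸_)
 open import Relation.Binary.PropositionalEquality
 open import Function using (_∘_)
 open RationalArithmetic
 open MertensEstimates using (ι*rec′)
 open Configurations hiding (sum-remove)
 open PathCount
 open LowerEstimate using (*-^; ^-cancel-<; close-ratio)
 open import Algebra.Properties.Semiring.Sum ℚₚ.semiring as ℚΣ using (∑-distrib-+; *-distribˡ-sum; *-distribʳ-sum) renaming (sum to ∑; ∑-comm to ∑-swap; sum-cong-≗ to ∑-cong)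

 0≤square : ∀ x → 0ℚ ≤ x * x
 0≤square x with ≤-total 0ℚ x
 ... | inj₁ h = 0≤* h h
 ... | inj₂ h = lin (x ∷ []) 0 (nat 0) (x0 :* x0) ((le x0 (nat 0) h) ⊛ (le x0 (nat 0) h)) refl

 -- AM-GM for `1/(uv)`, `u` and `v`. The certificate is `4 + 4uv(u+v-3) = v(2u+v-3)² +
 -- (1-v)²(4-v)`, with `4 - v = 1 + u + (3-u-v)`.
 am-gm : ∀ u v → 0ℚ ≤ u → 0ℚ ≤ v → u + v ≤ ι 3 → 0ℚ ≤ 1ℚ + (u * v) * (u + v - ι 3)
 am-gm u v hu hv h = lin (u ∷ v ∷ []) 3 (nat 0) (one :+ x0 :* x1 :* (x0 :+ x1 :- nat 3)) (nn ((one :- x1) :* (one :- x1)) (0≤square (1ℚ - v))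
     ⊞
     (nn ((nat 2 :* x0 :+ x1 :- nat 3) :* (nat 2 :* x0 :+ x1 :- nat 3)) (0≤square (ι 2 * u + v - ι 3))) ⊛ (nn x1 hv)
     ⊞ (nn ((one :- x1) :* (one :- x1)) (0≤square (1ℚ - v))) ⊛ (le (x0 :+ x1) (nat 3) h) ⊞
     (nn ((one :- x1) :* (one :- x1)) (0≤square (1ℚ - v))) ⊛ (nn x0 hu)) refl

 module _ (L : ℕ) where
   private
     K : ℕ
     K = suc L

   -- A degree of at least a third of the average `A ≥ 3K` is at least `K`, so that lowering it by 1
   -- costs at most the factor `L/K`.
   degree-bound : ∀ {A d} → 1 ℕ.≤ d → ι 3 * ι K ≤ A → A * rec d ≤ ι 3 → L ℕ.* d ℕ.≤ K ℕ.* (d ∸ 1)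
   degree-bound {A} {suc d} d≥1 big h = linᴺ (L ∷ d ∷ []) 0 (x0 :* (nat 1 :+ x1)) ((nat 1 :+ x0) :* x1) (leᴺ (nat 1 :+ x0) (nat 1 :+ x1) K≤d) refl
     where
     K≤d : K ℕ.≤ suc d
     K≤d = ι-cancel-≤ (lin ((ι K) ∷ A ∷ (rec (suc d)) ∷ (ι d) ∷ []) 2 x0 (one :+ x3) (le (nat 3 :* x0) x1 big ⊞
         le (x1 :* one) (x1 :* ((one :+ x3) :* x2)) (≤-reflexive (sym (cong (A *_) (ι*rec d)))) ⊞
         (le (x1 :* x2) (nat 3) h) ⊛ (nn (one :+ x3) (0≤ι (suc d)))) refl)

   -- If `A/d + B/c ≥ 3`, the correction terms suffice alone. Otherwise each quotient is at most 3,
   -- both degrees fall under `degree-bound`, and `am-gm` applies to the two quotients.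
   edge-weight : ∀ {A B} d c → 1 ℕ.≤ d → 1 ℕ.≤ c → ι 3 * ι K ≤ A → ι 3 * ι K ≤ B →
     ι (L ℕ.* L) * (A * B) * ι 3 ≤ ι (K ℕ.* K) * ι ((c ∸ 1) ℕ.* (d ∸ 1)) + (ι (L ℕ.* L) * (A * B) * A * rec d + ι (L ℕ.* L) * (A * B) * B * rec c)
   edge-weight {A} {B} d c d≥1 c≥1 A≥ B≥ = split (≤-total (ι 3) (u + v))
     where
     u v α w : ℚ
     u = A * rec d
     v = B * rec c
     α = ι (L ℕ.* L) * (A * B)
     w = ι (K ℕ.* K) * ι ((c ∸ 1) ℕ.* (d ∸ 1))
     0≤A : 0ℚ ≤ A
     0≤A = ≤-trans (0≤* (0≤ι 3) (0≤ι K)) A≥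
     0≤B : 0ℚ ≤ B
     0≤B = ≤-trans (0≤* (0≤ι 3) (0≤ι K)) B≥
     0≤u : 0ℚ ≤ u
     0≤u = 0≤* 0≤A (0≤rec d)
     0≤v : 0ℚ ≤ v
     0≤v = 0≤* 0≤B (0≤rec c)
     0≤α : 0ℚ ≤ α
     0≤α = 0≤* (0≤ι (L ℕ.* L)) (0≤* 0≤A 0≤B)
     0≤w : 0ℚ ≤ w
     0≤w = 0≤* (0≤ι (K ℕ.* K)) (0≤ι ((c ∸ 1) ℕ.* (d ∸ 1)))
     Goal : Set
     Goal = α * ι 3 ≤ w + (α * A * rec d + α * B * rec c)
     split : ι 3 ≤ u + v ⊎ u + v ≤ ι 3 → Goal
     split (inj₁ h) = lin (A ∷ (rec d) ∷ B ∷ (rec c) ∷ α ∷ w ∷ []) 0 (x4 :* nat 3) (x5 :+ (x4 :* x0 :* x1 :+ x4 :* x2 :* x3)) (nn x5 0≤w ⊞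
         (le (nat 3) (x0 :* x1 :+ x2 :* x3) h) ⊛ (nn x4 0≤α)) refl
     split (inj₂ h) = lin (M ∷ u ∷ v ∷ w ∷ α ∷ A ∷ (rec d) ∷ B ∷ (rec c) ∷ []) 0 (x4 :* nat 3) (x3 :+ (x4 :* x5 :* x6 :+ x4 :* x7 :* x8)) (nn (x0 :* (one :+ x1 :* x2 :* (x1 :+ x2 :- nat 3))) weighted
         ⊞ le x0 x3 M≤w ⊞
         le (x0 :* (one :+ x1 :* x2 :* (x1 :+ x2 :- nat 3))) (x0 :+ x4 :* (x5 :* x6 :+ x7 :* x8 :- nat 3)) (≤-reflexive expand)) refl
       where
       M : ℚ
       M = ι (L ℕ.* L) * (ι d * ι c)
       weighted : 0ℚ ≤ M * (1ℚ + (u * v) * (u + v - ι 3))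
       weighted = 0≤* (0≤* (0≤ι (L ℕ.* L)) (0≤* (0≤ι d) (0≤ι c))) (am-gm u v 0≤u 0≤v h)
       d≥ : L ℕ.* d ℕ.≤ K ℕ.* (d ∸ 1)
       d≥ = degree-bound d≥1 A≥ (lin (A ∷ (rec d) ∷ B ∷ (rec c) ∷ []) 0 (x0 :* x1) (nat 3) (le (x0 :* x1 :+ x2 :* x3) (nat 3) h
           ⊞ le (nat 0) (x2 :* x3) 0≤v) refl)
       c≥ : L ℕ.* c ℕ.≤ K ℕ.* (c ∸ 1)
       c≥ = degree-bound c≥1 B≥ (lin (A ∷ (rec d) ∷ B ∷ (rec c) ∷ []) 0 (x2 :* x3) (nat 3) (le (x0 :* x1 :+ x2 :* x3) (nat 3) h
           ⊞ le (nat 0) (x0 :* x1) 0≤u) refl)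
       M≤w : M ≤ w
       M≤w = subst₂ _≤_ (trans (ι-* (L ℕ.* L) (d ℕ.* c)) (cong (ι (L ℕ.* L) *_) (ι-* d c))) (ι-* (K ℕ.* K) ((c ∸ 1) ℕ.* (d ∸ 1)))
         (ι-mono (ℕ.≤-trans (ℕ.≤-reflexive (shuffle L d c)) (ℕ.≤-trans (ℕ.*-mono-≤ c≥ d≥) (ℕ.≤-reflexive (sym (shuffle′ K (c ∸ 1) (d ∸ 1)))))))
         where
         shuffle : ∀ x y z → (x ℕ.* x) ℕ.* (y ℕ.* z) ≡ (x ℕ.* z) ℕ.* (x ℕ.* y)
         shuffle x y z = ring-eqᴺ (x ∷ y ∷ z ∷ []) (x0 :* x0 :* (x1 :* x2)) (x0 :* x2 :* (x0 :* x1)) refl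
         shuffle′ : ∀ x y z → (x ℕ.* x) ℕ.* (y ℕ.* z) ≡ (x ℕ.* y) ℕ.* (x ℕ.* z)
         shuffle′ x y z = ring-eqᴺ (x ∷ y ∷ z ∷ []) (x0 :* x0 :* (x1 :* x2)) (x0 :* x1 :* (x0 :* x2)) refl
       expand : M * (1ℚ + (u * v) * (u + v - ι 3)) ≡ M + α * (u + v - ι 3)
       expand = regroup (ι (L ℕ.* L)) (ι d) (ι c) A B (rec d) (rec c) (ι*rec′ d≥1) (ι*rec′ c≥1) (u + v - ι 3)
         where
         regroup : ∀ l x y A B r s → x * r ≡ 1ℚ → y * s ≡ 1ℚ → ∀ z → (l * (x * y)) * (1ℚ + ((A * r) * (B * s)) * z) ≡ l * (x * y) + (l * (A * B)) * z
         regroup l x y A B r s p q z = trans (ring-eq (l ∷ x ∷ y ∷ A ∷ r ∷ B ∷ s ∷ z ∷ []) (x0 :* (x1 :* x2) :* (one :+ x3 :* x4 :* (x5 :* x6) :* x7)) (x0 :* (x1 :* x2) :+ x0 :* (x3 :* x5) :* x7 :* (x1 :* x4 :* (x2 :* x6))) refl)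
           (trans (cong₂ (λ P Q → l * (x * y) + (l * (A * B)) * z * (P * Q)) p q) (ring-eq (l ∷ x ∷ y ∷ A ∷ B ∷ z ∷ []) (x0 :* (x1 :* x2) :+ x0 :* (x3 :* x4) :* x5 :* (one :* one)) (x0 :* (x1 :* x2) :+ x0 :* (x3 :* x4) :* x5) refl))

 ∑-mono : ∀ {n} {f g : Fin n → ℚ} → (∀ i → f i ≤ g i) → ∑ f ≤ ∑ g
 ∑-mono {zero} h = ≤-refl
 ∑-mono {suc n} h = +-mono-≤ (h zero) (∑-mono (h ∘ suc))

 ∑-≤-const : ∀ {n C} {f : Fin n → ℚ} → (∀ i → f i ≤ C) → ∑ f ≤ ι n * C
 ∑-≤-const {zero} {C} h = ≤-reflexive (sym (ℚₚ.zeroˡ C))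
 ∑-≤-const {suc n} {C} {f} h = lin ((f zero) ∷ C ∷ (∑ (f ∘ suc)) ∷ (ι n) ∷ []) 0 (x0 :+ x2) ((one :+ x3) :* x1) (le x0 x1 (h zero) ⊞
     le x2 (x3 :* x1) (∑-≤-const {n} {C} {f ∘ suc} (h ∘ suc))) refl

 ι-sum : ∀ {n} (f : Fin n → ℕ) → ι (sum f) ≡ ∑ (ι ∘ f)
 ι-sum {zero} f = refl
 ι-sum {suc n} f = trans (ι-+ (f zero) (sum (f ∘ suc))) (cong (ι (f zero) +_) (ι-sum (f ∘ suc)))

 rec-≤1 : ∀ n → ι n * rec n ≤ 1ℚ
 rec-≤1 zero = ≤-trans (≤-reflexive (ℚₚ.zeroˡ (rec 0))) 0≤1
 rec-≤1 (suc n) = ≤-reflexive (ι*rec n)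

 module _ {m n} (E : BipGraph m n) where
   private
     x : Fin m → Fin n → ℚ
     x a b = ι (𝟙 (E a b))

     ∑∑ : (Fin m → Fin n → ℚ) → ℚ
     ∑∑ f = ∑ (λ a → ∑ (f a))

   ∑∑-const : ∀ C → ∑∑ (λ a b → x a b * C) ≡ ι (edges E) * C
   ∑∑-const C = trans (∑-cong (λ a → trans (sym (*-distribʳ-sum C (x a))) (cong (_* C) (sym (ι-sum (λ b → 𝟙 (E a b)))))))
     (trans (sym (*-distribʳ-sum C (λ a → ι (sum (λ b → 𝟙 (E a b)))))) (cong (_* C) (trans (sym (ι-sum (λ a → sum (λ b → 𝟙 (E a b))))) (cong ι (sym (edges-sum E))))))

   -- A vertex of degree `d` collects `C/d` from each of its `d` edges; the inequality allows for
   -- `d = 0`.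
   0≤-weight : ∀ {C} → 0ℚ ≤ C → ∀ d → ι d * (C * rec d) ≤ C
   0≤-weight {C} 0≤C d = lin (C ∷ (ι d) ∷ (rec d) ∷ []) 0 (x1 :* (x0 :* x2)) x0 ((nn x0 0≤C) ⊛ (le (x1 :* x2) one (rec-≤1 d))) refl

   row-weights : ∀ {C} → 0ℚ ≤ C → ∑∑ (λ a b → x a b * (C * rec (rowDegree E a))) ≤ ι m * C
   row-weights {C} 0≤C = ∑-≤-const (λ a → ≤-trans (≤-reflexive (trans (sym (*-distribʳ-sum (C * rec (rowDegree E a)) (x a))) (cong (_* (C * rec (rowDegree E a))) (sym (ι-sum (λ b → 𝟙 (E a b)))))))
     (0≤-weight 0≤C (rowDegree E a)))

   column-weights : ∀ {C} → 0ℚ ≤ C → ∑∑ (λ a b → x a b * (C * rec (columnDegree E b))) ≤ ι n * C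
   column-weights {C} 0≤C = ≤-trans (≤-reflexive (∑-swap (λ a b → x a b * (C * rec (columnDegree E b)))))
     (∑-≤-const (λ b → ≤-trans (≤-reflexive (trans (sym (*-distribʳ-sum (C * rec (columnDegree E b)) (λ a → x a b))) (cong (_* (C * rec (columnDegree E b))) (sym (ι-sum (λ a → 𝟙 (E a b)))))))
       (0≤-weight 0≤C (columnDegree E b))))

   term≤sum : ∀ {n} (f : Fin n → ℕ) i → f i ℕ.≤ sum f
   term≤sum f zero = ℕ.m≤m+n (f zero) _
   term≤sum f (suc i) = ℕ.≤-trans (term≤sum (f ∘ suc) i) (ℕ.m≤n+m _ (f zero))

   -- Each edge ab carries (deg a - 1)(deg b - 1) paths, and by AM-GM this is, up to the factor (L/K)²,
   -- at least A B (3 - A / deg a - B / deg b) with A and B the average degrees; the corrections sum to 2 e(E).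
   cubic-bound : ∀ {k} L → ¬ Square E → ¬ Theta E (suc k) → 1 ℕ.≤ m → 1 ℕ.≤ n → 3 ℕ.* suc L ℕ.* m ℕ.≤ edges E → 3 ℕ.* suc L ℕ.* n ℕ.≤ edges E →
     L ℕ.* L ℕ.* (edges E ℕ.* edges E ℕ.* edges E) ℕ.≤ suc L ℕ.* suc L ℕ.* k ℕ.* ((m ℕ.* n) ℕ.* (m ℕ.* n))
   cubic-bound {k} L no-square no-theta m≥1 n≥1 e≥m e≥n = result
     where
     K e : ℕ
     K = suc L
     e = edges E
     A B α κ : ℚ
     A = ι e * rec m
     B = ι e * rec n
     α = ι (L ℕ.* L) * (A * B)
     κ = ι (K ℕ.* K)
     average : ∀ {m} → 1 ℕ.≤ m → 3 ℕ.* K ℕ.* m ℕ.≤ e → ι 3 * ι K ≤ ι e * rec m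
     average {m} m≥1 h = lin ((ι K) ∷ (ι m) ∷ (ι e) ∷ (rec m) ∷ []) 0 (nat 3 :* x0) (x2 :* x3) (le (nat 3 :* x0 :* one) (nat 3 :* x0 :* (x1 :* x3)) (≤-reflexive (sym (cong (ι 3 * ι K *_) (ι*rec′ m≥1))))
         ⊞
         (le (nat 3 :* x0 :* x1) x2 (subst (_≤ ι e) (trans (ι-* (3 ℕ.* K) m) (cong (_* ι m) (ι-* 3 K))) (ι-mono h))) ⊛ (nn x3 (0≤rec m))) refl
     0≤A : 0ℚ ≤ A
     0≤A = 0≤* (0≤ι e) (0≤rec m)
     0≤B : 0ℚ ≤ B
     0≤B = 0≤* (0≤ι e) (0≤rec n)
     0≤α : 0ℚ ≤ α
     0≤α = 0≤* (0≤ι (L ℕ.* L)) (0≤* 0≤A 0≤B)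
     w : Fin m → Fin n → ℕ
     w a b = 𝟙 (E a b) ℕ.* ((columnDegree E b ∸ 1) ℕ.* (rowDegree E a ∸ 1))
     pointwise : ∀ a b → x a b * (α * ι 3) ≤ κ * ι (w a b) + (x a b * (α * A * rec (rowDegree E a)) + x a b * (α * B * rec (columnDegree E b)))
     pointwise a b = case (E a b) refl
       where
       d c : ℕ
       d = rowDegree E a
       c = columnDegree E b
       case : ∀ t → E a b ≡ t → ι (𝟙 t) * (α * ι 3) ≤ κ * ι (𝟙 t ℕ.* ((c ∸ 1) ℕ.* (d ∸ 1))) + (ι (𝟙 t) * (α * A * rec d) + ι (𝟙 t) * (α * B * rec c))
       case false _ = ≤-reflexive (ring-eq (α ∷ κ ∷ A ∷ (rec d) ∷ B ∷ (rec c) ∷ []) (nat 0 :* (x0 :* nat 3)) (x1 :* nat 0 :+ (nat 0 :* (x0 :* x2 :* x3) :+ nat 0 :* (x0 :* x4 :* x5))) refl)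
       case true eq = subst (λ z → ι 1 * (α * ι 3) ≤ κ * ι z + (ι 1 * (α * A * rec d) + ι 1 * (α * B * rec c))) (sym (ℕ.+-identityʳ W))
         (lin (α ∷ κ ∷ (ι W) ∷ A ∷ (rec d) ∷ B ∷ (rec c) ∷ []) 0 (nat 1 :* (x0 :* nat 3)) (x1 :* x2 :+ (nat 1 :* (x0 :* x3 :* x4) :+ nat 1 :* (x0 :* x5 :* x6))) (le (x0 :* nat 3) (x1 :* x2 :+ (x0 :* x3 :* x4 :+ x0 :* x5 :* x6)) (edge-weight L d c d≥1 c≥1 (average m≥1 e≥m) (average n≥1 e≥n))) refl)
         where
         W : ℕ
         W = (c ∸ 1) ℕ.* (d ∸ 1)
         d≥1 : 1 ℕ.≤ d
         d≥1 = ℕ.≤-trans (ℕ.≤-reflexive (sym (cong 𝟙 eq))) (term≤sum (λ b → 𝟙 (E a b)) b)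
         c≥1 : 1 ℕ.≤ c
         c≥1 = ℕ.≤-trans (ℕ.≤-reflexive (sym (cong 𝟙 eq))) (term≤sum (λ a → 𝟙 (E a b)) a)
     ∑∑-+ : ∀ f g → ∑∑ (λ a b → f a b + g a b) ≡ ∑∑ f + ∑∑ g
     ∑∑-+ f g = trans (∑-cong (λ a → ∑-distrib-+ (f a) (g a))) (∑-distrib-+ (λ a → ∑ (f a)) (λ a → ∑ (g a)))
     F₁ F₂ F₃ : Fin m → Fin n → ℚ
     F₁ a b = κ * ι (w a b)
     F₂ a b = x a b * (α * A * rec (rowDegree E a))
     F₃ a b = x a b * (α * B * rec (columnDegree E b))
     paths : ∑∑ F₁ ≤ κ * ι (m ℕ.* (n ℕ.* k))
     paths = ≤-trans (≤-reflexive (trans (∑-cong (λ a → trans (sym (*-distribˡ-sum κ (λ b → ι (w a b)))) (cong (κ *_) (sym (ι-sum (w a))))))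
       (trans (sym (*-distribˡ-sum κ (λ a → ι (sum (w a))))) (cong (κ *_) (sym (ι-sum (λ a → sum (w a))))))))
       (lin ((ι (sum (λ a → sum (w a)))) ∷ (ι (m ℕ.* (n ℕ.* k))) ∷ κ ∷ []) 0 (x2 :* x0) (x2 :* x1) ((le x0 x1 (ι-mono (path-count E no-square no-theta))) ⊛ (nn x2 (0≤ι (K ℕ.* K)))) refl)
     total : ι e * (α * ι 3) ≤ κ * ι (m ℕ.* (n ℕ.* k)) + (ι m * (α * A) + ι n * (α * B))
     total = subst (_≤ κ * ι (m ℕ.* (n ℕ.* k)) + (ι m * (α * A) + ι n * (α * B))) (∑∑-const (α * ι 3))
       (≤-trans (∑-mono (λ a → ∑-mono (λ b → pointwise a b)))
         (≤-trans (≤-reflexive (trans (∑∑-+ F₁ (λ a b → F₂ a b + F₃ a b)) (cong (∑∑ F₁ +_) (∑∑-+ F₂ F₃))))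
           (+-mono-≤ paths (+-mono-≤ (row-weights (0≤* 0≤α 0≤A)) (column-weights (0≤* 0≤α 0≤B))))))
     mA : ι m * (α * A) ≡ α * ι e
     mA = trans (ring-eq ((ι m) ∷ α ∷ (ι e) ∷ (rec m) ∷ []) (x0 :* (x1 :* (x2 :* x3))) (x1 :* x2 :* (x0 :* x3)) refl) (trans (cong (α * ι e *_) (ι*rec′ m≥1)) (ℚₚ.*-identityʳ (α * ι e)))
     nB : ι n * (α * B) ≡ α * ι e
     nB = trans (ring-eq ((ι n) ∷ α ∷ (ι e) ∷ (rec n) ∷ []) (x0 :* (x1 :* (x2 :* x3))) (x1 :* x2 :* (x0 :* x3)) refl) (trans (cong (α * ι e *_) (ι*rec′ n≥1)) (ℚₚ.*-identityʳ (α * ι e)))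
     core : α * ι e ≤ κ * ι (m ℕ.* (n ℕ.* k))
     core = lin ((ι e) ∷ α ∷ κ ∷ (ι (m ℕ.* (n ℕ.* k))) ∷ (ι m) ∷ A ∷ (ι n) ∷ B ∷ []) 0 (x1 :* x0) (x2 :* x3) (le (x0 :* (x1 :* nat 3)) (x2 :* x3 :+ (x4 :* (x1 :* x5) :+ x6 :* (x1 :* x7))) total
         ⊞ le (x4 :* (x1 :* x5)) (x1 :* x0) (≤-reflexive mA) ⊞
         le (x6 :* (x1 :* x7)) (x1 :* x0) (≤-reflexive nB)) refl
     cleared : ι m * ι n * (α * ι e) ≡ ι (L ℕ.* L) * (ι e * ι e * ι e)
     cleared = trans (ring-eq ((ι m) ∷ (ι n) ∷ (ι (L ℕ.* L)) ∷ (ι e) ∷ (rec m) ∷ (rec n) ∷ []) (x0 :* x1 :* (x2 :* (x3 :* x4 :* (x3 :* x5)) :* x3)) (x2 :* (x3 :* x3 :* x3) :* (x0 :* x4 :* (x1 :* x5))) refl)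
       (trans (cong₂ (λ P Q → ι (L ℕ.* L) * (ι e * ι e * ι e) * (P * Q)) (ι*rec′ m≥1) (ι*rec′ n≥1)) (ring-eq ((ι (L ℕ.* L)) ∷ (ι e) ∷ []) (x0 :* (x1 :* x1 :* x1) :* (one :* one)) (x0 :* (x1 :* x1 :* x1)) refl))
     ι-e³ : ι (L ℕ.* L ℕ.* (e ℕ.* e ℕ.* e)) ≡ ι (L ℕ.* L) * (ι e * ι e * ι e)
     ι-e³ = trans (ι-* (L ℕ.* L) (e ℕ.* e ℕ.* e)) (cong (ι (L ℕ.* L) *_) (trans (ι-* (e ℕ.* e) e) (cong (_* ι e) (ι-* e e))))
     ι-rhs : ι (m ℕ.* n ℕ.* (K ℕ.* K ℕ.* (m ℕ.* (n ℕ.* k)))) ≡ ι m * ι n * (κ * ι (m ℕ.* (n ℕ.* k)))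
     ι-rhs = trans (ι-* (m ℕ.* n) (K ℕ.* K ℕ.* (m ℕ.* (n ℕ.* k)))) (cong₂ _*_ (ι-* m n) (ι-* (K ℕ.* K) (m ℕ.* (n ℕ.* k))))
     scaled : ι (L ℕ.* L) * (ι e * ι e * ι e) ≤ ι m * ι n * (κ * ι (m ℕ.* (n ℕ.* k)))
     scaled = subst (_≤ ι m * ι n * (κ * ι (m ℕ.* (n ℕ.* k)))) cleared
       (lin (α ∷ (ι e) ∷ κ ∷ (ι (m ℕ.* (n ℕ.* k))) ∷ (ι m) ∷ (ι n) ∷ []) 0 (x4 :* x5 :* (x0 :* x1)) (x4 :* x5 :* (x2 :* x3)) ((le (x0 :* x1) (x2 :* x3) core) ⊛ (nn (x4 :* x5) (0≤* (0≤ι m) (0≤ι n)))) refl)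
     result : L ℕ.* L ℕ.* (e ℕ.* e ℕ.* e) ℕ.≤ K ℕ.* K ℕ.* k ℕ.* ((m ℕ.* n) ℕ.* (m ℕ.* n))
     result = ℕ.≤-trans (ι-cancel-≤ (subst₂ _≤_ (sym ι-e³) (sym ι-rhs) scaled)) (ℕ.≤-reflexive (rearrange (K ℕ.* K) m n k))
       where
       rearrange : ∀ Q m n k → m ℕ.* n ℕ.* (Q ℕ.* (m ℕ.* (n ℕ.* k))) ≡ Q ℕ.* k ℕ.* ((m ℕ.* n) ℕ.* (m ℕ.* n))
       rearrange Q m n k = ring-eqᴺ (m ∷ n ∷ Q ∷ k ∷ []) (x0 :* x1 :* (x2 :* (x0 :* (x1 :* x3)))) (x2 :* x3 :* (x0 :* x1 :* (x0 :* x1))) refl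

-- The upper bound and the asymptotic statement.

open import Data.Nat using (_+_; _*_; _∸_; _^_; _≤_; _<_)
open import Data.Nat.Combinatorics using (_C_)
open import Data.Product using (Σ)
open ≡ using (_≡_; refl; trans; sym; cong; cong₂; subst)
open RationalArithmetic using (ring-eqᴺ; var; _:*_; _:+_; one; nat; x0; x1; x2; x3)
open Configurations
open LowerEstimate
open UpperEstimate
open ResidueRing using (size; size-binomial)

open ℕ.≤-Reasoning

module _ {k j : ℕ} (1≤j : 1 ≤ j) where
  private
    D e : ℕ
    D = j + suc j
    e = suc (suc j) + j

  -- In the dense case `cubic-bound` is raised to the power `D`, where `(m n)^D ≤ n^(j+2+D)` and
  -- twice this exponent is `3e`. A graph with too few edges for `cubic-bound` has at most `c n` of
  -- them, since `m ≤ n` when `1 ≤ j`; then one spare factor `n > (c r)^D` is enough.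
  upper-bound : ∀ p r → 0 < r → k * r ^ 3 < p ^ 3 → Σ ℕ λ N → ∀ n m x → N ≤ n → m ^ D ≤ n ^ suc (suc j) → n ^ suc (suc j) < suc m ^ D →
    IsBipEx n m (C4 ∷ᶠ (θ3 (suc k) ∷ᶠ []ᶠ)) x → r ^ D * x ^ D ≤ p ^ D * n ^ e
  upper-bound p r 0<r h with close-ratio 2 h
  ... | L , L≥1 , close = suc ((c * r) ^ D) , bound
    where
    K c : ℕ
    K = suc L
    c = 3 * K
    p≥1 : 1 ≤ p
    p≥1 = ^-cancel-< 3 (ℕ.≤-<-trans z≤n h)
    bound : ∀ n m x → suc ((c * r) ^ D) ≤ n → m ^ D ≤ n ^ suc (suc j) → n ^ suc (suc j) < suc m ^ D →
      IsBipEx n m (C4 ∷ᶠ (θ3 (suc k) ∷ᶠ []ᶠ)) x → r ^ D * x ^ D ≤ p ^ D * n ^ e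
    bound n m x N≤n m≤n n<m ((E , (no-C4 , no-θ , _) , refl) , _) = split (c * m ℕ.≤? edges E) (c * n ℕ.≤? edges E)
      where
      n≥1 : 1 ≤ n
      n≥1 = ℕ.≤-trans (s≤s z≤n) N≤n
      m≥1 : 1 ≤ m
      m≥1 = ℕ.s≤s⁻¹ (^-cancel-< D (ℕ.≤-<-trans (ℕ.≤-trans (ℕ.≤-reflexive (ℕ.^-zeroˡ D)) (ℕ.≤-trans (ℕ.≤-reflexive (sym (ℕ.^-zeroˡ (suc (suc j))))) (ℕ.^-monoˡ-≤ (suc (suc j)) n≥1))) n<m))
      e≡ : e ≡ suc D
      e≡ = cong suc (sym (ℕ.+-suc j j))
      sparse : ∀ {z} → z ^ D ≤ n ^ D → edges E ≤ c * z → r ^ D * edges E ^ D ≤ p ^ D * n ^ e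
      sparse {z} z≤n′ few = begin
        r ^ D * edges E ^ D ≡⟨ *-^ r (edges E) D ⟨
        (r * edges E) ^ D ≤⟨ ℕ.^-monoˡ-≤ D (ℕ.≤-trans (ℕ.*-monoʳ-≤ r few) (ℕ.≤-reflexive (trans (sym (ℕ.*-assoc r c z)) (cong (_* z) (ℕ.*-comm r c))))) ⟩
        (c * r * z) ^ D ≡⟨ *-^ (c * r) z D ⟩
        (c * r) ^ D * z ^ D ≤⟨ ℕ.*-mono-≤ (ℕ.≤-trans (ℕ.n≤1+n _) N≤n) z≤n′ ⟩
        n * n ^ D ≡⟨ cong (n ^_) e≡ ⟨
        n ^ e ≤⟨ ℕ.m≤n*m (n ^ e) (p ^ D) {{ℕ.m^n≢0 p D {{ℕ.>-nonZero p≥1}}}} ⟩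
        p ^ D * n ^ e ∎
      dense : c * m ≤ edges E → c * n ≤ edges E → r ^ D * edges E ^ D ≤ p ^ D * n ^ e
      dense e≥m e≥n = ℕ.≮⇒≥ λ big → ℕ.<⇒≱ (ℕ.^-monoˡ-< 3 big) cubed
        where
        cube : (r * edges E) ^ 3 ≤ p ^ 3 * (m * n) ^ 2
        cube = ℕ.*-cancelˡ-≤ (L ^ 2) {{ℕ.m^n≢0 L 2 {{L≢0}}}} (begin
          L ^ 2 * (r * X) ^ 3 ≡⟨ ring-eqᴺ (L ∷ r ∷ X ∷ []) (x0 :* (x0 :* nat 1) :* (x1 :* x2 :* (x1 :* x2 :* (x1 :* x2 :* nat 1)))) (x1 :* (x1 :* (x1 :* nat 1)) :* (x0 :* x0 :* (x2 :* x2 :* x2))) refl ⟩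
          r ^ 3 * (L * L * (X * X * X)) ≤⟨ ℕ.*-monoʳ-≤ (r ^ 3) (cubic-bound E L (λ s → no-C4 (square⇒embedding E s)) (λ s → no-θ (theta⇒embedding E s)) m≥1 n≥1 e≥m e≥n) ⟩
          r ^ 3 * (K * K * k * ((m * n) * (m * n))) ≡⟨ ring-eqᴺ (R ∷ K ∷ k ∷ M ∷ []) (x0 :* (x1 :* x1 :* x2 :* (x3 :* x3))) (x2 :* x0 :* (x1 :* (x1 :* nat 1)) :* (x3 :* (x3 :* nat 1))) refl ⟩
          (k * r ^ 3 * K ^ 2) * (m * n) ^ 2 ≤⟨ ℕ.*-monoˡ-≤ ((m * n) ^ 2) close ⟩
          (p ^ 3 * L ^ 2) * (m * n) ^ 2 ≡⟨ ring-eqᴺ (P ∷ Q ∷ S ∷ []) (x0 :* x1 :* x2) (x1 :* (x0 :* x2)) refl ⟩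
          L ^ 2 * (p ^ 3 * (m * n) ^ 2) ∎)
          where
          X R M P Q S : ℕ
          X = edges E
          R = r ^ 3
          M = m * n
          P = p ^ 3
          Q = L ^ 2
          S = M ^ 2
          L≢0 : ℕ.NonZero L
          L≢0 = ℕ.>-nonZero L≥1
        cubed : (r ^ D * edges E ^ D) ^ 3 ≤ (p ^ D * n ^ e) ^ 3
        cubed = begin
          (r ^ D * edges E ^ D) ^ 3 ≡⟨ cong (_^ 3) (*-^ r (edges E) D) ⟨
          ((r * edges E) ^ D) ^ 3 ≡⟨ ^-swap (r * edges E) D 3 ⟩
          ((r * edges E) ^ 3) ^ D ≤⟨ ℕ.^-monoˡ-≤ D cube ⟩
          (p ^ 3 * (m * n) ^ 2) ^ D ≡⟨ *-^ (p ^ 3) ((m * n) ^ 2) D ⟩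
          (p ^ 3) ^ D * ((m * n) ^ 2) ^ D ≡⟨ cong₂ _*_ (^-swap p 3 D) (^-swap (m * n) 2 D) ⟩
          (p ^ D) ^ 3 * ((m * n) ^ D) ^ 2 ≤⟨ ℕ.*-monoʳ-≤ ((p ^ D) ^ 3) (ℕ.^-monoˡ-≤ 2 (begin
            (m * n) ^ D ≡⟨ *-^ m n D ⟩
            m ^ D * n ^ D ≤⟨ ℕ.*-monoˡ-≤ (n ^ D) m≤n ⟩
            n ^ suc (suc j) * n ^ D ≡⟨ ℕ.^-distribˡ-+-* n (suc (suc j)) D ⟨
            n ^ (suc (suc j) + D) ∎)) ⟩
          (p ^ D) ^ 3 * (n ^ (suc (suc j) + D)) ^ 2 ≡⟨ cong ((p ^ D) ^ 3 *_) (trans (ℕ.^-*-assoc n (suc (suc j) + D) 2) (trans (cong (n ^_) exponent) (sym (ℕ.^-*-assoc n e 3)))) ⟩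
          (p ^ D) ^ 3 * (n ^ e) ^ 3 ≡⟨ *-^ (p ^ D) (n ^ e) 3 ⟨
          (p ^ D * n ^ e) ^ 3 ∎
          where
          exponent : (suc (suc j) + D) * 2 ≡ e * 3
          exponent = ring-eqᴺ (j ∷ []) ((nat 1 :+ (nat 1 :+ x0) :+ (x0 :+ (nat 1 :+ x0))) :* nat 2) ((nat 1 :+ (nat 1 :+ x0) :+ x0) :* nat 3) refl
      split : Dec (c * m ≤ edges E) → Dec (c * n ≤ edges E) → r ^ D * edges E ^ D ≤ p ^ D * n ^ e
      split (no few) _ = sparse (ℕ.≤-trans m≤n (ℕ.^-monoʳ-≤ n {{ℕ.>-nonZero n≥1}} (ℕ.+-monoˡ-≤ (suc j) 1≤j))) (ℕ.<⇒≤ (ℕ.≰⇒> few))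
      split (yes _) (no few) = sparse ℕ.≤-refl (ℕ.<⇒≤ (ℕ.≰⇒> few))
      split (yes e≥m) (yes e≥n) = dense e≥m e≥n

theorem1p6 : (t j : ℕ) → 2 ≤ t → 2 ≤ j → j ≤ (t + 1) C 2 →
    ((p r : ℕ) → p < r →
      Σ ℕ λ N → (n m k : ℕ) → N ≤ n → IsFloorPow j n m →
        IsBipEx n m (C4 ∷ᶠ (θ3 t ∷ᶠ []ᶠ)) k →
        p ^ (2 * j ∸ 1) * n ^ (2 * j) ≤ r ^ (2 * j ∸ 1) * k ^ (2 * j ∸ 1))
    × ((p r : ℕ) → 0 < r → (t ∸ 1) * r ^ 3 < p ^ 3 →
      Σ ℕ λ N → (n m k : ℕ) → N ≤ n → IsFloorPow j n m →
        IsBipEx n m (C4 ∷ᶠ (θ3 t ∷ᶠ []ᶠ)) k →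
        r ^ (2 * j ∸ 1) * k ^ (2 * j ∸ 1) ≤ p ^ (2 * j ∸ 1) * n ^ (2 * j))
theorem1p6 (suc t) (suc j) _ (s≤s 1≤j) j≤ =
  transport Lower D≡ e≡ (ℕ.+-comm (suc j) 1) (λ p r p<r → let N , bound = lower-bound size≥ p r p<r in N , λ n m k N≤n (_ , n<m) → bound n m k N≤n n<m) ,
  transport Upper D≡ e≡ (ℕ.+-comm (suc j) 1) (λ p r 0<r h → let N , bound = upper-bound 1≤j p r 0<r h in N , λ n m k N≤n (m≤n , n<m) → bound n m k N≤n m≤n n<m)
  where
  F : Family
  F = C4 ∷ᶠ (θ3 (suc t) ∷ᶠ []ᶠ)
  Lower Upper : ℕ → ℕ → ℕ → Set
  Lower D e i = ∀ p r → p < r → Σ ℕ λ N → ∀ n m k → N ≤ n → m ^ D ≤ n ^ i × n ^ i < suc m ^ D → IsBipEx n m F k → p ^ D * n ^ e ≤ r ^ D * k ^ D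
  Upper D e i = ∀ p r → 0 < r → t * r ^ 3 < p ^ 3 → Σ ℕ λ N → ∀ n m k → N ≤ n → m ^ D ≤ n ^ i × n ^ i < suc m ^ D → IsBipEx n m F k → r ^ D * k ^ D ≤ p ^ D * n ^ e
  transport : ∀ {ℓ} (P : ℕ → ℕ → ℕ → Set ℓ) {D D′ e e′ i i′} → D′ ≡ D → e′ ≡ e → i′ ≡ i → P D e i → P D′ e′ i′
  transport P refl refl refl h = h
  size≥ : j ≤ size t
  size≥ = ℕ.s≤s⁻¹ (subst (suc j ≤_) (trans (cong (λ z → suc z C 2) (ℕ.+-comm t 1)) (sym (size-binomial t))) j≤)
  D≡ : 2 * suc j ∸ 1 ≡ j + suc j
  D≡ = cong (λ z → j + suc z) (ℕ.+-identityʳ j)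
  e≡ : 2 * suc j ≡ suc (suc j) + j
  e≡ = ring-eqᴺ (j ∷ []) (nat 2 :* (nat 1 :+ x0)) (nat 1 :+ (nat 1 :+ x0) :+ x0) refl
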